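{- There is a randomized algorithm that, given cut-query access to an $n$-vertex simple graph $G$, computes the edge connectivity of $G$ with probability at least $2/3$ after $O(n\log\log n)$ cut queries. If $\delta(G)>\log^{10}(n)$ then only $O(n)$ cut queries are needed.
   Context: A simple graph $G=(V,E)$ is undirected, unweighted, loopless, with at most one edge per pair of vertices; $\delta(G)$ is its minimum degree. For $S\subseteq V$, $\mathrm{cut}_G(S)$ is the set of edges with exactly one endpoint in $S$; a cut query on $S$ returns $|\mathrm{cut}_G(S)|$. The edge connectivity is $\lambda(G)=\min_{\emptyset\ne S\subsetneq V}|\mathrm{cut}_G(S)|$. -}

module Defs where

open import Data.Bool using (Bool; true; false; _∧_; not; if_then_else_)
open import Data.Nat using (ℕ; zero; suc; _⊔_; _≤_)
open import Data.Fin using (Fin)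
open import Data.List using (List; map)
open import Data.Nat.ListAction using (sum)
open import Data.List using () renaming (allFin to allFinL)
open import Data.Product using (Σ; ∃; _×_)
open import Data.Rational using (ℚ; 0ℚ; 1ℚ; ½; _+_; _*_)
open import Relation.Binary.PropositionalEquality using (_≡_)
open import Relation.Nullary using (yes; no)
import Data.Nat as ℕ

record Graph (n : ℕ) : Set where
  field
    adj     : Fin n → Fin n → Bool
    sym     : ∀ i j → adj i j ≡ adj j i
    irrefl  : ∀ i → adj i i ≡ false
open Graph public

VSet : ℕ → Set
VSet n = Fin n → Bool

count : ∀ {n} → (Fin n → Bool) → ℕ
count {n} p = sum (map (λ j → if p j then 1 else 0) (allFinL n))

degree : ∀ {n} → Graph n → Fin n → ℕ
degree G v = count (adj G v)

cutSize : ∀ {n} → Graph n → VSet n → ℕ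
cutSize {n} G S =
  sum (map (λ u → count (λ v → S u ∧ not (S v) ∧ adj G u v)) (allFinL n))

IsEdgeConnectivity : ∀ {n} → Graph n → ℕ → Set
IsEdgeConnectivity {n} G k =
  (Σ (VSet n) λ S → (∃ λ i → S i ≡ true) × (∃ λ j → S j ≡ false) × cutSize G S ≡ k)
  × (∀ (S : VSet n) → (∃ λ i → S i ≡ true) → (∃ λ j → S j ≡ false) → k ≤ cutSize G S)

-- Randomized cut-query algorithms on n-vertex graphs, as (randomized)
-- decision trees: output a number, ask a cut query on S and continue
-- depending on the answer, or flip a fair coin and continue.

data Alg (n : ℕ) : Set where
  output : ℕ → Alg n
  query  : VSet n → (ℕ → Alg n) → Alg n
  coin   : (Bool → Alg n) → Alg n

queries : ∀ {n} → Graph n → Alg n → ℕ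
queries G (output _)  = 0
queries G (query S k) = suc (queries G (k (cutSize G S)))
queries G (coin f)    = queries G (f true) ⊔ queries G (f false)

probOutputs : ∀ {n} → Graph n → ℕ → Alg n → ℚ
probOutputs G k (output m) with m ℕ.≟ k
... | yes _ = 1ℚ
... | no  _ = 0ℚ
probOutputs G k (query S f) = probOutputs G k (f (cutSize G S))
probOutputs G k (coin f)    = ½ * (probOutputs G k (f true) + probOutputs G k (f false))

{-# OPTIONS --safe #-}

-- O(n) queries suffice for every graph, which gives both bounds. Let δ be the minimum degree; if no
-- cut has fewer than δ edges, the answer is δ. Otherwise let S be a minimum cut, with fewer than δ
-- edges. Clusters of vertices are merged along random edges: in a phase of level ℓ a random 2 ^ (− q)
-- fraction of the clusters with fewer than 2 ^ (ℓ + 1) vertices pick a random edge to the remaining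
-- ones, while clusters with few outgoing edges are frozen. The other ends of these edges are found by
-- coin weighing, so that a phase costs O(ℓ + 1) queries per small cluster, and the number of small
-- clusters decreases geometrically in expectation. An edge of S is picked so rarely that
-- (W / (W + 1)) ^ danger is a submartingale on the event that S still separates whole clusters, where
-- danger ≤ 72 · 128 · W; hence S survives with a constant probability. When all clusters are frozen,
-- O(n) edges between clusters remain; these are learned by the same sampling, and a cut that is
-- minimal among those respecting the clusters is then known. Markov's inequality bounds the number
-- of queries of a trial, and a constant number of trials gives success probability 2 / 3. For the
-- finitely many n for which the overhead of coin weighing exceeds n, all cuts are queried.
module Submission where

open import Defs hiding (sym)
open import Data.Bool using (Bool; true; false; _∧_; _∨_; not; if_then_else_) renaming (_≟_ to _≟ᴮ_; T to Tᴮ)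
open import Data.Nat using (ℕ; zero; suc; _+_; _*_; _∸_; _^_; _⊓_; _≤_; _<_; z≤n; s≤s; s≤s⁻¹; NonZero; ≢-nonZero; >-nonZero; _≤ᵇ_; _<ᵇ_; _≡ᵇ_; _%_; ⌊_/2⌋) renaming (_/_ to _div_)
open import Data.Nat.Properties
open import Data.Nat.DivMod using (m≡m%n+[m/n]*n; m%n<n; m/n*n≤m; m<n⇒m%n≡m; [m+kn]%n≡m%n)
open import Data.Bool.Properties using (∨-comm)
open import Data.Nat.Logarithm using (⌊log₂_⌋; ⌊log₂⌋-mono-≤)
open import Data.Nat.ListAction using () renaming (sum to sumᴸ)
open import Data.Nat.Solver using (module +-*-Solver)
open import Data.Fin using (Fin; zero; suc; toℕ)
open import Data.Fin.Properties using (toℕ<n) renaming (_≟_ to _≟ᶠ_; any? to anyᶠ?; all? to allᶠ?)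
open import Data.List using (List; []; _∷_; _++_; length; filter; take; drop; replicate) renaming (map to mapᴸ; allFin to allFinᴸ; tabulate to tabulateᴸ)
open import Data.List.Properties using (map-tabulate; length-++; length-map; length-take; length-drop; length-replicate; take++drop≡id; map-++)
open import Data.List.Relation.Unary.All using (All; []; _∷_) renaming (map to mapᴬ; lookup to lookupᴬ; tabulate to tabulateᴬ)
open import Data.List.Relation.Unary.Any using (here; there)
open import Data.List.Relation.Unary.AllPairs using ([]; _∷_)
open import Data.List.Relation.Unary.Unique.Propositional using (Unique)
import Data.List.Relation.Unary.Unique.Propositional.Properties as Uniqueₚ
open import Data.List.Membership.Propositional using (_∈_)
open import Data.List.Membership.Propositional.Properties using (∈-map⁺; ∈-map⁻; ∈-++⁺ˡ; ∈-++⁻; ∈-++⁺ʳ; ∈-allFin; ∈-filter⁺; ∈-filter⁻)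
open import Data.Maybe using (Maybe; just; nothing; maybe)
open import Data.Product using (Σ; ∃; _×_; _,_; proj₁; proj₂)
open import Data.Sum using (_⊎_; inj₁; inj₂)
open import Data.Empty using (⊥; ⊥-elim)
open import Data.Unit using (tt)
open import Data.Vec using (Vec; []; _∷_; lookup) renaming (tabulate to tabulateⱽ)
open import Data.Vec.Properties using (lookup∘tabulate)
open import Function using (_∘_; id; case_of_)
open import Relation.Nullary using (Dec; yes; no; does; _→-dec_)
open import Relation.Binary.PropositionalEquality using (_≡_; _≢_; refl; sym; trans; cong; cong₂; subst; subst₂; module ≡-Reasoning)
open import Relation.Nullary.Decidable using (dec-true)
import Data.Rational as ℚ
import Data.Rational.Properties as ℚᵖ
open +-*-Solver using (solve; _:+_; _:*_; _:=_; con)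

-- The obstacle is that a minimum cut must survive many phases with constant probability, although a
-- cluster may stay small for long. Phase by phase, risk is weighed against progress. A cluster that
-- attempts a merge and contains `cl` ends of edges of `S` picks an edge of `S` with probability at
-- most `16 cl / (bound Q)`, where `Q = 2 ^ q`; with probability at least `1 / (128 Q)` it merges
-- while `S` survives, and then it is no longer small. So risk is paid for by lost exposure, at the
-- price `2048 / bound` per edge end. An edge end is lost at most once per level, there are fewer
-- than `2 δ` of them, and `bound` is at least `δ` and doubles from level to level apart from one
-- change of regime; the prices therefore sum to O(1 / δ) and the total risk to a constant. The
-- value `Q = 4096` makes the chance that another cluster hits `S` at the same time, at most
-- `32 / Q ^ 2`, no more than half of the success probability `1 / (64 Q)`. Errors are one-sided: no
-- trial outputs less than the edge connectivity, so among repeated trials a single good one is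
-- enough.

infix 4 _==_

-- Boolean equality and indicators

_==_ : ∀ {n} → Fin n → Fin n → Bool
i == j = does (i ≟ᶠ j)

⟦_⟧ : Bool → ℕ
⟦ true ⟧  = 1
⟦ false ⟧ = 0

true≢false : true ≢ false
true≢false ()

bool-cases : (b : Bool) → b ≡ true ⊎ b ≡ false
bool-cases true  = inj₁ refl
bool-cases false = inj₂ refl

==-refl : ∀ {n} (i : Fin n) → (i == i) ≡ true
==-refl i with i ≟ᶠ i
... | yes _ = refl
... | no i≢i = ⊥-elim (i≢i refl)

==⇒≡ : ∀ {n} {i j : Fin n} → (i == j) ≡ true → i ≡ j
==⇒≡ {i = i} {j} e with i ≟ᶠ j
... | yes p = p
==⇒≡ () | no _

≡⇒== : ∀ {n} {i j : Fin n} → i ≡ j → (i == j) ≡ true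
≡⇒== {i = i} refl = ==-refl i

≢⇒== : ∀ {n} {i j : Fin n} → i ≢ j → (i == j) ≡ false
≢⇒== {i = i} {j} ne with i ≟ᶠ j
... | yes p = ⊥-elim (ne p)
... | no _ = refl

∧-true : ∀ {a b} → (a ∧ b) ≡ true → a ≡ true × b ≡ true
∧-true {true} {true} _ = refl , refl

∧-intro : ∀ {a b} → a ≡ true → b ≡ true → (a ∧ b) ≡ true
∧-intro refl refl = refl

not-true : ∀ {a} → not a ≡ true → a ≡ false
not-true {false} _ = refl

⟦⟧≤1 : ∀ b → ⟦ b ⟧ ≤ 1
⟦⟧≤1 true  = ≤-refl
⟦⟧≤1 false = z≤n

⟦∧⟧ : ∀ a b → ⟦ a ∧ b ⟧ ≡ ⟦ a ⟧ * ⟦ b ⟧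
⟦∧⟧ true  b = sym (*-identityˡ ⟦ b ⟧)
⟦∧⟧ false b = refl

⟦⟧+⟦not⟧ : ∀ b → ⟦ b ⟧ + ⟦ not b ⟧ ≡ 1
⟦⟧+⟦not⟧ true  = refl
⟦⟧+⟦not⟧ false = refl

⟦⟧-mono : ∀ {a b} → (a ≡ true → b ≡ true) → ⟦ a ⟧ ≤ ⟦ b ⟧
⟦⟧-mono {true} {b} h rewrite h refl = ≤-refl
⟦⟧-mono {false} h = z≤n

⟦⟧-if0 : ∀ {a} → a ≡ false → ⟦ a ⟧ ≡ 0
⟦⟧-if0 refl = refl

⟦⟧*-mono : ∀ a {x y} → (a ≡ true → x ≤ y) → ⟦ a ⟧ * x ≤ ⟦ a ⟧ * y
⟦⟧*-mono true  h = *-monoʳ-≤ 1 (h refl)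
⟦⟧*-mono false h = z≤n

⟦⟧*-cong : ∀ a {x y} → (a ≡ true → x ≡ y) → ⟦ a ⟧ * x ≡ ⟦ a ⟧ * y
⟦⟧*-cong true  h = cong (1 *_) (h refl)
⟦⟧*-cong false h = refl

⟦⟧*≤ : ∀ a x → ⟦ a ⟧ * x ≤ x
⟦⟧*≤ true  x = ≤-reflexive (*-identityˡ x)
⟦⟧*≤ false x = z≤n

⟦⟧*-0 : ∀ {a} x → a ≡ false → ⟦ a ⟧ * x ≡ 0
⟦⟧*-0 x refl = refl

⟦⟧*-1 : ∀ {a} x → a ≡ true → ⟦ a ⟧ * x ≡ x
⟦⟧*-1 x refl = *-identityˡ x

-- Finite sums

opaque
  ∑ : ∀ {n} → (Fin n → ℕ) → ℕ
  ∑ {zero}  f = 0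
  ∑ {suc n} f = f zero + ∑ (λ i → f (suc i))

  ∑-cong : ∀ {n} {f g : Fin n → ℕ} → (∀ i → f i ≡ g i) → ∑ f ≡ ∑ g
  ∑-cong {zero}  h = refl
  ∑-cong {suc n} h = cong₂ _+_ (h zero) (∑-cong (λ i → h (suc i)))

  ∑-mono : ∀ {n} {f g : Fin n → ℕ} → (∀ i → f i ≤ g i) → ∑ f ≤ ∑ g
  ∑-mono {zero}  h = z≤n
  ∑-mono {suc n} h = +-mono-≤ (h zero) (∑-mono (λ i → h (suc i)))

  ∑-0 : ∀ {n} → ∑ {n} (λ _ → 0) ≡ 0
  ∑-0 {zero}  = refl
  ∑-0 {suc n} = ∑-0 {n}

  ∑-const : ∀ {n} c → ∑ {n} (λ _ → c) ≡ n * c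
  ∑-const {zero}  c = refl
  ∑-const {suc n} c = cong (c +_) (∑-const {n} c)

  +-interchange : ∀ a b c d → (a + b) + (c + d) ≡ (a + c) + (b + d)
  +-interchange = solve 4 (λ a b c d → (a :+ b) :+ (c :+ d) := (a :+ c) :+ (b :+ d)) refl

  ∑-+ : ∀ {n} (f g : Fin n → ℕ) → ∑ (λ i → f i + g i) ≡ ∑ f + ∑ g
  ∑-+ {zero}  f g = refl
  ∑-+ {suc n} f g = trans (cong (f zero + g zero +_) (∑-+ (f ∘ suc) (g ∘ suc)))
                          (+-interchange (f zero) (g zero) _ _)

  ∑-*ˡ : ∀ {n} c (f : Fin n → ℕ) → ∑ (λ i → c * f i) ≡ c * ∑ f
  ∑-*ˡ {zero}  c f = sym (*-zeroʳ c)
  ∑-*ˡ {suc n} c f = trans (cong (c * f zero +_) (∑-*ˡ c (f ∘ suc)))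
                           (sym (*-distribˡ-+ c (f zero) _))

  ∑-*ʳ : ∀ {n} c (f : Fin n → ℕ) → ∑ (λ i → f i * c) ≡ ∑ f * c
  ∑-*ʳ c f = trans (∑-cong (λ i → *-comm (f i) c)) (trans (∑-*ˡ c f) (*-comm c _))

  ∑-swap : ∀ {m n} (f : Fin m → Fin n → ℕ) → ∑ (λ i → ∑ (λ j → f i j)) ≡ ∑ (λ j → ∑ (λ i → f i j))
  ∑-swap {zero}  {n} f = sym (∑-0 {n})
  ∑-swap {suc m} {n} f = trans (cong (∑ (f zero) +_) (∑-swap (λ i → f (suc i))))
                           (sym (∑-+ (f zero) (λ j → ∑ (λ i → f (suc i) j))))

  ∑-≥ : ∀ {n} (f : Fin n → ℕ) i → f i ≤ ∑ f
  ∑-≥ f zero    = m≤m+n _ _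
  ∑-≥ f (suc i) = ≤-trans (∑-≥ (f ∘ suc) i) (m≤n+m _ _)

  ∑-zero : ∀ {n} (f : Fin n → ℕ) → (∀ i → f i ≡ 0) → ∑ f ≡ 0
  ∑-zero {n} f h = trans (∑-cong h) (∑-0 {n})

  ==-suc : ∀ {n} (i j : Fin n) → (suc i == suc j) ≡ (i == j)
  ==-suc i j with i ≟ᶠ j
  ... | yes _ = refl
  ... | no  _ = refl

  ∑-δ : ∀ {n} (j : Fin n) (f : Fin n → ℕ) → ∑ (λ i → ⟦ i == j ⟧ * f i) ≡ f j
  ∑-δ {suc n} zero f =
    trans (cong₂ _+_ (*-identityˡ (f zero)) (∑-zero {n} (λ i → ⟦ suc i == zero ⟧ * f (suc i)) (λ i → refl)))
          (+-identityʳ _)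
  ∑-δ {suc n} (suc j) f =
    trans (∑-cong {n} (λ i → cong (λ b → ⟦ b ⟧ * f (suc i)) (==-suc i j))) (∑-δ j (f ∘ suc))

  ==-sym : ∀ {n} (i j : Fin n) → (i == j) ≡ (j == i)
  ==-sym i j with i ≟ᶠ j
  ... | yes refl = sym (==-refl i)
  ... | no ne = sym (≢⇒== (λ e → ne (sym e)))

  ∑-δ′ : ∀ {n} (j : Fin n) (f : Fin n → ℕ) → ∑ (λ i → ⟦ j == i ⟧ * f i) ≡ f j
  ∑-δ′ j f = trans (∑-cong (λ i → cong (λ b → ⟦ b ⟧ * f i) (==-sym j i))) (∑-δ j f)

  ∑-empty : (f : Fin 0 → ℕ) → ∑ f ≡ 0
  ∑-empty f = refl

  ∑-suc : ∀ {n} (f : Fin (suc n) → ℕ) → ∑ f ≡ f zero + ∑ (λ i → f (suc i))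
  ∑-suc f = refl

  ∑-pos : ∀ {n} (f : Fin n → ℕ) → 1 ≤ ∑ f → ∃ λ i → 1 ≤ f i
  ∑-pos {suc n} f p with f zero in e
  ... | suc k = zero , subst (1 ≤_) (sym e) (s≤s z≤n)
  ... | zero with ∑-pos (f ∘ suc) p
  ...   | i , q = suc i , q

  sum-tabulate : ∀ {n} (f : Fin n → ℕ) → sumᴸ (tabulateᴸ f) ≡ ∑ f
  sum-tabulate {zero} f  = refl
  sum-tabulate {suc n} f = cong (f zero +_) (sum-tabulate (f ∘ suc))

-- With `h` the labelling by clusters, this regroups a sum over vertices into a sum over clusters.
∑-fibre : ∀ {m n} (h : Fin m → Fin n) (f : Fin m → ℕ) →
          ∑ (λ v → f v) ≡ ∑ (λ l → ∑ (λ v → ⟦ h v == l ⟧ * f v))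
∑-fibre h f = trans (∑-cong (λ v → sym (∑-δ′ (h v) (λ _ → f v))))
                    (∑-swap (λ v l → ⟦ h v == l ⟧ * f v))

∑-split : ∀ {n} (p : Fin n → Bool) (f : Fin n → ℕ) →
          ∑ f ≡ ∑ (λ i → ⟦ p i ⟧ * f i) + ∑ (λ i → ⟦ not (p i) ⟧ * f i)
∑-split p f = trans (∑-cong (λ i → sym (trans (sym (*-distribʳ-+ (f i) ⟦ p i ⟧ ⟦ not (p i) ⟧))
                      (trans (cong (_* f i) (⟦⟧+⟦not⟧ (p i))) (*-identityˡ (f i))))))
                    (∑-+ (λ i → ⟦ p i ⟧ * f i) (λ i → ⟦ not (p i) ⟧ * f i))

card : ∀ {n} → (Fin n → Bool) → ℕ
card P = ∑ (λ v → ⟦ P v ⟧)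

anyᵇ : ∀ {n} → (Fin n → Bool) → Bool
anyᵇ {zero} p  = false
anyᵇ {suc n} p = p zero ∨ anyᵇ (p ∘ suc)

anyᵇ-intro : ∀ {n} (p : Fin n → Bool) i → p i ≡ true → anyᵇ p ≡ true
anyᵇ-intro p zero e rewrite e = refl
anyᵇ-intro p (suc i) e with p zero
... | true  = refl
... | false = anyᵇ-intro (p ∘ suc) i e

anyᵇ-elim : ∀ {n} (p : Fin n → Bool) → anyᵇ p ≡ true → ∃ λ i → p i ≡ true
anyᵇ-elim {suc n} p e with p zero in e₀
... | true = zero , e₀
... | false with anyᵇ-elim (p ∘ suc) e
...   | i , q = suc i , q

sum-allFin : ∀ {n} (f : Fin n → ℕ) → sumᴸ (mapᴸ f (allFinᴸ n)) ≡ ∑ f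
sum-allFin {n} f = trans (cong sumᴸ (map-tabulate {n = n} id f)) (sum-tabulate f)

-- Deterministic cut-query decision trees

-- Randomness is kept apart from querying: a randomized algorithm is a family of such trees indexed
-- by a seed, so that expectations become finite sums over seeds.
data DT (n : ℕ) (A : Set) : Set where
  ret : A → DT n A
  ask : VSet n → (ℕ → DT n A) → DT n A

infixl 1 _>>=_

_>>=_ : ∀ {n} {A B : Set} → DT n A → (A → DT n B) → DT n B
ret a   >>= f = f a
ask S k >>= f = ask S (λ c → k c >>= f)

module _ {n : ℕ} (G : Graph n) where

  run : {A : Set} → DT n A → A
  run (ret a)   = a
  run (ask S k) = run (k (cutSize G S))

  cost : {A : Set} → DT n A → ℕ
  cost (ret a)   = 0
  cost (ask S k) = suc (cost (k (cutSize G S)))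

  run->>= : {A B : Set} (m : DT n A) (f : A → DT n B) → run (m >>= f) ≡ run (f (run m))
  run->>= (ret a)   f = refl
  run->>= (ask S k) f = run->>= (k (cutSize G S)) f

  cost->>= : {A B : Set} (m : DT n A) (f : A → DT n B) →
             cost (m >>= f) ≡ cost m + cost (f (run m))
  cost->>= (ret a)   f = refl
  cost->>= (ask S k) f = cong suc (cost->>= (k (cutSize G S)) f)

consᶠ : ∀ {k} {A : Set} → A → (Fin k → A) → Fin (suc k) → A
consᶠ a g zero    = a
consᶠ a g (suc i) = g i

forFin : ∀ {n k} {A : Set} → (Fin k → DT n A) → DT n (Fin k → A)
forFin {k = zero}  f = ret (λ ())
forFin {k = suc k} f = f zero >>= λ a → forFin (f ∘ suc) >>= λ g → ret (consᶠ a g)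

module _ {n : ℕ} (G : Graph n) where

  run-forFin-suc : ∀ {k} {A : Set} (f : Fin (suc k) → DT n A) →
                   run G (forFin f) ≡ consᶠ (run G (f zero)) (run G (forFin (f ∘ suc)))
  run-forFin-suc f =
    trans (run->>= G (f zero) (λ a → forFin (f ∘ suc) >>= λ g → ret (consᶠ a g)))
          (run->>= G (forFin (f ∘ suc)) (λ g → ret (consᶠ (run G (f zero)) g)))

  run-forFin : ∀ {k} {A : Set} (f : Fin k → DT n A) i → run G (forFin f) i ≡ run G (f i)
  run-forFin f zero    = cong (λ g → g zero) (run-forFin-suc f)
  run-forFin f (suc i) = trans (cong (λ g → g (suc i)) (run-forFin-suc f)) (run-forFin (f ∘ suc) i)

  cost-forFin : ∀ {k} {A : Set} (f : Fin k → DT n A) → cost G (forFin f) ≡ ∑ (λ i → cost G (f i))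
  cost-forFin {zero}  f = sym (∑-empty (λ i → cost G (f i)))
  cost-forFin {suc k} f =
    trans (cost->>= G (f zero) _)
      (trans (cong (cost G (f zero) +_)
        (trans (cost->>= G (forFin (f ∘ suc)) _) (trans (+-identityʳ _) (cost-forFin (f ∘ suc)))))
        (sym (∑-suc (λ i → cost G (f i)))))

guard : ∀ {n} {A : Set} → Bool → A → DT n A → DT n A
guard true  d t = t
guard false d t = ret d

module _ {n : ℕ} (G : Graph n) {A : Set} where

  cost-guard : ∀ b (d : A) t → cost G (guard b d t) ≡ ⟦ b ⟧ * cost G t
  cost-guard true  d t = sym (+-identityʳ _)
  cost-guard false d t = refl

  run-guard : ∀ {b} (d : A) t → b ≡ true → run G (guard b d t) ≡ run G t
  run-guard d t refl = refl

-- Truncation turns a bound on the expected cost into a bound for every seed. The default `d` does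
-- no harm if it is an upper bound for the true answer, since only minima are taken afterwards.
limit : ∀ {n} {A : Set} → ℕ → A → DT n A → DT n A
limit q       d (ret a)   = ret a
limit zero    d (ask S k) = ret d
limit (suc q) d (ask S k) = ask S (λ c → limit q d (k c))

module _ {n : ℕ} (G : Graph n) {A : Set} where

  cost-limit : ∀ q d (t : DT n A) → cost G (limit q d t) ≤ q
  cost-limit zero    d (ret a)   = z≤n
  cost-limit (suc q) d (ret a)   = z≤n
  cost-limit zero    d (ask S k) = z≤n
  cost-limit (suc q) d (ask S k) = s≤s (cost-limit q d (k (cutSize G S)))

  run-limit : ∀ q d (t : DT n A) → cost G t ≤ q → run G (limit q d t) ≡ run G t
  run-limit zero    d (ret a)   p = refl
  run-limit (suc q) d (ret a)   p = refl
  run-limit (suc q) d (ask S k) (s≤s p) = run-limit q d (k (cutSize G S)) p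

  run-limit-either : ∀ q d (t : DT n A) → run G (limit q d t) ≡ run G t ⊎ run G (limit q d t) ≡ d
  run-limit-either zero    d (ret a)   = inj₁ refl
  run-limit-either (suc q) d (ret a)   = inj₁ refl
  run-limit-either zero    d (ask S k) = inj₂ refl
  run-limit-either (suc q) d (ask S k) = run-limit-either q d (k (cutSize G S))

-- Numbers of edges between vertex sets

-- Neighbour counts are stated for an arbitrary relation because the sampling is used twice: on the
-- graph itself and on the graph of those edges that are still unknown.
Rel₂ : ℕ → Set
Rel₂ n = Fin n → Fin n → Bool

nb : ∀ {n} → Rel₂ n → Fin n → VSet n → ℕ
nb R v B = ∑ (λ w → ⟦ B w ⟧ * ⟦ R v w ⟧)

form : ∀ {n} → Rel₂ n → VSet n → VSet n → ℕ
form R I B = ∑ (λ v → ⟦ I v ⟧ * nb R v B)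

Disjoint : ∀ {n} → VSet n → VSet n → Set
Disjoint I B = ∀ v → I v ≡ true → B v ≡ true → ⊥

nb-mono : ∀ {n} (R : Rel₂ n) v {B C : VSet n} → (∀ w → B w ≡ true → C w ≡ true) → nb R v B ≤ nb R v C
nb-mono R v h = ∑-mono (λ w → *-monoˡ-≤ ⟦ R v w ⟧ (⟦⟧-mono (h w)))

nb-cong : ∀ {n} (R : Rel₂ n) v {B C : VSet n} → (∀ w → B w ≡ C w) → nb R v B ≡ nb R v C
nb-cong R v h = ∑-cong (λ w → cong (λ b → ⟦ b ⟧ * ⟦ R v w ⟧) (h w))

form-single : ∀ {n} (R : Rel₂ n) v B → form R (_== v) B ≡ nb R v B
form-single R v B = ∑-δ v (λ u → nb R u B)

if-⟦⟧ : ∀ b → (if b then 1 else 0) ≡ ⟦ b ⟧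
if-⟦⟧ true  = refl
if-⟦⟧ false = refl

count-∑ : ∀ {n} (p : Fin n → Bool) → count p ≡ ∑ (λ j → ⟦ p j ⟧)
count-∑ p = trans (sum-allFin _) (∑-cong (λ j → if-⟦⟧ (p j)))

module _ {n : ℕ} (G : Graph n) where

  cutSize-∑ : ∀ S → cutSize G S ≡ ∑ (λ v → ∑ (λ w → ⟦ S v ∧ not (S w) ∧ adj G v w ⟧))
  cutSize-∑ S = trans (sum-allFin _) (∑-cong (λ v → count-∑ (λ w → S v ∧ not (S w) ∧ adj G v w)))

  cutSize-form : ∀ S → cutSize G S ≡ form (adj G) S (not ∘ S)
  cutSize-form S = trans (cutSize-∑ S) (∑-cong (λ v → trans (∑-cong (λ w →
    trans (⟦∧⟧ (S v) _) (cong (⟦ S v ⟧ *_) (⟦∧⟧ (not (S w)) _)))) (∑-*ˡ ⟦ S v ⟧ _)))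

  cutSize-cong : ∀ {S T} → (∀ v → S v ≡ T v) → cutSize G S ≡ cutSize G T
  cutSize-cong {S} {T} h = trans (cutSize-∑ S) (trans
    (∑-cong (λ v → ∑-cong (λ w → cong₂ (λ a b → ⟦ a ∧ not b ∧ adj G v w ⟧) (h v) (h w))))
    (sym (cutSize-∑ T)))

  form-sym : ∀ I B → form (adj G) I B ≡ form (adj G) B I
  form-sym I B = begin
    ∑ (λ v → ⟦ I v ⟧ * ∑ (λ w → ⟦ B w ⟧ * ⟦ adj G v w ⟧))
      ≡⟨ ∑-cong (λ v → sym (∑-*ˡ ⟦ I v ⟧ _)) ⟩
    ∑ (λ v → ∑ (λ w → ⟦ I v ⟧ * (⟦ B w ⟧ * ⟦ adj G v w ⟧)))
      ≡⟨ ∑-swap (λ v w → ⟦ I v ⟧ * (⟦ B w ⟧ * ⟦ adj G v w ⟧)) ⟩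
    ∑ (λ w → ∑ (λ v → ⟦ I v ⟧ * (⟦ B w ⟧ * ⟦ adj G v w ⟧)))
      ≡⟨ ∑-cong (λ w → trans (∑-cong (λ v → trans (cong (λ b → ⟦ I v ⟧ * (⟦ B w ⟧ * ⟦ b ⟧)) (Graph.sym G v w))
           (exch ⟦ I v ⟧ ⟦ B w ⟧ _))) (∑-*ˡ ⟦ B w ⟧ _)) ⟩
    ∑ (λ w → ⟦ B w ⟧ * ∑ (λ v → ⟦ I v ⟧ * ⟦ adj G w v ⟧)) ∎
    where
    open ≡-Reasoning
    exch : ∀ a b c → a * (b * c) ≡ b * (a * c)
    exch = solve 3 (λ a b c → a :* (b :* c) := b :* (a :* c)) refl

  -- An edge between `I` and `B` is counted from both of its ends on the left and not at all in the
  -- cut of the union; every other edge leaving the union is counted once on each side. Hence three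
  -- cut queries determine `form (adj G) I B`, after an exact halving.
  cut-union : ∀ I B → Disjoint I B →
              cutSize G I + cutSize G B ≡ cutSize G (λ v → I v ∨ B v) + (form (adj G) I B + form (adj G) I B)
  cut-union I B dis = begin
    cutSize G I + cutSize G B
      ≡⟨ cong₂ _+_ (cutSize-∑ I) (cutSize-∑ B) ⟩
    ∑ (λ v → ∑ (λ w → ⟦ I v ∧ not (I w) ∧ a v w ⟧)) + ∑ (λ v → ∑ (λ w → ⟦ B v ∧ not (B w) ∧ a v w ⟧))
      ≡⟨ sym (∑∑-+ (λ v w → ⟦ I v ∧ not (I w) ∧ a v w ⟧) (λ v w → ⟦ B v ∧ not (B w) ∧ a v w ⟧)) ⟩
    ∑ (λ v → ∑ (λ w → ⟦ I v ∧ not (I w) ∧ a v w ⟧ + ⟦ B v ∧ not (B w) ∧ a v w ⟧))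
      ≡⟨ ∑-cong (λ v → ∑-cong (λ w → pointwise (I v) (B v) (I w) (B w) (a v w) (dis v) (dis w))) ⟩
    ∑ (λ v → ∑ (λ w → ⟦ (I v ∨ B v) ∧ not (I w ∨ B w) ∧ a v w ⟧ +
                       (⟦ I v ⟧ * (⟦ B w ⟧ * ⟦ a v w ⟧) + ⟦ B v ⟧ * (⟦ I w ⟧ * ⟦ a v w ⟧))))
      ≡⟨ trans (∑∑-+ (λ v w → ⟦ (I v ∨ B v) ∧ not (I w ∨ B w) ∧ a v w ⟧) _)
           (cong₂ _+_ (sym (cutSize-∑ (λ v → I v ∨ B v)))
             (trans (∑∑-+ (λ v w → ⟦ I v ⟧ * (⟦ B w ⟧ * ⟦ a v w ⟧)) _)
               (cong₂ _+_ (∑-cong (λ v → ∑-*ˡ ⟦ I v ⟧ _))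
                 (trans (∑-cong (λ v → ∑-*ˡ ⟦ B v ⟧ _)) (sym (form-sym I B)))))) ⟩
    cutSize G (λ v → I v ∨ B v) + (form (adj G) I B + form (adj G) I B) ∎
    where
    open ≡-Reasoning
    a = adj G
    ∑∑-+ : ∀ (f g : Fin n → Fin n → ℕ) →
           ∑ (λ v → ∑ (λ w → f v w + g v w)) ≡ ∑ (λ v → ∑ (f v)) + ∑ (λ v → ∑ (g v))
    ∑∑-+ f g = trans (∑-cong (λ v → ∑-+ (f v) (g v))) (∑-+ (λ v → ∑ (f v)) (λ v → ∑ (g v)))
    pointwise : ∀ x y x' y' e → (x ≡ true → y ≡ true → ⊥) → (x' ≡ true → y' ≡ true → ⊥) →
      ⟦ x ∧ not x' ∧ e ⟧ + ⟦ y ∧ not y' ∧ e ⟧ ≡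
      ⟦ (x ∨ y) ∧ not (x' ∨ y') ∧ e ⟧ + (⟦ x ⟧ * (⟦ y' ⟧ * ⟦ e ⟧) + ⟦ y ⟧ * (⟦ x' ⟧ * ⟦ e ⟧))
    pointwise true  true  x' y' e d d' = ⊥-elim (d refl refl)
    pointwise true  false true  true  e d d' = ⊥-elim (d' refl refl)
    pointwise false true  true  true  e d d' = ⊥-elim (d' refl refl)
    pointwise false false true  true  e d d' = refl
    pointwise true  false true  false e d d' = refl
    pointwise true  false false true  true  d d' = refl
    pointwise true  false false true  false d d' = refl
    pointwise true  false false false true  d d' = refl
    pointwise true  false false false false d d' = refl
    pointwise false true  true  false true  d d' = refl
    pointwise false true  true  false false d d' = refl
    pointwise false true  false true  e d d' = refl
    pointwise false true  false false true  d d' = refl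
    pointwise false true  false false false d d' = refl
    pointwise false false true  false e d d' = refl
    pointwise false false false true  e d d' = refl
    pointwise false false false false e d d' = refl

opaque
  pairQ : ∀ {n} → VSet n → VSet n → DT n ℕ
  pairQ I B = ask I λ x → ask B λ y → ask (λ v → I v ∨ B v) λ z → ret (⌊ x + y ∸ z /2⌋)

  cost-pairQ : ∀ {n} (G : Graph n) I B → cost G (pairQ I B) ≡ 3
  cost-pairQ G I B = refl

  run-pairQ : ∀ {n} (G : Graph n) I B → Disjoint I B → run G (pairQ I B) ≡ form (adj G) I B
  run-pairQ G I B dis = begin
    ⌊ cutSize G I + cutSize G B ∸ u /2⌋ ≡⟨ cong (λ z → ⌊ z ∸ u /2⌋) (cut-union G I B dis) ⟩
    ⌊ u + (f + f) ∸ u /2⌋               ≡⟨ cong ⌊_/2⌋ (m+n∸m≡n u (f + f)) ⟩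
    ⌊ f + f /2⌋                         ≡⟨ sym (n≡⌊n+n/2⌋ f) ⟩
    f ∎
    where
    open ≡-Reasoning
    u f : ℕ
    u = cutSize G (λ v → I v ∨ B v)
    f = form (adj G) I B

-- Spaces of random seeds

infixr 5 _⊗_

-- Seeds are built from fair bits. A probability or expectation is a ratio `total c f / vol c`, and
-- such ratios are compared after clearing denominators, so the whole analysis stays in ℕ.
data Code : Set where
  bit : Code
  _⊗_ : Code → Code → Code
  pow : ℕ → Code → Code

Seed : Code → Set
Seed bit       = Bool
Seed (c ⊗ d)   = Seed c × Seed d
Seed (pow n c) = Vec (Seed c) n

opaque
  total : (c : Code) → (Seed c → ℕ) → ℕ
  total bit             f = f true + f false
  total (c ⊗ d)         f = total c (λ a → total d (λ b → f (a , b)))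
  total (pow zero c)    f = f []
  total (pow (suc n) c) f = total c (λ a → total (pow n c) (λ as → f (a ∷ as)))

  total-bit : ∀ f → total bit f ≡ f true + f false
  total-bit f = refl

  total-⊗ : ∀ c d f → total (c ⊗ d) f ≡ total c (λ a → total d (λ b → f (a , b)))
  total-⊗ c d f = refl

  total-[] : ∀ c f → total (pow zero c) f ≡ f []
  total-[] c f = refl

  total-∷ : ∀ n c f → total (pow (suc n) c) f ≡ total c (λ a → total (pow n c) (λ as → f (a ∷ as)))
  total-∷ n c f = refl

  total-cong : ∀ c {f g} → (∀ ω → f ω ≡ g ω) → total c f ≡ total c g
  total-cong bit             h = cong₂ _+_ (h true) (h false)
  total-cong (c ⊗ d)         h = total-cong c (λ a → total-cong d (λ b → h (a , b)))
  total-cong (pow zero c)    h = h []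
  total-cong (pow (suc n) c) h = total-cong c (λ a → total-cong (pow n c) (λ as → h (a ∷ as)))

  total-mono : ∀ c {f g} → (∀ ω → f ω ≤ g ω) → total c f ≤ total c g
  total-mono bit             h = +-mono-≤ (h true) (h false)
  total-mono (c ⊗ d)         h = total-mono c (λ a → total-mono d (λ b → h (a , b)))
  total-mono (pow zero c)    h = h []
  total-mono (pow (suc n) c) h = total-mono c (λ a → total-mono (pow n c) (λ as → h (a ∷ as)))

  total-+ : ∀ c f g → total c (λ ω → f ω + g ω) ≡ total c f + total c g
  total-+ bit f g = +-interchange (f true) (g true) (f false) (g false)
  total-+ (c ⊗ d) f g =
    trans (total-cong c (λ a → total-+ d (λ b → f (a , b)) (λ b → g (a , b)))) (total-+ c _ _)
  total-+ (pow zero c) f g = refl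
  total-+ (pow (suc n) c) f g =
    trans (total-cong c (λ a → total-+ (pow n c) (λ b → f (a ∷ b)) (λ b → g (a ∷ b)))) (total-+ c _ _)

  total-*ˡ : ∀ c k f → total c (λ ω → k * f ω) ≡ k * total c f
  total-*ˡ bit k f = sym (*-distribˡ-+ k (f true) (f false))
  total-*ˡ (c ⊗ d) k f = trans (total-cong c (λ a → total-*ˡ d k (λ b → f (a , b)))) (total-*ˡ c k _)
  total-*ˡ (pow zero c) k f = refl
  total-*ˡ (pow (suc n) c) k f =
    trans (total-cong c (λ a → total-*ˡ (pow n c) k (λ b → f (a ∷ b)))) (total-*ˡ c k _)

vol : Code → ℕ
vol c = total c (λ _ → 1)

total-const : ∀ c k → total c (λ _ → k) ≡ k * (vol c)
total-const c k = trans (total-cong c (λ _ → sym (*-identityʳ k))) (total-*ˡ c k (λ _ → 1))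

total-*ʳ : ∀ c k f → total c (λ ω → f ω * k) ≡ total c f * k
total-*ʳ c k f = trans (total-cong c (λ ω → *-comm (f ω) k)) (trans (total-*ˡ c k f) (*-comm k _))

vol-⊗ : ∀ c d → (vol (c ⊗ d)) ≡ (vol c) * (vol d)
vol-⊗ c d = trans (total-⊗ c d _) (trans (total-const c (vol d)) (*-comm (vol d) (vol c)))

vol-∷ : ∀ n c → (vol (pow (suc n) c)) ≡ (vol c) * (vol (pow n c))
vol-∷ n c = trans (total-∷ n c _) (trans (total-const c (vol (pow n c))) (*-comm (vol (pow n c)) (vol c)))

opaque
  unfolding total ∑

  total-∑ : ∀ c {n} (f : Fin n → Seed c → ℕ) → total c (λ ω → ∑ (λ i → f i ω)) ≡ ∑ (λ i → total c (f i))
  total-∑ c {zero}  f = total-const c 0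
  total-∑ c {suc n} f = trans (total-+ c (f zero) (λ ω → ∑ (λ i → f (suc i) ω)))
                              (cong (total c (f zero) +_) (total-∑ c (λ i → f (suc i))))

  vol-pos : ∀ c → 1 ≤ (vol c)
  vol-pos bit             = s≤s z≤n
  vol-pos (c ⊗ d)         = subst (1 ≤_) (sym (vol-⊗ c d)) (*-mono-≤ (vol-pos c) (vol-pos d))
  vol-pos (pow zero c)    = ≤-refl
  vol-pos (pow (suc n) c) = subst (1 ≤_) (sym (vol-∷ n c)) (*-mono-≤ (vol-pos c) (vol-pos (pow n c)))

-- One coordinate of a vector of seeds is distributed like a single seed.
total-marginal : ∀ {n} c (g : Seed c → ℕ) (i : Fin n) →
  total (pow n c) (λ ρ → g (lookup ρ i)) * (vol c) ≡ (vol (pow n c)) * total c g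
total-marginal {suc n} c g zero = begin
  total (pow (suc n) c) (λ ρ → g (lookup ρ zero)) * (vol c)
    ≡⟨ cong (_* vol c) (trans (total-∷ n c _) (total-cong c (λ a → total-const (pow n c) (g a)))) ⟩
  total c (λ a → g a * (vol (pow n c))) * (vol c)
    ≡⟨ cong (_* vol c) (total-*ʳ c (vol (pow n c)) g) ⟩
  total c g * (vol (pow n c)) * (vol c)
    ≡⟨ solve 3 (λ x y z → x :* y :* z := z :* y :* x) refl (total c g) (vol (pow n c)) (vol c) ⟩
  (vol c) * (vol (pow n c)) * total c g
    ≡⟨ cong (_* total c g) (sym (vol-∷ n c)) ⟩
  (vol (pow (suc n) c)) * total c g ∎
  where
  open ≡-Reasoning
total-marginal {suc n} c g (suc i) = begin
  total (pow (suc n) c) (λ ρ → g (lookup ρ (suc i))) * (vol c)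
    ≡⟨ cong (_* vol c) (total-∷ n c _) ⟩
  total c (λ a → T) * (vol c)
    ≡⟨ cong (_* vol c) (total-const c T) ⟩
  T * (vol c) * (vol c)
    ≡⟨ cong (_* vol c) (total-marginal c g i) ⟩
  (vol (pow n c)) * total c g * (vol c)
    ≡⟨ solve 3 (λ x y z → x :* y :* z := z :* x :* y) refl (vol (pow n c)) (total c g) (vol c) ⟩
  (vol c) * (vol (pow n c)) * total c g
    ≡⟨ cong (_* total c g) (sym (vol-∷ n c)) ⟩
  (vol (pow (suc n) c)) * total c g ∎
  where
  open ≡-Reasoning
  T = total (pow n c) (λ ρ → g (lookup ρ i))

-- Two different coordinates are independent. This is what bounds the probability that two sampled
-- vertices, or two calling clusters, collide.
total-marginal₂ : ∀ {n} c (g h : Seed c → ℕ) (i j : Fin n) → i ≢ j →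
  total (pow n c) (λ ρ → g (lookup ρ i) * h (lookup ρ j)) * ((vol c) * (vol c)) ≡
  (vol (pow n c)) * (total c g * total c h)
total-marginal₂ c g h zero zero ne = ⊥-elim (ne refl)
total-marginal₂ {suc n} c g h zero (suc j) ne = begin
  total (pow (suc n) c) (λ ρ → g (lookup ρ zero) * h (lookup ρ (suc j))) * ((vol c) * (vol c))
    ≡⟨ cong (_* ((vol c) * (vol c))) (trans (total-∷ n c _)
        (trans (total-cong c (λ a → total-*ˡ (pow n c) (g a) (λ ρ → h (lookup ρ j)))) (total-*ʳ c T g))) ⟩
  total c g * T * ((vol c) * (vol c))
    ≡⟨ solve 3 (λ x y z → x :* y :* (z :* z) := z :* x :* (y :* z)) refl (total c g) T (vol c) ⟩
  (vol c) * total c g * (T * (vol c))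
    ≡⟨ cong ((vol c) * total c g *_) (total-marginal c h j) ⟩
  (vol c) * total c g * ((vol (pow n c)) * total c h)
    ≡⟨ solve 4 (λ x y z w → x :* y :* (z :* w) := x :* z :* (y :* w)) refl (vol c) (total c g) (vol (pow n c)) (total c h) ⟩
  (vol c) * (vol (pow n c)) * (total c g * total c h)
    ≡⟨ cong (_* (total c g * total c h)) (sym (vol-∷ n c)) ⟩
  (vol (pow (suc n) c)) * (total c g * total c h) ∎
  where
  open ≡-Reasoning
  T = total (pow n c) (λ ρ → h (lookup ρ j))
total-marginal₂ {suc n} c g h (suc i) zero ne =
  trans (cong (_* ((vol c) * (vol c))) (total-cong (pow (suc n) c) (λ ρ → *-comm (g (lookup ρ (suc i))) (h (lookup ρ zero)))))
    (trans (total-marginal₂ c h g zero (suc i) (λ ()))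
      (cong ((vol (pow (suc n) c)) *_) (*-comm (total c h) (total c g))))
total-marginal₂ {suc n} c g h (suc i) (suc j) ne = begin
  total (pow (suc n) c) (λ ρ → g (lookup ρ (suc i)) * h (lookup ρ (suc j))) * ((vol c) * (vol c))
    ≡⟨ cong (_* ((vol c) * (vol c))) (trans (total-∷ n c _) (total-const c T)) ⟩
  T * (vol c) * ((vol c) * (vol c))
    ≡⟨ solve 2 (λ x y → x :* y :* (y :* y) := y :* (x :* (y :* y))) refl T (vol c) ⟩
  (vol c) * (T * ((vol c) * (vol c)))
    ≡⟨ cong ((vol c) *_) (total-marginal₂ c g h i j (λ e → ne (cong suc e))) ⟩
  (vol c) * ((vol (pow n c)) * (total c g * total c h))
    ≡⟨ sym (*-assoc (vol c) (vol (pow n c)) _) ⟩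
  (vol c) * (vol (pow n c)) * (total c g * total c h)
    ≡⟨ cong (_* (total c g * total c h)) (sym (vol-∷ n c)) ⟩
  (vol (pow (suc n) c)) * (total c g * total c h) ∎
  where
  open ≡-Reasoning
  T = total (pow n c) (λ ρ → g (lookup ρ i) * h (lookup ρ j))

-- Sums over initial segments of ℕ

∑< : ℕ → (ℕ → ℕ) → ℕ
∑< zero    f = 0
∑< (suc m) f = ∑< m f + f m

∑<-cong : ∀ m {f g} → (∀ r → r < m → f r ≡ g r) → ∑< m f ≡ ∑< m g
∑<-cong zero    h = refl
∑<-cong (suc m) h = cong₂ _+_ (∑<-cong m (λ r p → h r (m≤n⇒m≤1+n p))) (h m ≤-refl)

∑<-+ : ∀ a b f → ∑< (a + b) f ≡ ∑< a f + ∑< b (λ r → f (a + r))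
∑<-+ a zero    f = trans (cong (λ m → ∑< m f) (+-identityʳ a)) (sym (+-identityʳ _))
∑<-+ a (suc b) f = trans (cong (λ m → ∑< m f) (+-suc a b))
                     (trans (cong (_+ f (a + b)) (∑<-+ a b f)) (+-assoc (∑< a f) _ _))

∑<-mono-range : ∀ {a b} f → a ≤ b → ∑< a f ≤ ∑< b f
∑<-mono-range {a} {b} f p = subst (λ m → ∑< a f ≤ ∑< m f) (m+[n∸m]≡n p)
  (subst (∑< a f ≤_) (sym (∑<-+ a (b ∸ a) f)) (m≤m+n _ _))

bits : ℕ → Code
bits k = pow k bit

vol-bits : ∀ k → vol (bits k) ≡ 2 ^ k
vol-bits zero = total-[] bit _
vol-bits (suc k) = trans (vol-∷ k bit) (cong₂ _*_ (total-bit (λ _ → 1)) (vol-bits k))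

value : ∀ {k} → Vec Bool k → ℕ
value [] = 0
value {suc k} (true  ∷ v) = 2 ^ k + value v
value {suc k} (false ∷ v) = value v

total-value : ∀ k (f : ℕ → ℕ) → total (bits k) (λ v → f (value v)) ≡ ∑< (2 ^ k) f
total-value zero    f = total-[] bit _
total-value (suc k) f = begin
  total (bits (suc k)) (λ v → f (value v))
    ≡⟨ trans (total-∷ k bit _) (total-bit _) ⟩
  total (bits k) (λ v → f (2 ^ k + value v)) + total (bits k) (λ v → f (value v))
    ≡⟨ cong₂ _+_ (total-value k (λ r → f (2 ^ k + r))) (total-value k f) ⟩
  ∑< (2 ^ k) (λ r → f (2 ^ k + r)) + ∑< (2 ^ k) f
    ≡⟨ +-comm (∑< (2 ^ k) (λ r → f (2 ^ k + r))) _ ⟩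
  ∑< (2 ^ k) f + ∑< (2 ^ k) (λ r → f (2 ^ k + r))
    ≡⟨ sym (∑<-+ (2 ^ k) (2 ^ k) f) ⟩
  ∑< (2 ^ k + 2 ^ k) f
    ≡⟨ cong (λ m → ∑< (2 ^ k + m) f) (sym (+-identityʳ (2 ^ k))) ⟩
  ∑< (2 ^ suc k) f ∎
  where open ≡-Reasoning

-- An event of probability `2 ^ (− j)`. The events are nested in `j`, so one string of bits serves
-- every sampling rate at once.
leading : ∀ {k} → ℕ → Vec Bool k → Bool
leading zero    v       = true
leading (suc j) []      = false
leading (suc j) (b ∷ v) = b ∧ leading j v

total-leading : ∀ {k} j → j ≤ k → total (bits k) (λ v → ⟦ leading j v ⟧) * 2 ^ j ≡ (vol (bits k))
total-leading {k} zero p = *-identityʳ _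
total-leading {suc k} (suc j) (s≤s p) = begin
  total (bits (suc k)) (λ v → ⟦ leading (suc j) v ⟧) * 2 ^ suc j
    ≡⟨ cong (_* 2 ^ suc j) (trans (total-∷ k bit _) (trans (total-bit _)
         (trans (cong (total (bits k) (λ v → ⟦ leading j v ⟧) +_) (total-const (bits k) 0)) (+-identityʳ _)))) ⟩
  total (bits k) (λ v → ⟦ leading j v ⟧) * (2 * 2 ^ j)
    ≡⟨ solve 2 (λ x y → x :* (con 2 :* y) := con 2 :* (x :* y)) refl (total (bits k) (λ v → ⟦ leading j v ⟧)) (2 ^ j) ⟩
  2 * (total (bits k) (λ v → ⟦ leading j v ⟧) * 2 ^ j)
    ≡⟨ cong (2 *_) (total-leading j p) ⟩
  2 * (vol (bits k))
    ≡⟨ sym (trans (vol-∷ k bit) (cong (_* (vol (bits k))) (total-bit (λ _ → 1)))) ⟩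
  (vol (bits (suc k))) ∎
  where
  open ≡-Reasoning

module _ {n : ℕ} (k j : ℕ) (j≤k : j ≤ k) where

  private
    c = vol (bits k)
    V = vol (pow n (bits k))
    f : Vec Bool k → ℕ
    f a = ⟦ leading j a ⟧
    t = total (bits k) f

  leading-marginal : ∀ i → total (pow n (bits k)) (λ ρ → ⟦ leading j (lookup ρ i) ⟧) * 2 ^ j ≡ V
  leading-marginal i = *-cancelʳ-≡ _ V c {{>-nonZero (vol-pos (bits k))}} (begin
    T₁ * 2 ^ j * c   ≡⟨ solve 3 (λ a p c → a :* p :* c := a :* c :* p) refl T₁ (2 ^ j) c ⟩
    T₁ * c * 2 ^ j   ≡⟨ cong (_* 2 ^ j) (total-marginal (bits k) f i) ⟩
    V * t * 2 ^ j    ≡⟨ trans (*-assoc V t _) (cong (V *_) (total-leading j j≤k)) ⟩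
    V * c ∎)
    where
    open ≡-Reasoning
    T₁ = total (pow n (bits k)) (λ ρ → f (lookup ρ i))

  leading-marginal₂ : ∀ i i′ → i ≢ i′ →
    total (pow n (bits k)) (λ ρ → ⟦ leading j (lookup ρ i) ⟧ * ⟦ leading j (lookup ρ i′) ⟧) * (2 ^ j * 2 ^ j) ≡ V
  leading-marginal₂ i i′ ne =
    *-cancelʳ-≡ _ V (c * c) {{>-nonZero (*-mono-≤ (vol-pos (bits k)) (vol-pos (bits k)))}} (begin
    T₂ * (2 ^ j * 2 ^ j) * (c * c)
      ≡⟨ solve 3 (λ a p c → a :* (p :* p) :* (c :* c) := a :* (c :* c) :* (p :* p)) refl T₂ (2 ^ j) c ⟩
    T₂ * (c * c) * (2 ^ j * 2 ^ j)
      ≡⟨ cong (_* (2 ^ j * 2 ^ j)) (total-marginal₂ (bits k) f f i i′ ne) ⟩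
    V * (t * t) * (2 ^ j * 2 ^ j)
      ≡⟨ solve 3 (λ V t p → V :* (t :* t) :* (p :* p) := V :* ((t :* p) :* (t :* p))) refl V t (2 ^ j) ⟩
    V * ((t * 2 ^ j) * (t * 2 ^ j))
      ≡⟨ cong (λ z → V * (z * z)) (total-leading j j≤k) ⟩
    V * (c * c) ∎)
    where
    open ≡-Reasoning
    T₂ = total (pow n (bits k)) (λ ρ → f (lookup ρ i) * f (lookup ρ i′))

module _ (W : ℕ) .{{_ : NonZero W}} (g : ℕ → ℕ) where

  private
    h : ℕ → ℕ
    h r = g (r % W)

  ∑<-periods : ∀ k → ∑< (k * W) h ≡ k * ∑< W g
  ∑<-periods zero    = refl
  ∑<-periods (suc k) = trans (∑<-+ W (k * W) h)
    (cong₂ _+_ (∑<-cong W (λ r p → cong g (m<n⇒m%n≡m p)))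
      (trans (∑<-cong (k * W) (λ r _ → cong g (trans (cong (_% W) (trans (+-comm W r) (cong (r +_) (sym (*-identityˡ W)))))
                                                ([m+kn]%n≡m%n r 1 W))))
             (∑<-periods k)))

  private
    decomposition : ∀ N → ∑< N h ≡ (N div W) * ∑< W g + ∑< (N % W) g
    decomposition N = begin
      ∑< N h ≡⟨ cong (λ m → ∑< m h) (trans (m≡m%n+[m/n]*n N W) (+-comm (N % W) _)) ⟩
      ∑< ((N div W) * W + N % W) h ≡⟨ ∑<-+ ((N div W) * W) (N % W) h ⟩
      ∑< ((N div W) * W) h + ∑< (N % W) (λ r → h ((N div W) * W + r))
        ≡⟨ cong₂ _+_ (∑<-periods (N div W)) (∑<-cong (N % W) (λ r p → cong g
             (trans (cong (_% W) (+-comm ((N div W) * W) r))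
               (trans ([m+kn]%n≡m%n r (N div W) W) (m<n⇒m%n≡m (<-trans p (m%n<n N W))))))) ⟩
      (N div W) * ∑< W g + ∑< (N % W) g ∎
      where open ≡-Reasoning

  -- Among the numbers below `N`, each residue modulo `W` occurs `N div W` times or once more. For
  -- `W ≤ N` this is `N / W` up to a factor 2, so a reduced random number replaces a uniform choice
  -- among `W` things, which fair coins cannot make exactly in general.
  ∑<-mod-≤ : ∀ N → W ≤ N → W * ∑< N h ≤ 2 * (N * ∑< W g)
  ∑<-mod-≤ N p = begin
    W * ∑< N h                               ≡⟨ cong (W *_) (decomposition N) ⟩
    W * ((N div W) * S + ∑< (N % W) g)         ≤⟨ *-monoʳ-≤ W (+-monoʳ-≤ ((N div W) * S) (∑<-mono-range g (<⇒≤ (m%n<n N W)))) ⟩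
    W * ((N div W) * S + S)                    ≡⟨ solve 3 (λ w k s → w :* (k :* s :+ s) := (k :* w :+ w) :* s) refl W (N div W) S ⟩
    ((N div W) * W + W) * S                    ≤⟨ *-monoˡ-≤ S (+-mono-≤ (m/n*n≤m N W) p) ⟩
    (N + N) * S                              ≡⟨ solve 2 (λ n s → (n :+ n) :* s := con 2 :* (n :* s)) refl N S ⟩
    2 * (N * S) ∎
    where
    open ≤-Reasoning
    S = ∑< W g

  ∑<-mod-≥ : ∀ N → W ≤ N → N * ∑< W g ≤ 2 * (W * ∑< N h)
  ∑<-mod-≥ N p = begin
    N * S                               ≡⟨ cong (_* S) (m≡m%n+[m/n]*n N W) ⟩
    (N % W + k * W) * S                 ≤⟨ *-monoˡ-≤ S (+-monoˡ-≤ (k * W) (<⇒≤ (m%n<n N W))) ⟩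
    (W + k * W) * S                     ≤⟨ *-monoˡ-≤ S (+-monoˡ-≤ (k * W) (m≤n*m W k {{≢-nonZero k≢0}})) ⟩
    (k * W + k * W) * S                 ≡⟨ solve 3 (λ k w s → (k :* w :+ k :* w) :* s := con 2 :* (w :* (k :* s))) refl k W S ⟩
    2 * (W * (k * S))                   ≤⟨ *-monoʳ-≤ 2 (*-monoʳ-≤ W (m≤m+n (k * S) _)) ⟩
    2 * (W * (k * S + ∑< (N % W) g))    ≡⟨ cong (λ z → 2 * (W * z)) (sym (decomposition N)) ⟩
    2 * (W * ∑< N h) ∎
    where
    open ≤-Reasoning
    S = ∑< W g
    k = N div W
    k≢0 : k ≢ 0
    k≢0 e = <⇒≱ (m%n<n N W) (subst (W ≤_) (trans (m≡m%n+[m/n]*n N W)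
              (trans (cong (λ z → N % W + z * W) e) (+-identityʳ _))) p)

-- Coin weighing

data Sign : Set where
  pos neg nil : Sign

opp : Sign → Sign
opp pos = neg
opp neg = pos
opp nil = nil

-- A row acts on `x` as `plus − minus`. The two parts are kept apart because a query can only add,
-- so that a row costs two of them.
plus minus : List Sign → (ℕ → ℕ) → ℕ
plus []         x = 0
plus (pos ∷ r)  x = x 0 + plus r (x ∘ suc)
plus (neg ∷ r)  x = plus r (x ∘ suc)
plus (nil ∷ r)  x = plus r (x ∘ suc)
minus []        x = 0
minus (pos ∷ r) x = minus r (x ∘ suc)
minus (neg ∷ r) x = x 0 + minus r (x ∘ suc)
minus (nil ∷ r) x = minus r (x ∘ suc)

shift : ℕ → (ℕ → ℕ) → ℕ → ℕ
shift zero    x = x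
shift (suc j) x = shift j (x ∘ suc)

shift-at : ∀ j x i → shift j x i ≡ x (j + i)
shift-at zero    x i = refl
shift-at (suc j) x i = shift-at j (x ∘ suc) i

plus-++ : ∀ r s x → plus (r ++ s) x ≡ plus r x + plus s (shift (length r) x)
plus-++ []        s x = refl
plus-++ (pos ∷ r) s x = trans (cong (x 0 +_) (plus-++ r s (x ∘ suc))) (sym (+-assoc (x 0) _ _))
plus-++ (neg ∷ r) s x = plus-++ r s (x ∘ suc)
plus-++ (nil ∷ r) s x = plus-++ r s (x ∘ suc)

minus-++ : ∀ r s x → minus (r ++ s) x ≡ minus r x + minus s (shift (length r) x)
minus-++ []        s x = refl
minus-++ (pos ∷ r) s x = minus-++ r s (x ∘ suc)
minus-++ (neg ∷ r) s x = trans (cong (x 0 +_) (minus-++ r s (x ∘ suc))) (sym (+-assoc (x 0) _ _))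
minus-++ (nil ∷ r) s x = minus-++ r s (x ∘ suc)

plus-opp : ∀ r x → plus (mapᴸ opp r) x ≡ minus r x
plus-opp []        x = refl
plus-opp (pos ∷ r) x = plus-opp r (x ∘ suc)
plus-opp (neg ∷ r) x = cong (x 0 +_) (plus-opp r (x ∘ suc))
plus-opp (nil ∷ r) x = plus-opp r (x ∘ suc)

minus-opp : ∀ r x → minus (mapᴸ opp r) x ≡ plus r x
minus-opp []        x = refl
minus-opp (pos ∷ r) x = cong (x 0 +_) (minus-opp r (x ∘ suc))
minus-opp (neg ∷ r) x = minus-opp r (x ∘ suc)
minus-opp (nil ∷ r) x = minus-opp r (x ∘ suc)

unit : ℕ → ℕ → List Sign
unit zero    j       = []
unit (suc m) zero    = pos ∷ replicate m nil
unit (suc m) (suc j) = nil ∷ unit m j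

plus-nil : ∀ m x → plus (replicate m nil) x ≡ 0
plus-nil zero    x = refl
plus-nil (suc m) x = plus-nil m (x ∘ suc)

minus-nil : ∀ m x → minus (replicate m nil) x ≡ 0
minus-nil zero    x = refl
minus-nil (suc m) x = minus-nil m (x ∘ suc)

plus-unit : ∀ m j x → j < m → plus (unit m j) x ≡ x j
plus-unit (suc m) zero    x _       = trans (cong (x 0 +_) (plus-nil m (x ∘ suc))) (+-identityʳ (x 0))
plus-unit (suc m) (suc j) x (s≤s p) = plus-unit m j (x ∘ suc) p

minus-unit : ∀ m j x → minus (unit m j) x ≡ 0
minus-unit zero    j       x = refl
minus-unit (suc m) zero    x = minus-nil m (x ∘ suc)
minus-unit (suc m) (suc j) x = minus-unit m j (x ∘ suc)

length-unit : ∀ m j → length (unit m j) ≡ m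
length-unit zero    j       = refl
length-unit (suc m) zero    = cong suc (length-replicate m)
length-unit (suc m) (suc j) = cong suc (length-unit m j)

-- Here `m` is the width of the identity block and `j` the position of the next 1 in it.
doubleRows : ℕ → ℕ → List (List Sign) → List (List Sign)
doubleRows m j []       = []
doubleRows m j (r ∷ rs) = (r ++ r ++ unit m j) ∷ (r ++ mapᴸ opp r ++ replicate m nil) ∷ doubleRows m (suc j) rs

-- The Cantor–Mills detecting matrices: from D one builds (D D I ; D -D 0).
rows : ℕ → List (List Sign)
rows zero    = (pos ∷ []) ∷ []
rows (suc k) = doubleRows (2 ^ k) 0 (rows k)

capacity : ℕ → ℕ
capacity zero    = 1
capacity (suc k) = capacity k + (capacity k + 2 ^ k)

length-doubleRows : ∀ m j rs → length (doubleRows m j rs) ≡ 2 * length rs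
length-doubleRows m j []       = refl
length-doubleRows m j (r ∷ rs) = trans (cong (λ l → suc (suc l)) (length-doubleRows m (suc j) rs))
                                       (sym (*-suc 2 (length rs)))

length-rows : ∀ k → length (rows k) ≡ 2 ^ k
length-rows zero    = refl
length-rows (suc k) = trans (length-doubleRows (2 ^ k) 0 (rows k)) (cong (2 *_) (length-rows k))

doubleRows-lengths : ∀ m j N rs → All (λ r → length r ≡ N) rs →
                     All (λ r → length r ≡ N + (N + m)) (doubleRows m j rs)
doubleRows-lengths m j N [] [] = []
doubleRows-lengths m j N (r ∷ rs) (refl ∷ ls) =
  trans (length-++ r) (cong (N +_) (trans (length-++ r) (cong (N +_) (length-unit m j)))) ∷
  trans (length-++ r) (cong (N +_) (trans (length-++ (mapᴸ opp r))
    (cong₂ _+_ (length-map opp r) (length-replicate m)))) ∷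
  doubleRows-lengths m (suc j) N rs ls

rows-lengths : ∀ k → All (λ r → length r ≡ capacity k) (rows k)
rows-lengths zero    = refl ∷ []
rows-lengths (suc k) = doubleRows-lengths (2 ^ k) 0 (capacity k) (rows k) (rows-lengths k)

-- The `2 ^ k` rows weigh `(k + 2) 2 ^ (k − 1)` coins, about `k / 2` coins per row. This saving
-- cancels the factor `L` for reading the name of a vertex digit by digit.
capacity-closed : ∀ k → 2 * capacity k ≡ (k + 2) * 2 ^ k
capacity-closed zero    = refl
capacity-closed (suc k) = begin
  2 * (c + (c + 2 ^ k)) ≡⟨ solve 2 (λ c p → con 2 :* (c :+ (c :+ p)) := con 2 :* (con 2 :* c) :+ con 2 :* p) refl c (2 ^ k) ⟩
  2 * (2 * c) + 2 * 2 ^ k ≡⟨ cong (λ z → 2 * z + 2 * 2 ^ k) (capacity-closed k) ⟩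
  2 * ((k + 2) * 2 ^ k) + 2 * 2 ^ k ≡⟨ solve 2 (λ k p → con 2 :* ((k :+ con 2) :* p) :+ con 2 :* p := (con 1 :+ k :+ con 2) :* (con 2 :* p)) refl k (2 ^ k) ⟩
  (suc k + 2) * 2 ^ suc k ∎
  where
  open ≡-Reasoning
  c = capacity k

-- The row `r` takes the same value `plus − minus` on both vectors, written without subtraction.
Same : (ℕ → ℕ) → (ℕ → ℕ) → List Sign → Set
Same x x′ r = plus r x + minus r x′ ≡ plus r x′ + minus r x

parity : ∀ p q z z′ → z ≤ 1 → z′ ≤ 1 → 2 * p + z ≡ 2 * q + z′ → z ≡ z′ × p ≡ q
parity p q zero zero _ _ e =
  refl , *-cancelˡ-≡ p q 2 (trans (sym (+-identityʳ _)) (trans e (+-identityʳ _)))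
parity p q zero (suc zero) _ _ e =
  ⊥-elim (even≢odd p q (trans (sym (+-identityʳ _)) (trans e (+-comm _ 1))))
parity p q (suc zero) zero _ _ e =
  ⊥-elim (even≢odd q p (trans (sym (+-identityʳ _)) (trans (sym e) (+-comm _ 1))))
parity p q (suc zero) (suc zero) _ _ e =
  refl , *-cancelˡ-≡ p q 2 (+-cancelʳ-≡ 1 (2 * p) (2 * q) e)
parity p q (suc (suc z)) z′ (s≤s ()) _ e
parity p q z (suc (suc z′)) _ (s≤s ()) e

-- The differences `a − b` and `c − d` are the values of one row on the two halves of a vector. The
-- first reading is their sum plus the bit `z`, the second their difference; adding the readings
-- gives `2 (a − b) + z`, whose parity reveals `z`, and then the two halves separate.
split-pair : ∀ a b c d a′ b′ c′ d′ z z′ → z ≤ 1 → z′ ≤ 1 →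
  (a + (c + z)) + (b′ + (d′ + 0)) ≡ (a′ + (c′ + z′)) + (b + (d + 0)) →
  (a + d) + (b′ + c′) ≡ (a′ + d′) + (b + c) →
  z ≡ z′ × (a + b′ ≡ a′ + b) × (c + d′ ≡ c′ + d)
split-pair a b c d a′ b′ c′ d′ z z′ z≤ z′≤ e₁ e₂ =
  proj₁ par , proj₂ par , +-cancelˡ-≡ (a + b′ + z) (c + d′) (c′ + d) (begin
    a + b′ + z + (c + d′) ≡⟨ solve 5 (λ a b c d z → a :+ b :+ z :+ (c :+ d) := (a :+ (c :+ z)) :+ (b :+ (d :+ con 0))) refl a b′ c d′ z ⟩
    (a + (c + z)) + (b′ + (d′ + 0)) ≡⟨ e₁ ⟩
    (a′ + (c′ + z′)) + (b + (d + 0)) ≡⟨ solve 5 (λ a b c d z → (a :+ (c :+ z)) :+ (b :+ (d :+ con 0)) := a :+ b :+ z :+ (c :+ d)) refl a′ b c′ d z′ ⟩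
    a′ + b + z′ + (c′ + d) ≡⟨ cong₂ (λ u v → u + v + (c′ + d)) (sym (proj₂ par)) (sym (proj₁ par)) ⟩
    a + b′ + z + (c′ + d) ∎)
  where
  open ≡-Reasoning
  par : z ≡ z′ × a + b′ ≡ a′ + b
  par = parity (a + b′) (a′ + b) z z′ z≤ z′≤
    (+-cancelʳ-≡ (c + d + c′ + d′) (2 * (a + b′) + z) (2 * (a′ + b) + z′) (begin
      2 * (a + b′) + z + (c + d + c′ + d′)
        ≡⟨ solve 7 (λ a b c d c′ d′ z → con 2 :* (a :+ b) :+ z :+ (c :+ d :+ c′ :+ d′) :=
             ((a :+ (c :+ z)) :+ (b :+ (d′ :+ con 0))) :+ ((a :+ d) :+ (b :+ c′))) refl a b′ c d c′ d′ z ⟩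
      ((a + (c + z)) + (b′ + (d′ + 0))) + ((a + d) + (b′ + c′)) ≡⟨ cong₂ _+_ e₁ e₂ ⟩
      ((a′ + (c′ + z′)) + (b + (d + 0))) + ((a′ + d′) + (b + c))
        ≡⟨ solve 7 (λ a b c d c′ d′ z → ((a :+ (c′ :+ z)) :+ (b :+ (d :+ con 0))) :+ ((a :+ d′) :+ (b :+ c)) :=
             con 2 :* (a :+ b) :+ z :+ (c :+ d :+ c′ :+ d′)) refl a′ b c d c′ d′ z′ ⟩
      2 * (a′ + b) + z′ + (c + d + c′ + d′) ∎))

module _ (x x′ : ℕ → ℕ) (N : ℕ) (b : ∀ i → x i ≤ 1) (b′ : ∀ i → x′ i ≤ 1) where

  private
    y  = shift N x
    y′ = shift N x′
    z  = shift N y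
    z′ = shift N y′

  doubleRows-Same : ∀ m j rs → j + length rs ≤ m → All (λ r → length r ≡ N) rs →
    All (Same x x′) (doubleRows m j rs) →
    All (Same x x′) rs × All (Same y y′) rs × (∀ i → i < length rs → z (j + i) ≡ z′ (j + i))
  doubleRows-Same m j [] _ [] [] = [] , [] , λ i ()
  doubleRows-Same m j (r ∷ rs) j≤ (refl ∷ ls) (e₁ ∷ e₂ ∷ es)
    with doubleRows-Same m (suc j) rs (subst (_≤ m) (+-suc j (length rs)) j≤) ls es
  ... | xs , ys , zs = (proj₁ (proj₂ sp) ∷ xs) , (proj₂ (proj₂ sp) ∷ ys) , λ where
      zero    _       → subst (λ m → z m ≡ z′ m) (sym (+-identityʳ j)) (proj₁ sp)
      (suc i) (s≤s p) → subst (λ m → z m ≡ z′ m) (sym (+-suc j i)) (zs i p)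
    where
    j<m : j < m
    j<m = ≤-trans (s≤s (m≤m+n j (length rs))) (subst (_≤ m) (+-suc j (length rs)) j≤)
    P₁ : ∀ u → plus (r ++ r ++ unit m j) u ≡ plus r u + (plus r (shift N u) + shift N (shift N u) j)
    P₁ u = trans (plus-++ r (r ++ unit m j) u) (cong (plus r u +_)
             (trans (plus-++ r (unit m j) (shift N u)) (cong (plus r (shift N u) +_) (plus-unit m j _ j<m))))
    M₁ : ∀ u → minus (r ++ r ++ unit m j) u ≡ minus r u + (minus r (shift N u) + 0)
    M₁ u = trans (minus-++ r (r ++ unit m j) u) (cong (minus r u +_)
             (trans (minus-++ r (unit m j) (shift N u)) (cong (minus r (shift N u) +_) (minus-unit m j _))))
    P₂ : ∀ u → plus (r ++ mapᴸ opp r ++ replicate m nil) u ≡ plus r u + minus r (shift N u)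
    P₂ u = trans (plus-++ r (mapᴸ opp r ++ replicate m nil) u) (cong (plus r u +_)
             (trans (plus-++ (mapᴸ opp r) (replicate m nil) (shift N u))
               (trans (cong₂ _+_ (plus-opp r (shift N u)) (plus-nil m _)) (+-identityʳ _))))
    M₂ : ∀ u → minus (r ++ mapᴸ opp r ++ replicate m nil) u ≡ minus r u + plus r (shift N u)
    M₂ u = trans (minus-++ r (mapᴸ opp r ++ replicate m nil) u) (cong (minus r u +_)
             (trans (minus-++ (mapᴸ opp r) (replicate m nil) (shift N u))
               (trans (cong₂ _+_ (minus-opp r (shift N u)) (minus-nil m _)) (+-identityʳ _))))
    zb : ∀ i → z i ≤ 1
    zb i = subst (_≤ 1) (sym (trans (shift-at N y i) (shift-at N x (N + i)))) (b (N + (N + i)))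
    zb′ : ∀ i → z′ i ≤ 1
    zb′ i = subst (_≤ 1) (sym (trans (shift-at N y′ i) (shift-at N x′ (N + i)))) (b′ (N + (N + i)))
    sp = split-pair (plus r x) (minus r x) (plus r y) (minus r y)
                    (plus r x′) (minus r x′) (plus r y′) (minus r y′) (z j) (z′ j) (zb j) (zb′ j)
           (trans (sym (cong₂ _+_ (P₁ x) (M₁ x′))) (trans e₁ (cong₂ _+_ (P₁ x′) (M₁ x))))
           (trans (sym (cong₂ _+_ (P₂ x) (M₂ x′))) (trans e₂ (cong₂ _+_ (P₂ x′) (M₂ x))))

-- A position lies in the first copy of `D`, in the second copy, or in the identity block. The
-- copies go by induction; the identity block is settled by the parity argument.
rows-detect : ∀ k x x′ → (∀ i → x i ≤ 1) → (∀ i → x′ i ≤ 1) → All (Same x x′) (rows k) →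
              ∀ i → i < capacity k → x i ≡ x′ i
rows-detect zero x x′ b b′ (e ∷ []) zero _ =
  trans (sym (trans (+-identityʳ _) (+-identityʳ _))) (trans e (trans (+-identityʳ _) (+-identityʳ _)))
rows-detect zero x x′ b b′ es (suc i) (s≤s ())
rows-detect (suc k) x x′ b b′ es i i<
  with doubleRows-Same x x′ (capacity k) b b′ (2 ^ k) 0 (rows k) (≤-reflexive (length-rows k)) (rows-lengths k) es
... | xs , ys , zs with i <? capacity k
...   | yes p = rows-detect k x x′ b b′ xs i p
...   | no ¬p with i ∸ capacity k <? capacity k
...     | yes q = begin
            x i                       ≡⟨ cong x (sym i≡) ⟩
            x (N + (i ∸ N))           ≡⟨ sym (shift-at N x (i ∸ N)) ⟩
            shift N x (i ∸ N)         ≡⟨ rows-detect k (shift N x) (shift N x′) (bs x b) (bs x′ b′) ys (i ∸ N) q ⟩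
            shift N x′ (i ∸ N)        ≡⟨ shift-at N x′ (i ∸ N) ⟩
            x′ (N + (i ∸ N))          ≡⟨ cong x′ i≡ ⟩
            x′ i ∎
  where
  open ≡-Reasoning
  N = capacity k
  i≡ : N + (i ∸ N) ≡ i
  i≡ = m+[n∸m]≡n (≮⇒≥ ¬p)
  bs : ∀ u → (∀ i → u i ≤ 1) → ∀ i → shift N u i ≤ 1
  bs u h i = subst (_≤ 1) (sym (shift-at N u i)) (h (N + i))
...     | no ¬q = begin
            x i                               ≡⟨ cong x (sym i≡) ⟩
            x (N + (N + i′))                  ≡⟨ sym (at₂ x) ⟩
            shift N (shift N x) i′            ≡⟨ zs i′ i′< ⟩
            shift N (shift N x′) i′           ≡⟨ at₂ x′ ⟩
            x′ (N + (N + i′))                 ≡⟨ cong x′ i≡ ⟩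
            x′ i ∎
  where
  open ≡-Reasoning
  N = capacity k
  i′ = i ∸ N ∸ N
  i≡ : N + (N + i′) ≡ i
  i≡ = trans (cong (N +_) (m+[n∸m]≡n (≮⇒≥ ¬q))) (m+[n∸m]≡n (≮⇒≥ ¬p))
  i′< : i′ < length (rows k)
  i′< = subst (i′ <_) (sym (length-rows k))
    (+-cancelˡ-< N i′ (2 ^ k) (+-cancelˡ-< N (N + i′) (N + 2 ^ k) (subst (_< N + (N + 2 ^ k)) (sym i≡) i<)))
  at₂ : ∀ u → shift N (shift N u) i′ ≡ u (N + (N + i′))
  at₂ u = trans (shift-at N (shift N u) i′) (shift-at N u (N + i′))

at : List ℕ → ℕ → ℕ
at []       i       = 0
at (x ∷ xs) zero    = x
at (x ∷ xs) (suc i) = at xs i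

allBits : ℕ → List (List ℕ)
allBits zero    = [] ∷ []
allBits (suc m) = mapᴸ (0 ∷_) (allBits m) ++ mapᴸ (1 ∷_) (allBits m)

∈-allBits : ∀ {xs} → All (_≤ 1) xs → xs ∈ allBits (length xs)
∈-allBits [] = here refl
∈-allBits {zero ∷ xs} (_ ∷ bs) = ∈-++⁺ˡ (∈-map⁺ (0 ∷_) (∈-allBits bs))
∈-allBits {suc zero ∷ xs} (_ ∷ bs) = ∈-++⁺ʳ (mapᴸ (0 ∷_) (allBits (length xs))) (∈-map⁺ (1 ∷_) (∈-allBits bs))
∈-allBits {suc (suc x) ∷ xs} (s≤s () ∷ bs)

search : {A : Set} → (A → Bool) → A → List A → A
search p d []       = d
search p d (x ∷ xs) = if p x then x else search p d xs

search-∈ : {A : Set} (p : A → Bool) (d : A) {x : A} {xs : List A} → x ∈ xs → p x ≡ true →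
           p (search p d xs) ≡ true × search p d xs ∈ xs
search-∈ p d {x} {y ∷ xs} i e with p y in py
... | true = py , here refl
search-∈ p d (here refl) e | false with trans (sym e) py
... | ()
search-∈ p d (there i) e | false with search-∈ p d i e
... | q , j = q , there j

allBits-bits : ∀ m {xs} → xs ∈ allBits m → All (_≤ 1) xs × length xs ≡ m
allBits-bits zero (here refl) = [] , refl
allBits-bits (suc m) i with ∈-++⁻ (mapᴸ (0 ∷_) (allBits m)) i
... | inj₁ j with ∈-map⁻ (0 ∷_) j
...   | ys , j′ , refl = let bs , l = allBits-bits m j′ in (z≤n ∷ bs) , cong suc l
allBits-bits (suc m) i | inj₂ j with ∈-map⁻ (1 ∷_) j
...   | ys , j′ , refl = let bs , l = allBits-bits m j′ in (≤-refl ∷ bs) , cong suc l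

at-≤1 : ∀ {xs} → All (_≤ 1) xs → ∀ i → at xs i ≤ 1
at-≤1 []       i       = z≤n
at-≤1 (b ∷ bs) zero    = b
at-≤1 (b ∷ bs) (suc i) = at-≤1 bs i

at-ext : ∀ xs ys → length xs ≡ length ys → (∀ i → i < length xs → at xs i ≡ at ys i) → xs ≡ ys
at-ext [] [] _ _ = refl
at-ext (x ∷ xs) (y ∷ ys) l h =
  cong₂ _∷_ (h 0 (s≤s z≤n)) (at-ext xs ys (suc-injective l) (λ i p → h (suc i) (s≤s p)))

matches : List (List Sign) → List (ℕ × ℕ) → List ℕ → Bool
matches []       as             ys = true
matches (r ∷ rs) []             ys = true
matches (r ∷ rs) ((p , q) ∷ as) ys = (plus r (at ys) ≡ᵇ p) ∧ ((minus r (at ys) ≡ᵇ q) ∧ matches rs as ys)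

readings : List (List Sign) → List ℕ → List (ℕ × ℕ)
readings rs ys = mapᴸ (λ r → plus r (at ys) , minus r (at ys)) rs

≡ᵇ-refl : ∀ m → (m ≡ᵇ m) ≡ true
≡ᵇ-refl zero    = refl
≡ᵇ-refl (suc m) = ≡ᵇ-refl m

≡ᵇ-true : ∀ m n → (m ≡ᵇ n) ≡ true → m ≡ n
≡ᵇ-true zero    zero    _ = refl
≡ᵇ-true (suc m) (suc n) e = cong suc (≡ᵇ-true m n e)

matches-self : ∀ rs ys → matches rs (readings rs ys) ys ≡ true
matches-self []       ys = refl
matches-self (r ∷ rs) ys = ∧-intro (≡ᵇ-refl (plus r (at ys))) (∧-intro (≡ᵇ-refl (minus r (at ys))) (matches-self rs ys))

matches-Same : ∀ rs xs ys → matches rs (readings rs xs) ys ≡ true → All (Same (at ys) (at xs)) rs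
matches-Same []       xs ys e = []
matches-Same (r ∷ rs) xs ys e with ∧-true {plus r (at ys) ≡ᵇ plus r (at xs)} e
... | e₁ , e′ with ∧-true {minus r (at ys) ≡ᵇ minus r (at xs)} e′
...   | e₂ , e₃ = cong₂ _+_ (≡ᵇ-true (plus r (at ys)) _ e₁) (sym (≡ᵇ-true (minus r (at ys)) _ e₂)) ∷ matches-Same rs xs ys e₃

-- Exhaustive search, since only queries are counted. By `rows-detect`, the 0/1 vector that it finds
-- is the only one with these readings.
decode : ℕ → ℕ → List (ℕ × ℕ) → List ℕ
decode k m as = search (matches (rows k) as) [] (allBits m)

decode-correct : ∀ k xs → All (_≤ 1) xs → length xs ≤ capacity k →
                 decode k (length xs) (readings (rows k) xs) ≡ xs
decode-correct k xs bs le = at-ext ys xs ly (λ i p → rows-detect k (at ys) (at xs) (at-≤1 (proj₁ yb)) (at-≤1 bs)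
    (matches-Same (rows k) xs ys (proj₁ found)) i (≤-trans p (≤-trans (≤-reflexive ly) le)))
  where
  ys = decode k (length xs) (readings (rows k) xs)
  found = search-∈ (matches (rows k) (readings (rows k) xs)) [] (∈-allBits bs) (matches-self (rows k) xs)
  yb = allBits-bits (length xs) (proj₂ found)
  ly = proj₂ yb

plusItems minusItems : {A : Set} → List Sign → List A → List A
plusItems []        xs       = []
plusItems (_ ∷ r)   []       = []
plusItems (pos ∷ r) (x ∷ xs) = x ∷ plusItems r xs
plusItems (neg ∷ r) (x ∷ xs) = plusItems r xs
plusItems (nil ∷ r) (x ∷ xs) = plusItems r xs
minusItems r = plusItems (mapᴸ opp r)

plus-at[] : ∀ r → plus r (at []) ≡ 0
plus-at[] []        = refl
plus-at[] (pos ∷ r) = plus-at[] r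
plus-at[] (neg ∷ r) = plus-at[] r
plus-at[] (nil ∷ r) = plus-at[] r

module _ {A : Set} where

  sum-plusItems : ∀ (f : A → ℕ) r xs → sumᴸ (mapᴸ f (plusItems r xs)) ≡ plus r (at (mapᴸ f xs))
  sum-plusItems f []        xs       = refl
  sum-plusItems f (s ∷ r)   []       = sym (plus-at[] (s ∷ r))
  sum-plusItems f (pos ∷ r) (x ∷ xs) = cong (f x +_) (sum-plusItems f r xs)
  sum-plusItems f (neg ∷ r) (x ∷ xs) = sum-plusItems f r xs
  sum-plusItems f (nil ∷ r) (x ∷ xs) = sum-plusItems f r xs

  sum-minusItems : ∀ (f : A → ℕ) r xs → sumᴸ (mapᴸ f (minusItems r xs)) ≡ minus r (at (mapᴸ f xs))
  sum-minusItems f r xs = trans (sum-plusItems f (mapᴸ opp r) xs) (plus-opp r (at (mapᴸ f xs)))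

  All-plusItems : ∀ {P : A → Set} r {xs} → All P xs → All P (plusItems r xs)
  All-plusItems []        ps       = []
  All-plusItems (_ ∷ r)   []       = []
  All-plusItems (pos ∷ r) (p ∷ ps) = p ∷ All-plusItems r ps
  All-plusItems (neg ∷ r) (p ∷ ps) = All-plusItems r ps
  All-plusItems (nil ∷ r) (p ∷ ps) = All-plusItems r ps

  Unique-plusItems : ∀ r {xs : List A} → Unique xs → Unique (plusItems r xs)
  Unique-plusItems []        us       = []
  Unique-plusItems (_ ∷ r)   []       = []
  Unique-plusItems (pos ∷ r) (u ∷ us) = All-plusItems r u ∷ Unique-plusItems r us
  Unique-plusItems (neg ∷ r) (u ∷ us) = Unique-plusItems r us
  Unique-plusItems (nil ∷ r) (u ∷ us) = Unique-plusItems r us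

  All-take : ∀ {P : A → Set} m {xs} → All P xs → All P (take m xs)
  All-take zero    ps       = []
  All-take (suc m) []       = []
  All-take (suc m) (p ∷ ps) = p ∷ All-take m ps

  All-drop : ∀ {P : A → Set} m {xs} → All P xs → All P (drop m xs)
  All-drop zero    ps       = ps
  All-drop (suc m) []       = []
  All-drop (suc m) (p ∷ ps) = All-drop m ps

  Unique-take : ∀ m {xs : List A} → Unique xs → Unique (take m xs)
  Unique-take zero    us       = []
  Unique-take (suc m) []       = []
  Unique-take (suc m) (u ∷ us) = All-take m u ∷ Unique-take m us

  Unique-drop : ∀ m {xs : List A} → Unique xs → Unique (drop m xs)
  Unique-drop zero    us       = us
  Unique-drop (suc m) []       = []
  Unique-drop (suc m) (u ∷ us) = Unique-drop m us

-- The answer to a list is meant to be the sum of an unknown 0/1 function over it, which is what a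
-- weighing of coins returns.
Oracle : ℕ → Set
Oracle n = List (Fin n) → DT n ℕ

readAll : ∀ {n} → Oracle n → List (List Sign) → List (Fin n) → DT n (List (ℕ × ℕ))
readAll o []       xs = ret []
readAll o (r ∷ rs) xs = o (plusItems r xs) >>= λ p → o (minusItems r xs) >>= λ q →
                        readAll o rs xs >>= λ as → ret ((p , q) ∷ as)

block : ∀ {n} → ℕ → Oracle n → List (Fin n) → DT n (List ℕ)
block k o xs = readAll o (rows k) xs >>= λ as → ret (decode k (length xs) as)

blocks : ∀ {n} → ℕ → ℕ → Oracle n → List (Fin n) → DT n (List ℕ)
blocks zero    k o xs = ret []
blocks (suc t) k o xs =
  if length xs ≤ᵇ capacity k then block k o xs else
  (block k o (take (capacity k) xs) >>= λ ys → blocks t k o (drop (capacity k) xs) >>= λ zs → ret (ys ++ zs))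

oneByOne : ∀ {n} → Oracle n → List (Fin n) → DT n (List ℕ)
oneByOne o []       = ret []
oneByOne o (x ∷ xs) = o (x ∷ []) >>= λ y → oneByOne o xs >>= λ ys → ret (y ∷ ys)

assoc : ∀ {n} → List (Fin n) → List ℕ → Fin n → ℕ
assoc []       ys       v = 0
assoc (x ∷ xs) []       v = 0
assoc (x ∷ xs) (y ∷ ys) v = if v == x then y else assoc xs ys v

assoc-map : ∀ {n} (f : Fin n → ℕ) xs {v} → v ∈ xs → assoc xs (mapᴸ f xs) v ≡ f v
assoc-map f (x ∷ xs) {v} i with v ≟ᶠ x
... | yes refl = refl
assoc-map f (x ∷ xs) (here e)  | no ne = ⊥-elim (ne e)
assoc-map f (x ∷ xs) (there i) | no ne = assoc-map f xs i

-- A block costs `6 · 2 ^ k` queries however few items it holds. Short lists are therefore read one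
-- by one, which keeps their cost linear in their length.
weigh : ∀ {n} → ℕ → Oracle n → List (Fin n) → DT n (Fin n → ℕ)
weigh k o xs = (if length xs <ᵇ capacity k then oneByOne o xs else blocks (length xs) k o xs) >>= λ ys →
               ret (assoc xs ys)

if-true : ∀ {A : Set} {b} {x y : A} → b ≡ true → (if b then x else y) ≡ x
if-true refl = refl

if-false : ∀ {A : Set} {b} {x y : A} → b ≡ false → (if b then x else y) ≡ y
if-false refl = refl

≤ᵇ-true : ∀ {m n} → (m ≤ᵇ n) ≡ true → m ≤ n
≤ᵇ-true {m} {n} e = ≤ᵇ⇒≤ m n (subst Tᴮ (sym e) tt)

≤ᵇ-intro : ∀ {m n} → m ≤ n → (m ≤ᵇ n) ≡ true
≤ᵇ-intro {m} {n} p with m ≤ᵇ n | ≤⇒≤ᵇ p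
... | true | _ = refl

≤ᵇ-false : ∀ {m n} → (m ≤ᵇ n) ≡ false → n < m
≤ᵇ-false e = ≰⇒> (λ p → true≢false (trans (sym (≤ᵇ-intro p)) e))

<ᵇ-true : ∀ {m n} → (m <ᵇ n) ≡ true → m < n
<ᵇ-true {m} {n} e = <ᵇ⇒< m n (subst Tᴮ (sym e) tt)

<ᵇ-intro : ∀ {m n} → m < n → (m <ᵇ n) ≡ true
<ᵇ-intro {m} {n} p with m <ᵇ n | <⇒<ᵇ p
... | true | _ = refl

<ᵇ-false : ∀ {m n} → (m <ᵇ n) ≡ false → n ≤ m
<ᵇ-false e = ≮⇒≥ (λ p → true≢false (trans (sym (<ᵇ-intro p)) e))

capacity-pos : ∀ k → 1 ≤ capacity k
capacity-pos zero    = ≤-refl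
capacity-pos (suc k) = ≤-trans (capacity-pos k) (m≤m+n _ _)

-- The cost multiplied by `k + 2`: an amortized `24 / (k + 2)` for each item, and 3 for each item of
-- a short list.
weighCost : ℕ → ℕ → ℕ
weighCost k m = 24 * m + (k + 2) * (3 * (⟦ m <ᵇ capacity k ⟧ * m))

module _ {n : ℕ} (G : Graph n) (k : ℕ) (o : Oracle n) where

  module _ (P : Fin n → Set) (f : Fin n → ℕ) (f≤1 : ∀ {v} → P v → f v ≤ 1)
           (spec : ∀ xs → Unique xs → All P xs → run G (o xs) ≡ sumᴸ (mapᴸ f xs)) where

    run-readAll : ∀ rs xs → Unique xs → All P xs → run G (readAll o rs xs) ≡ readings rs (mapᴸ f xs)
    run-readAll []       xs us ps = refl
    run-readAll (r ∷ rs) xs us ps =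
      trans (run->>= G (o (plusItems r xs)) _)
        (trans (run->>= G (o (minusItems r xs)) _)
          (trans (run->>= G (readAll o rs xs) _)
            (cong₂ _∷_ (cong₂ _,_
              (trans (spec _ (Unique-plusItems r us) (All-plusItems r ps)) (sum-plusItems f r xs))
              (trans (spec _ (Unique-plusItems (mapᴸ opp r) us) (All-plusItems (mapᴸ opp r) ps)) (sum-minusItems f r xs)))
              (run-readAll rs xs us ps))))

    bits-map : ∀ {xs} → All P xs → All (_≤ 1) (mapᴸ f xs)
    bits-map []       = []
    bits-map (p ∷ ps) = f≤1 p ∷ bits-map ps

    run-block : ∀ xs → Unique xs → All P xs → length xs ≤ capacity k → run G (block k o xs) ≡ mapᴸ f xs
    run-block xs us ps le =
      trans (run->>= G (readAll o (rows k) xs) _)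
        (trans (cong₂ (decode k) (sym (length-map f xs)) (run-readAll (rows k) xs us ps))
          (decode-correct k (mapᴸ f xs) (bits-map ps) (≤-trans (≤-reflexive (length-map f xs)) le)))

    run-blocks : ∀ t xs → Unique xs → All P xs → length xs ≤ t → run G (blocks t k o xs) ≡ mapᴸ f xs
    run-blocks zero    []       us ps le = refl
    run-blocks (suc t) xs us ps le with length xs ≤ᵇ capacity k in e
    ... | true  = run-block xs us ps (≤ᵇ-true e)
    ... | false = begin
      run G (block k o hd >>= λ ys → blocks t k o tl >>= λ zs → ret (ys ++ zs))
        ≡⟨ trans (run->>= G (block k o hd) _) (run->>= G (blocks t k o tl) _) ⟩
      run G (block k o hd) ++ run G (blocks t k o tl)
        ≡⟨ cong₂ _++_ (run-block hd (Unique-take N us) (All-take N ps) (≤-trans (≤-reflexive (length-take N xs)) (m⊓n≤m N _)))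
             (run-blocks t tl (Unique-drop N us) (All-drop N ps)
               (≤-trans (≤-reflexive (length-drop N xs))
                 (s≤s⁻¹ (≤-trans (∸-monoʳ-< (capacity-pos k) (<⇒≤ (≤ᵇ-false {length xs} e))) le)))) ⟩
      mapᴸ f hd ++ mapᴸ f tl ≡⟨ sym (map-++ f hd tl) ⟩
      mapᴸ f (hd ++ tl)      ≡⟨ cong (mapᴸ f) (take++drop≡id N xs) ⟩
      mapᴸ f xs ∎
      where
      open ≡-Reasoning
      N = capacity k
      hd = take N xs
      tl = drop N xs

    run-oneByOne : ∀ xs → Unique xs → All P xs → run G (oneByOne o xs) ≡ mapᴸ f xs
    run-oneByOne []       us ps = refl
    run-oneByOne (x ∷ xs) (u ∷ us) (p ∷ ps) =
      trans (run->>= G (o (x ∷ [])) _) (trans (run->>= G (oneByOne o xs) _)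
        (cong₂ _∷_ (trans (spec (x ∷ []) ([] ∷ []) (p ∷ [])) (+-identityʳ (f x))) (run-oneByOne xs us ps)))

    run-weigh : ∀ xs → Unique xs → All P xs → ∀ {v} → v ∈ xs → run G (weigh k o xs) v ≡ f v
    run-weigh xs us ps {v} i = trans (cong (λ g → g v) (run->>= G (if length xs <ᵇ capacity k then oneByOne o xs else blocks (length xs) k o xs) (λ ys → ret (assoc xs ys))))
      (trans (cong (λ ys → assoc xs ys v) (aux (length xs <ᵇ capacity k))) (assoc-map f xs i))
      where
      aux : ∀ b → run G (if b then oneByOne o xs else blocks (length xs) k o xs) ≡ mapᴸ f xs
      aux true  = run-oneByOne xs us ps
      aux false = run-blocks (length xs) xs us ps ≤-refl

  module _ (cost-o : ∀ xs → cost G (o xs) ≡ 3) where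

    cost-readAll : ∀ rs xs → cost G (readAll o rs xs) ≡ 6 * length rs
    cost-readAll []       xs = refl
    cost-readAll (r ∷ rs) xs =
      trans (cost->>= G (o (plusItems r xs)) _)
        (trans (cong₂ _+_ (cost-o (plusItems r xs)) (trans (cost->>= G (o (minusItems r xs)) _)
          (cong₂ _+_ (cost-o (minusItems r xs)) (trans (cost->>= G (readAll o rs xs) _)
            (trans (+-identityʳ _) (cost-readAll rs xs)))))) (sym (*-suc 6 (length rs))))

    cost-block : ∀ xs → cost G (block k o xs) ≡ 6 * 2 ^ k
    cost-block xs = trans (cost->>= G (readAll o (rows k) xs) _) (trans (+-identityʳ _)
                      (trans (cost-readAll (rows k) xs) (cong (6 *_) (length-rows k))))

    cost-blocks : ∀ t xs → cost G (blocks t k o xs) * capacity k ≤ 6 * 2 ^ k * (length xs + capacity k)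
    cost-blocks zero    xs = z≤n
    cost-blocks (suc t) xs with length xs ≤ᵇ capacity k in e
    ... | true = begin
      cost G (block k o xs) * N ≡⟨ cong (_* N) (cost-block xs) ⟩
      6 * 2 ^ k * N             ≤⟨ *-monoʳ-≤ (6 * 2 ^ k) (m≤n+m N (length xs)) ⟩
      6 * 2 ^ k * (length xs + N) ∎
      where
      open ≤-Reasoning
      N = capacity k
    ... | false = begin
      cost G (block k o hd >>= λ ys → blocks t k o tl >>= λ zs → ret (ys ++ zs)) * N
        ≡⟨ cong (_* N) (trans (cost->>= G (block k o hd) _)
             (cong₂ _+_ (cost-block hd) (trans (cost->>= G (blocks t k o tl) _) (+-identityʳ _)))) ⟩
      (6 * 2 ^ k + cost G (blocks t k o tl)) * N
        ≡⟨ *-distribʳ-+ N (6 * 2 ^ k) _ ⟩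
      6 * 2 ^ k * N + cost G (blocks t k o tl) * N
        ≤⟨ +-monoʳ-≤ (6 * 2 ^ k * N) (cost-blocks t tl) ⟩
      6 * 2 ^ k * N + 6 * 2 ^ k * (length tl + N)
        ≡⟨ sym (*-distribˡ-+ (6 * 2 ^ k) N _) ⟩
      6 * 2 ^ k * (N + (length tl + N))
        ≡⟨ cong (6 * 2 ^ k *_) (trans (sym (+-assoc N (length tl) N)) (cong (_+ N)
             (trans (cong (N +_) (length-drop N xs)) (m+[n∸m]≡n (<⇒≤ (≤ᵇ-false {length xs} e)))))) ⟩
      6 * 2 ^ k * (length xs + N) ∎
      where
      open ≤-Reasoning
      N = capacity k
      hd = take N xs
      tl = drop N xs

    cost-oneByOne : ∀ xs → cost G (oneByOne o xs) ≡ 3 * length xs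
    cost-oneByOne []       = refl
    cost-oneByOne (x ∷ xs) =
      trans (cost->>= G (o (x ∷ [])) _)
        (trans (cong₂ _+_ (cost-o (x ∷ [])) (trans (cost->>= G (oneByOne o xs) _)
          (trans (+-identityʳ _) (cost-oneByOne xs)))) (sym (*-suc 3 (length xs))))

    cost-weigh : ∀ xs → (k + 2) * cost G (weigh k o xs) ≤ weighCost k (length xs)
    cost-weigh xs with length xs <ᵇ capacity k in e
    ... | true = begin
      (k + 2) * cost G (oneByOne o xs >>= λ ys → ret (assoc xs ys))
        ≡⟨ cong ((k + 2) *_) (trans (cost->>= G (oneByOne o xs) _) (trans (+-identityʳ _) (cost-oneByOne xs))) ⟩
      (k + 2) * (3 * length xs)
        ≡⟨ cong (λ z → (k + 2) * (3 * z)) (sym (*-identityˡ (length xs))) ⟩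
      (k + 2) * (3 * (1 * length xs))
        ≤⟨ m≤n+m _ (24 * length xs) ⟩
      24 * length xs + (k + 2) * (3 * (1 * length xs)) ∎
      where open ≤-Reasoning
    ... | false = ≤-trans (*-cancelʳ-≤ ((k + 2) * c) (24 * length xs) (2 ^ k) (begin
      (k + 2) * c * 2 ^ k          ≡⟨ solve 3 (λ a c p → a :* c :* p := c :* (a :* p)) refl (k + 2) c (2 ^ k) ⟩
      c * ((k + 2) * 2 ^ k)        ≡⟨ cong (c *_) (sym (capacity-closed k)) ⟩
      c * (2 * N)                  ≡⟨ solve 2 (λ c N → c :* (con 2 :* N) := con 2 :* (c :* N)) refl c N ⟩
      2 * (c * N)                  ≡⟨ cong (λ z → 2 * (z * N)) (trans (cost->>= G (blocks (length xs) k o xs) _) (+-identityʳ _)) ⟩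
      2 * (cost G (blocks (length xs) k o xs) * N)
                                   ≤⟨ *-monoʳ-≤ 2 (cost-blocks (length xs) xs) ⟩
      -- The last block may be nearly empty. It is charged to the others by `N ≤ length xs`, which
      -- doubles the constant from 12 to 24.
      2 * (6 * 2 ^ k * (length xs + N))
                                   ≤⟨ *-monoʳ-≤ 2 (*-monoʳ-≤ (6 * 2 ^ k) (+-monoʳ-≤ (length xs) (<ᵇ-false {length xs} e))) ⟩
      2 * (6 * 2 ^ k * (length xs + length xs))
                                   ≡⟨ solve 2 (λ p l → con 2 :* (con 6 :* p :* (l :+ l)) := con 24 :* l :* p) refl (2 ^ k) (length xs) ⟩
      24 * length xs * 2 ^ k ∎)) (m≤m+n (24 * length xs) _)
      where
      open ≤-Reasoning
      N = capacity k
      c = cost G (blocks (length xs) k o xs >>= λ ys → ret (assoc xs ys))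
      instance 2^k≢0 = m^n≢0 2 k

-- Binary digits

odd : ℕ → Bool
odd zero          = false
odd (suc zero)    = true
odd (suc (suc m)) = odd m

odd-half : ∀ m → ⟦ odd m ⟧ + 2 * ⌊ m /2⌋ ≡ m
odd-half zero          = refl
odd-half (suc zero)    = refl
odd-half (suc (suc m)) = begin
  ⟦ odd m ⟧ + 2 * suc ⌊ m /2⌋     ≡⟨ solve 2 (λ o h → o :+ con 2 :* (con 1 :+ h) := con 2 :+ (o :+ con 2 :* h)) refl ⟦ odd m ⟧ ⌊ m /2⌋ ⟩
  2 + (⟦ odd m ⟧ + 2 * ⌊ m /2⌋)   ≡⟨ cong (2 +_) (odd-half m) ⟩
  2 + m ∎
  where open ≡-Reasoning

digit : ∀ {L} → Fin L → ℕ → Bool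
digit zero    m = odd m
digit (suc i) m = digit i ⌊ m /2⌋

undigits : ∀ {L} → (Fin L → ℕ) → ℕ
undigits {zero}  d = 0
undigits {suc L} d = d zero + 2 * undigits (λ i → d (suc i))

undigits-cong : ∀ {L} {d e : Fin L → ℕ} → (∀ i → d i ≡ e i) → undigits d ≡ undigits e
undigits-cong {zero}  h = refl
undigits-cong {suc L} h = cong₂ (λ a b → a + 2 * b) (h zero) (undigits-cong (λ i → h (suc i)))

undigits-digit : ∀ L m → m < 2 ^ L → undigits {L} (λ i → ⟦ digit i m ⟧) ≡ m
undigits-digit zero    zero    p = refl
undigits-digit zero    (suc m) (s≤s ())
undigits-digit (suc L) m p = trans (cong (λ z → ⟦ odd m ⟧ + 2 * z) (undigits-digit L ⌊ m /2⌋ half<)) (odd-half m)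
  where
  half< : ⌊ m /2⌋ < 2 ^ L
  half< = *-cancelˡ-< 2 ⌊ m /2⌋ (2 ^ L) (≤-trans (s≤s (≤-trans (m≤n+m (2 * ⌊ m /2⌋) ⟦ odd m ⟧) (≤-reflexive (odd-half m)))) p)

-- up d is the least j with d ≤ 2 ^ j.
up : ℕ → ℕ
up zero    = 0
up (suc d) = if suc d ≤ᵇ 2 ^ up d then up d else suc (up d)

up-≤ : ∀ d → d ≤ 2 ^ up d
up-< : ∀ d → 1 ≤ d → 2 ^ up d < 2 * d

up-≤ zero = z≤n
up-≤ (suc d) with suc d ≤ᵇ 2 ^ up d in e
... | true  = ≤ᵇ-true e
... | false = ≤-trans (+-mono-≤ (m^n>0 2 (up d)) (up-≤ d)) (≤-reflexive (cong (2 ^ up d +_) (sym (+-identityʳ _))))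

up-< (suc d) p with suc d ≤ᵇ 2 ^ up d in e
up-< (suc zero)    p | true = s≤s (s≤s z≤n)
up-< (suc (suc d)) p | true = <-trans (up-< (suc d) (s≤s z≤n)) (*-monoʳ-< 2 (n<1+n (suc d)))
... | false = *-monoʳ-< 2 (≤ᵇ-false {suc d} {2 ^ up d} e)

-- A rate 2 ^ (− level d) between 1 / 4 d and 1 / 2 d.
level : ℕ → ℕ
level d = suc (up d)

level-≥ : ∀ d → 2 * d ≤ 2 ^ level d
level-≥ d = *-monoʳ-≤ 2 (up-≤ d)

level-≤ : ∀ d → 1 ≤ d → 2 ^ level d ≤ 4 * d
level-≤ d p = ≤-trans (*-monoʳ-≤ 2 (<⇒≤ (up-< d p))) (≤-reflexive (sym (*-assoc 2 2 d)))

clamp : ∀ m → ℕ → Fin (suc m)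
clamp m       zero    = zero
clamp zero    (suc x) = zero
clamp (suc m) (suc x) = suc (clamp m x)

toℕ-clamp : ∀ m x → x ≤ m → toℕ (clamp m x) ≡ x
toℕ-clamp m       zero    p       = refl
toℕ-clamp (suc m) (suc x) (s≤s p) = cong suc (toℕ-clamp m x p)

fromNat? : ∀ {n} → ℕ → Maybe (Fin n)
fromNat? {zero}  m       = nothing
fromNat? {suc n} zero    = just zero
fromNat? {suc n} (suc m) = maybe (just ∘ suc) nothing (fromNat? {n} m)

fromNat?-toℕ : ∀ {n} (w : Fin n) → fromNat? (toℕ w) ≡ just w
fromNat?-toℕ zero    = refl
fromNat?-toℕ (suc w) = cong (maybe (just ∘ suc) nothing) (fromNat?-toℕ w)

-- Vertex sets as lists

_∈ᵇ_ : ∀ {n} → Fin n → List (Fin n) → Bool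
v ∈ᵇ []       = false
v ∈ᵇ (x ∷ xs) = (v == x) ∨ (v ∈ᵇ xs)

∈ᵇ-All : ∀ {n} {P : Fin n → Set} {v} xs → All P xs → (v ∈ᵇ xs) ≡ true → P v
∈ᵇ-All {v = v} (x ∷ xs) (p ∷ ps) e with v ≟ᶠ x
... | yes refl = p
... | no _     = ∈ᵇ-All xs ps e

∈ᵇ-∉ : ∀ {n} (x : Fin n) xs → All (x ≢_) xs → (x ∈ᵇ xs) ≡ false
∈ᵇ-∉ x []       []       = refl
∈ᵇ-∉ x (y ∷ ys) (u ∷ us) rewrite ≢⇒== u = ∈ᵇ-∉ x ys us

∑-∈ᵇ : ∀ {n} (f : Fin n → ℕ) xs → Unique xs → ∑ (λ v → ⟦ v ∈ᵇ xs ⟧ * f v) ≡ sumᴸ (mapᴸ f xs)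
∑-∈ᵇ f []       us = ∑-zero _ (λ _ → refl)
∑-∈ᵇ f (x ∷ xs) (u ∷ us) = begin
  ∑ (λ v → ⟦ (v == x) ∨ (v ∈ᵇ xs) ⟧ * f v)            ≡⟨ ∑-cong (λ v → pw v) ⟩
  ∑ (λ v → ⟦ v == x ⟧ * f v + ⟦ v ∈ᵇ xs ⟧ * f v)      ≡⟨ ∑-+ (λ v → ⟦ v == x ⟧ * f v) _ ⟩
  ∑ (λ v → ⟦ v == x ⟧ * f v) + ∑ (λ v → ⟦ v ∈ᵇ xs ⟧ * f v) ≡⟨ cong₂ _+_ (∑-δ x f) (∑-∈ᵇ f xs us) ⟩
  f x + sumᴸ (mapᴸ f xs) ∎
  where
  open ≡-Reasoning
  pw : ∀ v → ⟦ (v == x) ∨ (v ∈ᵇ xs) ⟧ * f v ≡ ⟦ v == x ⟧ * f v + ⟦ v ∈ᵇ xs ⟧ * f v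
  pw v with v ≟ᶠ x
  ... | yes refl rewrite ∈ᵇ-∉ x xs u = sym (+-identityʳ _)
  ... | no _ = refl

elems : ∀ {n} → VSet n → List (Fin n)
elems {n} U = filter (λ v → U v ≟ᴮ true) (allFinᴸ n)

elems-Unique : ∀ {n} (U : VSet n) → Unique (elems U)
elems-Unique {n} U = Uniqueₚ.filter⁺ (λ v → U v ≟ᴮ true) (Uniqueₚ.allFin⁺ n)

elems-All : ∀ {n} (U : VSet n) → All (λ v → U v ≡ true) (elems U)
elems-All {n} U = tabulateᴬ (λ i → proj₂ (∈-filter⁻ (λ v → U v ≟ᴮ true) {xs = allFinᴸ n} i))

∈-elems : ∀ {n} (U : VSet n) {v} → U v ≡ true → v ∈ elems U
∈-elems U {v} e = ∈-filter⁺ (λ v → U v ≟ᴮ true) (∈-allFin v) e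

opaque
  unfolding ∑

  length-filter-tabulate : ∀ {n m} (U : VSet n) (f : Fin m → Fin n) →
    length (filter (λ v → U v ≟ᴮ true) (tabulateᴸ f)) ≡ ∑ (λ i → ⟦ U (f i) ⟧)
  length-filter-tabulate {m = zero}  U f = refl
  length-filter-tabulate {m = suc m} U f with U (f zero)
  ... | true  = cong suc (length-filter-tabulate U (f ∘ suc))
  ... | false = length-filter-tabulate U (f ∘ suc)

length-elems : ∀ {n} (U : VSet n) → length (elems U) ≡ card U
length-elems {n} U = length-filter-tabulate U (λ i → i)

-- With `P` the test of one binary digit, counting neighbours in `B ∧ P` reads that digit of the
-- only neighbour in `B`.
nb-unique : ∀ {n} (R : Rel₂ n) v (B P : VSet n) {w} → nb R v B ≡ 1 → B w ≡ true → R v w ≡ true →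
            nb R v (λ u → B u ∧ P u) ≡ ⟦ P w ⟧
nb-unique R v B P {w} one Bw Rw = helper (P w) refl
  where
  lower : ∀ Q → Q w ≡ true → 1 ≤ nb R v (λ u → B u ∧ Q u)
  lower Q Qw = ≤-trans (≤-reflexive (sym (cong₂ (λ a b → ⟦ a ⟧ * ⟦ b ⟧) (∧-intro Bw Qw) Rw)))
                 (∑-≥ (λ u → ⟦ B u ∧ Q u ⟧ * ⟦ R v u ⟧) w)
  parts : nb R v (λ u → B u ∧ P u) + nb R v (λ u → B u ∧ not (P u)) ≡ 1
  parts = trans (sym (∑-+ (λ u → ⟦ B u ∧ P u ⟧ * ⟦ R v u ⟧) (λ u → ⟦ B u ∧ not (P u) ⟧ * ⟦ R v u ⟧)))
            (trans (∑-cong (λ u → trans (sym (*-distribʳ-+ ⟦ R v u ⟧ ⟦ B u ∧ P u ⟧ ⟦ B u ∧ not (P u) ⟧))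
                                        (cong (_* ⟦ R v u ⟧) (pw (B u) (P u))))) one)
    where
    pw : ∀ b p → ⟦ b ∧ p ⟧ + ⟦ b ∧ not p ⟧ ≡ ⟦ b ⟧
    pw true  p = ⟦⟧+⟦not⟧ p
    pw false p = refl
  helper : ∀ b → P w ≡ b → nb R v (λ u → B u ∧ P u) ≡ ⟦ b ⟧
  helper true  e = ≤-antisym (≤-trans (m≤m+n _ _) (≤-reflexive parts)) (lower P e)
  helper false e = n≤0⇒n≡0 (s≤s⁻¹ (≤-trans (≤-reflexive (+-comm 1 _))
                     (≤-trans (+-monoʳ-≤ (nb R v (λ u → B u ∧ P u)) (lower (not ∘ P) (cong not e))) (≤-reflexive parts))))

-- Sampling a neighbour in Y of every vertex of U

module Pick {n : ℕ} (k L : ℕ) (Qr : VSet n → VSet n → DT n ℕ) where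

  -- Every vertex of `xs` is supposed to have exactly one neighbour in the common set `B`. Each
  -- binary digit of that neighbour is a 0/1 quantity whose sum over a sublist is an edge count, so
  -- one coin weighing per digit reads it for all of `xs` together.
  identify : List (Fin n) → VSet n → DT n (Fin n → ℕ)
  identify xs B =
    forFin {k = L} (λ i → weigh k (λ sub → Qr (_∈ᵇ sub) (λ w → B w ∧ digit i (toℕ w))) xs) >>= λ g →
    ret (λ v → undigits (λ i → g i v))

  -- Vertices whose degrees into `Y` agree up to a constant factor use the same sample of `Y`.
  -- Sharing the sample is what allows a single coin weighing for the whole class, and there are
  -- only `L + 2` classes.
  class : ℕ → Fin (suc (suc L))
  class d = clamp (suc L) (level d)

  Seeds : Set
  Seeds = Vec (Vec Bool (suc L)) n

  sample : VSet n → Seeds → ℕ → VSet n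
  sample Y β j w = Y w ∧ leading j (lookup β w)

  isolated : VSet n → (Fin n → ℕ) → (Fin n → ℕ) → Fin (suc (suc L)) → VSet n
  isolated U d e j v = U v ∧ ((e v ≡ᵇ 1) ∧ (class (d v) == j))

  module _ (U Y : VSet n) (β : Seeds) where

    degrees : Fin n → DT n ℕ
    degrees v = guard (U v) 0 (Qr (_== v) Y)

    sampled : (Fin n → ℕ) → Fin n → DT n ℕ
    sampled d v = guard (U v) 0 (Qr (_== v) (sample Y β (toℕ (class (d v)))))

    identified : (Fin n → ℕ) → (Fin n → ℕ) → Fin (suc (suc L)) → DT n (Fin n → ℕ)
    identified d e j = identify (elems (isolated U d e j)) (sample Y β (toℕ j))

    picked : (Fin n → ℕ) → (Fin n → ℕ) → (Fin (suc (suc L)) → Fin n → ℕ) → Fin n → Maybe (Fin n)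
    picked d e g v = if U v ∧ (e v ≡ᵇ 1) then fromNat? (g (class (d v)) v) else nothing

    pickPhase : DT n (Fin n → Maybe (Fin n))
    pickPhase =
      forFin degrees >>= λ d → forFin (sampled d) >>= λ e → forFin (identified d e) >>= λ g → ret (picked d e g)

  module Correct (G : Graph n) (n≤2^L : n ≤ 2 ^ L) (R : Rel₂ n)
    (spec : ∀ I B → Disjoint I B → run G (Qr I B) ≡ form R I B) where

    module _ {xs : List (Fin n)} {B : VSet n} (us : Unique xs) (B# : All (λ v → B v ≡ false) xs) where

      run-identify : (∀ {v} → v ∈ xs → nb R v B ≡ 1) → ∀ {v w} → v ∈ xs → B w ≡ true → R v w ≡ true →
                     run G (identify xs B) v ≡ toℕ w
      run-identify one {v} {w} i Bw Rw = begin
        run G (identify xs B) v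
          ≡⟨ cong (λ g → g v) (run->>= G (forFin f) (λ g → ret (λ v → undigits (λ i → g i v)))) ⟩
        undigits {L} (λ j → run G (forFin f) j v)
          ≡⟨ undigits-cong (λ j → trans (cong (λ g → g v) (run-forFin G f j)) (bitwise j)) ⟩
        undigits {L} (λ j → ⟦ digit j (toℕ w) ⟧)
          ≡⟨ undigits-digit L (toℕ w) (≤-trans (toℕ<n w) n≤2^L) ⟩
        toℕ w ∎
        where
        open ≡-Reasoning
        f : Fin L → DT n (Fin n → ℕ)
        f i = weigh k (λ sub → Qr (_∈ᵇ sub) (λ w → B w ∧ digit i (toℕ w))) xs
        bitwise : ∀ j → run G (f j) v ≡ ⟦ digit j (toℕ w) ⟧
        bitwise j = trans
          (run-weigh G k (λ sub → Qr (_∈ᵇ sub) B′) (_∈ xs) (λ u → nb R u B′)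
            (λ {u} i′ → ≤-trans (nb-mono R u {B′} {B} (λ u e → proj₁ (∧-true {B u} e))) (≤-reflexive (one i′)))
            (λ ys us′ ps → trans (spec (_∈ᵇ ys) B′ (dis ys ps)) (∑-∈ᵇ (λ u → nb R u B′) ys us′))
            xs us (tabulateᴬ (λ i′ → i′)) i)
          (nb-unique R v B (λ u → digit j (toℕ u)) (one i) Bw Rw)
          where
          B′ : VSet n
          B′ u = B u ∧ digit j (toℕ u)
          dis : ∀ ys → All (_∈ xs) ys → Disjoint (_∈ᵇ ys) B′
          dis ys ps u u∈ e = true≢false (trans (sym (proj₁ (∧-true {B u} e))) (lookupᴬ B# (∈ᵇ-All ys ps u∈)))

    module _ (U Y : VSet n) (U#Y : Disjoint U Y) (β : Seeds) where

      private
        d = run G (forFin (degrees U Y β))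
        e = run G (forFin (sampled U Y β d))
        g = run G (forFin (identified U Y β d e))

        run-pickPhase : run G (pickPhase U Y β) ≡ picked U Y β d e g
        run-pickPhase =
          trans (run->>= G (forFin (degrees U Y β)) (λ d → forFin (sampled U Y β d) >>= λ e →
                   forFin (identified U Y β d e) >>= λ g → ret (picked U Y β d e g)))
            (trans (run->>= G (forFin (sampled U Y β d)) (λ e → forFin (identified U Y β d e) >>= λ g → ret (picked U Y β d e g)))
              (run->>= G (forFin (identified U Y β d e)) (λ g → ret (picked U Y β d e g))))

        pick-eq : ∀ v → run G (pickPhase U Y β) v ≡ picked U Y β d e g v
        pick-eq v = cong (λ h → h v) run-pickPhase

      -- The sampled part of Y in which v looks for its neighbour.
      target : Fin n → VSet n
      target v = sample Y β (toℕ (class (nb R v Y)))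

      private
        d-eq : ∀ v → U v ≡ true → d v ≡ nb R v Y
        d-eq v Uv = trans (run-forFin G (degrees U Y β) v) (trans (run-guard G 0 (Qr (_== v) Y) Uv)
          (trans (spec (_== v) Y (λ u p q → U#Y u (subst (λ z → U z ≡ true) (sym (==⇒≡ p)) Uv) q)) (form-single R v Y)))

        e-eq : ∀ v → U v ≡ true → e v ≡ nb R v (target v)
        e-eq v Uv = trans (run-forFin G (sampled U Y β d) v) (trans (run-guard G 0 (Qr (_== v) S) Uv)
          (trans (spec (_== v) S (λ u p q → U#Y u (subst (λ z → U z ≡ true) (sym (==⇒≡ p)) Uv) (proj₁ (∧-true {Y u} q))))
            (trans (form-single R v S) (cong (λ c → nb R v (sample Y β (toℕ (class c)))) (d-eq v Uv)))))
          where S = sample Y β (toℕ (class (d v)))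

        g-eq : ∀ v w → U v ≡ true → nb R v (target v) ≡ 1 → target v w ≡ true → R v w ≡ true →
               g (class (d v)) v ≡ toℕ w
        g-eq v w Uv one Tw Rw = trans (cong (λ h → h v) (run-forFin G (identified U Y β d e) j))
          (run-identify (elems-Unique W) B# oneAll (∈-elems W (∧-intro Uv (∧-intro (e≡ᵇ1 v Uv one) (==-refl j))))
            (subst (λ c → sample Y β (toℕ (class c)) w ≡ true) (sym (d-eq v Uv)) Tw) Rw)
          where
          j = class (d v)
          W = isolated U d e j
          e≡ᵇ1 : ∀ v → U v ≡ true → nb R v (target v) ≡ 1 → (e v ≡ᵇ 1) ≡ true
          e≡ᵇ1 v Uv one = trans (cong (_≡ᵇ 1) (trans (e-eq v Uv) one)) refl
          B# : All (λ v → sample Y β (toℕ j) v ≡ false) (elems W)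
          B# = mapᴬ (λ {u} Wu → false-of u (proj₁ (∧-true {U u} Wu))) (elems-All W)
            where
            false-of : ∀ u → U u ≡ true → sample Y β (toℕ j) u ≡ false
            false-of u Uu with Y u in Yu
            ... | true  = ⊥-elim (U#Y u Uu Yu)
            ... | false = refl
          oneAll : ∀ {u} → u ∈ elems W → nb R u (sample Y β (toℕ j)) ≡ 1
          oneAll {u} i with ∧-true {U u} (lookupᴬ (elems-All W) i)
          ... | Uu , r with ∧-true {e u ≡ᵇ 1} r
          ...   | e1 , c = begin
            nb R u (sample Y β (toℕ j))               ≡⟨ cong (λ z → nb R u (sample Y β (toℕ z))) (sym (==⇒≡ {i = class (d u)} {j} c)) ⟩
            nb R u (sample Y β (toℕ (class (d u))))   ≡⟨ cong (λ z → nb R u (sample Y β (toℕ (class z)))) (d-eq u Uu) ⟩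
            nb R u (target u)                         ≡⟨ sym (e-eq u Uu) ⟩
            e u                                       ≡⟨ ≡ᵇ-true (e u) 1 e1 ⟩
            1 ∎
            where open ≡-Reasoning

      pick-complete : ∀ {v w} → U v ≡ true → nb R v (target v) ≡ 1 → target v w ≡ true → R v w ≡ true →
                      run G (pickPhase U Y β) v ≡ just w
      pick-complete {v} {w} Uv one Tw Rw =
        trans (pick-eq v) (trans (if-true (∧-intro Uv (cong (_≡ᵇ 1) (trans (e-eq v Uv) one))))
          (trans (cong fromNat? (g-eq v w Uv one Tw Rw)) (fromNat?-toℕ w)))

      pick-sound : ∀ {v w} → run G (pickPhase U Y β) v ≡ just w →
                   U v ≡ true × target v w ≡ true × R v w ≡ true × nb R v (target v) ≡ 1
      pick-sound {v} {w} eq with U v ∧ (e v ≡ᵇ 1) in q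
      ... | false = ⊥-elim (nothing≢just (trans (sym (trans (pick-eq v) (if-false q))) eq))
        where
        nothing≢just : nothing ≢ just w
        nothing≢just ()
      ... | true with ∧-true {U v} q
      ...   | Uv , e1 with ∑-pos (λ u → ⟦ target v u ⟧ * ⟦ R v u ⟧) (≤-reflexive (sym one))
        where
        one : nb R v (target v) ≡ 1
        one = trans (sym (e-eq v Uv)) (≡ᵇ-true (e v) 1 e1)
      ...     | u , pos-u with target v u in Tu | R v u in Ru
      ...       | true  | true  = conclude
        where
        one : nb R v (target v) ≡ 1
        one = trans (sym (e-eq v Uv)) (≡ᵇ-true (e v) 1 e1)
        just-inj : ∀ {x y : Fin n} → just x ≡ just y → x ≡ y
        just-inj refl = refl
        -- By completeness the output is the sampled neighbour `u` just found, so the given output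
        -- `w` must be `u`.
        u≡w : u ≡ w
        u≡w = just-inj (trans (sym (pick-complete Uv one Tu Ru)) eq)
        conclude : U v ≡ true × target v w ≡ true × R v w ≡ true × nb R v (target v) ≡ 1
        conclude = Uv , subst (λ z → target v z ≡ true) u≡w Tu , subst (λ z → R v z ≡ true) u≡w Ru , one
      ...       | true  | false = ⊥-elim (1+n≰n pos-u)
      ...       | false | true  = ⊥-elim (1+n≰n pos-u)
      ...       | false | false = ⊥-elim (1+n≰n pos-u)

-- Cost and distribution of the sampled neighbours

up-bound : ∀ {d} L → 1 ≤ d → d ≤ 2 ^ L → up d ≤ L
up-bound {d} L p q = s≤s⁻¹ (≰⇒> λ r → <-irrefl refl (begin-strict
  2 ^ up d     <⟨ up-< d p ⟩
  2 * d        ≤⟨ *-monoʳ-≤ 2 q ⟩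
  2 ^ suc L    ≤⟨ ^-monoʳ-≤ 2 r ⟩
  2 ^ up d ∎))
  where open ≤-Reasoning

∑-classes : ∀ {n m} (U : VSet n) (c : Fin n → Fin m) → ∑ (λ j → card (λ v → U v ∧ (c v == j))) ≡ card U
∑-classes U c = trans (∑-cong (λ j → ∑-cong (λ v → trans (⟦∧⟧ (U v) (c v == j)) (*-comm ⟦ U v ⟧ _))))
                      (sym (∑-fibre c (λ v → ⟦ U v ⟧)))

card-mono : ∀ {n} {U V : VSet n} → (∀ v → U v ≡ true → V v ≡ true) → card U ≤ card V
card-mono h = ∑-mono (λ v → ⟦⟧-mono (h v))

opaque
  -- Per vertex: 3 + 3 for the degree and the sampled degree, 192 = 24 · 8 for the digits because
  -- `L ≤ 8 (k + 2)`, and 3 for the classes that do not fill a block.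
  pickRate : ℕ
  pickRate = 201

  pickRate-def : pickRate ≡ 201
  pickRate-def = refl

-- The additive overhead is only paid for few vertices.
pickCost : ℕ → ℕ → ℕ → ℕ
pickCost b L m = pickRate * m + 3 * (L * (⟦ m <ᵇ b ⟧ * m))

-- Classes below `capacity k` hold at most `(2 + L) * capacity k` vertices together, each costing
-- `3 L` queries. From this many vertices on, that overhead averages to at most 3 per vertex.
threshold : ℕ → ℕ → ℕ
threshold k L = L * ((2 + L) * capacity k)

module PickCost {n : ℕ} (k L : ℕ) (Qr : VSet n → VSet n → DT n ℕ) (G : Graph n)
  (cost-Qr : ∀ I B → cost G (Qr I B) ≡ 3) (L≤ : L ≤ 8 * (k + 2)) where

  open Pick {n} k L Qr

  module _ (U Y : VSet n) (β : Seeds) where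

    private
      d = run G (forFin (degrees U Y β))
      e = run G (forFin (sampled U Y β d))
      mj : Fin (suc (suc L)) → ℕ
      mj j = card (isolated U d e j)
      N = capacity k
      X = ∑ (λ j → ⟦ mj j <ᵇ N ⟧ * mj j)

      cost-identify : ∀ xs B → (k + 2) * cost G (identify xs B) ≤ L * weighCost k (length xs)
      cost-identify xs B = begin
        (k + 2) * cost G (identify xs B)
          ≡⟨ cong ((k + 2) *_) (trans (cost->>= G (forFin f) (λ g → ret (λ v → undigits (λ i → g i v)))) (trans (+-identityʳ _) (cost-forFin G f))) ⟩
        (k + 2) * ∑ (λ i → cost G (f i))
          ≡⟨ sym (∑-*ˡ (k + 2) _) ⟩
        ∑ (λ i → (k + 2) * cost G (f i))
          ≤⟨ ∑-mono (λ i → cost-weigh G k (λ sub → Qr (_∈ᵇ sub) (λ w → B w ∧ digit i (toℕ w))) (λ sub → cost-Qr (_∈ᵇ sub) (λ w → B w ∧ digit i (toℕ w))) xs) ⟩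
        ∑ {L} (λ i → weighCost k (length xs))
          ≡⟨ ∑-const {L} (weighCost k (length xs)) ⟩
        L * weighCost k (length xs) ∎
        where
        open ≤-Reasoning
        f : Fin L → DT n (Fin n → ℕ)
        f i = weigh k (λ sub → Qr (_∈ᵇ sub) (λ w → B w ∧ digit i (toℕ w))) xs

      guarded : ∀ (f : Fin n → DT n ℕ) → (∀ v → cost G (f v) ≡ ⟦ U v ⟧ * 3) → cost G (forFin f) ≡ 3 * card U
      guarded f h = trans (cost-forFin G f) (trans (∑-cong (λ v → trans (h v) (*-comm ⟦ U v ⟧ 3))) (∑-*ˡ 3 (λ v → ⟦ U v ⟧)))

      cost-total : cost G (pickPhase U Y β) ≡ 3 * card U + (3 * card U + ∑ (λ j → cost G (identified U Y β d e j)))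
      cost-total =
        trans (cost->>= G (forFin (degrees U Y β)) (λ d → forFin (sampled U Y β d) >>= λ e →
                 forFin (identified U Y β d e) >>= λ g → ret (picked U Y β d e g)))
          (cong₂ _+_ (guarded (degrees U Y β) (λ v → trans (cost-guard G (U v) 0 _) (cong (⟦ U v ⟧ *_) (cost-Qr _ _))))
            (trans (cost->>= G (forFin (sampled U Y β d)) (λ e → forFin (identified U Y β d e) >>= λ g → ret (picked U Y β d e g)))
              (cong₂ _+_ (guarded (sampled U Y β d) (λ v → trans (cost-guard G (U v) 0 _) (cong (⟦ U v ⟧ *_) (cost-Qr _ _))))
                (trans (cost->>= G (forFin (identified U Y β d e)) (λ g → ret (picked U Y β d e g)))
                  (trans (+-identityʳ _) (cost-forFin G (identified U Y β d e)))))))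

      ∑mj : ∑ mj ≤ card U
      ∑mj = begin
        ∑ mj
          ≡⟨ ∑-cong (λ j → ∑-cong (λ v → cong ⟦_⟧ (assoc-∧ (U v) (e v ≡ᵇ 1) (class (d v) == j)))) ⟩
        ∑ (λ j → card (λ v → (U v ∧ (e v ≡ᵇ 1)) ∧ (class (d v) == j)))
          ≡⟨ ∑-classes (λ v → U v ∧ (e v ≡ᵇ 1)) (class ∘ d) ⟩
        card (λ v → U v ∧ (e v ≡ᵇ 1))
          ≤⟨ card-mono {V = U} (λ v p → proj₁ (∧-true {U v} p)) ⟩
        card U ∎
        where
        open ≤-Reasoning
        assoc-∧ : ∀ a b c → (a ∧ (b ∧ c)) ≡ ((a ∧ b) ∧ c)
        assoc-∧ true  b c = refl
        assoc-∧ false b c = refl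

      X≤card : X ≤ card U
      X≤card = ≤-trans (∑-mono (λ j → ⟦⟧*≤ (mj j <ᵇ N) (mj j))) ∑mj

      X≤cap : X ≤ (2 + L) * N
      X≤cap = ≤-trans (∑-mono (λ j → aux (mj j))) (≤-reflexive (∑-const {2 + L} N))
        where
        aux : ∀ m → ⟦ m <ᵇ N ⟧ * m ≤ N
        aux m with m <ᵇ N in q
        ... | true  = ≤-trans (≤-reflexive (*-identityˡ m)) (<⇒≤ (<ᵇ-true q))
        ... | false = z≤n

      identified-cost : (k + 2) * ∑ (λ j → cost G (identified U Y β d e j)) ≤ (k + 2) * (192 * card U + 3 * (L * X))
      identified-cost = begin
        (k + 2) * ∑ (λ j → cost G (identified U Y β d e j))
          ≡⟨ sym (∑-*ˡ (k + 2) _) ⟩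
        ∑ (λ j → (k + 2) * cost G (identified U Y β d e j))
          ≤⟨ ∑-mono (λ j → ≤-trans (cost-identify (elems (isolated U d e j)) (sample Y β (toℕ j)))
               (≤-reflexive (cong (λ l → L * weighCost k l) (length-elems (isolated U d e j))))) ⟩
        ∑ (λ j → L * weighCost k (mj j))
          ≡⟨ trans (∑-*ˡ L _) (cong (L *_) (trans (∑-+ (λ j → 24 * mj j) _) (cong₂ _+_ (∑-*ˡ 24 mj)
               (trans (∑-*ˡ (k + 2) _) (cong ((k + 2) *_) (∑-*ˡ 3 (λ j → ⟦ mj j <ᵇ N ⟧ * mj j))))))) ⟩
        L * (24 * ∑ mj + (k + 2) * (3 * X))
          ≤⟨ *-monoʳ-≤ L (+-monoˡ-≤ _ (*-monoʳ-≤ 24 ∑mj)) ⟩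
        L * (24 * card U + (k + 2) * (3 * X))
          ≡⟨ *-distribˡ-+ L (24 * card U) _ ⟩
        L * (24 * card U) + L * ((k + 2) * (3 * X))
          ≤⟨ +-monoˡ-≤ _ (*-monoˡ-≤ (24 * card U) L≤) ⟩
        8 * (k + 2) * (24 * card U) + L * ((k + 2) * (3 * X))
          ≡⟨ solve 4 (λ k2 m l x → con 8 :* k2 :* (con 24 :* m) :+ l :* (k2 :* (con 3 :* x)) :=
               k2 :* (con 192 :* m :+ con 3 :* (l :* x))) refl (k + 2) (card U) L X ⟩
        (k + 2) * (192 * card U + 3 * (L * X)) ∎
        where open ≤-Reasoning

    cost-pickPhase : ∀ m → card U ≤ m → cost G (pickPhase U Y β) ≤ pickCost (threshold k L) L m
    cost-pickPhase m U≤m = begin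
      cost G (pickPhase U Y β)
        ≡⟨ cost-total ⟩
      3 * card U + (3 * card U + ∑ (λ j → cost G (identified U Y β d e j)))
        ≤⟨ +-monoʳ-≤ (3 * card U) (+-monoʳ-≤ (3 * card U) (*-cancelˡ-≤ (k + 2) {{>-nonZero (m≤n⇒m≤o+n k (s≤s z≤n))}} identified-cost)) ⟩
      3 * card U + (3 * card U + (192 * card U + 3 * (L * X)))
        ≡⟨ solve 2 (λ u y → con 3 :* u :+ (con 3 :* u :+ (con 192 :* u :+ con 3 :* y)) := con 198 :* u :+ con 3 :* y) refl (card U) (L * X) ⟩
      198 * card U + 3 * (L * X)
        ≤⟨ +-mono-≤ (*-monoʳ-≤ 198 U≤m) (*-monoʳ-≤ 3 LX) ⟩
      198 * m + 3 * (m + L * (⟦ m <ᵇ b ⟧ * m))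
        ≡⟨ solve 3 (λ c m y → c :* m :+ con 3 :* (m :+ y) := (c :+ con 3) :* m :+ con 3 :* y) refl 198 m (L * (⟦ m <ᵇ b ⟧ * m)) ⟩
      (198 + 3) * m + 3 * (L * (⟦ m <ᵇ b ⟧ * m)) ≡⟨ cong (λ c → c * m + 3 * (L * (⟦ m <ᵇ b ⟧ * m))) (sym pickRate-def) ⟩
      pickRate * m + 3 * (L * (⟦ m <ᵇ b ⟧ * m)) ∎
      where
      open ≤-Reasoning
      b = threshold k L
      LX : L * X ≤ m + L * (⟦ m <ᵇ b ⟧ * m)
      LX with m <ᵇ b in q
      ... | true  = ≤-trans (*-monoʳ-≤ L (≤-trans X≤card (≤-trans U≤m (≤-reflexive (sym (*-identityˡ m)))))) (m≤n+m _ m)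
      ... | false = ≤-trans (*-monoʳ-≤ L X≤cap) (≤-trans (<ᵇ-false {m} q) (m≤m+n m _))

module PickDist {n : ℕ} (k L : ℕ) (Qr : VSet n → VSet n → DT n ℕ) (n≤2^L : n ≤ 2 ^ L) (R : Rel₂ n) (Y : VSet n) where

  open Pick {n} k L Qr

  seedCode : Code
  seedCode = pow n (bits (suc L))

  rate : Fin n → ℕ
  rate v = toℕ (class (nb R v Y))

  iso : Fin n → Fin n → Seeds → Bool
  iso v w β = (sample Y β (rate v) w ∧ R v w) ∧ (nb R v (sample Y β (rate v)) ≡ᵇ 1)

  nb≤n : ∀ v → nb R v Y ≤ n
  nb≤n v = ≤-trans (∑-mono (λ w → ≤-trans (*-mono-≤ (⟦⟧≤1 (Y w)) (⟦⟧≤1 (R v w))) ≤-refl))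
             (≤-reflexive (trans (∑-const 1) (*-identityʳ n)))

  module _ (v : Fin n) (d≥1 : 1 ≤ nb R v Y) where

    private
      d = nb R v Y
      j = rate v
      V = vol seedCode

      up≤L : up d ≤ L
      up≤L = up-bound L d≥1 (≤-trans (nb≤n v) n≤2^L)

      j≡ : j ≡ level d
      j≡ = toℕ-clamp (suc L) (level d) (s≤s up≤L)

      2d≤ : 2 * d ≤ 2 ^ j
      2d≤ = subst (λ i → 2 * d ≤ 2 ^ i) (sym j≡) (level-≥ d)

      ≤4d : 2 ^ j ≤ 4 * d
      ≤4d = subst (λ i → 2 ^ i ≤ 4 * d) (sym j≡) (level-≤ d d≥1)

      j≤ : j ≤ suc L
      j≤ = subst (_≤ suc L) (sym j≡) (s≤s up≤L)

      T₁ : Fin n → ℕ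
      T₁ w = total seedCode (λ β → ⟦ leading j (lookup β w) ⟧)

      T₁-eq : ∀ w → T₁ w * 2 ^ j ≡ V
      T₁-eq = leading-marginal (suc L) j j≤

      T₂ : Fin n → Fin n → ℕ
      T₂ w u = total seedCode (λ β → ⟦ leading j (lookup β w) ⟧ * ⟦ leading j (lookup β u) ⟧)

      T₂-eq : ∀ w u → w ≢ u → T₂ w u * (2 ^ j * 2 ^ j) ≡ V
      T₂-eq = leading-marginal₂ (suc L) j j≤

    -- Being isolated requires being sampled, which has probability `2 ^ (− j) ≤ 1 / (2 d)`.
    iso-upper : ∀ w → total seedCode (λ β → ⟦ iso v w β ⟧) * (2 * d) ≤ ⟦ Y w ⟧ * ⟦ R v w ⟧ * V
    iso-upper w = begin
      total seedCode (λ β → ⟦ iso v w β ⟧) * (2 * d)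
        ≤⟨ *-mono-≤ (total-mono seedCode (λ β → pw (Y w) (leading j (lookup β w)) (R v w) _)) 2d≤ ⟩
      total seedCode (λ β → ⟦ Y w ⟧ * ⟦ R v w ⟧ * ⟦ leading j (lookup β w) ⟧) * 2 ^ j
        ≡⟨ cong (_* 2 ^ j) (total-*ˡ seedCode (⟦ Y w ⟧ * ⟦ R v w ⟧) _) ⟩
      ⟦ Y w ⟧ * ⟦ R v w ⟧ * T₁ w * 2 ^ j
        ≡⟨ trans (*-assoc (⟦ Y w ⟧ * ⟦ R v w ⟧) (T₁ w) _) (cong (⟦ Y w ⟧ * ⟦ R v w ⟧ *_) (T₁-eq w)) ⟩
      ⟦ Y w ⟧ * ⟦ R v w ⟧ * V ∎
      where
      open ≤-Reasoning
      pw : ∀ y l r q → ⟦ ((y ∧ l) ∧ r) ∧ q ⟧ ≤ ⟦ y ⟧ * ⟦ r ⟧ * ⟦ l ⟧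
      pw true  true  true  q = ⟦⟧≤1 q
      pw true  true  false q = z≤n
      pw true  false r     q = z≤n
      pw false l     r     q = z≤n

    -- A second-moment bound: with `p = 2 ^ (− j)`, the vertex `w` is sampled with probability `p`,
    -- and together with another neighbour with probability at most `d p ^ 2 ≤ p / 2`. What remains
    -- is at least `p / 2 ≥ 1 / (8 d)`.
    iso-lower : ∀ w → Y w ≡ true → R v w ≡ true → V ≤ 8 * d * total seedCode (λ β → ⟦ iso v w β ⟧)
    iso-lower w Yw Rw = *-cancelʳ-≤ V (8 * d * I) (2 ^ j) {{m^n≢0 2 j}} (begin
      V * P              ≤⟨ +-cancelʳ-≤ (P * V) (V * P) (2 * (I * (P * P))) twice ⟩
      2 * (I * (P * P))  ≡⟨ solve 2 (λ i p → con 2 :* (i :* (p :* p)) := con 2 :* p :* i :* p) refl I P ⟩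
      2 * P * I * P      ≤⟨ *-monoˡ-≤ P (*-monoˡ-≤ I (*-monoʳ-≤ 2 ≤4d)) ⟩
      2 * (4 * d) * I * P ≡⟨ cong (λ z → z * I * P) (sym (*-assoc 2 4 d)) ⟩
      8 * d * I * P ∎)
      where
      open ≤-Reasoning
      P = 2 ^ j
      I = total seedCode (λ β → ⟦ iso v w β ⟧)
      other : Fin n → ℕ
      other u = ⟦ not (u == w) ⟧ * (⟦ Y u ⟧ * ⟦ R v u ⟧)
      pointwise : ∀ β → ⟦ leading j (lookup β w) ⟧ ≤
                  ⟦ iso v w β ⟧ + ∑ (λ u → other u * (⟦ leading j (lookup β w) ⟧ * ⟦ leading j (lookup β u) ⟧))
      pointwise β with leading j (lookup β w) in lw
      ... | false = z≤n
      ... | true rewrite Yw | Rw with nb R v (sample Y β j) in nbs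
      ...   | zero = ⊥-elim (1+n≰n (≤-trans (≤-trans (≤-reflexive (sym (cong₂ (λ a b → ⟦ a ⟧ * ⟦ b ⟧) (∧-intro Yw lw) Rw)))
                       (∑-≥ (λ u → ⟦ sample Y β j u ⟧ * ⟦ R v u ⟧) w)) (≤-reflexive nbs)))
      ...   | suc zero = s≤s z≤n
      ...   | suc (suc m) = s≤s⁻¹ (begin
        2                ≤⟨ s≤s (s≤s z≤n) ⟩
        suc (suc m)      ≡⟨ sym nbs ⟩
        ∑ (λ u → ⟦ sample Y β j u ⟧ * ⟦ R v u ⟧)
                         ≤⟨ ∑-mono (λ u → split (u == w) (Y u) (leading j (lookup β u)) (R v u)) ⟩
        ∑ (λ u → ⟦ u == w ⟧ * 1 + other u * (1 * ⟦ leading j (lookup β u) ⟧))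
                         ≡⟨ ∑-+ (λ u → ⟦ u == w ⟧ * 1) _ ⟩
        ∑ (λ u → ⟦ u == w ⟧ * 1) + ∑ (λ u → other u * (1 * ⟦ leading j (lookup β u) ⟧))
                         ≡⟨ cong (_+ ∑ (λ u → other u * (1 * ⟦ leading j (lookup β u) ⟧))) (∑-δ w (λ _ → 1)) ⟩
        1 + ∑ (λ u → other u * (1 * ⟦ leading j (lookup β u) ⟧)) ∎)
        where
        split : ∀ q y l r → ⟦ y ∧ l ⟧ * ⟦ r ⟧ ≤ ⟦ q ⟧ * 1 + ⟦ not q ⟧ * (⟦ y ⟧ * ⟦ r ⟧) * (1 * ⟦ l ⟧)
        split true  y l r = ≤-trans (*-mono-≤ (⟦⟧≤1 (y ∧ l)) (⟦⟧≤1 r)) (s≤s z≤n)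
        split false true  true  r = ≤-reflexive (solve 1 (λ r → con 1 :* r := con 1 :* (con 1 :* r) :* con 1) refl ⟦ r ⟧)
        split false true  false r = z≤n
        split false false l     r = z≤n
      summed : T₁ w ≤ I + ∑ (λ u → other u * T₂ w u)
      summed = ≤-trans (total-mono seedCode pointwise) (≤-reflexive
        (trans (total-+ seedCode (λ β → ⟦ iso v w β ⟧) _)
          (cong (I +_) (trans (total-∑ seedCode (λ u β → other u * (⟦ leading j (lookup β w) ⟧ * ⟦ leading j (lookup β u) ⟧)))
            (∑-cong (λ u → total-*ˡ seedCode (other u) _))))))
      others : ∑ (λ u → other u * T₂ w u) * (P * P) ≤ d * V
      others = begin
        ∑ (λ u → other u * T₂ w u) * (P * P)   ≡⟨ sym (∑-*ʳ (P * P) _) ⟩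
        ∑ (λ u → other u * T₂ w u * (P * P))   ≤⟨ ∑-mono (λ u → term u) ⟩
        ∑ (λ u → ⟦ Y u ⟧ * ⟦ R v u ⟧ * V)      ≡⟨ ∑-*ʳ V (λ u → ⟦ Y u ⟧ * ⟦ R v u ⟧) ⟩
        d * V ∎
        where
        term : ∀ u → other u * T₂ w u * (P * P) ≤ ⟦ Y u ⟧ * ⟦ R v u ⟧ * V
        term u with u ≟ᶠ w
        ... | yes _ = z≤n
        ... | no ne = ≤-reflexive (trans (*-assoc (1 * (⟦ Y u ⟧ * ⟦ R v u ⟧)) (T₂ w u) (P * P))
            (cong₂ _*_ (*-identityˡ (⟦ Y u ⟧ * ⟦ R v u ⟧)) (T₂-eq w u (λ e → ne (sym e)))))
      once : V * P ≤ I * (P * P) + d * V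
      once = begin
        V * P                                        ≡⟨ cong (_* P) (sym (T₁-eq w)) ⟩
        T₁ w * P * P                                 ≡⟨ *-assoc (T₁ w) P P ⟩
        T₁ w * (P * P)                               ≤⟨ *-monoˡ-≤ (P * P) summed ⟩
        (I + ∑ (λ u → other u * T₂ w u)) * (P * P)   ≡⟨ *-distribʳ-+ (P * P) I _ ⟩
        I * (P * P) + ∑ (λ u → other u * T₂ w u) * (P * P) ≤⟨ +-monoʳ-≤ (I * (P * P)) others ⟩
        I * (P * P) + d * V ∎
      twice : V * P + P * V ≤ 2 * (I * (P * P)) + P * V
      twice = begin
        V * P + P * V              ≡⟨ solve 2 (λ v p → v :* p :+ p :* v := con 2 :* (v :* p)) refl V P ⟩
        2 * (V * P)                ≤⟨ *-monoʳ-≤ 2 once ⟩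
        2 * (I * (P * P) + d * V)  ≡⟨ solve 3 (λ x d v → con 2 :* (x :+ d :* v) := con 2 :* x :+ con 2 :* d :* v) refl (I * (P * P)) d V ⟩
        2 * (I * (P * P)) + 2 * d * V ≤⟨ +-monoʳ-≤ (2 * (I * (P * P))) (*-monoˡ-≤ V 2d≤) ⟩
        2 * (I * (P * P)) + P * V ∎

-- Binary search for the end of a random edge

locate : ∀ {n} → VSet n → Fin n → ℕ → List (Fin n) → ℕ → DT n (Fin n)
branch : ∀ {n} → VSet n → Fin n → ℕ → List (Fin n) → ℕ → ℕ → DT n (Fin n)
locate Y z zero    []       r = ret z
locate Y z zero    (x ∷ xs) r = ret x
locate Y z (suc t) xs       r = pairQ (_∈ᵇ take (2 ^ t) xs) Y >>= λ w →
  branch Y z t xs r w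

branch Y z t xs r w = if r <ᵇ w then locate Y z t (take (2 ^ t) xs) r else locate Y z t (drop (2 ^ t) xs) (r ∸ w)

opaque
  unfolding ∑

  sum-filter-tabulate : ∀ {n m} (U : VSet n) (f : Fin n → ℕ) (h : Fin m → Fin n) →
    sumᴸ (mapᴸ f (filter (λ v → U v ≟ᴮ true) (tabulateᴸ h))) ≡ ∑ (λ i → ⟦ U (h i) ⟧ * f (h i))
  sum-filter-tabulate {m = zero}  U f h = refl
  sum-filter-tabulate {m = suc m} U f h with U (h zero)
  ... | true  = cong₂ _+_ (sym (*-identityˡ _)) (sum-filter-tabulate U f (h ∘ suc))
  ... | false = sum-filter-tabulate U f (h ∘ suc)

sum-elems : ∀ {n} (U : VSet n) (f : Fin n → ℕ) → sumᴸ (mapᴸ f (elems U)) ≡ ∑ (λ v → ⟦ U v ⟧ * f v)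
sum-elems {n} U f = sum-filter-tabulate U f (λ i → i)

∑<-const : ∀ m c → ∑< m (λ _ → c) ≡ m * c
∑<-const zero    c = refl
∑<-const (suc m) c = trans (cong (_+ c) (∑<-const m c)) (+-comm (m * c) c)

sum-++ : ∀ xs ys → sumᴸ (xs ++ ys) ≡ sumᴸ xs + sumᴸ ys
sum-++ []       ys = refl
sum-++ (x ∷ xs) ys = trans (cong (x +_) (sum-++ xs ys)) (sym (+-assoc x _ _))

∈-take : ∀ {A : Set} m {xs : List A} {x} → x ∈ take m xs → x ∈ xs
∈-take (suc m) {y ∷ xs} (here e)  = here e
∈-take (suc m) {y ∷ xs} (there i) = there (∈-take m i)

∈-drop : ∀ {A : Set} m {xs : List A} {x} → x ∈ drop m xs → x ∈ xs
∈-drop zero    i = i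
∈-drop (suc m) {y ∷ xs} i = there (∈-drop m i)

module Locate {n : ℕ} (G : Graph n) (Y : VSet n) (z : Fin n) where

  private
    N : Fin n → ℕ
    N v = nb (adj G) v Y

    loc : ℕ → List (Fin n) → ℕ → Fin n
    loc t xs r = run G (locate Y z t xs r)

    weight : List (Fin n) → ℕ
    weight xs = sumᴸ (mapᴸ N xs)

  cost-locate : ∀ t xs r → cost G (locate Y z t xs r) ≤ 3 * t
  cost-locate zero    []       r = z≤n
  cost-locate zero    (x ∷ xs) r = z≤n
  cost-locate (suc t) xs       r = ≤-trans (≤-reflexive (trans (cost->>= G (pairQ (_∈ᵇ take (2 ^ t) xs) Y) (branch Y z t xs r)) (cong (_+ cost G (branch Y z t xs r w)) (cost-pairQ G _ Y))))
    (≤-trans (+-monoʳ-≤ 3 (aux (r <ᵇ run G (pairQ (_∈ᵇ take (2 ^ t) xs) Y)))) (≤-reflexive (sym (*-suc 3 t))))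
    where
    w = run G (pairQ (_∈ᵇ take (2 ^ t) xs) Y)
    aux : ∀ b → cost G (if b then locate Y z t (take (2 ^ t) xs) r else locate Y z t (drop (2 ^ t) xs) (r ∸ w)) ≤ 3 * t
    aux true  = cost-locate t (take (2 ^ t) xs) r
    aux false = cost-locate t (drop (2 ^ t) xs) (r ∸ w)

  module _ (t : ℕ) (xs : List (Fin n)) (us : Unique xs) (Y# : All (λ v → Y v ≡ false) xs) where

    private
      hd = take (2 ^ t) xs
      tl = drop (2 ^ t) xs

    weight-split : weight xs ≡ weight hd + weight tl
    weight-split = trans (cong weight (sym (take++drop≡id (2 ^ t) xs)))
      (trans (cong sumᴸ (map-++ N hd tl)) (sum-++ (mapᴸ N hd) (mapᴸ N tl)))

    run-half : run G (pairQ (_∈ᵇ hd) Y) ≡ weight hd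
    run-half = trans (run-pairQ G (_∈ᵇ hd) Y
                 (λ v p q → true≢false (trans (sym q) (∈ᵇ-All hd (All-take (2 ^ t) Y#) p))))
                 (∑-∈ᵇ N hd (Unique-take (2 ^ t) us))

    loc-left : ∀ r → r < weight hd → loc (suc t) xs r ≡ loc t hd r
    loc-left r p = trans (run->>= G (pairQ (_∈ᵇ hd) Y) (branch Y z t xs r))
      (trans (cong (λ w → run G (branch Y z t xs r w)) run-half)
        (cong (λ b → run G (if b then locate Y z t hd r else locate Y z t tl (r ∸ weight hd))) (<ᵇ-intro p)))

    loc-right : ∀ r → loc (suc t) xs (weight hd + r) ≡ loc t tl r
    loc-right r = trans (run->>= G (pairQ (_∈ᵇ hd) Y) (branch Y z t xs (weight hd + r)))
      (trans (cong (λ w → run G (branch Y z t xs (weight hd + r) w)) run-half)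
        (trans (cong (λ b → run G (if b then locate Y z t hd (weight hd + r) else locate Y z t tl (weight hd + r ∸ weight hd))) not<)
          (cong (loc t tl) (m+n∸m≡n (weight hd) r))))
      where
      not< : (weight hd + r <ᵇ weight hd) ≡ false
      not< with weight hd + r <ᵇ weight hd in e
      ... | false = refl
      ... | true  = ⊥-elim (m+n≮m (weight hd) r (<ᵇ-true e))

  module _ {t : ℕ} {xs : List (Fin n)} (le : length xs ≤ 2 ^ suc t) where

    length-hd : length (take (2 ^ t) xs) ≤ 2 ^ t
    length-hd = ≤-trans (≤-reflexive (length-take (2 ^ t) xs)) (m⊓n≤m (2 ^ t) _)

    length-tl : length (drop (2 ^ t) xs) ≤ 2 ^ t
    length-tl = ≤-trans (≤-reflexive (length-drop (2 ^ t) xs))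
      (≤-trans (∸-monoˡ-≤ (2 ^ t) le) (≤-reflexive (trans (m+n∸m≡n (2 ^ t) (2 ^ t + 0)) (+-identityʳ _))))

  -- The search lines up the edges into `Y` by their ends in `xs`, so `v` is the answer for exactly
  -- `N v` of the numbers `r`. A uniform `r` thus finds `v` with probability proportional to its
  -- degree into `Y`.
  loc-sum : ∀ t xs → Unique xs → All (λ v → Y v ≡ false) xs → length xs ≤ 2 ^ t → (g : Fin n → ℕ) →
            ∑< (weight xs) (λ r → g (loc t xs r)) ≡ sumᴸ (mapᴸ (λ v → N v * g v) xs)
  loc-sum zero    []           us ys le g = refl
  loc-sum zero    (x ∷ [])     us ys le g = trans (∑<-const (N x + 0) (g x))
    (trans (cong (_* g x) (+-identityʳ (N x))) (sym (+-identityʳ _)))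
  loc-sum zero    (x ∷ y ∷ xs) us ys (s≤s ()) g
  loc-sum (suc t) xs us ys le g = begin
    ∑< (weight xs) (λ r → g (loc (suc t) xs r))
      ≡⟨ cong (λ m → ∑< m (λ r → g (loc (suc t) xs r))) (weight-split t xs us ys) ⟩
    ∑< (weight hd + weight tl) (λ r → g (loc (suc t) xs r))
      ≡⟨ ∑<-+ (weight hd) (weight tl) _ ⟩
    ∑< (weight hd) (λ r → g (loc (suc t) xs r)) + ∑< (weight tl) (λ r → g (loc (suc t) xs (weight hd + r)))
      ≡⟨ cong₂ _+_ (∑<-cong (weight hd) (λ r p → cong g (loc-left t xs us ys r p)))
                   (∑<-cong (weight tl) (λ r _ → cong g (loc-right t xs us ys r))) ⟩
    ∑< (weight hd) (λ r → g (loc t hd r)) + ∑< (weight tl) (λ r → g (loc t tl r))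
      ≡⟨ cong₂ _+_ (loc-sum t hd (Unique-take (2 ^ t) us) (All-take (2 ^ t) ys) (length-hd {t} {xs} le) g)
                   (loc-sum t tl (Unique-drop (2 ^ t) us) (All-drop (2 ^ t) ys) (length-tl {t} {xs} le) g) ⟩
    sumᴸ (mapᴸ h hd) + sumᴸ (mapᴸ h tl)
      ≡⟨ sym (sum-++ (mapᴸ h hd) (mapᴸ h tl)) ⟩
    sumᴸ (mapᴸ h hd ++ mapᴸ h tl)
      ≡⟨ cong sumᴸ (sym (map-++ h hd tl)) ⟩
    sumᴸ (mapᴸ h (hd ++ tl))
      ≡⟨ cong (λ ys → sumᴸ (mapᴸ h ys)) (take++drop≡id (2 ^ t) xs) ⟩
    sumᴸ (mapᴸ h xs) ∎
    where
    open ≡-Reasoning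
    hd = take (2 ^ t) xs
    tl = drop (2 ^ t) xs
    h : Fin n → ℕ
    h v = N v * g v

  loc-∈ : ∀ t xs → Unique xs → All (λ v → Y v ≡ false) xs → length xs ≤ 2 ^ t →
          ∀ r → r < weight xs → loc t xs r ∈ xs
  loc-∈ zero    (x ∷ xs) us ys le r p = here refl
  loc-∈ (suc t) xs us ys le r p with r <? weight (take (2 ^ t) xs)
  ... | yes q = ∈-take (2 ^ t) (subst (_∈ take (2 ^ t) xs) (sym (loc-left t xs us ys r q))
                  (loc-∈ t (take (2 ^ t) xs) (Unique-take (2 ^ t) us) (All-take (2 ^ t) ys) (length-hd {t} {xs} le) r q))
  ... | no ¬q = ∈-drop (2 ^ t) (subst (λ m → loc (suc t) xs m ∈ drop (2 ^ t) xs) r≡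
                  (subst (_∈ drop (2 ^ t) xs) (sym (loc-right t xs us ys r′))
                    (loc-∈ t (drop (2 ^ t) xs) (Unique-drop (2 ^ t) us) (All-drop (2 ^ t) ys) (length-tl {t} {xs} le) r′ r′<)))
    where
    w = weight (take (2 ^ t) xs)
    r′ = r ∸ w
    r≡ : w + r′ ≡ r
    r≡ = m+[n∸m]≡n (≮⇒≥ ¬q)
    r′< : r′ < weight (drop (2 ^ t) xs)
    r′< = +-cancelˡ-< w r′ _ (subst₂ _<_ (sym r≡) (weight-split t xs us ys) p)

modulo : ℕ → ℕ → ℕ
modulo r zero    = 0
modulo r (suc W) = r % suc W

modulo-< : ∀ r W → 1 ≤ W → modulo r W < W
modulo-< r (suc W) _ = m%n<n r (suc W)

module Representative {n : ℕ} (G : Graph n) (Y C : VSet n) (Y#C : Disjoint C Y) (z : Fin n) (t b : ℕ) where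

  W : ℕ
  W = form (adj G) C Y

  -- The end in `C` of an edge to `Y`, chosen uniformly up to the factor 2 lost in reducing a random
  -- number modulo the number of these edges.
  representative : Vec Bool b → DT n (Fin n)
  representative a = locate Y z t (elems C) (modulo (value a) W)

  private
    Y# : All (λ v → Y v ≡ false) (elems C)
    Y# = mapᴬ (λ {v} Cv → aux v Cv) (elems-All C)
      where
      aux : ∀ v → C v ≡ true → Y v ≡ false
      aux v Cv with Y v in e
      ... | true  = ⊥-elim (Y#C v Cv e)
      ... | false = refl

    W-weight : sumᴸ (mapᴸ (λ v → nb (adj G) v Y) (elems C)) ≡ W
    W-weight = sum-elems C (λ v → nb (adj G) v Y)

  module _ (le : card C ≤ 2 ^ t) (W>0 : 1 ≤ W) where

    private
      le′ : length (elems C) ≤ 2 ^ t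
      le′ = ≤-trans (≤-reflexive (length-elems C)) le

    representative-∈ : ∀ a → C (run G (representative a)) ≡ true
    representative-∈ a = lookupᴬ (elems-All C) (Locate.loc-∈ G Y z t (elems C) (elems-Unique C) Y# le′ _
      (subst (modulo (value a) W <_) (sym W-weight) (modulo-< (value a) W W>0)))

    module _ (W≤ : W ≤ 2 ^ b) (g : Fin n → ℕ) where

      private
        h : ℕ → ℕ
        h r = g (run G (locate Y z t (elems C) r))
        S : ℕ
        S = ∑ (λ v → ⟦ C v ⟧ * (nb (adj G) v Y * g v))

        ∑h : ∑< W h ≡ S
        ∑h = trans (cong (λ m → ∑< m h) (sym W-weight))
               (trans (Locate.loc-sum G Y z t (elems C) (elems-Unique C) Y# le′ g)
                 (sum-elems C (λ v → nb (adj G) v Y * g v)))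

        upper : ∀ V → 1 ≤ V → V ≤ 2 ^ b → V * ∑< (2 ^ b) (λ r → h (modulo r V)) ≤ 2 * (2 ^ b * ∑< V h)
        upper (suc V) _ p = ∑<-mod-≤ (suc V) h (2 ^ b) p

        lower : ∀ V → 1 ≤ V → V ≤ 2 ^ b → 2 ^ b * ∑< V h ≤ 2 * (V * ∑< (2 ^ b) (λ r → h (modulo r V)))
        lower (suc V) _ p = ∑<-mod-≥ (suc V) h (2 ^ b) p

      representative-≤ : W * total (bits b) (λ a → g (run G (representative a))) ≤ 2 * (vol (bits b) * S)
      representative-≤ = subst₂ _≤_ (cong (W *_) (sym (total-value b (λ r → h (modulo r W)))))
        (cong (2 *_) (cong₂ _*_ (sym (vol-bits b)) ∑h)) (upper W W>0 W≤)

      representative-≥ : vol (bits b) * S ≤ 2 * (W * total (bits b) (λ a → g (run G (representative a))))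
      representative-≥ = subst₂ _≤_ (cong₂ _*_ (sym (vol-bits b)) ∑h)
        (cong (λ e → 2 * (W * e)) (sym (total-value b (λ r → h (modulo r W))))) (lower W W>0 W≤)

opaque
  -- The reciprocal of `Q` times the guaranteed success probability of an attempt; the value 64 is
  -- computed in `success-lower`.
  odds : ℕ
  odds = 64

  odds-def : odds ≡ 64
  odds-def = refl

  1≤odds : 1 ≤ odds
  1≤odds = s≤s z≤n

-- One phase of the contraction

-- Clusters are the fibres of lab. A cluster is frozen once it has few edges to other unfrozen clusters.
module ContractPhase {n : ℕ} (k L q b δ ℓ : ℕ) (lab : Fin n → Fin n) (fz : VSet n) where

  open Pick {n} k L pairQ

  inC : Fin n → VSet n
  inC l v = lab v == l

  size : Fin n → ℕ
  size l = card (inC l)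

  act : VSet n
  act v = not (fz (lab v))

  out : Fin n → VSet n
  out l v = act v ∧ not (lab v == l)

  -- Empty labels are excluded explicitly, because a cluster that joins another one leaves its label
  -- behind without vertices.
  small : VSet n
  small l = not (fz l) ∧ ((0 <ᵇ size l) ∧ (size l <ᵇ 2 ^ suc ℓ))

  -- A small cluster attempts a merge if its out-degree is at least half of this. While
  -- `2 ^ (ℓ + 2) < δ`, a simple graph guarantees that by `half-degree`. Later, the constant 32 lets
  -- each vertex of a frozen cluster account for only 32 edge ends, and it still makes the bound at
  -- least `8 δ`, far above any cut of fewer than `δ` edges.
  bound : ℕ
  bound = 2 ^ ℓ * (if 2 ^ suc (suc ℓ) <ᵇ δ then δ else 32)

  att low : (Fin n → ℕ) → VSet n
  att D l = small l ∧ (bound ≤ᵇ 2 * D l)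
  low D l = small l ∧ not (bound ≤ᵇ 2 * D l)

  xC sC βC Ω : Code
  xC = pow n (bits q)
  sC = pow n (bits b)
  βC = pow n (bits (suc L))
  Ω  = xC ⊗ (sC ⊗ βC)

  inX : Seed xC → VSet n
  inX x l = leading q (lookup x l)

  -- Only clusters in `X` call, and they call only unfrozen clusters outside `X`. Hence a cluster
  -- that is called does not move itself, and no chains of merges arise.
  Yset : Seed xC → VSet n
  Yset x v = act v ∧ not (inX x (lab v))

  dQ : Fin n → DT n ℕ
  dQ l = guard (small l) 0 (pairQ (inC l) (out l))

  wQ : Seed xC → (Fin n → ℕ) → Fin n → DT n ℕ
  wQ x D l = guard (att D l ∧ inX x l) 0 (pairQ (inC l) (Yset x))

  -- A caller gives up unless an eighth of its out-edges lead to `Y`. This bounds the probability of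
  -- a given edge in terms of `D`, which is known to be large, instead of the random `W`.
  go : Seed xC → (Fin n → ℕ) → (Fin n → ℕ) → VSet n
  go x D W l = (att D l ∧ inX x l) ∧ ((0 <ᵇ W l) ∧ (D l ≤ᵇ 8 * W l))

  repQ : Seed xC → Seed sC → (Fin n → ℕ) → (Fin n → ℕ) → Fin n → DT n (Fin n)
  repQ x s D W l = guard (go x D W l) l (locate (Yset x) l (suc ℓ) (elems (inC l)) (modulo (value (lookup s l)) (W l)))

  reps : Seed xC → (Fin n → ℕ) → (Fin n → ℕ) → (Fin n → Fin n) → VSet n
  reps x D W rep v = go x D W (lab v) ∧ (v == rep (lab v))

  merge : Seed xC → (Fin n → ℕ) → (Fin n → ℕ) → (Fin n → Fin n) → (Fin n → Maybe (Fin n)) → Fin n → Maybe (Fin n)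
  merge x D W rep p l = if go x D W l then p (rep l) else nothing

  phase₃ : Seed Ω → (Fin n → ℕ) → (Fin n → ℕ) → (Fin n → Fin n) → DT n (VSet n × (Fin n → Maybe (Fin n)))
  phase₃ (x , s , β) D W rep = pickPhase (reps x D W rep) (Yset x) β >>= λ p → ret (low D , merge x D W rep p)

  phase₂ : Seed Ω → (Fin n → ℕ) → (Fin n → ℕ) → DT n (VSet n × (Fin n → Maybe (Fin n)))
  phase₂ (x , s , β) D W = forFin (repQ x s D W) >>= phase₃ (x , s , β) D W

  phase₁ : Seed Ω → (Fin n → ℕ) → DT n (VSet n × (Fin n → Maybe (Fin n)))
  phase₁ (x , s , β) D = forFin (wQ x D) >>= phase₂ (x , s , β) D

  phase : Seed Ω → DT n (VSet n × (Fin n → Maybe (Fin n)))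
  phase ω = forFin dQ >>= phase₁ ω

-- The events `i w` exclude each other, since each one determines `t`. So the probability of picking
-- from a class of edges is a sum over their ends.
event-sum : ∀ {n} (t : Maybe (Fin n)) (c i : Fin n → Bool) →
  (∀ w → i w ≡ true → t ≡ just w) → (∀ w → t ≡ just w → i w ≡ true) →
  ⟦ maybe c false t ⟧ ≡ ∑ (λ w → ⟦ c w ⟧ * ⟦ i w ⟧)
event-sum nothing c i to from =
  sym (∑-zero _ (λ w → trans (cong (⟦ c w ⟧ *_) (⟦⟧-if0 (none w (bool-cases (i w))))) (*-zeroʳ ⟦ c w ⟧)))
  where
  none : ∀ w → i w ≡ true ⊎ i w ≡ false → i w ≡ false
  none w (inj₂ e) = e
  none w (inj₁ e) with to w e
  ... | ()
event-sum (just w₀) c i to from =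
  sym (trans (∑-cong (λ w → trans (cong (λ b → ⟦ c w ⟧ * ⟦ b ⟧) (only w (bool-cases (i w)))) (*-comm ⟦ c w ⟧ _)))
         (∑-δ w₀ (λ w → ⟦ c w ⟧)))
  where
  only : ∀ w → i w ≡ true ⊎ i w ≡ false → i w ≡ (w == w₀)
  only w (inj₁ e) with to w e
  ... | refl = trans e (sym (==-refl w))
  only w (inj₂ e) = trans e (sym (≢⇒== {i = w} {w₀} (λ { refl → true≢false (trans (sym (from w refl)) e) })))

zero-or-pos : ∀ m → m ≡ 0 ⊎ 1 ≤ m
zero-or-pos zero    = inj₁ refl
zero-or-pos (suc m) = inj₂ (s≤s z≤n)

-- Distribution of the edge picked by a caller

module ContractDist {n : ℕ} (k L q b δ ℓ : ℕ) (lab : Fin n → Fin n) (fz : VSet n)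
  (G : Graph n) (n≤2^L : n ≤ 2 ^ L) (n²≤2^b : n * n ≤ 2 ^ b) where

  open ContractPhase k L q b δ ℓ lab fz public
  open Pick {n} k L pairQ

  opaque

    D : Fin n → ℕ
    D = run G (forFin dQ)

    W : Seed xC → Fin n → ℕ
    W x = run G (forFin (wQ x D))

    rep : Seed xC → Seed sC → Fin n → Fin n
    rep x s = run G (forFin (repQ x s D (W x)))

    pk : Seed xC → Seed sC → Seed βC → Fin n → Maybe (Fin n)
    pk x s β = run G (pickPhase (reps x D (W x) (rep x s)) (Yset x) β)

    D-at : ∀ l → D l ≡ run G (dQ l)
    D-at = run-forFin G dQ

    W-at : ∀ x l → W x l ≡ run G (wQ x D l)
    W-at x = run-forFin G (wQ x D)

    rep-at : ∀ x s l → rep x s l ≡ run G (repQ x s D (W x) l)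
    rep-at x s = run-forFin G (repQ x s D (W x))

    run-phase′ : ∀ x s β → run G (phase (x , s , β)) ≡ (low D , merge x D (W x) (rep x s) (pk x s β))
    run-phase′ x s β = trans (run->>= G (forFin dQ) (phase₁ (x , s , β)))
      (trans (run->>= G (forFin (wQ x D)) (phase₂ (x , s , β) D))
        (trans (run->>= G (forFin (repQ x s D (W x))) (phase₃ (x , s , β) D (W x)))
          (run->>= G (pickPhase (reps x D (W x) (rep x s)) (Yset x) β) (λ p → ret (low D , merge x D (W x) (rep x s) p)))))

    pk-complete : ∀ x s β → Disjoint (reps x D (W x) (rep x s)) (Yset x) → ∀ {v w} → reps x D (W x) (rep x s) v ≡ true →
      PickDist.iso k L pairQ n≤2^L (adj G) (Yset x) v w β ≡ true → pk x s β v ≡ just w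
    pk-complete x s β dis {v} {w} Uv iw =
      Correct.pick-complete G n≤2^L (adj G) (run-pairQ G) (reps x D (W x) (rep x s)) (Yset x) dis β Uv
        (≡ᵇ-true _ 1 (proj₂ (∧-true {T ∧ adj G v w} iw))) (proj₁ (∧-true {T} Ti)) (proj₂ (∧-true {T} Ti))
      where
      T : Bool
      T = sample (Yset x) β (toℕ (class (nb (adj G) v (Yset x)))) w
      Ti : (T ∧ adj G v w) ≡ true
      Ti = proj₁ (∧-true {T ∧ adj G v w} iw)

    pk-sound : ∀ x s β → Disjoint (reps x D (W x) (rep x s)) (Yset x) → ∀ {v w} → pk x s β v ≡ just w →
      PickDist.iso k L pairQ n≤2^L (adj G) (Yset x) v w β ≡ true
    pk-sound x s β dis {v} {w} e with Correct.pick-sound G n≤2^L (adj G) (run-pairQ G) (reps x D (W x) (rep x s)) (Yset x) dis β {v} {w} e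
    ... | _ , Tw , Rw , one = ∧-intro (∧-intro Tw Rw) (cong (_≡ᵇ 1) one)

  degreeOut : Fin n → ℕ
  degreeOut l = form (adj G) (inC l) (out l)

  inC-out : ∀ l → Disjoint (inC l) (out l)
  inC-out l v p r = true≢false (trans (sym p) (not-true (proj₂ (∧-true {act v} r))))

  D-eq : ∀ l → small l ≡ true → D l ≡ degreeOut l
  D-eq l sl = trans (D-at l) (trans (run-guard G 0 (pairQ (inC l) (out l)) sl)
                (run-pairQ G (inC l) (out l) (inC-out l)))

  attD lowD : VSet n
  attD = att D
  lowD = low D

  tgt : Seed xC → Seed sC → Seed βC → Fin n → Maybe (Fin n)
  tgt x s β = merge x D (W x) (rep x s) (pk x s β)

  run-phase : ∀ x s β → run G (phase (x , s , β)) ≡ (lowD , tgt x s β)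
  run-phase = run-phase′

  inC-Y : ∀ x l → inX x l ≡ true → Disjoint (inC l) (Yset x)
  inC-Y x l Xl v p r = true≢false (trans (sym Xl) (trans (cong (inX x) (sym (==⇒≡ {i = lab v} p))) (not-true (proj₂ (∧-true {act v} r)))))

  W-eq : ∀ x l → (attD l ∧ inX x l) ≡ true → W x l ≡ form (adj G) (inC l) (Yset x)
  W-eq x l al = trans (W-at x l) (trans (run-guard G 0 (pairQ (inC l) (Yset x)) al)
    (run-pairQ G (inC l) (Yset x) (inC-Y x l (proj₂ (∧-true {attD l} al)))))

  form≤n² : ∀ I B → form (adj G) I B ≤ n * n
  form≤n² I B = ≤-trans (∑-mono (λ v → ≤-trans (⟦⟧*≤ (I v) _)
      (≤-trans (∑-mono (λ w → *-mono-≤ (⟦⟧≤1 (B w)) (⟦⟧≤1 (adj G v w)))) (≤-reflexive (trans (∑-const {n} 1) (*-identityʳ n))))))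
    (≤-reflexive (∑-const {n} n))

  event : (Fin n → Fin n → Bool) → Fin n → Seed xC → Seed sC → Seed βC → ℕ
  event c l x s β = ⟦ maybe (c l) false (tgt x s β l) ⟧

  -- The set of callers is fixed here. Two independent sources remain: `s` for the representative
  -- and `β` for its neighbour.
  module Fixed (x : Seed xC) (l : Fin n) (gl : go x D (W x) l ≡ true) where

    private
      Y = Yset x
      open PickDist k L pairQ n≤2^L (adj G) Y using (iso; iso-upper; iso-lower)

    att-l : attD l ≡ true
    att-l = proj₁ (∧-true {attD l} (proj₁ (∧-true {attD l ∧ inX x l} gl)))

    X-l : inX x l ≡ true
    X-l = proj₂ (∧-true {attD l} (proj₁ (∧-true {attD l ∧ inX x l} gl)))

    small-l : small l ≡ true
    small-l = proj₁ (∧-true {small l} att-l)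

    Wl-eq : W x l ≡ form (adj G) (inC l) Y
    Wl-eq = W-eq x l (proj₁ (∧-true {attD l ∧ inX x l} gl))

    Wl>0 : 1 ≤ W x l
    Wl>0 = <ᵇ-true (proj₁ (∧-true {0 <ᵇ W x l} (proj₂ (∧-true {attD l ∧ inX x l} gl))))

    D≤8W : D l ≤ 8 * W x l
    D≤8W = ≤ᵇ-true (proj₂ (∧-true {0 <ᵇ W x l} (proj₂ (∧-true {attD l ∧ inX x l} gl))))

    private
      module Rep = Representative G Y (inC l) (inC-Y x l X-l) l (suc ℓ) b

      size≤ : card (inC l) ≤ 2 ^ suc ℓ
      size≤ = <⇒≤ (<ᵇ-true (proj₂ (∧-true {0 <ᵇ size l} (proj₂ (∧-true {not (fz l)} small-l)))))

      W>0 : 1 ≤ Rep.W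
      W>0 = subst (1 ≤_) Wl-eq Wl>0

    rep-eq : ∀ s → rep x s l ≡ run G (Rep.representative (lookup s l))
    rep-eq s = trans (rep-at x s l)
      (trans (run-guard G l (locate Y l (suc ℓ) (elems (inC l)) (modulo (value (lookup s l)) (W x l))) gl)
        (cong (λ w → run G (locate Y l (suc ℓ) (elems (inC l)) (modulo (value (lookup s l)) w))) Wl-eq))

    lab-rep : ∀ s → lab (rep x s l) ≡ l
    lab-rep s = ==⇒≡ (subst (λ v → inC l v ≡ true) (sym (rep-eq s)) (Rep.representative-∈ size≤ W>0 (lookup s l)))

    module _ (s : Seed sC) (β : Seed βC) where

      private
        v = rep x s l
        Us = reps x D (W x) (rep x s)

        Us-v : Us v ≡ true
        Us-v = ∧-intro (trans (cong (go x D (W x)) (lab-rep s)) gl)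
                 (trans (cong (λ m → v == rep x s m) (lab-rep s)) (==-refl v))

        Us#Y : Disjoint Us Y
        Us#Y u p r = inC-Y x (lab u) (proj₂ (∧-true {attD (lab u)} (proj₁ (∧-true {attD (lab u) ∧ inX x (lab u)}
          (proj₁ (∧-true {go x D (W x) (lab u)} p)))))) u (==-refl (lab u)) r

      tgt-pk : tgt x s β l ≡ pk x s β v
      tgt-pk = if-true gl

      tgt-Y : ∀ w → tgt x s β l ≡ just w → Y w ≡ true
      tgt-Y w e = proj₁ (∧-true {Y w} (proj₁ (∧-true {sample Y β (toℕ (class (nb (adj G) v Y))) w} (proj₁ (∧-true
        {sample Y β (toℕ (class (nb (adj G) v Y))) w ∧ adj G v w} (pk-sound x s β Us#Y (trans (sym tgt-pk) e)))))))

      event-eq : ∀ c → event c l x s β ≡ ∑ (λ w → ⟦ c l w ⟧ * ⟦ iso v w β ⟧)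
      event-eq c = event-sum (tgt x s β l) (c l) (λ w → iso v w β)
        (λ w iw → trans tgt-pk (pk-complete x s β Us#Y Us-v iw))
        (λ w e → pk-sound x s β Us#Y (trans (sym tgt-pk) e))

    module Distribution (c : Fin n → Fin n → Bool) where

      edgesY : ℕ
      edgesY = form (adj G) (inC l) (λ w → Y w ∧ c l w)

      E : ℕ
      E = total sC (λ s → total βC (event c l x s))

      private
        vs = vol sC
        vβ = vol βC
        vb = vol (bits b)

        g : Fin n → ℕ
        g v = total βC (λ β → ∑ (λ w → ⟦ c l w ⟧ * ⟦ iso v w β ⟧))

        d : Fin n → ℕ
        d v = nb (adj G) v Y

        S : ℕ
        S = ∑ (λ v → ⟦ inC l v ⟧ * (d v * g v))

        g′ : Vec Bool b → ℕ
        g′ a = g (run G (Rep.representative a))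

        E-marginal : E * vb ≡ vs * total (bits b) g′
        E-marginal = trans (cong (_* vb) (total-cong sC (λ s → trans (total-cong βC (λ β → event-eq s β c))
                       (cong g (rep-eq s))))) (total-marginal (bits b) g′ l)

        vb>0 : 1 ≤ vb
        vb>0 = vol-pos (bits b)

        W≤2^b : Rep.W ≤ 2 ^ b
        W≤2^b = ≤-trans (form≤n² (inC l) Y) n²≤2^b

        g-sum : ∀ v → g v ≡ ∑ (λ w → ⟦ c l w ⟧ * total βC (λ β → ⟦ iso v w β ⟧))
        g-sum v = trans (total-∑ βC (λ w β → ⟦ c l w ⟧ * ⟦ iso v w β ⟧)) (∑-cong (λ w → total-*ˡ βC ⟦ c l w ⟧ _))

        nbc : Fin n → ℕ
        nbc v = nb (adj G) v (λ w → Y w ∧ c l w)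

        reorder : ∀ v w → ⟦ c l w ⟧ * (⟦ Y w ⟧ * ⟦ adj G v w ⟧ * vβ) ≡ ⟦ Y w ∧ c l w ⟧ * ⟦ adj G v w ⟧ * vβ
        reorder v w = trans (solve 4 (λ c y a V → c :* (y :* a :* V) := y :* c :* a :* V) refl ⟦ c l w ⟧ ⟦ Y w ⟧ ⟦ adj G v w ⟧ vβ)
                        (cong (λ z → z * ⟦ adj G v w ⟧ * vβ) (sym (⟦∧⟧ (Y w) (c l w))))

        upper-v : ∀ v → 2 * (d v * g v) ≤ nbc v * vβ
        upper-v v with zero-or-pos (d v)
        ... | inj₁ d≡0 = subst (λ z → 2 * (z * g v) ≤ nbc v * vβ) (sym d≡0) z≤n
        ... | inj₂ d>0 = begin
          2 * (d v * g v)
            ≡⟨ solve 2 (λ d g → con 2 :* (d :* g) := g :* (con 2 :* d)) refl (d v) (g v) ⟩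
          g v * (2 * d v)
            ≡⟨ trans (cong (_* (2 * d v)) (g-sum v)) (sym (∑-*ʳ (2 * d v) _)) ⟩
          ∑ (λ w → ⟦ c l w ⟧ * total βC (λ β → ⟦ iso v w β ⟧) * (2 * d v))
            ≤⟨ ∑-mono (λ w → ≤-trans (≤-reflexive (*-assoc ⟦ c l w ⟧ _ _)) (≤-trans
                 (*-monoʳ-≤ ⟦ c l w ⟧ (iso-upper v d>0 w)) (≤-reflexive (reorder v w)))) ⟩
          ∑ (λ w → ⟦ Y w ∧ c l w ⟧ * ⟦ adj G v w ⟧ * vβ)
            ≡⟨ ∑-*ʳ vβ _ ⟩
          nbc v * vβ ∎
          where open ≤-Reasoning

        lower-v : ∀ v → nbc v * vβ ≤ 8 * (d v * g v)
        lower-v v with zero-or-pos (d v)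
        ... | inj₁ d≡0 = subst (λ z → z * vβ ≤ 8 * (d v * g v)) (sym nbc0) z≤n
          where
          nbc0 : nbc v ≡ 0
          nbc0 = n≤0⇒n≡0 (≤-trans (nb-mono (adj G) v {λ w → Y w ∧ c l w} {Y} (λ w p → proj₁ (∧-true {Y w} p))) (≤-reflexive d≡0))
        ... | inj₂ d>0 = begin
          nbc v * vβ
            ≡⟨ sym (∑-*ʳ vβ _) ⟩
          ∑ (λ w → ⟦ Y w ∧ c l w ⟧ * ⟦ adj G v w ⟧ * vβ)
            ≤⟨ ∑-mono (λ w → ≤-trans (≤-reflexive (sym (reorder v w))) (term w)) ⟩
          ∑ (λ w → 8 * d v * (⟦ c l w ⟧ * total βC (λ β → ⟦ iso v w β ⟧)))
            ≡⟨ trans (∑-*ˡ (8 * d v) _) (cong (8 * d v *_) (sym (g-sum v))) ⟩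
          8 * d v * g v
            ≡⟨ *-assoc 8 (d v) (g v) ⟩
          8 * (d v * g v) ∎
          where
          open ≤-Reasoning
          term : ∀ w → ⟦ c l w ⟧ * (⟦ Y w ⟧ * ⟦ adj G v w ⟧ * vβ) ≤ 8 * d v * (⟦ c l w ⟧ * total βC (λ β → ⟦ iso v w β ⟧))
          term w = ≤-trans (*-monoʳ-≤ ⟦ c l w ⟧ (bnd (Y w) (adj G v w) refl refl))
            (≤-reflexive (solve 3 (λ c e t → c :* (e :* t) := e :* (c :* t)) refl ⟦ c l w ⟧ (8 * d v) (total βC (λ β → ⟦ iso v w β ⟧))))
            where
            bnd : ∀ y a → Y w ≡ y → adj G v w ≡ a → ⟦ y ⟧ * ⟦ a ⟧ * vβ ≤ 8 * d v * total βC (λ β → ⟦ iso v w β ⟧)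
            bnd true  true  Yw Rw = ≤-trans (≤-reflexive (+-identityʳ vβ)) (iso-lower v d>0 w Yw Rw)
            bnd true  false Yw Rw = z≤n
            bnd false a     Yw Rw = z≤n

      -- The factor 2 lost in reducing modulo `W` is regained, because isolation has probability at
      -- most `1 / (2 d)`: an edge of the class is picked with probability at most `edgesY / W`.
      dist-upper : W x l * E ≤ edgesY * (vs * vβ)
      dist-upper = subst (λ z → z * E ≤ edgesY * (vs * vβ)) (sym Wl-eq) (*-cancelʳ-≤ _ _ vb {{>-nonZero vb>0}} (begin
        Rep.W * E * vb                          ≡⟨ trans (*-assoc Rep.W E vb) (cong (Rep.W *_) E-marginal) ⟩
        Rep.W * (vs * total (bits b) g′)        ≡⟨ solve 3 (λ w s t → w :* (s :* t) := s :* (w :* t)) refl Rep.W vs (total (bits b) g′) ⟩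
        vs * (Rep.W * total (bits b) g′)        ≤⟨ *-monoʳ-≤ vs (Rep.representative-≤ size≤ W>0 W≤2^b g) ⟩
        vs * (2 * (vb * S))                     ≡⟨ solve 3 (λ s v S → s :* (con 2 :* (v :* S)) := (con 2 :* S) :* (s :* v)) refl vs vb S ⟩
        2 * S * (vs * vb)                       ≤⟨ *-monoˡ-≤ (vs * vb) S-upper ⟩
        edgesY * vβ * (vs * vb)                 ≡⟨ solve 4 (λ e v s b → e :* v :* (s :* b) := e :* (s :* v) :* b) refl edgesY vβ vs vb ⟩
        edgesY * (vs * vβ) * vb ∎))
        where
        open ≤-Reasoning
        S-upper : 2 * S ≤ edgesY * vβ
        S-upper = begin
          2 * S ≡⟨ sym (∑-*ˡ 2 _) ⟩
          ∑ (λ v → 2 * (⟦ inC l v ⟧ * (d v * g v)))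
            ≤⟨ ∑-mono (λ v → ≤-trans (≤-reflexive (solve 2 (λ i z → con 2 :* (i :* z) := i :* (con 2 :* z)) refl ⟦ inC l v ⟧ (d v * g v)))
                 (≤-trans (*-monoʳ-≤ ⟦ inC l v ⟧ (upper-v v)) (≤-reflexive (sym (*-assoc ⟦ inC l v ⟧ (nbc v) vβ))))) ⟩
          ∑ (λ v → ⟦ inC l v ⟧ * nbc v * vβ) ≡⟨ ∑-*ʳ vβ _ ⟩
          edgesY * vβ ∎

      -- A factor 2 is lost in the reduction modulo `W` and a factor 8 in the isolation, hence 16.
      dist-lower : edgesY * (vs * vβ) ≤ 16 * (W x l * E)
      dist-lower = subst (λ z → edgesY * (vs * vβ) ≤ 16 * (z * E)) (sym Wl-eq) (*-cancelʳ-≤ _ _ vb {{>-nonZero vb>0}} (begin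
        edgesY * (vs * vβ) * vb                 ≡⟨ solve 4 (λ e v s b → e :* (s :* v) :* b := e :* v :* (s :* b)) refl edgesY vβ vs vb ⟩
        edgesY * vβ * (vs * vb)                 ≤⟨ *-monoˡ-≤ (vs * vb) S-lower ⟩
        8 * S * (vs * vb)                       ≡⟨ solve 3 (λ s v S → con 8 :* S :* (s :* v) := con 8 :* (s :* (v :* S))) refl vs vb S ⟩
        8 * (vs * (vb * S))                     ≤⟨ *-monoʳ-≤ 8 (*-monoʳ-≤ vs (Rep.representative-≥ size≤ W>0 W≤2^b g)) ⟩
        8 * (vs * (2 * (Rep.W * total (bits b) g′))) ≡⟨ solve 3 (λ w s t → con 8 :* (s :* (con 2 :* (w :* t))) := con 16 :* (w :* (s :* t))) refl Rep.W vs (total (bits b) g′) ⟩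
        16 * (Rep.W * (vs * total (bits b) g′)) ≡⟨ cong (λ z → 16 * (Rep.W * z)) (sym E-marginal) ⟩
        16 * (Rep.W * (E * vb))                 ≡⟨ solve 3 (λ w e v → con 16 :* (w :* (e :* v)) := con 16 :* (w :* e) :* v) refl Rep.W E vb ⟩
        16 * (Rep.W * E) * vb ∎))
        where
        open ≤-Reasoning
        S-lower : edgesY * vβ ≤ 8 * S
        S-lower = begin
          edgesY * vβ ≡⟨ sym (∑-*ʳ vβ _) ⟩
          ∑ (λ v → ⟦ inC l v ⟧ * nbc v * vβ)
            ≤⟨ ∑-mono (λ v → ≤-trans (≤-reflexive (*-assoc ⟦ inC l v ⟧ (nbc v) vβ)) (≤-trans (*-monoʳ-≤ ⟦ inC l v ⟧ (lower-v v))
                 (≤-reflexive (solve 2 (λ i z → i :* (con 8 :* z) := con 8 :* (i :* z)) refl ⟦ inC l v ⟧ (d v * g v))))) ⟩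
          ∑ (λ v → 8 * (⟦ inC l v ⟧ * (d v * g v))) ≡⟨ ∑-*ˡ 8 _ ⟩
          8 * S ∎

-- Averages over the random set of callers

module ContractAverage {n : ℕ} (k L q b δ ℓ : ℕ) (lab : Fin n → Fin n) (fz : VSet n)
  (G : Graph n) (n≤2^L : n ≤ 2 ^ L) (n²≤2^b : n * n ≤ 2 ^ b) where

  open ContractDist k L q b δ ℓ lab fz G n≤2^L n²≤2^b public

  eventΩ : (Fin n → Fin n → Bool) → Fin n → Seed Ω → ℕ
  eventΩ c l (x , s , β) = event c l x s β

  EΩ : (Fin n → Fin n → Bool) → Fin n → ℕ
  EΩ c l = total Ω (eventΩ c l)

  Q vx V : ℕ
  Q = 2 ^ q
  vx = vol xC
  V = vol sC * vol βC

  vol-Ω : vol Ω ≡ vx * V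
  vol-Ω = trans (vol-⊗ xC (sC ⊗ βC)) (cong (vx *_) (vol-⊗ sC βC))

  total-Ω : ∀ f → total Ω f ≡ total xC (λ x → total sC (λ s → total βC (λ β → f (x , s , β))))
  total-Ω f = trans (total-⊗ xC (sC ⊗ βC) f) (total-cong xC (λ x → total-⊗ sC βC (λ t → f (x , t))))

  Ex : (Fin n → Fin n → Bool) → Fin n → Seed xC → ℕ
  Ex c l x = total sC (λ s → total βC (event c l x s))

  EΩ-eq : ∀ c l → EΩ c l ≡ total xC (Ex c l)
  EΩ-eq c l = total-Ω (eventΩ c l)

  edges : (Fin n → Fin n → Bool) → Fin n → ℕ
  edges c l = form (adj G) (inC l) (λ w → out l w ∧ c l w)

  private
    TX : Fin n → ℕ
    TX l = total xC (λ x → ⟦ inX x l ⟧)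

    TXX : Fin n → Fin n → ℕ
    TXX l l′ = total xC (λ x → ⟦ inX x l ⟧ * ⟦ inX x l′ ⟧)

    TX-eq : ∀ l → TX l * Q ≡ vx
    TX-eq = leading-marginal q q ≤-refl

    TXX-eq : ∀ l l′ → l ≢ l′ → TXX l l′ * (Q * Q) ≡ vx
    TXX-eq = leading-marginal₂ q q ≤-refl

    Ex-zero : ∀ c l x → go x D (W x) l ≡ false → Ex c l x ≡ 0
    Ex-zero c l x gl = trans (total-cong sC (λ s → trans (total-cong βC (λ β → cong (λ t → ⟦ maybe (c l) false t ⟧) (if-false gl)))
      (total-const βC 0))) (total-const sC 0)

    Y⊆out : ∀ x l → inX x l ≡ true → ∀ w → Yset x w ≡ true → out l w ≡ true
    Y⊆out x l Xl w Yw with lab w ≟ᶠ l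
    ... | no _ = ∧-intro (proj₁ (∧-true {act w} Yw)) refl
    ... | yes refl = ⊥-elim (true≢false (trans (sym Xl) (not-true (proj₂ (∧-true {act w} Yw)))))

    form-mono : ∀ I {A B : VSet n} → (∀ w → A w ≡ true → B w ≡ true) → form (adj G) I A ≤ form (adj G) I B
    form-mono I {A} {B} h = ∑-mono (λ v → *-monoʳ-≤ ⟦ I v ⟧ (nb-mono (adj G) v {A} {B} h))

    edgesY : (Fin n → Fin n → Bool) → Fin n → Seed xC → ℕ
    edgesY c l x = form (adj G) (inC l) (λ w → Yset x w ∧ c l w)

    edgesY≤ : ∀ c l x → inX x l ≡ true → edgesY c l x ≤ edges c l
    edgesY≤ c l x Xl = form-mono (inC l) (λ w p →
      ∧-intro (Y⊆out x l Xl w (proj₁ (∧-true {Yset x w} p))) (proj₂ (∧-true {Yset x w} p)))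

    edgesY≤W : ∀ c l x → (attD l ∧ inX x l) ≡ true → edgesY c l x ≤ W x l
    edgesY≤W c l x al = ≤-trans (form-mono (inC l) (λ w p → proj₁ (∧-true {Yset x w} p))) (≤-reflexive (sym (W-eq x l al)))

    W≤D : ∀ l x → (attD l ∧ inX x l) ≡ true → W x l ≤ D l
    W≤D l x al = ≤-trans (≤-reflexive (W-eq x l al)) (≤-trans
      (form-mono (inC l) (Y⊆out x l (proj₂ (∧-true {attD l} al))))
      (≤-reflexive (sym (D-eq l (proj₁ (∧-true {small l} (proj₁ (∧-true {attD l} al))))))))

    upper-x : ∀ c l x → D l * Ex c l x ≤ ⟦ inX x l ⟧ * (8 * (edges c l * V))
    upper-x c l x with bool-cases (go x D (W x) l)
    ... | inj₂ gl = ≤-trans (≤-reflexive (trans (cong (D l *_) (Ex-zero c l x gl)) (*-zeroʳ (D l)))) z≤n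
    ... | inj₁ gl = begin
      D l * Ex c l x                          ≤⟨ *-monoˡ-≤ (Ex c l x) (Fixed.D≤8W x l gl) ⟩
      8 * W x l * Ex c l x                    ≡⟨ *-assoc 8 (W x l) (Ex c l x) ⟩
      8 * (W x l * Ex c l x)                  ≤⟨ *-monoʳ-≤ 8 found ⟩
      8 * (edgesY c l x * V)                  ≤⟨ *-monoʳ-≤ 8 (*-monoˡ-≤ V (edgesY≤ c l x (Fixed.X-l x l gl))) ⟩
      8 * (edges c l * V)                     ≡⟨ sym (⟦⟧*-1 (8 * (edges c l * V)) (Fixed.X-l x l gl)) ⟩
      ⟦ inX x l ⟧ * (8 * (edges c l * V)) ∎
      where
      open ≤-Reasoning
      found : W x l * Ex c l x ≤ edgesY c l x * V
      found = Fixed.Distribution.dist-upper x l gl c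

    -- If a caller gives up, then `8 edgesY ≤ 8 W ≤ D`, so the second term on the right covers the
    -- loss.
    lower-x : ∀ c l x → attD l ≡ true →
              ⟦ inX x l ⟧ * (8 * (edgesY c l x * V)) ≤ 8 * (16 * (D l * Ex c l x)) + ⟦ inX x l ⟧ * (D l * V)
    lower-x c l x al = outside (bool-cases (inX x l))
      where
      open ≤-Reasoning
      goal = ⟦ inX x l ⟧ * (8 * (edgesY c l x * V)) ≤ 8 * (16 * (D l * Ex c l x)) + ⟦ inX x l ⟧ * (D l * V)

      balanced : Bool
      balanced = (0 <ᵇ W x l) ∧ (D l ≤ᵇ 8 * W x l)

      found : inX x l ≡ true → balanced ≡ true → edgesY c l x * V ≤ 16 * (W x l * Ex c l x)
      found Xl r = Fixed.Distribution.dist-lower x l (∧-intro (∧-intro al Xl) r) c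

      few : balanced ≡ false → W x l ≡ 0 ⊎ 1 ≤ W x l → (D l ≤ᵇ 8 * W x l) ≡ true ⊎ (D l ≤ᵇ 8 * W x l) ≡ false → 8 * W x l ≤ D l
      few r (inj₁ W≡0) _        = subst (λ w → 8 * w ≤ D l) (sym W≡0) z≤n
      few r (inj₂ W>0) (inj₁ t) = ⊥-elim (true≢false (trans (sym (∧-intro (<ᵇ-intro W>0) t)) r))
      few r (inj₂ W>0) (inj₂ f) = <⇒≤ (≤ᵇ-false {D l} {8 * W x l} f)

      inside : inX x l ≡ true → balanced ≡ true ⊎ balanced ≡ false → goal
      inside Xl (inj₁ r) = begin
        ⟦ inX x l ⟧ * (8 * (edgesY c l x * V))  ≡⟨ ⟦⟧*-1 (8 * (edgesY c l x * V)) Xl ⟩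
        8 * (edgesY c l x * V)                  ≤⟨ *-monoʳ-≤ 8 (found Xl r) ⟩
        8 * (16 * (W x l * Ex c l x))           ≤⟨ *-monoʳ-≤ 8 (*-monoʳ-≤ 16 (*-monoˡ-≤ (Ex c l x) (W≤D l x (∧-intro al Xl)))) ⟩
        8 * (16 * (D l * Ex c l x))             ≤⟨ m≤m+n (8 * (16 * (D l * Ex c l x))) (⟦ inX x l ⟧ * (D l * V)) ⟩
        8 * (16 * (D l * Ex c l x)) + ⟦ inX x l ⟧ * (D l * V) ∎
      inside Xl (inj₂ r) = begin
        ⟦ inX x l ⟧ * (8 * (edgesY c l x * V))  ≤⟨ *-monoʳ-≤ ⟦ inX x l ⟧ (≤-trans (≤-reflexive (sym (*-assoc 8 (edgesY c l x) V)))
                                                     (*-monoˡ-≤ V (≤-trans (*-monoʳ-≤ 8 (edgesY≤W c l x (∧-intro al Xl)))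
                                                       (few r (zero-or-pos (W x l)) (bool-cases (D l ≤ᵇ 8 * W x l)))))) ⟩
        ⟦ inX x l ⟧ * (D l * V)                 ≤⟨ m≤n+m (⟦ inX x l ⟧ * (D l * V)) (8 * (16 * (D l * Ex c l x))) ⟩
        8 * (16 * (D l * Ex c l x)) + ⟦ inX x l ⟧ * (D l * V) ∎

      outside : inX x l ≡ true ⊎ inX x l ≡ false → goal
      outside (inj₂ Xl) = ≤-trans (≤-reflexive (⟦⟧*-0 (8 * (edgesY c l x * V)) Xl)) z≤n
      outside (inj₁ Xl) = inside Xl (bool-cases balanced)

  -- A cluster calls with probability `1 / Q`, and a caller picks from the class with probability at
  -- most `8 edges / D`.
  hits-upper : ∀ c l → D l * EΩ c l * Q ≤ 8 * (edges c l * vol Ω)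
  hits-upper c l = begin
    D l * EΩ c l * Q
      ≡⟨ cong (λ z → D l * z * Q) (EΩ-eq c l) ⟩
    D l * total xC (Ex c l) * Q
      ≡⟨ cong (_* Q) (sym (total-*ˡ xC (D l) (Ex c l))) ⟩
    total xC (λ x → D l * Ex c l x) * Q
      ≤⟨ *-monoˡ-≤ Q (total-mono xC (upper-x c l)) ⟩
    total xC (λ x → ⟦ inX x l ⟧ * (8 * (edges c l * V))) * Q
      ≡⟨ cong (_* Q) (total-*ʳ xC (8 * (edges c l * V)) (λ x → ⟦ inX x l ⟧)) ⟩
    TX l * (8 * (edges c l * V)) * Q
      ≡⟨ solve 4 (λ t e v q → t :* (con 8 :* (e :* v)) :* q := con 8 :* (e :* ((t :* q) :* v))) refl (TX l) (edges c l) V Q ⟩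
    8 * (edges c l * ((TX l * Q) * V))
      ≡⟨ cong (λ z → 8 * (edges c l * z)) (trans (cong (_* V) (TX-eq l)) (sym vol-Ω)) ⟩
    8 * (edges c l * vol Ω) ∎
    where open ≤-Reasoning

  inXΩ : Seed Ω → VSet n
  inXΩ (x , _) = inX x

  -- Requiring that a second cluster is a caller as well costs another factor `1 / Q`, by pairwise
  -- independence.
  hits-pair : ∀ c l l′ → l ≢ l′ → D l * total Ω (λ ω → ⟦ inXΩ ω l′ ⟧ * eventΩ c l ω) * (Q * Q) ≤ 8 * (edges c l * vol Ω)
  hits-pair c l l′ ne = begin
    D l * total Ω (λ ω → ⟦ inXΩ ω l′ ⟧ * eventΩ c l ω) * (Q * Q)
      ≡⟨ cong (λ z → D l * z * (Q * Q)) (trans (total-Ω _) (total-cong xC (λ x →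
           trans (total-cong sC (λ s → total-*ˡ βC ⟦ inX x l′ ⟧ _)) (total-*ˡ sC ⟦ inX x l′ ⟧ _)))) ⟩
    D l * total xC (λ x → ⟦ inX x l′ ⟧ * Ex c l x) * (Q * Q)
      ≡⟨ cong (_* (Q * Q)) (trans (sym (total-*ˡ xC (D l) _)) (total-cong xC (λ x →
           solve 3 (λ d i e → d :* (i :* e) := i :* (d :* e)) refl (D l) ⟦ inX x l′ ⟧ (Ex c l x)))) ⟩
    total xC (λ x → ⟦ inX x l′ ⟧ * (D l * Ex c l x)) * (Q * Q)
      ≤⟨ *-monoˡ-≤ (Q * Q) (total-mono xC (λ x → ≤-trans (*-monoʳ-≤ ⟦ inX x l′ ⟧ (upper-x c l x))
           (≤-reflexive (solve 3 (λ i j e → i :* (j :* e) := j :* i :* e) refl ⟦ inX x l′ ⟧ ⟦ inX x l ⟧ (8 * (edges c l * V)))))) ⟩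
    total xC (λ x → ⟦ inX x l ⟧ * ⟦ inX x l′ ⟧ * (8 * (edges c l * V))) * (Q * Q)
      ≡⟨ cong (_* (Q * Q)) (total-*ʳ xC (8 * (edges c l * V)) (λ x → ⟦ inX x l ⟧ * ⟦ inX x l′ ⟧)) ⟩
    TXX l l′ * (8 * (edges c l * V)) * (Q * Q)
      ≡⟨ solve 4 (λ t e v q → t :* (con 8 :* (e :* v)) :* q := con 8 :* (e :* ((t :* q) :* v))) refl (TXX l l′) (edges c l) V (Q * Q) ⟩
    8 * (edges c l * ((TXX l l′ * (Q * Q)) * V))
      ≡⟨ cong (λ z → 8 * (edges c l * z)) (trans (cong (_* V) (TXX-eq l l′ ne)) (sym vol-Ω)) ⟩
    8 * (edges c l * vol Ω) ∎
    where open ≤-Reasoning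

  private
    A : (Fin n → Fin n → Bool) → Fin n → ℕ
    A c l = total xC (λ x → ⟦ inX x l ⟧ * edgesY c l x)

    -- An out-edge is usable if its cluster calls and the cluster at the other end does not, an
    -- event of probability `1 / Q − 1 / Q ^ 2`.
    split-w : (c : Fin n → Fin n → Bool) (l w : Fin n) → ⟦ out l w ∧ c l w ⟧ * (Q * vx) ≤
      total xC (λ x → ⟦ inX x l ⟧ * ⟦ Yset x w ∧ c l w ⟧) * (Q * Q) + ⟦ out l w ∧ c l w ⟧ * vx
    split-w c l w with bool-cases (out l w ∧ c l w)
    ... | inj₂ f = ≤-trans (≤-reflexive (⟦⟧*-0 (Q * vx) f)) z≤n
    ... | inj₁ t = begin
      ⟦ out l w ∧ c l w ⟧ * (Q * vx)                       ≡⟨ ⟦⟧*-1 (Q * vx) t ⟩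
      Q * vx                                               ≡⟨ cong (Q *_) (sym (TX-eq l)) ⟩
      Q * (TX l * Q)                                       ≡⟨ solve 2 (λ q t → q :* (t :* q) := t :* (q :* q)) refl Q (TX l) ⟩
      TX l * (Q * Q)                                       ≡⟨ cong (_* (Q * Q)) TX-split ⟩
      (T′ + TXX l (lab w)) * (Q * Q)                       ≡⟨ *-distribʳ-+ (Q * Q) T′ _ ⟩
      T′ * (Q * Q) + TXX l (lab w) * (Q * Q)               ≡⟨ cong (T′ * (Q * Q) +_) (trans (TXX-eq l (lab w) ne) (sym (⟦⟧*-1 vx t))) ⟩
      T′ * (Q * Q) + ⟦ out l w ∧ c l w ⟧ * vx ∎
      where
      open ≤-Reasoning
      ol = proj₁ (∧-true {out l w} t)
      cl = proj₂ (∧-true {out l w} t)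
      ne : l ≢ lab w
      ne e = true≢false (trans (sym (proj₂ (∧-true {act w} ol))) (cong not (trans (cong (_== l) (sym e)) (==-refl l))))
      T′ = total xC (λ x → ⟦ inX x l ⟧ * ⟦ Yset x w ∧ c l w ⟧)
      TX-split : TX l ≡ T′ + TXX l (lab w)
      TX-split = trans (total-cong xC (λ x → pw x)) (total-+ xC (λ x → ⟦ inX x l ⟧ * ⟦ Yset x w ∧ c l w ⟧) _)
        where
        pw : ∀ x → ⟦ inX x l ⟧ ≡ ⟦ inX x l ⟧ * ⟦ Yset x w ∧ c l w ⟧ + ⟦ inX x l ⟧ * ⟦ inX x (lab w) ⟧
        pw x = trans (sym (*-identityʳ ⟦ inX x l ⟧)) (trans (cong (⟦ inX x l ⟧ *_) (inner (act w) (c l w) (inX x (lab w)) (proj₁ (∧-true {act w} ol)) cl))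
                 (*-distribˡ-+ ⟦ inX x l ⟧ ⟦ Yset x w ∧ c l w ⟧ _))
          where
          inner : ∀ a c i → a ≡ true → c ≡ true → 1 ≡ ⟦ (a ∧ not i) ∧ c ⟧ + ⟦ i ⟧
          inner true true true  _ _ = refl
          inner true true false _ _ = refl

    A-eq : ∀ c l → A c l ≡ ∑ (λ v → ⟦ inC l v ⟧ * ∑ (λ w → total xC (λ x → ⟦ inX x l ⟧ * ⟦ Yset x w ∧ c l w ⟧) * ⟦ adj G v w ⟧))
    A-eq c l = begin
      total xC (λ x → ⟦ inX x l ⟧ * ∑ (λ v → ⟦ inC l v ⟧ * nb (adj G) v (λ w → Yset x w ∧ c l w)))
        ≡⟨ total-cong xC (λ x → trans (sym (∑-*ˡ ⟦ inX x l ⟧ _)) (∑-cong (λ v →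
             trans (solve 3 (λ i c z → i :* (c :* z) := c :* (i :* z)) refl ⟦ inX x l ⟧ ⟦ inC l v ⟧ (nb (adj G) v (λ w → Yset x w ∧ c l w)))
               (cong (⟦ inC l v ⟧ *_) (trans (sym (∑-*ˡ ⟦ inX x l ⟧ _)) (∑-cong (λ w → sym (*-assoc ⟦ inX x l ⟧ _ _)))))))) ⟩
      total xC (λ x → ∑ (λ v → ⟦ inC l v ⟧ * ∑ (λ w → ⟦ inX x l ⟧ * ⟦ Yset x w ∧ c l w ⟧ * ⟦ adj G v w ⟧)))
        ≡⟨ trans (total-∑ xC (λ v x → ⟦ inC l v ⟧ * ∑ (λ w → ⟦ inX x l ⟧ * ⟦ Yset x w ∧ c l w ⟧ * ⟦ adj G v w ⟧)))
             (∑-cong (λ v → trans (total-*ˡ xC ⟦ inC l v ⟧ _) (cong (⟦ inC l v ⟧ *_)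
               (trans (total-∑ xC (λ w x → ⟦ inX x l ⟧ * ⟦ Yset x w ∧ c l w ⟧ * ⟦ adj G v w ⟧))
                 (∑-cong (λ w → total-*ʳ xC ⟦ adj G v w ⟧ _)))))) ⟩
      ∑ (λ v → ⟦ inC l v ⟧ * ∑ (λ w → total xC (λ x → ⟦ inX x l ⟧ * ⟦ Yset x w ∧ c l w ⟧) * ⟦ adj G v w ⟧)) ∎
      where open ≡-Reasoning

    form-scale : ∀ I B z → form (adj G) I B * z ≡ ∑ (λ v → ⟦ I v ⟧ * ∑ (λ w → ⟦ B w ⟧ * z * ⟦ adj G v w ⟧))
    form-scale I B z = trans (sym (∑-*ʳ z _)) (∑-cong (λ v → trans (*-assoc ⟦ I v ⟧ _ z) (cong (⟦ I v ⟧ *_)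
      (trans (sym (∑-*ʳ z _)) (∑-cong (λ w → solve 3 (λ b a z → b :* a :* z := b :* z :* a) refl ⟦ B w ⟧ ⟦ adj G v w ⟧ z))))))

    A-lower : ∀ c l → edges c l * (Q * vx) ≤ A c l * (Q * Q) + edges c l * vx
    A-lower c l = begin
      edges c l * (Q * vx)
        ≡⟨ form-scale (inC l) (λ w → out l w ∧ c l w) (Q * vx) ⟩
      ∑ (λ v → ⟦ inC l v ⟧ * ∑ (λ w → ⟦ out l w ∧ c l w ⟧ * (Q * vx) * ⟦ adj G v w ⟧))
        ≤⟨ ∑-mono (λ v → *-monoʳ-≤ ⟦ inC l v ⟧ (∑-mono (λ w → *-monoˡ-≤ ⟦ adj G v w ⟧ (split-w c l w)))) ⟩
      ∑ (λ v → ⟦ inC l v ⟧ * ∑ (λ w → (T w * (Q * Q) + ⟦ out l w ∧ c l w ⟧ * vx) * ⟦ adj G v w ⟧))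
        ≡⟨ trans (∑-cong (λ v → trans (cong (⟦ inC l v ⟧ *_) (trans (∑-cong (λ w → *-distribʳ-+ ⟦ adj G v w ⟧ (T w * (Q * Q)) _))
                 (∑-+ (λ w → T w * (Q * Q) * ⟦ adj G v w ⟧) _))) (*-distribˡ-+ ⟦ inC l v ⟧ _ _)))
             (∑-+ (λ v → ⟦ inC l v ⟧ * ∑ (λ w → T w * (Q * Q) * ⟦ adj G v w ⟧)) _) ⟩
      ∑ (λ v → ⟦ inC l v ⟧ * ∑ (λ w → T w * (Q * Q) * ⟦ adj G v w ⟧)) +
      ∑ (λ v → ⟦ inC l v ⟧ * ∑ (λ w → ⟦ out l w ∧ c l w ⟧ * vx * ⟦ adj G v w ⟧))
        ≡⟨ cong₂ _+_ (trans (∑-cong (λ v → trans (cong (⟦ inC l v ⟧ *_) (trans (∑-cong (λ w →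
               solve 3 (λ t q a → t :* q :* a := t :* a :* q) refl (T w) (Q * Q) ⟦ adj G v w ⟧)) (∑-*ʳ (Q * Q) _)))
               (sym (*-assoc ⟦ inC l v ⟧ _ (Q * Q))))) (trans (∑-*ʳ (Q * Q) _) (cong (_* (Q * Q)) (sym (A-eq c l)))))
             (sym (form-scale (inC l) (λ w → out l w ∧ c l w) vx)) ⟩
      A c l * (Q * Q) + edges c l * vx ∎
      where
      open ≤-Reasoning
      T : Fin n → ℕ
      T w = total xC (λ x → ⟦ inX x l ⟧ * ⟦ Yset x w ∧ c l w ⟧)

    A-upper : ∀ c l → attD l ≡ true → 8 * (A c l * V) ≤ 8 * (16 * (D l * EΩ c l)) + TX l * (D l * V)
    A-upper c l al = begin
      8 * (A c l * V)
        ≡⟨ solve 2 (λ a v → con 8 :* (a :* v) := a :* (con 8 :* v)) refl (A c l) V ⟩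
      A c l * (8 * V)
        ≡⟨ trans (sym (total-*ʳ xC (8 * V) _)) (total-cong xC (λ x →
             solve 3 (λ i e v → i :* e :* (con 8 :* v) := i :* (con 8 :* (e :* v))) refl ⟦ inX x l ⟧ (edgesY c l x) V)) ⟩
      total xC (λ x → ⟦ inX x l ⟧ * (8 * (edgesY c l x * V)))
        ≤⟨ total-mono xC (λ x → lower-x c l x al) ⟩
      total xC (λ x → 8 * (16 * (D l * Ex c l x)) + ⟦ inX x l ⟧ * (D l * V))
        ≡⟨ trans (total-+ xC (λ x → 8 * (16 * (D l * Ex c l x))) _) (cong₂ _+_
             (trans (total-*ˡ xC 8 _) (cong (8 *_) (trans (total-*ˡ xC 16 _) (cong (16 *_) (trans (total-*ˡ xC (D l) _) (cong (D l *_) (sym (EΩ-eq c l))))))))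
             (total-*ʳ xC (D l * V) _)) ⟩
      8 * (16 * (D l * EΩ c l)) + TX l * (D l * V) ∎
      where open ≤-Reasoning

  -- In units of `D / Q`: at least `e (1 − 1 / Q)`, that is 3/8, of the admissible edges are usable
  -- on average, giving up loses at most 1/8, and `dist-lower` costs a factor 16. So 1/64 is left.
  success-lower : ∀ c l → attD l ≡ true → 1 ≤ D l → D l ≤ 2 * edges c l → 4 ≤ Q → vol Ω ≤ odds * (Q * EΩ c l)
  success-lower c l al D>0 D≤2e 4≤Q =
    subst (λ z → vol Ω ≤ z * (Q * EΩ c l)) (sym odds-def)
      (combine (edges c l) Q vx V (A c l) (D l) (EΩ c l) (TX l) (vol Ω) vol-Ω (A-lower c l) (A-upper c l al) (TX-eq l) D>0 D≤2e 4≤Q)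
    where
    combine : ∀ e Q vx V A D E T vΩ → vΩ ≡ vx * V → e * (Q * vx) ≤ A * (Q * Q) + e * vx →
      8 * (A * V) ≤ 8 * (16 * (D * E)) + T * (D * V) → T * Q ≡ vx → 1 ≤ D → D ≤ 2 * e → 4 ≤ Q → vΩ ≤ 64 * (Q * E)
    combine e Q vx V A D E T .(vx * V) refl h₁ h₂ h₃ D>0 h₄ h₅ =
      *-cancelˡ-≤ (2 * (D * Q)) {{>-nonZero (*-mono-≤ {1} {2} (s≤s z≤n) (*-mono-≤ D>0 (≤-trans (s≤s z≤n) h₅)))}}
        (+-cancelʳ-≤ (D * Q * vx * V + 2 * (e * Q * vx * V)) _ _ (begin
        2 * (D * Q) * (vx * V) + (D * Q * vx * V + 2 * (e * Q * vx * V))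
          ≡⟨ solve 5 (λ D Q vx V e → con 2 :* (D :* Q) :* (vx :* V) :+ (D :* Q :* vx :* V :+ con 2 :* (e :* Q :* vx :* V)) :=
               con 3 :* (D :* (Q :* vx :* V)) :+ con 2 :* (e :* Q :* vx :* V)) refl D Q vx V e ⟩
        3 * (D * (Q * vx * V)) + 2 * (e * Q * vx * V)
          ≤⟨ +-monoˡ-≤ (2 * (e * Q * vx * V)) (*-monoʳ-≤ 3 (*-monoˡ-≤ (Q * vx * V) h₄)) ⟩
        3 * (2 * e * (Q * vx * V)) + 2 * (e * Q * vx * V)
          ≡⟨ solve 4 (λ Q vx V e → con 3 :* (con 2 :* e :* (Q :* vx :* V)) :+ con 2 :* (e :* Q :* vx :* V) :=
               con 8 :* V :* (e :* (Q :* vx))) refl Q vx V e ⟩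
        8 * V * (e * (Q * vx))
          ≤⟨ *-monoʳ-≤ (8 * V) h₁ ⟩
        8 * V * (A * (Q * Q) + e * vx)
          ≡⟨ solve 5 (λ A Q vx V e → con 8 :* V :* (A :* (Q :* Q) :+ e :* vx) :=
               (con 8 :* (A :* V)) :* (Q :* Q) :+ con 2 :* (e :* con 4 :* vx :* V)) refl A Q vx V e ⟩
        (8 * (A * V)) * (Q * Q) + 2 * (e * 4 * vx * V)
          ≤⟨ +-mono-≤ (*-monoˡ-≤ (Q * Q) h₂) (*-monoʳ-≤ 2 (*-monoˡ-≤ V (*-monoˡ-≤ vx (*-monoʳ-≤ e h₅)))) ⟩
        (8 * (16 * (D * E)) + T * (D * V)) * (Q * Q) + 2 * (e * Q * vx * V)
          ≡⟨ solve 6 (λ D E T V Q r → (con 8 :* (con 16 :* (D :* E)) :+ T :* (D :* V)) :* (Q :* Q) :+ r :=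
               con 2 :* (D :* Q) :* (con 64 :* (Q :* E)) :+ (D :* Q :* (T :* Q) :* V :+ r)) refl D E T V Q (2 * (e * Q * vx * V)) ⟩
        2 * (D * Q) * (64 * (Q * E)) + (D * Q * (T * Q) * V + 2 * (e * Q * vx * V))
          ≡⟨ cong (λ z → 2 * (D * Q) * (64 * (Q * E)) + (D * Q * z * V + 2 * (e * Q * vx * V))) h₃ ⟩
        2 * (D * Q) * (64 * (Q * E)) + (D * Q * vx * V + 2 * (e * Q * vx * V)) ∎))
      where open ≤-Reasoning

-- Merging clusters along stars

-- The set is a union of clusters, which is what survival under contraction means.
Respecting : ∀ {n} → VSet n → (Fin n → Fin n) → Set
Respecting S lab = ∀ u v → lab u ≡ lab v → S u ≡ S v

sizeOf : ∀ {n} → (Fin n → Fin n) → Fin n → ℕ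
sizeOf lab l = card (λ v → lab v == l)

smallOf : ∀ {n} → ℕ → (Fin n → Fin n) → VSet n → VSet n
smallOf ℓ lab fz l = not (fz l) ∧ ((0 <ᵇ sizeOf lab l) ∧ (sizeOf lab l <ᵇ 2 ^ suc ℓ))

-- The invariant of a level: any two unfrozen clusters have at least `2 ^ (ℓ + 1)` vertices
-- together, so a single merge takes both of them out of the level.
LowerSize : ∀ {n} → ℕ → (Fin n → Fin n) → VSet n → Set
LowerSize ℓ lab fz = ∀ l → fz l ≡ false → 1 ≤ sizeOf lab l → 2 ^ ℓ ≤ sizeOf lab l

isNothing : {A : Set} → Maybe A → Bool
isNothing nothing  = true
isNothing (just _) = false

size-pos : ∀ {n} (lab : Fin n → Fin n) v → 1 ≤ sizeOf lab (lab v)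
size-pos lab v = ≤-trans (≤-reflexive (cong ⟦_⟧ (sym (==-refl (lab v))))) (∑-≥ (λ u → ⟦ lab u == lab v ⟧) v)

size-member : ∀ {n} (lab : Fin n → Fin n) l → 1 ≤ sizeOf lab l → ∃ λ v → lab v ≡ l
size-member lab l p with ∑-pos (λ v → ⟦ lab v == l ⟧) p
... | v , q with lab v ≟ᶠ l
...   | yes e = v , e
...   | no _ = ⊥-elim (1+n≰n q)

module Merge {n : ℕ} (lab : Fin n → Fin n) (fz low : VSet n) (t : Fin n → Maybe (Fin n)) where

  lab′ : Fin n → Fin n
  lab′ v = maybe lab (lab v) (t (lab v))

  -- A cluster of low out-degree is frozen only if nothing has joined it; otherwise it has outgrown
  -- the level and is judged again later.
  fz′ : VSet n
  fz′ l = fz l ∨ (low l ∧ (sizeOf lab′ l ≡ᵇ sizeOf lab l))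

  module Facts (ℓ : ℕ)
    (t-small : ∀ l w → t l ≡ just w → smallOf ℓ lab fz l ≡ true × low l ≡ false)
    (t-target : ∀ l w → t l ≡ just w → fz (lab w) ≡ false × t (lab w) ≡ nothing)
    (low-small : ∀ l → low l ≡ true → smallOf ℓ lab fz l ≡ true) where

    lab′-stay : ∀ v → t (lab v) ≡ nothing → lab′ v ≡ lab v
    lab′-stay v e = cong (maybe lab (lab v)) e

    lab′-move : ∀ v w → t (lab v) ≡ just w → lab′ v ≡ lab w
    lab′-move v w e = cong (maybe lab (lab v)) e

    private
      decide : ∀ l → t l ≡ nothing ⊎ (∃ λ w → t l ≡ just w)
      decide l with t l
      ... | nothing = inj₁ refl
      ... | just w  = inj₂ (w , refl)

    small-unfrozen : ∀ l → smallOf ℓ lab fz l ≡ true → fz l ≡ false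
    small-unfrozen l s = not-true (proj₁ (∧-true {not (fz l)} s))

    frozen-stays : ∀ l → fz l ≡ true → t l ≡ nothing
    frozen-stays l f with decide l
    ... | inj₁ e = e
    ... | inj₂ (w , e) = ⊥-elim (true≢false (trans (sym f) (small-unfrozen l (proj₁ (t-small l w e)))))

    low-stays : ∀ l → low l ≡ true → t l ≡ nothing
    low-stays l f with decide l
    ... | inj₁ e = e
    ... | inj₂ (w , e) = ⊥-elim (true≢false (trans (sym f) (proj₂ (t-small l w e))))

    lab′-stays : ∀ v → t (lab′ v) ≡ nothing
    lab′-stays v with decide (lab v)
    ... | inj₁ e = trans (cong t (lab′-stay v e)) e
    ... | inj₂ (w , e) = trans (cong t (lab′-move v w e)) (proj₂ (t-target (lab v) w e))

    lab′-pos : ∀ v → 1 ≤ sizeOf lab (lab′ v)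
    lab′-pos v with decide (lab v)
    ... | inj₁ e = subst (λ l → 1 ≤ sizeOf lab l) (sym (lab′-stay v e)) (size-pos lab v)
    ... | inj₂ (w , e) = subst (λ l → 1 ≤ sizeOf lab l) (sym (lab′-move v w e)) (size-pos lab w)

    size-grows : ∀ l → t l ≡ nothing → sizeOf lab l ≤ sizeOf lab′ l
    size-grows l e = card-mono {V = λ v → lab′ v == l} (λ v p →
      trans (cong (_== l) (trans (lab′-stay v (trans (cong t (==⇒≡ {i = lab v} p)) e)) (==⇒≡ {i = lab v} p))) (==-refl l))

    size-merged : ∀ v → lab v ≢ lab′ v → sizeOf lab (lab′ v) + sizeOf lab (lab v) ≤ sizeOf lab′ (lab′ v)
    size-merged v ne = ≤-trans (≤-reflexive (sym (∑-+ (λ u → ⟦ lab u == l ⟧) (λ u → ⟦ lab u == lab v ⟧)))) (∑-mono pw)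
      where
      l = lab′ v
      pw : ∀ u → ⟦ lab u == l ⟧ + ⟦ lab u == lab v ⟧ ≤ ⟦ lab′ u == l ⟧
      pw u with lab u ≟ᶠ l | lab u ≟ᶠ lab v
      ... | yes p | yes q = ⊥-elim (ne (trans (sym q) p))
      ... | yes p | no _ = ≤-reflexive (sym (cong ⟦_⟧ (trans (cong (_== l) (trans (lab′-stay u (trans (cong t p) (lab′-stays v))) p)) (==-refl l))))
      ... | no _ | yes q = ≤-reflexive (sym (cong ⟦_⟧ (trans (cong (λ m → maybe lab m (t m) == l) q) (==-refl l))))
      ... | no _ | no _ = z≤n

    module _ (lower : LowerSize ℓ lab fz) where

      merged-large : ∀ v → lab v ≢ lab′ v → 2 ^ suc ℓ ≤ sizeOf lab′ (lab′ v)
      merged-large v ne with decide (lab v)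
      ... | inj₁ e = ⊥-elim (ne (sym (lab′-stay v e)))
      ... | inj₂ (w , e) = ≤-trans (+-mono-≤
              (lower (lab′ v) (trans (cong fz (lab′-move v w e)) (proj₁ (t-target (lab v) w e))) (lab′-pos v))
              (≤-trans (≤-reflexive (+-identityʳ _)) (lower (lab v) (small-unfrozen (lab v) (proj₁ (t-small (lab v) w e))) (size-pos lab v))))
            (size-merged v ne)

      private
        ∨-false : ∀ {a c} → (a ∨ c) ≡ false → a ≡ false × c ≡ false
        ∨-false {false} {false} _ = refl , refl

      lower′ : LowerSize ℓ lab′ fz′
      lower′ l f p with size-member lab′ l p
      ... | v , refl = ≤-trans (lower (lab′ v) (proj₁ (∨-false {fz (lab′ v)} f)) (lab′-pos v)) (size-grows (lab′ v) (lab′-stays v))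

      -- Merging makes a cluster too large for the level, and a low cluster that stays alone is
      -- frozen. What is still small has therefore attempted a merge in vain.
      small′-old : ∀ v → smallOf ℓ lab′ fz′ (lab′ v) ≡ true →
                   lab v ≡ lab′ v × t (lab v) ≡ nothing × smallOf ℓ lab fz (lab v) ≡ true × low (lab v) ≡ false
      small′-old v s with lab v ≟ᶠ lab′ v
      ... | no ne = ⊥-elim (<⇒≱ (<ᵇ-true (proj₂ (∧-true {0 <ᵇ sizeOf lab′ (lab′ v)} (proj₂ (∧-true {not (fz′ (lab′ v))} s)))))
                      (merged-large v ne))
      ... | yes e = e , stays , old , notLow
        where
        l = lab′ v
        s₁ = not-true (proj₁ (∧-true {not (fz′ l)} s))
        s₂ = <ᵇ-true (proj₂ (∧-true {0 <ᵇ sizeOf lab′ l} (proj₂ (∧-true {not (fz′ l)} s))))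
        stays : t (lab v) ≡ nothing
        stays = trans (cong t e) (lab′-stays v)
        old : smallOf ℓ lab fz (lab v) ≡ true
        old = subst (λ m → smallOf ℓ lab fz m ≡ true) (sym e)
          (∧-intro (cong not (proj₁ (∨-false {fz l} s₁)))
            (∧-intro (<ᵇ-intro (lab′-pos v)) (<ᵇ-intro (<-≤-trans (s≤s (size-grows l (lab′-stays v))) s₂))))
        same-size : sizeOf lab′ l ≡ sizeOf lab l
        same-size = ∑-cong (λ u → cong ⟦_⟧ (same u))
          where
          same : ∀ u → (lab′ u == l) ≡ (lab u == l)
          same u with lab u ≟ᶠ lab′ u
          ... | yes q = cong (_== l) (sym q)
          ... | no ne with lab′ u ≟ᶠ l
          ...   | yes q = ⊥-elim (<⇒≱ s₂ (subst (λ m → 2 ^ suc ℓ ≤ sizeOf lab′ m) q (merged-large u ne)))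
          ...   | no q′ = sym (≢⇒== λ q → ne (trans q (sym (trans (lab′-stay u (trans (cong t q) (lab′-stays v))) q))))
        notLow : low (lab v) ≡ false
        notLow with bool-cases (low (lab v))
        ... | inj₂ f = f
        ... | inj₁ f = ⊥-elim (true≢false (trans (sym (∧-intro (subst (λ m → low m ≡ true) e f)
                         (trans (cong (_≡ᵇ sizeOf lab l) same-size) (≡ᵇ-refl (sizeOf lab l))))) (proj₂ (∨-false {fz l} s₁))))

      small′-sum : ∀ (f : Fin n → ℕ) →
        ∑ (λ v → f v * ⟦ smallOf ℓ lab′ fz′ (lab′ v) ⟧) ≤
        ∑ (λ v → f v * ⟦ (smallOf ℓ lab fz (lab v) ∧ not (low (lab v))) ∧ isNothing (t (lab v)) ⟧)
      small′-sum f = ∑-mono (λ v → *-monoʳ-≤ (f v) (⟦⟧-mono (λ s → let e , stays , old , nl = small′-old v s in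
        ∧-intro (∧-intro old (cong not nl)) (cong isNothing stays))))

      small′-count : card (smallOf ℓ lab′ fz′) ≤
                     card (λ l → (smallOf ℓ lab fz l ∧ not (low l)) ∧ isNothing (t l))
      small′-count = card-mono {V = λ l → (smallOf ℓ lab fz l ∧ not (low l)) ∧ isNothing (t l)} λ l s →
        case size-member lab′ l (<ᵇ-true (proj₁ (∧-true {0 <ᵇ sizeOf lab′ l} (proj₂ (∧-true {not (fz′ l)} s))))) of λ where
          (v , refl) → let e , stays , old , nl = small′-old v s in
            subst (λ m → ((smallOf ℓ lab fz m ∧ not (low m)) ∧ isNothing (t m)) ≡ true) e
              (∧-intro (∧-intro old (cong not nl)) (cong isNothing stays))

    respects′ : ∀ S → Respecting S lab → (∀ v w → t (lab v) ≡ just w → S v ≡ S w) → Respecting S lab′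
    respects′ S res safe u v e with decide (lab u) | decide (lab v)
    ... | inj₁ p | inj₁ q = res u v (trans (sym (lab′-stay u p)) (trans e (lab′-stay v q)))
    ... | inj₁ p | inj₂ (w , q) = trans (res u w (trans (sym (lab′-stay u p)) (trans e (lab′-move v w q)))) (sym (safe v w q))
    ... | inj₂ (w , p) | inj₁ q = trans (safe u w p) (res w v (trans (sym (lab′-move u w p)) (trans e (lab′-stay v q))))
    ... | inj₂ (w , p) | inj₂ (z , q) = trans (safe u w p) (trans (res w z (trans (sym (lab′-move u w p)) (trans e (lab′-move v z q)))) (sym (safe v z q)))

    -- Edges between different clusters that touch a frozen cluster, counted twice.

    new : VSet n
    new l = low l ∧ (sizeOf lab′ l ≡ᵇ sizeOf lab l)

    private
      new-stays : ∀ l → new l ≡ true → t l ≡ nothing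
      new-stays l p = low-stays l (proj₁ (∧-true {low l} p))

      new-unfrozen : ∀ l → new l ≡ true → fz l ≡ false
      new-unfrozen l p = small-unfrozen l (low-small l (proj₁ (∧-true {low l} p)))

      -- A vertex that moves cannot end in a frozen cluster: its new cluster was unfrozen, and newly
      -- frozen clusters have kept their size.
      fz′-origin : ∀ v → fz′ (lab′ v) ≡ true → fz (lab v) ≡ true ⊎ new (lab v) ≡ true
      fz′-origin v p with decide (lab v)
      ... | inj₁ e = subst (λ l → fz′ l ≡ true → fz (lab v) ≡ true ⊎ new (lab v) ≡ true) (sym (lab′-stay v e)) (orr (fz (lab v))) p
        where
        orr : ∀ a {c} → (a ∨ c) ≡ true → a ≡ true ⊎ c ≡ true
        orr true  _ = inj₁ refl
        orr false q = inj₂ q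
      ... | inj₂ (w , e) = ⊥-elim (contra (bool-cases (new (lab′ v))))
        where
        unfrozen : fz (lab′ v) ≡ false
        unfrozen = trans (cong fz (lab′-move v w e)) (proj₁ (t-target (lab v) w e))
        ne : lab v ≢ lab′ v
        ne q with trans (sym (lab′-stays v)) (trans (cong t (sym q)) e)
        ... | ()
        contra : new (lab′ v) ≡ true ⊎ new (lab′ v) ≡ false → ⊥
        contra (inj₂ f) = true≢false (trans (sym p) (trans (cong (_∨ new (lab′ v)) unfrozen) f))
        contra (inj₁ f) = <⇒≱ (≤-trans (≤-reflexive (+-comm 1 _)) (+-monoʳ-≤ (sizeOf lab (lab′ v)) (size-pos lab v)))
          (≤-trans (size-merged v ne) (≤-reflexive (≡ᵇ-true (sizeOf lab′ (lab′ v)) _ (proj₂ (∧-true {low (lab′ v)} f)))))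

    frozen-count : ∑ (λ v → ⟦ fz (lab v) ⟧) + ∑ (λ v → ⟦ new (lab v) ⟧) ≤ ∑ (λ v → ⟦ fz′ (lab′ v) ⟧)
    frozen-count = ≤-trans (≤-reflexive (sym (∑-+ (λ v → ⟦ fz (lab v) ⟧) (λ v → ⟦ new (lab v) ⟧)))) (∑-mono pw)
      where
      pw : ∀ v → ⟦ fz (lab v) ⟧ + ⟦ new (lab v) ⟧ ≤ ⟦ fz′ (lab′ v) ⟧
      pw v with bool-cases (new (lab v)) | bool-cases (fz (lab v))
      ... | inj₁ p | _ = subst (λ l → ⟦ fz (lab v) ⟧ + ⟦ new (lab v) ⟧ ≤ ⟦ fz′ l ⟧) (sym (lab′-stay v (new-stays (lab v) p)))
                           (≤-reflexive (trans (cong (λ z → ⟦ z ⟧ + ⟦ new (lab v) ⟧) (new-unfrozen (lab v) p))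
                             (cong (λ z → ⟦ z ∨ new (lab v) ⟧) (sym (new-unfrozen (lab v) p)))))
      ... | inj₂ p | inj₁ q = subst (λ l → ⟦ fz (lab v) ⟧ + ⟦ new (lab v) ⟧ ≤ ⟦ fz′ l ⟧) (sym (lab′-stay v (frozen-stays (lab v) q)))
                           (≤-reflexive (trans (cong₂ (λ a c → ⟦ a ⟧ + ⟦ c ⟧) q p) (cong (λ z → ⟦ z ∨ new (lab v) ⟧) (sym q))))
      ... | inj₂ p | inj₂ q = ≤-trans (≤-reflexive (cong₂ (λ a c → ⟦ a ⟧ + ⟦ c ⟧) q p)) z≤n

    module _ (R : Rel₂ n) (R-sym : ∀ v w → R v w ≡ R w v) where

      outOf : Fin n → VSet n
      outOf l w = not (fz (lab w)) ∧ not (lab w == l)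

      touching : (Fin n → Fin n) → VSet n → Fin n → Fin n → Bool
      touching lab fz v w = not (lab w == lab v) ∧ (fz (lab v) ∨ fz (lab w))

      frozenEdges : (Fin n → Fin n) → VSet n → ℕ
      frozenEdges lab fz = ∑ (λ v → nb R v (touching lab fz v))

      -- An edge that is counted for the first time joins a newly frozen cluster to one that was
      -- unfrozen so far. It is seen in both orientations, whence the factor 2.
      frozenEdges-step : frozenEdges lab′ fz′ ≤
        frozenEdges lab fz + 2 * ∑ (λ l → ⟦ new l ⟧ * form R (λ v → lab v == l) (outOf l))
      frozenEdges-step = begin
        ∑ (λ v → ∑ (λ w → ⟦ touching lab′ fz′ v w ⟧ * ⟦ R v w ⟧))
          ≤⟨ ∑-mono (λ v → ∑-mono (λ w → pw v w)) ⟩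
        ∑ (λ v → ∑ (λ w → ⟦ touching lab fz v w ⟧ * ⟦ R v w ⟧ + (N v w + N w v)))
          ≡⟨ trans (∑-cong (λ v → trans (∑-+ (λ w → ⟦ touching lab fz v w ⟧ * ⟦ R v w ⟧) _)
               (cong (nb R v (touching lab fz v) +_) (∑-+ (N v) _)))) (trans (∑-+ (λ v → nb R v (touching lab fz v)) _)
               (cong (frozenEdges lab fz +_) (trans (∑-+ (λ v → ∑ (N v)) _) (cong (NN +_) (∑-swap (λ v w → N w v)))))) ⟩
        frozenEdges lab fz + (NN + NN)
          ≡⟨ cong (frozenEdges lab fz +_) (trans (cong (NN +_) (sym (+-identityʳ NN))) (cong (2 *_) NN-eq)) ⟩
        frozenEdges lab fz + 2 * ∑ (λ l → ⟦ new l ⟧ * form R (λ v → lab v == l) (outOf l)) ∎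
        where
        open ≤-Reasoning
        N : Fin n → Fin n → ℕ
        N v w = ⟦ new (lab v) ⟧ * (⟦ outOf (lab v) w ⟧ * ⟦ R v w ⟧)
        NN = ∑ (λ v → ∑ (N v))
        NN-eq : NN ≡ ∑ (λ l → ⟦ new l ⟧ * form R (λ v → lab v == l) (outOf l))
        NN-eq = trans (∑-cong (λ v → ∑-*ˡ ⟦ new (lab v) ⟧ _)) (trans (∑-fibre lab (λ v → ⟦ new (lab v) ⟧ * nb R v (outOf (lab v))))
          (∑-cong (λ l → trans (∑-cong (λ v → trans (⟦⟧*-cong (lab v == l) (λ e → cong (λ m → ⟦ new m ⟧ * nb R v (outOf m)) (==⇒≡ {i = lab v} e)))
             (solve 3 (λ a c d → a :* (c :* d) := c :* (a :* d)) refl ⟦ lab v == l ⟧ ⟦ new l ⟧ (nb R v (outOf l))))) (∑-*ˡ ⟦ new l ⟧ _))))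
        pw : ∀ v w → ⟦ touching lab′ fz′ v w ⟧ * ⟦ R v w ⟧ ≤ ⟦ touching lab fz v w ⟧ * ⟦ R v w ⟧ + (N v w + N w v)
        pw v w with bool-cases (touching lab′ fz′ v w)
        ... | inj₂ f = ≤-trans (≤-reflexive (⟦⟧*-0 ⟦ R v w ⟧ f)) z≤n
        ... | inj₁ p = ≤-trans (⟦⟧*≤ (touching lab′ fz′ v w) ⟦ R v w ⟧) (analyse (bool-cases (fz (lab v) ∨ fz (lab w))) (either (fz′ (lab′ v)) (proj₂ (∧-true {not (lab′ w == lab′ v)} p))))
          where
          differ : (lab w == lab v) ≡ false
          differ = ≢⇒== λ e → true≢false (trans (sym (proj₁ (∧-true {not (lab′ w == lab′ v)} p)))
            (cong not (trans (cong (λ m → maybe lab m (t m) == lab′ v) e) (==-refl (lab′ v)))))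
          either : ∀ a {c} → (a ∨ c) ≡ true → a ≡ true ⊎ c ≡ true
          either true  _ = inj₁ refl
          either false q = inj₂ q
          neither : ∀ {a c} → (a ∨ c) ≡ false → a ≡ false × c ≡ false
          neither {false} {false} _ = refl , refl
          full : ∀ a v w → new (lab v) ≡ true → fz (lab w) ≡ false → (lab w == lab v) ≡ false → R v w ≡ a → ⟦ a ⟧ ≤ N v w
          full a v w nv fw d Ra = ≤-reflexive (sym (trans (⟦⟧*-1 _ nv) (trans (⟦⟧*-1 ⟦ R v w ⟧ (∧-intro (cong not fw) (cong not d))) (cong ⟦_⟧ Ra))))
          analyse : (fz (lab v) ∨ fz (lab w)) ≡ true ⊎ (fz (lab v) ∨ fz (lab w)) ≡ false →
            fz′ (lab′ v) ≡ true ⊎ fz′ (lab′ w) ≡ true →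
            ⟦ R v w ⟧ ≤ ⟦ touching lab fz v w ⟧ * ⟦ R v w ⟧ + (N v w + N w v)
          analyse (inj₁ q) _ = ≤-trans (≤-reflexive (sym (⟦⟧*-1 ⟦ R v w ⟧ (∧-intro (cong not differ) q)))) (m≤m+n _ _)
          analyse (inj₂ q) (inj₁ r) with fz′-origin v r
          ... | inj₁ fv = ⊥-elim (true≢false (trans (sym fv) (proj₁ (neither {fz (lab v)} q))))
          ... | inj₂ nv = ≤-trans (full (R v w) v w nv (proj₂ (neither {fz (lab v)} q)) differ refl)
                            (≤-trans (m≤m+n (N v w) (N w v)) (m≤n+m _ (⟦ touching lab fz v w ⟧ * ⟦ R v w ⟧)))
          analyse (inj₂ q) (inj₂ r) with fz′-origin w r
          ... | inj₁ fw = ⊥-elim (true≢false (trans (sym fw) (proj₂ (neither {fz (lab v)} q))))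
          ... | inj₂ nw = ≤-trans (full (R v w) w v nw (proj₁ (neither {fz (lab v)} q)) (trans (==-sym (lab v) (lab w)) differ) (R-sym w v))
                            (≤-trans (m≤n+m (N w v) (N v w)) (m≤n+m _ (⟦ touching lab fz v w ⟧ * ⟦ R v w ⟧)))

-- The exponential potential

opaque

  -- For `H ≤ M` this is `(W / (W + 1)) ^ H` multiplied by the fixed number `(W + 1) ^ M`, which
  -- makes it integral.
  potential : ℕ → ℕ → ℕ → ℕ
  potential W M H = W ^ H * suc W ^ (M ∸ H)

  potential-def : ∀ W M H → potential W M H ≡ W ^ H * suc W ^ (M ∸ H)
  potential-def W M H = refl

-- Bernoulli's inequality `(1 + 1 / W) ^ X ≥ 1 + X / W`.
bernoulli : ∀ W X → W ^ X * (W + X) ≤ W * suc W ^ X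
bernoulli W zero    = ≤-reflexive (trans (*-identityˡ (W + 0)) (trans (+-identityʳ W) (sym (*-identityʳ W))))
bernoulli W (suc X) = begin
  W * W ^ X * (W + suc X)
    ≤⟨ m≤m+n _ (W ^ X * X) ⟩
  W * W ^ X * (W + suc X) + W ^ X * X
    ≡⟨ solve 3 (λ w p x → w :* p :* (w :+ (con 1 :+ x)) :+ p :* x := (con 1 :+ w) :* (p :* (w :+ x))) refl W (W ^ X) X ⟩
  suc W * (W ^ X * (W + X))
    ≤⟨ *-monoʳ-≤ (suc W) (bernoulli W X) ⟩
  suc W * (W * suc W ^ X)
    ≡⟨ solve 3 (λ a w p → a :* (w :* p) := w :* (a :* p)) refl (suc W) W (suc W ^ X) ⟩
  W * suc W ^ suc X ∎
  where open ≤-Reasoning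

-- A loss of `X` units of danger multiplies the potential by at least `1 + X / W`. The factor is
-- linear in `X`, so the average of the potential over a phase needs only the average of `X`.
potential-step : ∀ W M H H′ X → H′ + X ≤ H → H ≤ M → potential W M H * (W + X) ≤ W * potential W M H′
potential-step W M H H′ X p q = subst₂ (λ a b → a * (W + X) ≤ W * b) (sym (potential-def W M H)) (sym (potential-def W M H′)) (begin
  W ^ H * suc W ^ (M ∸ H) * (W + X)
    ≡⟨ cong (λ h → W ^ h * suc W ^ (M ∸ H) * (W + X)) (sym H≡) ⟩
  W ^ (H′ + e + X) * suc W ^ (M ∸ H) * (W + X)
    ≡⟨ cong (λ z → z * suc W ^ (M ∸ H) * (W + X)) (trans (^-distribˡ-+-* W (H′ + e) X) (cong (_* W ^ X) (^-distribˡ-+-* W H′ e))) ⟩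
  W ^ H′ * W ^ e * W ^ X * suc W ^ (M ∸ H) * (W + X)
    ≡⟨ solve 5 (λ a b c d f → a :* b :* c :* d :* f := a :* d :* b :* (c :* f)) refl (W ^ H′) (W ^ e) (W ^ X) (suc W ^ (M ∸ H)) (W + X) ⟩
  W ^ H′ * suc W ^ (M ∸ H) * W ^ e * (W ^ X * (W + X))
    ≤⟨ *-mono-≤ (*-monoʳ-≤ (W ^ H′ * suc W ^ (M ∸ H)) (^-monoˡ-≤ e (n≤1+n W))) (bernoulli W X) ⟩
  W ^ H′ * suc W ^ (M ∸ H) * suc W ^ e * (W * suc W ^ X)
    ≡⟨ solve 5 (λ a b c d f → a :* b :* c :* (d :* f) := d :* (a :* (b :* (c :* f)))) refl (W ^ H′) (suc W ^ (M ∸ H)) (suc W ^ e) W (suc W ^ X) ⟩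
  W * (W ^ H′ * (suc W ^ (M ∸ H) * (suc W ^ e * suc W ^ X)))
    ≡⟨ cong (λ z → W * (W ^ H′ * z)) (trans (cong (suc W ^ (M ∸ H) *_) (sym (^-distribˡ-+-* (suc W) e X)))
         (trans (sym (^-distribˡ-+-* (suc W) (M ∸ H) (e + X))) (cong (suc W ^_) exponents))) ⟩
  W * (W ^ H′ * suc W ^ (M ∸ H′)) ∎)
  where
  open ≤-Reasoning
  e = H ∸ (H′ + X)
  H≡ : H′ + e + X ≡ H
  H≡ = trans (+-assoc H′ e X) (trans (cong (H′ +_) (+-comm e X)) (trans (sym (+-assoc H′ X e)) (m+[n∸m]≡n p)))
  exponents : M ∸ H + (e + X) ≡ M ∸ H′
  exponents = +-cancelˡ-≡ H′ _ _ (trans (trans (solve 3 (λ h m z → h :+ (m :+ z) := (h :+ z) :+ m) refl H′ (M ∸ H) (e + X))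
    (trans (cong (_+ (M ∸ H)) (trans (sym (+-assoc H′ e X)) H≡)) (m+[n∸m]≡n q)))
    (sym (m+[n∸m]≡n (≤-trans (≤-trans (m≤m+n H′ X) p) q))))

-- One phase in the abstract: risk against lost exposure

module PhaseAnalysis {n : ℕ} (Ω : Code) (att : VSet n) (cl : Fin n → ℕ) (hit safe picked : Fin n → Seed Ω → ℕ)
  (inX : Seed Ω → VSet n) (resp : Seed Ω → ℕ) (Q B : ℕ) (4096≤Q : 4096 ≤ Q) (1≤B : 1 ≤ B)
  (some-hit : ∀ ω → 1 ≤ resp ω + ∑ (λ l → hit l ω))
  (safe-picked : ∀ l ω → att l ≡ true →
     safe l ω ≤ resp ω * picked l ω + ∑ (λ l′ → ⟦ not (l′ == l) ⟧ * (⟦ inX ω l ⟧ * hit l′ ω)))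
  (hits : ∀ l → B * total Ω (hit l) * Q ≤ 16 * (⟦ att l ⟧ * cl l * vol Ω))
  (pairs : ∀ l′ l → l′ ≢ l → B * total Ω (λ ω → ⟦ inX ω l ⟧ * hit l′ ω) * (Q * Q) ≤ 16 * (cl l′ * vol Ω))
  (success : ∀ l → att l ≡ true → vol Ω ≤ odds * (Q * total Ω (safe l)))
  (∑cl≤ : ∑ cl ≤ 2 * B) where

  private
    v = vol Ω

    P : Fin n → ℕ
    P l = total Ω (λ ω → resp ω * picked l ω)

    C : Fin n → Fin n → ℕ
    C l l′ = total Ω (λ ω → ⟦ inX ω l ⟧ * hit l′ ω)

    others : Fin n → ℕ
    others l = ∑ (λ l′ → ⟦ not (l′ == l) ⟧ * C l l′)

    -- A union bound over the clusters that might hit the cut while `l` is a caller; by `pairs` and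
    -- `∑cl≤` their chances sum to at most `32 / Q ^ 2`.
    others-bound : ∀ l → Q * Q * others l ≤ 32 * v
    others-bound l = *-cancelˡ-≤ B {{>-nonZero 1≤B}} (begin
      B * (Q * Q * others l)
        ≡⟨ solve 3 (λ b q o → b :* (q :* o) := o :* (b :* q)) refl B (Q * Q) (others l) ⟩
      others l * (B * (Q * Q))
        ≡⟨ sym (∑-*ʳ (B * (Q * Q)) _) ⟩
      ∑ (λ l′ → ⟦ not (l′ == l) ⟧ * C l l′ * (B * (Q * Q)))
        ≤⟨ ∑-mono term ⟩
      ∑ (λ l′ → 16 * v * cl l′)
        ≡⟨ ∑-*ˡ (16 * v) cl ⟩
      16 * v * ∑ cl
        ≤⟨ *-monoʳ-≤ (16 * v) ∑cl≤ ⟩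
      16 * v * (2 * B)
        ≡⟨ solve 2 (λ v b → con 16 :* v :* (con 2 :* b) := b :* (con 32 :* v)) refl v B ⟩
      B * (32 * v) ∎)
      where
      open ≤-Reasoning
      term : ∀ l′ → ⟦ not (l′ == l) ⟧ * C l l′ * (B * (Q * Q)) ≤ 16 * v * cl l′
      term l′ with l′ ≟ᶠ l
      ... | yes _ = z≤n
      ... | no ne = begin
        1 * C l l′ * (B * (Q * Q))  ≡⟨ solve 3 (λ c b q → con 1 :* c :* (b :* q) := b :* c :* q) refl (C l l′) B (Q * Q) ⟩
        B * C l l′ * (Q * Q)        ≤⟨ pairs l′ l ne ⟩
        16 * (cl l′ * v)            ≡⟨ solve 2 (λ c v → con 16 :* (c :* v) := con 16 :* v :* c) refl (cl l′) v ⟩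
        16 * v * cl l′ ∎

    -- A safe pick has probability at least `1 / (64 Q)`. Interference by another cluster takes away
    -- at most `32 / Q ^ 2`, which is at most half of it since `Q ≥ 4096 = 32 · 128`.
    P-lower : ∀ l → att l ≡ true → v ≤ 128 * (Q * P l)
    P-lower l al = +-cancelʳ-≤ v v (128 * (Q * P l)) (begin
      v + v
        ≤⟨ +-mono-≤ success₆₄ success₆₄ ⟩
      64 * (Q * S) + 64 * (Q * S)
        ≡⟨ solve 1 (λ x → con 64 :* x :+ con 64 :* x := con 128 :* x) refl (Q * S) ⟩
      128 * (Q * S)
        ≤⟨ *-monoʳ-≤ 128 (*-monoʳ-≤ Q S≤) ⟩
      128 * (Q * (P l + others l))
        ≡⟨ solve 3 (λ q p o → con 128 :* (q :* (p :+ o)) := con 128 :* (q :* p) :+ con 128 :* (q :* o)) refl Q (P l) (others l) ⟩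
      128 * (Q * P l) + 128 * (Q * others l)
        ≤⟨ +-monoʳ-≤ (128 * (Q * P l)) small-others ⟩
      128 * (Q * P l) + v ∎)
      where
      open ≤-Reasoning
      S = total Ω (safe l)
      success₆₄ : v ≤ 64 * (Q * S)
      success₆₄ = subst (λ z → v ≤ z * (Q * S)) odds-def (success l al)
      S≤ : S ≤ P l + others l
      S≤ = ≤-trans (total-mono Ω (λ ω → safe-picked l ω al)) (≤-reflexive (trans (total-+ Ω (λ ω → resp ω * picked l ω) _)
             (cong (P l +_) (trans (total-∑ Ω (λ l′ ω → ⟦ not (l′ == l) ⟧ * (⟦ inX ω l ⟧ * hit l′ ω)))
               (∑-cong (λ l′ → total-*ˡ Ω ⟦ not (l′ == l) ⟧ _))))))
      small-others : 128 * (Q * others l) ≤ v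
      small-others = *-cancelˡ-≤ 32 (begin
        32 * (128 * (Q * others l))  ≡⟨ sym (*-assoc 32 128 (Q * others l)) ⟩
        4096 * (Q * others l)        ≤⟨ *-monoˡ-≤ (Q * others l) 4096≤Q ⟩
        Q * (Q * others l)           ≡⟨ sym (*-assoc Q Q (others l)) ⟩
        Q * Q * others l             ≤⟨ others-bound l ⟩
        32 * v ∎)

  gained : Seed Ω → ℕ
  gained ω = ∑ (λ l → cl l * (⟦ att l ⟧ * picked l ω))

  -- Divided by `W` this says that the probability of survival plus `Δ / W` times the mean exposure
  -- shed by survivors is at least 1. A cluster endangers the cut with probability at most
  -- `16 cl / (B Q)`, and it sheds its `cl` with probability at least `1 / (128 Q)`; hence the price
  -- 2048 = 16 · 128.
  balance : ∀ Δ W → 2048 * W ≤ Δ * B → W * vol Ω ≤ W * total Ω resp + Δ * total Ω (λ ω → resp ω * gained ω)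
  balance Δ W ΔB = begin
    W * v
      ≤⟨ *-monoʳ-≤ W (≤-trans (≤-reflexive (sym (trans (total-const Ω 1) (*-identityˡ v)))) (total-mono Ω some-hit)) ⟩
    W * total Ω (λ ω → resp ω + ∑ (λ l → hit l ω))
      ≡⟨ trans (cong (W *_) (trans (total-+ Ω resp _) (cong (total Ω resp +_) (total-∑ Ω hit)))) (*-distribˡ-+ W (total Ω resp) _) ⟩
    W * total Ω resp + W * ∑ (λ l → total Ω (hit l))
      ≤⟨ +-monoʳ-≤ (W * total Ω resp) (≤-trans (≤-reflexive (sym (∑-*ˡ W _))) (∑-mono each)) ⟩
    W * total Ω resp + ∑ (λ l → Δ * (cl l * (⟦ att l ⟧ * P l)))
      ≡⟨ cong (W * total Ω resp +_) (trans (∑-*ˡ Δ _) (cong (Δ *_) (sym gained-eq))) ⟩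
    W * total Ω resp + Δ * total Ω (λ ω → resp ω * gained ω) ∎
    where
    open ≤-Reasoning
    gained-eq : total Ω (λ ω → resp ω * gained ω) ≡ ∑ (λ l → cl l * (⟦ att l ⟧ * P l))
    gained-eq = trans (total-cong Ω (λ ω → trans (sym (∑-*ˡ (resp ω) _)) (∑-cong (λ l →
        solve 4 (λ r c a p → r :* (c :* (a :* p)) := c :* (a :* (r :* p))) refl (resp ω) (cl l) ⟦ att l ⟧ (picked l ω)))))
      (trans (total-∑ Ω (λ l ω → cl l * (⟦ att l ⟧ * (resp ω * picked l ω))))
        (∑-cong (λ l → trans (total-*ˡ Ω (cl l) _) (cong (cl l *_) (total-*ˡ Ω ⟦ att l ⟧ _)))))
    each : ∀ l → W * total Ω (hit l) ≤ Δ * (cl l * (⟦ att l ⟧ * P l))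
    each l = *-cancelˡ-≤ (B * Q) {{>-nonZero (*-mono-≤ 1≤B (≤-trans (s≤s z≤n) 4096≤Q))}} (begin
      B * Q * (W * E)
        ≡⟨ solve 4 (λ b q w e → b :* q :* (w :* e) := w :* (b :* e :* q)) refl B Q W E ⟩
      W * (B * E * Q)
        ≤⟨ *-monoʳ-≤ W (hits l) ⟩
      W * (16 * (⟦ att l ⟧ * cl l * v))
        ≡⟨ solve 4 (λ w a c v → w :* (con 16 :* (a :* c :* v)) := con 16 :* w :* c :* (a :* v)) refl W ⟦ att l ⟧ (cl l) v ⟩
      16 * W * cl l * (⟦ att l ⟧ * v)
        ≤⟨ *-monoʳ-≤ (16 * W * cl l) (⟦⟧*-mono (att l) (P-lower l)) ⟩
      16 * W * cl l * (⟦ att l ⟧ * (128 * (Q * P l)))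
        ≡⟨ solve 5 (λ w c a q p → con 16 :* w :* c :* (a :* (con 128 :* (q :* p))) := con 2048 :* w :* (q :* (c :* (a :* p)))) refl W (cl l) ⟦ att l ⟧ Q (P l) ⟩
      2048 * W * (Q * (cl l * (⟦ att l ⟧ * P l)))
        ≤⟨ *-monoˡ-≤ (Q * (cl l * (⟦ att l ⟧ * P l))) ΔB ⟩
      Δ * B * (Q * (cl l * (⟦ att l ⟧ * P l)))
        ≡⟨ solve 4 (λ d b q z → d :* b :* (q :* z) := b :* q :* (d :* z)) refl Δ B Q (cl l * (⟦ att l ⟧ * P l)) ⟩
      B * Q * (Δ * (cl l * (⟦ att l ⟧ * P l))) ∎)
      where E = total Ω (hit l)

  -- The submartingale property, with the potential counted as 0 once the cut is destroyed.
  potential-phase : ∀ Δ W M H (H′ : Seed Ω → ℕ) → 1 ≤ W → 2048 * W ≤ Δ * B → H ≤ M →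
    (∀ ω → H′ ω + Δ * gained ω ≤ H) →
    vol Ω * potential W M H ≤ total Ω (λ ω → resp ω * potential W M (H′ ω))
  potential-phase Δ W M H H′ 1≤W ΔB H≤M H′≤ = *-cancelˡ-≤ W {{>-nonZero 1≤W}} (begin
    W * (v * V)
      ≡⟨ solve 3 (λ w v p → w :* (v :* p) := p :* (w :* v)) refl W v V ⟩
    V * (W * v)
      ≤⟨ *-monoʳ-≤ V (balance Δ W ΔB) ⟩
    V * (W * total Ω resp + Δ * total Ω (λ ω → resp ω * gained ω))
      ≡⟨ cong (V *_) (cong₂ _+_ (sym (total-*ˡ Ω W resp)) (sym (total-*ˡ Ω Δ _))) ⟩
    V * (total Ω (λ ω → W * resp ω) + total Ω (λ ω → Δ * (resp ω * gained ω)))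
      ≡⟨ trans (cong (V *_) (sym (total-+ Ω _ _))) (sym (total-*ˡ Ω V _)) ⟩
    total Ω (λ ω → V * (W * resp ω + Δ * (resp ω * gained ω)))
      ≤⟨ total-mono Ω (λ ω → ≤-trans (≤-reflexive (solve 5 (λ p w r d g → p :* (w :* r :+ d :* (r :* g)) := r :* (p :* (w :+ d :* g))) refl V W (resp ω) Δ (gained ω)))
           (≤-trans (*-monoʳ-≤ (resp ω) (potential-step W M H (H′ ω) (Δ * gained ω) (H′≤ ω) H≤M))
             (≤-reflexive (solve 3 (λ r w p → r :* (w :* p) := w :* (r :* p)) refl (resp ω) W (potential W M (H′ ω)))))) ⟩
    total Ω (λ ω → W * (resp ω * potential W M (H′ ω)))
      ≡⟨ total-*ˡ Ω W _ ⟩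
    W * total Ω (λ ω → resp ω * potential W M (H′ ω)) ∎)
    where
    open ≤-Reasoning
    V = potential W M H

module Progress {n : ℕ} (Ω : Code) (att : VSet n) (Q : ℕ) (1≤Q : 1 ≤ Q) (any missed : Fin n → Seed Ω → ℕ)
  (success : ∀ l → att l ≡ true → vol Ω ≤ odds * (Q * total Ω (any l)))
  (exclusive : ∀ l ω → any l ω + missed l ω ≤ 1) where

  -- Each attempt fails with probability at most `1 − 1 / (odds Q)`. The `m − card att` others are
  -- absent from the sum on the left, a gain of 1 for each, which is even more.
  progress : ∀ m → card att ≤ m →
    odds * (Q * total Ω (λ ω → ∑ (λ l → ⟦ att l ⟧ * missed l ω))) + m * vol Ω ≤ odds * (Q * (m * vol Ω))
  progress m a≤m = begin
    odds * (Q * T) + m * v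
      ≡⟨ cong (λ z → odds * (Q * T) + z * v) (sym (m∸n+n≡m a≤m)) ⟩
    odds * (Q * T) + (m ∸ a + a) * v
      ≡⟨ solve 4 (λ x r a v → x :+ (r :+ a) :* v := x :+ a :* v :+ r :* v) refl (odds * (Q * T)) (m ∸ a) a v ⟩
    odds * (Q * T) + a * v + (m ∸ a) * v
      ≤⟨ +-mono-≤ attempted (≤-trans (m≤n*m ((m ∸ a) * v) (odds * Q) {{>-nonZero (*-mono-≤ {1} {odds} 1≤odds 1≤Q)}}) ≤-refl) ⟩
    odds * (Q * (a * v)) + odds * Q * ((m ∸ a) * v)
      ≡⟨ solve 5 (λ o q a v r → o :* (q :* (a :* v)) :+ o :* q :* (r :* v) := o :* (q :* ((r :+ a) :* v))) refl odds Q a v (m ∸ a) ⟩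
    odds * (Q * ((m ∸ a + a) * v))
      ≡⟨ cong (λ z → odds * (Q * (z * v))) (m∸n+n≡m a≤m) ⟩
    odds * (Q * (m * v)) ∎
    where
    open ≤-Reasoning
    v = vol Ω
    a = card att
    T = total Ω (λ ω → ∑ (λ l → ⟦ att l ⟧ * missed l ω))
    Tl : Fin n → ℕ
    Tl l = total Ω (missed l)
    T-eq : T ≡ ∑ (λ l → ⟦ att l ⟧ * Tl l)
    T-eq = trans (total-∑ Ω (λ l ω → ⟦ att l ⟧ * missed l ω)) (∑-cong (λ l → total-*ˡ Ω ⟦ att l ⟧ (missed l)))
    each : ∀ l → att l ≡ true → odds * Q * Tl l + v ≤ odds * Q * v
    each l al = begin
      odds * Q * Tl l + v
        ≤⟨ +-monoʳ-≤ (odds * Q * Tl l) (success l al) ⟩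
      odds * Q * Tl l + odds * (Q * total Ω (any l))
        ≡⟨ solve 4 (λ o q t s → o :* q :* t :+ o :* (q :* s) := o :* q :* (s :+ t)) refl odds Q (Tl l) (total Ω (any l)) ⟩
      odds * Q * (total Ω (any l) + Tl l)
        ≤⟨ *-monoʳ-≤ (odds * Q) (≤-trans (≤-reflexive (sym (total-+ Ω (any l) (missed l))))
             (≤-trans (total-mono Ω (exclusive l)) (≤-reflexive (trans (total-const Ω 1) (*-identityˡ v))))) ⟩
      odds * Q * v ∎
    attempted : odds * (Q * T) + a * v ≤ odds * (Q * (a * v))
    attempted = begin
      odds * (Q * T) + a * v
        ≡⟨ cong₂ _+_ (trans (sym (*-assoc odds Q T)) (trans (cong (odds * Q *_) T-eq) (sym (∑-*ˡ (odds * Q) _)))) (sym (∑-*ʳ v _)) ⟩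
      ∑ (λ l → odds * Q * (⟦ att l ⟧ * Tl l)) + ∑ (λ l → ⟦ att l ⟧ * v)
        ≡⟨ trans (sym (∑-+ (λ l → odds * Q * (⟦ att l ⟧ * Tl l)) _)) (∑-cong (λ l →
             solve 4 (λ k a t v → k :* (a :* t) :+ a :* v := a :* (k :* t :+ v)) refl (odds * Q) ⟦ att l ⟧ (Tl l) v)) ⟩
      ∑ (λ l → ⟦ att l ⟧ * (odds * Q * Tl l + v))
        ≤⟨ ∑-mono (λ l → ⟦⟧*-mono (att l) (each l)) ⟩
      ∑ (λ l → ⟦ att l ⟧ * (odds * Q * v))
        ≡⟨ trans (∑-*ʳ (odds * Q * v) _) (solve 4 (λ o a q v → a :* (o :* q :* v) := o :* (q :* (a :* v))) refl odds a Q v) ⟩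
      odds * (Q * (a * v)) ∎

-- A cut S of fewer than δ edges, where δ bounds all degrees from below

_⊕_ : Bool → Bool → Bool
true  ⊕ b = not b
false ⊕ b = b

⊕-false : ∀ {a b} → (a ⊕ b) ≡ false → a ≡ b
⊕-false {true}  {true}  _ = refl
⊕-false {false} {false} _ = refl

does-elim : {P : Set} (d : Dec P) → does d ≡ true → P
does-elim (yes p) _ = p

respecting? : ∀ {n} (S : VSet n) (lab : Fin n → Fin n) → Dec (Respecting S lab)
respecting? S lab = allᶠ? (λ u → allᶠ? (λ v → (lab u ≟ᶠ lab v) →-dec (S u ≟ᴮ S v)))

opaque

  respects : ∀ {n} → VSet n → (Fin n → Fin n) → Bool
  respects S lab = does (respecting? S lab)

  respects-intro : ∀ {n} {S : VSet n} {lab} → Respecting S lab → respects S lab ≡ true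
  respects-intro {S = S} {lab} = dec-true (respecting? S lab)

  respects-elim : ∀ {n} {S : VSet n} {lab} → respects S lab ≡ true → Respecting S lab
  respects-elim {S = S} {lab} = does-elim (respecting? S lab)

Proper : ∀ {n} → VSet n → Set
Proper S = (∃ λ i → S i ≡ true) × (∃ λ j → S j ≡ false)

proper-or-constant : ∀ {n} (T : VSet n) → Proper T ⊎ (∀ u v → T u ≡ T v)
proper-or-constant T with anyᶠ? (λ i → T i ≟ᴮ true) | anyᶠ? (λ j → T j ≟ᴮ false)
... | yes p | yes q = inj₁ (p , q)
... | no ¬p | _     = inj₂ (λ u v → trans (off u) (sym (off v)))
  where
  off : ∀ u → T u ≡ false
  off u with T u in e
  ... | false = refl
  ... | true  = ⊥-elim (¬p (u , e))
... | yes _ | no ¬q = inj₂ (λ u v → trans (on u) (sym (on v)))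
  where
  on : ∀ u → T u ≡ true
  on u with T u in e
  ... | true  = refl
  ... | false = ⊥-elim (¬q (u , e))

module Cuts {n : ℕ} (G : Graph n) where

  private
    a : Fin n → Fin n → ℕ
    a v w = ⟦ adj G v w ⟧

  crossing : VSet n → Fin n → ℕ
  crossing T v = nb (adj G) v (λ w → T v ⊕ T w)

  ∑crossing : ∀ T → ∑ (crossing T) ≡ 2 * cutSize G T
  ∑crossing T = begin
    ∑ (λ v → ∑ (λ w → ⟦ T v ⊕ T w ⟧ * a v w))
      ≡⟨ ∑-cong (λ v → trans (∑-cong (λ w → pw (T v) (T w) (a v w))) (∑-+ (λ w → F v w) _)) ⟩
    ∑ (λ v → ∑ (F v) + ∑ (λ w → ⟦ T w ⟧ * (⟦ not (T v) ⟧ * a v w)))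
      ≡⟨ ∑-+ (λ v → ∑ (F v)) _ ⟩
    ∑ (λ v → ∑ (F v)) + ∑ (λ v → ∑ (λ w → ⟦ T w ⟧ * (⟦ not (T v) ⟧ * a v w)))
      ≡⟨ cong (∑ (λ v → ∑ (F v)) +_) (trans (∑-swap (λ v w → ⟦ T w ⟧ * (⟦ not (T v) ⟧ * a v w)))
           (∑-cong (λ w → ∑-cong (λ v → cong (λ e → ⟦ T w ⟧ * (⟦ not (T v) ⟧ * ⟦ e ⟧)) (Graph.sym G v w))))) ⟩
    ∑ (λ v → ∑ (F v)) + ∑ (λ v → ∑ (F v))
      ≡⟨ cong₂ _+_ cut cut ⟩
    cutSize G T + cutSize G T
      ≡⟨ cong (cutSize G T +_) (sym (+-identityʳ _)) ⟩
    2 * cutSize G T ∎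
    where
    open ≡-Reasoning
    F : Fin n → Fin n → ℕ
    F v w = ⟦ T v ⟧ * (⟦ not (T w) ⟧ * a v w)
    cut : ∑ (λ v → ∑ (F v)) ≡ cutSize G T
    cut = trans (∑-cong (λ v → ∑-*ˡ ⟦ T v ⟧ _)) (sym (cutSize-form G T))
    pw : ∀ x y z → ⟦ x ⊕ y ⟧ * z ≡ ⟦ x ⟧ * (⟦ not y ⟧ * z) + ⟦ y ⟧ * (⟦ not x ⟧ * z)
    pw true  true  z = refl
    pw true  false z = solve 1 (λ z → con 1 :* z := con 1 :* (con 1 :* z) :+ con 0) refl z
    pw false true  z = solve 1 (λ z → con 1 :* z := con 1 :* (con 1 :* z)) refl z
    pw false false z = refl

  deg : Fin n → ℕ
  deg v = nb (adj G) v (λ _ → true)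

  module _ (C : VSet n) where

    private
      s = card C
      cut-C = form (adj G) C (not ∘ C)

    inside-bound : ∀ v → C v ≡ true → nb (adj G) v C + 1 ≤ s
    inside-bound v Cv = begin
      nb (adj G) v C + 1
        ≡⟨ cong (nb (adj G) v C +_) (sym (∑-δ v (λ _ → 1))) ⟩
      nb (adj G) v C + ∑ (λ w → ⟦ w == v ⟧ * 1)
        ≡⟨ sym (∑-+ (λ w → ⟦ C w ⟧ * a v w) _) ⟩
      ∑ (λ w → ⟦ C w ⟧ * a v w + ⟦ w == v ⟧ * 1)
        ≤⟨ ∑-mono pw ⟩
      s ∎
      where
      open ≤-Reasoning
      pw : ∀ w → ⟦ C w ⟧ * a v w + ⟦ w == v ⟧ * 1 ≤ ⟦ C w ⟧
      pw w with w ≟ᶠ v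
      ... | yes refl = ≤-reflexive (trans (cong (λ e → ⟦ C w ⟧ * ⟦ e ⟧ + 1) (irrefl G w))
                         (trans (cong (_+ 1) (*-zeroʳ ⟦ C w ⟧)) (cong ⟦_⟧ (sym Cv))))
      ... | no _ = ≤-trans (≤-reflexive (+-identityʳ _)) (≤-trans (*-monoʳ-≤ ⟦ C w ⟧ (⟦⟧≤1 (adj G v w))) (≤-reflexive (*-identityʳ _)))

    -- This is where simplicity of the graph enters: a vertex has at most `s − 1` neighbours inside
    -- a cluster of size `s`, so at least `δ + 1 − s` outside.
    cluster-degree : ∀ δ → (∀ v → δ ≤ deg v) → s * δ + s ≤ cut-C + s * s
    cluster-degree δ δ≤ = begin
      s * δ + s
        ≡⟨ solve 2 (λ s d → s :* d :+ s := s :* (d :+ con 1)) refl s δ ⟩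
      s * (δ + 1)
        ≡⟨ sym (∑-*ʳ (δ + 1) _) ⟩
      ∑ (λ v → ⟦ C v ⟧ * (δ + 1))
        ≤⟨ ∑-mono (λ v → ⟦⟧*-mono (C v) (λ Cv → each v Cv)) ⟩
      ∑ (λ v → ⟦ C v ⟧ * (nb (adj G) v (not ∘ C) + s))
        ≡⟨ trans (∑-cong (λ v → *-distribˡ-+ ⟦ C v ⟧ _ s)) (∑-+ (λ v → ⟦ C v ⟧ * nb (adj G) v (not ∘ C)) _) ⟩
      cut-C + ∑ (λ v → ⟦ C v ⟧ * s)
        ≡⟨ cong (cut-C +_) (∑-*ʳ s _) ⟩
      cut-C + s * s ∎
      where
      open ≤-Reasoning
      each : ∀ v → C v ≡ true → δ + 1 ≤ nb (adj G) v (not ∘ C) + s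
      each v Cv = begin
        δ + 1 ≤⟨ +-monoˡ-≤ 1 (δ≤ v) ⟩
        deg v + 1 ≡⟨ cong (_+ 1) (trans (∑-split C (λ w → 1 * a v w)) (trans (+-comm (∑ (λ w → ⟦ C w ⟧ * (1 * a v w))) _)
                       (cong₂ _+_ (∑-cong (λ w → cong (⟦ not (C w) ⟧ *_) (*-identityˡ (a v w))))
                                  (∑-cong (λ w → cong (⟦ C w ⟧ *_) (*-identityˡ (a v w))))))) ⟩
        nb (adj G) v (not ∘ C) + nb (adj G) v C + 1 ≡⟨ +-assoc (nb (adj G) v (not ∘ C)) _ 1 ⟩
        nb (adj G) v (not ∘ C) + (nb (adj G) v C + 1) ≤⟨ +-monoʳ-≤ (nb (adj G) v (not ∘ C)) (inside-bound v Cv) ⟩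
        nb (adj G) v (not ∘ C) + s ∎

    module _ (δ : ℕ) (δ≤ : ∀ v → δ ≤ deg v) (2s≤δ : 2 * s ≤ δ) where

      half-degree : s * δ ≤ 2 * cut-C
      half-degree = +-cancelʳ-≤ (s * (2 * s)) (s * δ) (2 * cut-C) (begin
        s * δ + s * (2 * s)         ≤⟨ +-monoʳ-≤ (s * δ) (*-monoʳ-≤ s 2s≤δ) ⟩
        s * δ + s * δ               ≡⟨ solve 1 (λ x → x :+ x := con 2 :* x) refl (s * δ) ⟩
        2 * (s * δ)                 ≤⟨ *-monoʳ-≤ 2 (≤-trans (m≤m+n (s * δ) s) (cluster-degree δ δ≤)) ⟩
        2 * (cut-C + s * s)         ≡⟨ solve 2 (λ c s → con 2 :* (c :+ s :* s) := con 2 :* c :+ s :* (con 2 :* s)) refl cut-C s ⟩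
        2 * cut-C + s * (2 * s) ∎)
        where open ≤-Reasoning

      δ≤cut : 1 ≤ s → δ ≤ cut-C
      δ≤cut p = +-cancelʳ-≤ (s * s) δ cut-C (≤-trans (convex s δ p (≤-trans (m≤m+n s _) 2s≤δ)) (cluster-degree δ δ≤))
        where
        -- That is `s (δ + 1 − s) ≥ δ`: the left side is concave in `s` and equals `δ` at `s = 1`
        -- and at `s = δ`.
        convex : ∀ s δ → 1 ≤ s → s ≤ δ → δ + s * s ≤ s * δ + s
        convex (suc r) δ _ q = begin
          δ + suc r * suc r           ≡⟨ solve 2 (λ d r → d :+ (con 1 :+ r) :* (con 1 :+ r) := d :+ r :* (con 1 :+ r) :+ (con 1 :+ r)) refl δ r ⟩
          δ + r * suc r + suc r       ≤⟨ +-monoˡ-≤ (suc r) (+-monoʳ-≤ δ (*-monoʳ-≤ r q)) ⟩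
          suc r * δ + suc r ∎
          where open ≤-Reasoning

    module _ (S : VSet n) (C-side : ∀ u v → C u ≡ true → C v ≡ true → S u ≡ S v)
      (minimal : ∀ T → Proper T → cutSize G S ≤ cutSize G T) (S<C : cutSize G S < cut-C) where

      private
        T : VSet n
        T v = S v ⊕ C v

        cl : ℕ
        cl = ∑ (λ v → ⟦ C v ⟧ * crossing S v)

        pq : Fin n → Fin n → ℕ
        pq v w = ⟦ (S v ⊕ S w) ∧ (C v ⊕ C w) ⟧ * a v w

        cut-C-eq : cutSize G C ≡ cut-C
        cut-C-eq = cutSize-form G C

        both : ∑ (λ v → ∑ (pq v)) ≡ 2 * cl
        both = begin
          ∑ (λ v → ∑ (pq v))
            ≡⟨ ∑-cong (λ v → trans (∑-cong (λ w → pw v w)) (∑-+ (λ w → ⟦ C v ⟧ * (⟦ S v ⊕ S w ⟧ * a v w)) _)) ⟩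
          ∑ (λ v → ∑ (λ w → ⟦ C v ⟧ * (⟦ S v ⊕ S w ⟧ * a v w)) + ∑ (λ w → ⟦ C w ⟧ * (⟦ S w ⊕ S v ⟧ * a w v)))
            ≡⟨ ∑-+ (λ v → ∑ (λ w → ⟦ C v ⟧ * (⟦ S v ⊕ S w ⟧ * a v w))) _ ⟩
          ∑ (λ v → ∑ (λ w → ⟦ C v ⟧ * (⟦ S v ⊕ S w ⟧ * a v w))) + ∑ (λ v → ∑ (λ w → ⟦ C w ⟧ * (⟦ S w ⊕ S v ⟧ * a w v)))
            ≡⟨ cong₂ _+_ half (trans (∑-swap (λ v w → ⟦ C w ⟧ * (⟦ S w ⊕ S v ⟧ * a w v))) half) ⟩
          cl + cl
            ≡⟨ cong (cl +_) (sym (+-identityʳ cl)) ⟩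
          2 * cl ∎
          where
          open ≡-Reasoning
          half : ∑ (λ v → ∑ (λ w → ⟦ C v ⟧ * (⟦ S v ⊕ S w ⟧ * a v w))) ≡ cl
          half = ∑-cong (λ v → ∑-*ˡ ⟦ C v ⟧ _)
          pw : ∀ v w → pq v w ≡ ⟦ C v ⟧ * (⟦ S v ⊕ S w ⟧ * a v w) + ⟦ C w ⟧ * (⟦ S w ⊕ S v ⟧ * a w v)
          pw v w = trans (table (S v) (S w) (C v) (C w) (a v w) (C-side v w))
                     (cong (λ e → ⟦ C v ⟧ * (⟦ S v ⊕ S w ⟧ * a v w) + ⟦ C w ⟧ * (⟦ S w ⊕ S v ⟧ * ⟦ e ⟧)) (Graph.sym G v w))
            where
            table : ∀ x y c d z → (c ≡ true → d ≡ true → x ≡ y) →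
              ⟦ (x ⊕ y) ∧ (c ⊕ d) ⟧ * z ≡ ⟦ c ⟧ * (⟦ x ⊕ y ⟧ * z) + ⟦ d ⟧ * (⟦ y ⊕ x ⟧ * z)
            table true  true  true  true  z h = refl
            table true  true  true  false z h = refl
            table true  true  false true  z h = refl
            table true  true  false false z h = refl
            table false false true  true  z h = refl
            table false false true  false z h = refl
            table false false false true  z h = refl
            table false false false false z h = refl
            table true  false true  true  z h with h refl refl
            ... | ()
            table false true  true  true  z h with h refl refl
            ... | ()
            table true  false true  false z h = solve 1 (λ z → con 1 :* z := con 1 :* (con 1 :* z) :+ con 0) refl z
            table false true  true  false z h = solve 1 (λ z → con 1 :* z := con 1 :* (con 1 :* z) :+ con 0) refl z
            table true  false false true  z h = solve 1 (λ z → con 1 :* z := con 1 :* (con 1 :* z)) refl z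
            table false true  false true  z h = solve 1 (λ z → con 1 :* z := con 1 :* (con 1 :* z)) refl z
            table true  false false false z h = refl
            table false true  false false z h = refl

        -- The identity `|S ⊕ C| + 2 cl = |S| + |C|` for numbers of cut edges, doubled because the
        -- sums run over ordered pairs.
        flip : 2 * cutSize G T + 2 * (2 * cl) ≡ 2 * cutSize G S + 2 * cut-C
        flip = begin
          2 * cutSize G T + 2 * (2 * cl)
            ≡⟨ cong₂ _+_ (sym (∑crossing T)) (cong (2 *_) (sym both)) ⟩
          ∑ (crossing T) + 2 * ∑ (λ v → ∑ (pq v))
            ≡⟨ cong (∑ (crossing T) +_) (trans (sym (∑-*ˡ 2 _)) (∑-cong (λ v → sym (∑-*ˡ 2 (pq v))))) ⟩
          ∑ (crossing T) + ∑ (λ v → ∑ (λ w → 2 * pq v w))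
            ≡⟨ trans (sym (∑-+ (crossing T) _)) (∑-cong (λ v → sym (∑-+ (λ w → ⟦ T v ⊕ T w ⟧ * a v w) _))) ⟩
          ∑ (λ v → ∑ (λ w → ⟦ T v ⊕ T w ⟧ * a v w + 2 * pq v w))
            ≡⟨ ∑-cong (λ v → ∑-cong (λ w → table (S v) (C v) (S w) (C w) (a v w))) ⟩
          ∑ (λ v → ∑ (λ w → ⟦ S v ⊕ S w ⟧ * a v w + ⟦ C v ⊕ C w ⟧ * a v w))
            ≡⟨ trans (∑-cong (λ v → ∑-+ (λ w → ⟦ S v ⊕ S w ⟧ * a v w) _)) (∑-+ (crossing S) (crossing C)) ⟩
          ∑ (crossing S) + ∑ (crossing C)
            ≡⟨ cong₂ _+_ (∑crossing S) (trans (∑crossing C) (cong (2 *_) cut-C-eq)) ⟩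
          2 * cutSize G S + 2 * cut-C ∎
          where
          open ≡-Reasoning
          table : ∀ x c y d z → ⟦ (x ⊕ c) ⊕ (y ⊕ d) ⟧ * z + 2 * (⟦ (x ⊕ y) ∧ (c ⊕ d) ⟧ * z) ≡ ⟦ x ⊕ y ⟧ * z + ⟦ c ⊕ d ⟧ * z
          table true  true  true  true  z = refl
          table true  true  true  false z = +-identityʳ _
          table true  true  false true  z = refl
          table true  true  false false z = solve 1 (λ z → con 2 :* (con 1 :* z) := con 1 :* z :+ con 1 :* z) refl z
          table true  false true  true  z = +-identityʳ _
          table true  false true  false z = refl
          table true  false false true  z = solve 1 (λ z → con 2 :* (con 1 :* z) := con 1 :* z :+ con 1 :* z) refl z
          table true  false false false z = refl
          table false true  true  true  z = refl
          table false true  true  false z = solve 1 (λ z → con 2 :* (con 1 :* z) := con 1 :* z :+ con 1 :* z) refl z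
          table false true  false true  z = refl
          table false true  false false z = +-identityʳ _
          table false false true  true  z = solve 1 (λ z → con 2 :* (con 1 :* z) := con 1 :* z :+ con 1 :* z) refl z
          table false false true  false z = refl
          table false false false true  z = +-identityʳ _
          table false false false false z = refl

      -- Moving the cluster to the other side of the cut must not make the cut smaller, so at most
      -- half of the boundary of `C` belongs to it. If the moved set is not proper, then `S` is `C`
      -- or its complement, and the two cuts have equal size, against `S<C`.
      minority : 2 * ∑ (λ v → ⟦ C v ⟧ * crossing S v) ≤ cut-C
      minority with proper-or-constant T
      ... | inj₁ proper = *-cancelˡ-≤ 2 (+-cancelˡ-≤ (2 * cutSize G S) _ _ (≤-trans
              (+-monoˡ-≤ (2 * (2 * cl)) (*-monoʳ-≤ 2 (minimal T proper))) (≤-reflexive flip)))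
      ... | inj₂ constant = ⊥-elim (<-irrefl equal S<C)
        where
        xor-cancel : ∀ x c y d → (x ⊕ c) ≡ (y ⊕ d) → (x ⊕ y) ≡ (c ⊕ d)
        xor-cancel true  true  true  true  _ = refl
        xor-cancel true  true  false false _ = refl
        xor-cancel true  false true  false _ = refl
        xor-cancel true  false false true  _ = refl
        xor-cancel false true  true  false _ = refl
        xor-cancel false true  false true  _ = refl
        xor-cancel false false true  true  _ = refl
        xor-cancel false false false false _ = refl
        equal : cutSize G S ≡ cut-C
        equal = *-cancelˡ-≡ (cutSize G S) cut-C 2 (trans (sym (∑crossing S)) (trans
          (∑-cong (λ v → ∑-cong (λ w → cong (λ e → ⟦ e ⟧ * a v w) (xor-cancel (S v) (C v) (S w) (C w) (constant v w)))))
          (trans (∑crossing C) (cong (2 *_) cut-C-eq))))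

-- A contraction phase seen by a minimum cut

module ContractStep {n : ℕ} (k L q b δ ℓ : ℕ) (lab : Fin n → Fin n) (fz : VSet n)
  (G : Graph n) (n≤2^L : n ≤ 2 ^ L) (n²≤2^b : n * n ≤ 2 ^ b)
  (lower : LowerSize ℓ lab fz) (all-unfrozen : 2 ^ suc (suc ℓ) < δ → ∀ l → fz l ≡ false)
  (δ≤ : ∀ v → δ ≤ Cuts.deg G v) (4096≤Q : 4096 ≤ 2 ^ q) where

  open ContractAverage k L q b δ ℓ lab fz G n≤2^L n²≤2^b public
  open Cuts G

  bound-pos : 1 ≤ bound
  bound-pos = *-mono-≤ (m^n>0 2 ℓ) (aux (2 ^ suc (suc ℓ) <ᵇ δ) refl)
    where
    aux : ∀ c → (2 ^ suc (suc ℓ) <ᵇ δ) ≡ c → 1 ≤ (if c then δ else 32)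
    aux true  e = ≤-trans (s≤s z≤n) (<ᵇ-true {2 ^ suc (suc ℓ)} e)
    aux false e = s≤s z≤n

  bound-low : 2 ^ suc (suc ℓ) < δ → bound ≡ 2 ^ ℓ * δ
  bound-low p = cong (2 ^ ℓ *_) (if-true (<ᵇ-intro p))

  bound-high : δ ≤ 2 ^ suc (suc ℓ) → bound ≡ 2 ^ ℓ * 32
  bound-high p = cong (2 ^ ℓ *_) (if-false (aux (bool-cases (2 ^ suc (suc ℓ) <ᵇ δ))))
    where
    aux : (2 ^ suc (suc ℓ) <ᵇ δ) ≡ true ⊎ (2 ^ suc (suc ℓ) <ᵇ δ) ≡ false → (2 ^ suc (suc ℓ) <ᵇ δ) ≡ false
    aux (inj₁ t) = ⊥-elim (<⇒≱ (<ᵇ-true {2 ^ suc (suc ℓ)} t) p)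
    aux (inj₂ f) = f

  8δ≤bound : δ ≤ 2 ^ suc (suc ℓ) → 8 * δ ≤ bound
  8δ≤bound p = ≤-trans (*-monoʳ-≤ 8 p) (≤-reflexive (trans (solve 1 (λ x → con 8 :* (con 2 :* (con 2 :* x)) := x :* con 32) refl (2 ^ ℓ)) (sym (bound-high p))))

  δ≤bound : δ ≤ bound
  δ≤bound with 2 ^ suc (suc ℓ) <? δ
  ... | yes p = ≤-trans (m≤n*m δ (2 ^ ℓ) {{m^n≢0 2 ℓ}}) (≤-reflexive (sym (bound-low p)))
  ... | no ¬p = ≤-trans (m≤n*m δ 8) (8δ≤bound (≮⇒≥ ¬p))

  small-size : ∀ l → small l ≡ true → 1 ≤ size l × size l < 2 ^ suc ℓ
  small-size l sl = <ᵇ-true (proj₁ (∧-true {0 <ᵇ size l} r)) , <ᵇ-true (proj₂ (∧-true {0 <ᵇ size l} r))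
    where r = proj₂ (∧-true {not (fz l)} sl)

  small-lower : ∀ l → small l ≡ true → 2 ^ ℓ ≤ size l
  small-lower l sl = lower l (not-true (proj₁ (∧-true {not (fz l)} sl))) (proj₁ (small-size l sl))

  degreeOut-cut : (∀ l → fz l ≡ false) → ∀ l → degreeOut l ≡ form (adj G) (inC l) (not ∘ inC l)
  degreeOut-cut h l = ∑-cong (λ v → cong (⟦ inC l v ⟧ *_) (nb-cong (adj G) v (λ w → cong (λ f → not f ∧ not (inC l w)) (h (lab w)))))

  twice-size : 2 ^ suc (suc ℓ) < δ → ∀ l → small l ≡ true → 2 * size l ≤ δ
  twice-size p l sl = ≤-trans (*-monoʳ-≤ 2 (<⇒≤ (proj₂ (small-size l sl)))) (<⇒≤ p)

  -- At these levels nothing is frozen and a small cluster has at most `δ / 2` vertices, so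
  -- `half-degree` gives it out-degree at least `size · δ / 2`, half of `bound` or more.
  low-impossible : 2 ^ suc (suc ℓ) < δ → ∀ l → lowD l ≡ false
  low-impossible p l with bool-cases (lowD l)
  ... | inj₂ f = f
  ... | inj₁ t = ⊥-elim (<⇒≱ (≤ᵇ-false {bound} (not-true (proj₂ (∧-true {small l} t)))) (begin
    bound                   ≡⟨ bound-low p ⟩
    2 ^ ℓ * δ               ≤⟨ *-monoˡ-≤ δ (small-lower l sl) ⟩
    size l * δ              ≤⟨ half-degree (inC l) δ δ≤ (twice-size p l sl) ⟩
    2 * form (adj G) (inC l) (not ∘ inC l) ≡⟨ cong (2 *_) (sym (trans (D-eq l sl) (degreeOut-cut (all-unfrozen p) l))) ⟩
    2 * D l ∎))
    where
    open ≤-Reasoning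
    sl = proj₁ (∧-true {small l} t)

  att-bound : ∀ l → attD l ≡ true → bound ≤ 2 * D l
  att-bound l al = ≤ᵇ-true (proj₂ (∧-true {small l} al))

  D-pos : ∀ l → attD l ≡ true → 1 ≤ D l
  D-pos l al with zero-or-pos (D l)
  ... | inj₂ p = p
  ... | inj₁ z = ⊥-elim (1+n≰n (≤-trans bound-pos (≤-trans (att-bound l al) (≤-reflexive (cong (2 *_) z)))))

  tgt-go : ∀ x s β l w → tgt x s β l ≡ just w → go x D (W x) l ≡ true
  tgt-go x s β l w e with bool-cases (go x D (W x) l)
  ... | inj₁ g = g
  ... | inj₂ g with trans (sym (if-false g)) e
  ...   | ()

  no-go : ∀ x s β l → inX x l ≡ false → tgt x s β l ≡ nothing
  no-go x s β l nX = if-false (aux (bool-cases (go x D (W x) l)))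
    where
    aux : go x D (W x) l ≡ true ⊎ go x D (W x) l ≡ false → go x D (W x) l ≡ false
    aux (inj₂ f) = f
    aux (inj₁ t) = ⊥-elim (true≢false (trans (sym (Fixed.X-l x l t)) nX))

  att-not-low : ∀ l → attD l ≡ true → lowD l ≡ false
  att-not-low l al = trans (cong (λ c → small l ∧ not c) (proj₂ (∧-true {small l} al))) (∧-false (small l))
    where
    ∧-false : ∀ a → (a ∧ false) ≡ false
    ∧-false true  = refl
    ∧-false false = refl

  t-small : ∀ x s β l w → tgt x s β l ≡ just w → small l ≡ true × lowD l ≡ false
  t-small x s β l w e = Fixed.small-l x l g , att-not-low l (Fixed.att-l x l g)
    where g = tgt-go x s β l w e

  t-target : ∀ x s β l w → tgt x s β l ≡ just w → fz (lab w) ≡ false × tgt x s β (lab w) ≡ nothing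
  t-target x s β l w e = not-true (proj₁ (∧-true {act w} Yw)) , no-go x s β (lab w) (not-true (proj₂ (∧-true {act w} Yw)))
    where Yw = Fixed.tgt-Y x l (tgt-go x s β l w e) s β w e

  low-small : ∀ l → lowD l ≡ true → small l ≡ true
  low-small l p = proj₁ (∧-true {small l} p)

  small-not-low : ∀ l → (small l ∧ not (lowD l)) ≡ attD l
  small-not-low l = table (small l) (bound ≤ᵇ 2 * D l)
    where
    table : ∀ a c → (a ∧ not (a ∧ not c)) ≡ (a ∧ c)
    table true  true  = refl
    table true  false = refl
    table false c     = refl

  module At (ω : Seed Ω) where
    private
      x = proj₁ ω
      s = proj₁ (proj₂ ω)
      β = proj₂ (proj₂ ω)
    open Merge lab fz lowD (tgt x s β) public
    open Facts ℓ (t-small x s β) (t-target x s β) low-small public using (lower′; small′-sum; small′-count; respects′; frozen-count; frozenEdges-step; new)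

  tgtΩ : Fin n → Seed Ω → Maybe (Fin n)
  tgtΩ l (x , s , β) = tgt x s β l

  missed : Fin n → Seed Ω → ℕ
  missed l ω = ⟦ isNothing (tgtΩ l ω) ⟧

  picked : Fin n → Seed Ω → ℕ
  picked l ω = ⟦ not (isNothing (tgtΩ l ω)) ⟧

  small-count : ∀ ω → card (smallOf ℓ (At.lab′ ω) (At.fz′ ω)) ≤ ∑ (λ l → ⟦ attD l ⟧ * missed l ω)
  small-count ω = ≤-trans (At.small′-count ω lower) (≤-reflexive (∑-cong (λ l →
    trans (⟦∧⟧ (small l ∧ not (lowD l)) _) (cong (λ c → ⟦ c ⟧ * missed l ω) (small-not-low l)))))

  edges-true : ∀ l → attD l ≡ true → edges (λ _ _ → true) l ≡ D l
  edges-true l al = trans (∑-cong (λ v → cong (⟦ inC l v ⟧ *_) (nb-cong (adj G) v (λ w → ∧-true-r (out l w)))))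
    (sym (D-eq l (proj₁ (∧-true {small l} al))))
    where
    ∧-true-r : ∀ c → (c ∧ true) ≡ c
    ∧-true-r true  = refl
    ∧-true-r false = refl

  4≤Q : 4 ≤ Q
  4≤Q = ≤-trans (s≤s (s≤s (s≤s (s≤s z≤n)))) 4096≤Q

  progress-contract : odds * (Q * total Ω (λ ω → card (smallOf ℓ (At.lab′ ω) (At.fz′ ω)))) + card small * vol Ω ≤
                      odds * (Q * (card small * vol Ω))
  progress-contract = ≤-trans (+-monoˡ-≤ (card small * vol Ω) (*-monoʳ-≤ odds (*-monoʳ-≤ Q (total-mono Ω small-count))))
    (Progress.progress Ω attD Q (≤-trans (s≤s z≤n) 4≤Q) (eventΩ (λ _ _ → true)) missed
      (λ l al → success-lower (λ _ _ → true) l al (D-pos l al)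
        (≤-trans (≤-reflexive (sym (edges-true l al))) (m≤n*m (edges (λ _ _ → true) l) 2)) 4≤Q)
      exclusive (card small) (card-mono {V = small} (λ l p → proj₁ (∧-true {small l} p))))
    where
    exclusive : ∀ l ω → eventΩ (λ _ _ → true) l ω + missed l ω ≤ 1
    exclusive l (x , s , β) with tgt x s β l
    ... | nothing = ≤-refl
    ... | just w  = ≤-refl

  module MinCut (S : VSet n) (minimal : ∀ T → Proper T → cutSize G S ≤ cutSize G T) (S<δ : cutSize G S < δ)
    (res : Respecting S lab) where

    side : VSet n
    side l = anyᵇ (λ v → (lab v == l) ∧ S v)

    side-eq : ∀ v → side (lab v) ≡ S v
    side-eq v with bool-cases (S v)
    ... | inj₁ t = trans (anyᵇ-intro (λ u → (lab u == lab v) ∧ S u) v (∧-intro (==-refl (lab v)) t)) (sym t)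
    ... | inj₂ f with bool-cases (side (lab v))
    ...   | inj₂ f′ = trans f′ (sym f)
    ...   | inj₁ t with anyᵇ-elim (λ u → (lab u == lab v) ∧ S u) t
    ...     | u , p = ⊥-elim (true≢false (trans (sym (proj₂ (∧-true {lab u == lab v} p)))
                        (trans (res u v (==⇒≡ {i = lab u} (proj₁ (∧-true {lab u == lab v} p)))) f)))

    cross safe : Fin n → Fin n → Bool
    cross l w = side l ⊕ S w
    safe l w = not (side l ⊕ S w)

    cl : Fin n → ℕ
    cl l = ∑ (λ v → ⟦ inC l v ⟧ * crossing S v)

    ∑cl : ∑ cl ≡ 2 * cutSize G S
    ∑cl = trans (sym (∑-fibre lab (crossing S))) (∑crossing S)

    edges-cross : ∀ l → edges cross l ≤ cl l
    edges-cross l = ∑-mono (λ v → ⟦⟧*-mono (inC l v) (λ p → nb-mono (adj G) v {λ w → out l w ∧ cross l w} {λ w → S v ⊕ S w}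
      (λ w r → subst (λ z → (z ⊕ S w) ≡ true) (trans (cong side (sym (==⇒≡ {i = lab v} p))) (side-eq v)) (proj₂ (∧-true {out l w} r)))))

    edges-sum : ∀ l → attD l ≡ true → D l ≡ edges cross l + edges safe l
    edges-sum l al = trans (sym (edges-true l al)) (trans (∑-cong (λ v → trans (cong (⟦ inC l v ⟧ *_) (inner v)) (*-distribˡ-+ ⟦ inC l v ⟧ _ _)))
      (∑-+ (λ v → ⟦ inC l v ⟧ * nb (adj G) v (λ w → out l w ∧ cross l w)) _))
      where
      inner : ∀ v → nb (adj G) v (λ w → out l w ∧ true) ≡ nb (adj G) v (λ w → out l w ∧ cross l w) + nb (adj G) v (λ w → out l w ∧ safe l w)
      inner v = trans (∑-cong (λ w → trans (cong (_* ⟦ adj G v w ⟧) (table (out l w) (cross l w))) (*-distribʳ-+ ⟦ adj G v w ⟧ ⟦ out l w ∧ cross l w ⟧ _)))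
        (∑-+ (λ w → ⟦ out l w ∧ cross l w ⟧ * ⟦ adj G v w ⟧) _)
        where
        table : ∀ a c → ⟦ a ∧ true ⟧ ≡ ⟦ a ∧ c ⟧ + ⟦ a ∧ not c ⟧
        table true  true  = refl
        table true  false = refl
        table false c     = refl

    -- At early levels by moving the cluster across the cut; at late levels because the whole cut
    -- has fewer than `δ` edges while the out-degree is at least `4 δ`.
    minority-cross : ∀ l → attD l ≡ true → 2 * edges cross l ≤ D l
    minority-cross l al with 2 ^ suc (suc ℓ) <? δ
    ... | yes p = begin
      2 * edges cross l  ≤⟨ *-monoʳ-≤ 2 (edges-cross l) ⟩
      2 * cl l           ≤⟨ minority (inC l) S sides minimal
                              (<-≤-trans S<δ (δ≤cut (inC l) δ δ≤ (twice-size p l sl) (proj₁ (small-size l sl)))) ⟩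
      form (adj G) (inC l) (not ∘ inC l) ≡⟨ sym (trans (D-eq l sl) (degreeOut-cut (all-unfrozen p) l)) ⟩
      D l ∎
      where
      open ≤-Reasoning
      sl = proj₁ (∧-true {small l} al)
      sides : ∀ u v → inC l u ≡ true → inC l v ≡ true → S u ≡ S v
      sides u v p q = res u v (trans (==⇒≡ {i = lab u} p) (sym (==⇒≡ {i = lab v} q)))
    ... | no ¬p = *-cancelˡ-≤ 2 (begin
      2 * (2 * edges cross l)       ≤⟨ *-monoʳ-≤ 2 (*-monoʳ-≤ 2 (≤-trans (edges-cross l) (∑-≥ cl l))) ⟩
      2 * (2 * ∑ cl)                ≡⟨ cong (λ z → 2 * (2 * z)) ∑cl ⟩
      2 * (2 * (2 * cutSize G S))   ≡⟨ solve 1 (λ x → con 2 :* (con 2 :* (con 2 :* x)) := con 8 :* x) refl (cutSize G S) ⟩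
      8 * cutSize G S               ≤⟨ *-monoʳ-≤ 8 (<⇒≤ S<δ) ⟩
      8 * δ                         ≤⟨ 8δ≤bound (≮⇒≥ ¬p) ⟩
      bound                         ≤⟨ att-bound l al ⟩
      2 * D l ∎)
      where open ≤-Reasoning

    D≤2safe : ∀ l → attD l ≡ true → D l ≤ 2 * edges safe l
    D≤2safe l al = +-cancelˡ-≤ (D l) _ _ (begin
      D l + D l                                   ≡⟨ cong₂ _+_ (edges-sum l al) (edges-sum l al) ⟩
      (edges cross l + edges safe l) + (edges cross l + edges safe l)
        ≡⟨ solve 2 (λ c s → (c :+ s) :+ (c :+ s) := con 2 :* c :+ con 2 :* s) refl (edges cross l) (edges safe l) ⟩
      2 * edges cross l + 2 * edges safe l        ≤⟨ +-monoˡ-≤ _ (minority-cross l al) ⟩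
      D l + 2 * edges safe l ∎)
      where open ≤-Reasoning

    resp : Seed Ω → ℕ
    resp ω = ⟦ respects S (At.lab′ ω) ⟧

    event-off : ∀ c l ω → attD l ≡ false → eventΩ c l ω ≡ 0
    event-off c l (x , s , β) na with tgt x s β l in e
    ... | nothing = refl
    ... | just w  = ⊥-elim (true≢false (trans (sym (Fixed.att-l x l (tgt-go x s β l w e))) na))

    no-hit : ∀ ω → ∑ (λ l → eventΩ cross l ω) ≡ 0 → Respecting S (At.lab′ ω)
    no-hit ω@(x , s , β) z = At.respects′ ω S res λ v w e → trans (sym (side-eq v)) (⊕-false (off (lab v) w e))
      where
      off : ∀ l w → tgt x s β l ≡ just w → cross l w ≡ false
      off l w e with bool-cases (cross l w)
      ... | inj₂ f = f
      ... | inj₁ t = ⊥-elim (1+n≰n (≤-trans (≤-trans (≤-reflexive (sym (trans (cong (λ m → ⟦ maybe (cross l) false m ⟧) e) (cong ⟦_⟧ t))))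
                       (∑-≥ (λ l → eventΩ cross l ω) l)) (≤-reflexive z)))

    resp-yes : ∀ ω → Respecting S (At.lab′ ω) → resp ω ≡ 1
    resp-yes ω r = cong ⟦_⟧ (respects-intro r)

    some-hit : ∀ ω → 1 ≤ resp ω + ∑ (λ l → eventΩ cross l ω)
    some-hit ω with zero-or-pos (∑ (λ l → eventΩ cross l ω))
    ... | inj₁ z = ≤-trans (≤-reflexive (sym (resp-yes ω (no-hit ω z)))) (m≤m+n _ _)
    ... | inj₂ p = ≤-trans p (m≤n+m _ (resp ω))

    -- If `l` picks a safe edge and the cut is destroyed all the same, some other cluster has picked
    -- an edge of it, and `l` was a caller at that time.
    safe-picked : ∀ l ω → attD l ≡ true → eventΩ safe l ω ≤
      resp ω * picked l ω + ∑ (λ l′ → ⟦ not (l′ == l) ⟧ * (⟦ inXΩ ω l ⟧ * eventΩ cross l′ ω))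
    safe-picked l ω@(x , s , β) al = by-target (tgt x s β l) refl
      where
      others : ℕ
      others = ∑ (λ l′ → ⟦ not (l′ == l) ⟧ * (⟦ inX x l ⟧ * event cross l′ x s β))
      by-target : ∀ m → tgt x s β l ≡ m → ⟦ maybe (safe l) false m ⟧ ≤ resp ω * ⟦ not (isNothing m) ⟧ + others
      by-target nothing  e = z≤n
      by-target (just w) e with bool-cases (safe l w)
      ... | inj₂ f = ≤-trans (≤-reflexive (cong ⟦_⟧ f)) z≤n
      ... | inj₁ t with zero-or-pos (∑ (λ l → eventΩ cross l ω))
      ...   | inj₁ z = ≤-trans (⟦⟧≤1 (safe l w)) (≤-trans (≤-reflexive (sym (trans (*-identityʳ (resp ω)) (resp-yes ω (no-hit ω z))))) (m≤m+n _ others))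
      ...   | inj₂ p with ∑-pos (λ l → eventΩ cross l ω) p
      ...     | l′ , p′ = ≤-trans (⟦⟧≤1 (safe l w)) (≤-trans (≤-trans p′ (≤-reflexive (sym (trans (⟦⟧*-1 _ (cong not (≢⇒== ne)))
                            (⟦⟧*-1 (event cross l′ x s β) (Fixed.X-l x l (tgt-go x s β l w e)))))))
                            (≤-trans (∑-≥ (λ l′ → ⟦ not (l′ == l) ⟧ * (⟦ inX x l ⟧ * event cross l′ x s β)) l′) (m≤n+m others _)))
        where
        ne : l′ ≢ l
        ne refl = 1+n≰n (≤-trans p′ (≤-reflexive (trans (cong (λ m → ⟦ maybe (cross l) false m ⟧) e) (cong ⟦_⟧ (not-true t)))))

    hits : ∀ l → bound * EΩ cross l * Q ≤ 16 * (⟦ attD l ⟧ * cl l * vol Ω)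
    hits l with bool-cases (attD l)
    ... | inj₂ na = ≤-trans (≤-reflexive (trans (cong (λ z → bound * z * Q) (trans (total-cong Ω (λ ω → event-off cross l ω na)) (total-const Ω 0)))
                      (cong (_* Q) (*-zeroʳ bound)))) z≤n
    ... | inj₁ al = begin
      bound * EΩ cross l * Q            ≤⟨ *-monoˡ-≤ Q (*-monoˡ-≤ (EΩ cross l) (att-bound l al)) ⟩
      2 * D l * EΩ cross l * Q          ≡⟨ solve 3 (λ d e q → con 2 :* d :* e :* q := con 2 :* (d :* e :* q)) refl (D l) (EΩ cross l) Q ⟩
      2 * (D l * EΩ cross l * Q)        ≤⟨ *-monoʳ-≤ 2 (hits-upper cross l) ⟩
      2 * (8 * (edges cross l * vol Ω)) ≤⟨ *-monoʳ-≤ 2 (*-monoʳ-≤ 8 (*-monoˡ-≤ (vol Ω) (edges-cross l))) ⟩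
      2 * (8 * (cl l * vol Ω))          ≡⟨ sym (*-assoc 2 8 (cl l * vol Ω)) ⟩
      16 * (cl l * vol Ω)               ≡⟨ cong (λ z → 16 * (z * vol Ω)) (sym (⟦⟧*-1 (cl l) al)) ⟩
      16 * (⟦ attD l ⟧ * cl l * vol Ω) ∎
      where open ≤-Reasoning

    pairs : ∀ l′ l → l′ ≢ l → bound * total Ω (λ ω → ⟦ inXΩ ω l ⟧ * eventΩ cross l′ ω) * (Q * Q) ≤ 16 * (cl l′ * vol Ω)
    pairs l′ l ne with bool-cases (attD l′)
    ... | inj₂ na = ≤-trans (≤-reflexive (trans (cong (λ z → bound * z * (Q * Q)) (trans (total-cong Ω (λ ω →
                      trans (cong (⟦ inXΩ ω l ⟧ *_) (event-off cross l′ ω na)) (*-zeroʳ ⟦ inXΩ ω l ⟧))) (total-const Ω 0))) (cong (_* (Q * Q)) (*-zeroʳ bound)))) z≤n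
    ... | inj₁ al = begin
      bound * T * (Q * Q)                ≤⟨ *-monoˡ-≤ (Q * Q) (*-monoˡ-≤ T (att-bound l′ al)) ⟩
      2 * D l′ * T * (Q * Q)             ≡⟨ solve 3 (λ d e q → con 2 :* d :* e :* q := con 2 :* (d :* e :* q)) refl (D l′) T (Q * Q) ⟩
      2 * (D l′ * T * (Q * Q))           ≤⟨ *-monoʳ-≤ 2 (hits-pair cross l′ l ne) ⟩
      2 * (8 * (edges cross l′ * vol Ω)) ≤⟨ *-monoʳ-≤ 2 (*-monoʳ-≤ 8 (*-monoˡ-≤ (vol Ω) (edges-cross l′))) ⟩
      2 * (8 * (cl l′ * vol Ω))          ≡⟨ sym (*-assoc 2 8 (cl l′ * vol Ω)) ⟩
      16 * (cl l′ * vol Ω) ∎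
      where
      open ≤-Reasoning
      T = total Ω (λ ω → ⟦ inXΩ ω l ⟧ * eventΩ cross l′ ω)

    -- The ends of edges of `S` inside small clusters: all that can still be hit at this level.
    exposed : (Fin n → Fin n) → VSet n → ℕ
    exposed lab fz = ∑ (λ v → crossing S v * ⟦ smallOf ℓ lab fz (lab v) ⟧)

    private
      module PA = PhaseAnalysis Ω attD cl (eventΩ cross) (eventΩ safe) picked inXΩ resp Q bound 4096≤Q bound-pos
        some-hit safe-picked hits pairs
        (λ l al → success-lower safe l al (D-pos l al) (D≤2safe l al) 4≤Q)
        (≤-trans (≤-reflexive ∑cl) (*-monoʳ-≤ 2 (≤-trans (<⇒≤ S<δ) δ≤bound)))

    exposed-drop : ∀ ω → exposed (At.lab′ ω) (At.fz′ ω) + PA.gained ω ≤ exposed lab fz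
    exposed-drop ω = begin
      exposed (At.lab′ ω) (At.fz′ ω) + PA.gained ω
        ≤⟨ +-mono-≤ (At.small′-sum ω lower (crossing S)) (≤-reflexive gained-eq) ⟩
      ∑ (λ v → crossing S v * ⟦ (small (lab v) ∧ not (lowD (lab v))) ∧ isNothing (tgtΩ (lab v) ω) ⟧) +
      ∑ (λ v → crossing S v * (⟦ attD (lab v) ⟧ * picked (lab v) ω))
        ≡⟨ sym (∑-+ (λ v → crossing S v * ⟦ (small (lab v) ∧ not (lowD (lab v))) ∧ isNothing (tgtΩ (lab v) ω) ⟧) _) ⟩
      ∑ (λ v → crossing S v * ⟦ (small (lab v) ∧ not (lowD (lab v))) ∧ isNothing (tgtΩ (lab v) ω) ⟧ +
               crossing S v * (⟦ attD (lab v) ⟧ * picked (lab v) ω))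
        ≤⟨ ∑-mono (λ v → ≤-trans (≤-reflexive (sym (*-distribˡ-+ (crossing S v) _ _))) (*-monoʳ-≤ (crossing S v) (pw (lab v)))) ⟩
      exposed lab fz ∎
      where
      open ≤-Reasoning
      gained-eq : PA.gained ω ≡ ∑ (λ v → crossing S v * (⟦ attD (lab v) ⟧ * picked (lab v) ω))
      gained-eq = sym (trans (∑-fibre lab (λ v → crossing S v * (⟦ attD (lab v) ⟧ * picked (lab v) ω)))
        (∑-cong (λ l → trans (∑-cong (λ v → trans (⟦⟧*-cong (lab v == l) (λ e → cong (λ m → crossing S v * (⟦ attD m ⟧ * picked m ω)) (==⇒≡ {i = lab v} e)))
          (sym (*-assoc ⟦ lab v == l ⟧ (crossing S v) _)))) (∑-*ʳ (⟦ attD l ⟧ * picked l ω) _))))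
      pw : ∀ l → ⟦ (small l ∧ not (lowD l)) ∧ isNothing (tgtΩ l ω) ⟧ + ⟦ attD l ⟧ * picked l ω ≤ ⟦ small l ⟧
      pw l = ≤-trans (≤-reflexive (cong (λ c → ⟦ c ∧ isNothing (tgtΩ l ω) ⟧ + ⟦ attD l ⟧ * picked l ω) (small-not-low l)))
        (table (small l) (bound ≤ᵇ 2 * D l) (isNothing (tgtΩ l ω)))
        where
        table : ∀ a c m → ⟦ (a ∧ c) ∧ m ⟧ + ⟦ a ∧ c ⟧ * ⟦ not m ⟧ ≤ ⟦ a ⟧
        table true  true  true  = ≤-refl
        table true  true  false = ≤-refl
        table true  false m     = z≤n
        table false c     m     = z≤n

    -- The number `A` is danger that this phase does not touch, namely that of the later levels.
    potential-contract : ∀ Δ W M A → 1 ≤ W → 2048 * W ≤ Δ * bound → A + Δ * exposed lab fz ≤ M →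
      vol Ω * potential W M (A + Δ * exposed lab fz) ≤
      total Ω (λ ω → resp ω * potential W M (A + Δ * exposed (At.lab′ ω) (At.fz′ ω)))
    potential-contract Δ W M A 1≤W ΔB ≤M = PA.potential-phase Δ W M (A + Δ * exposed lab fz) _ 1≤W ΔB ≤M
      (λ ω → ≤-trans (≤-reflexive (trans (+-assoc A _ _) (cong (A +_) (sym (*-distribˡ-+ Δ _ _)))))
        (+-monoʳ-≤ A (*-monoʳ-≤ Δ (exposed-drop ω))))

-- Cost of a contraction phase and the edges at frozen clusters

module ContractCost {n : ℕ} (k L q b δ ℓ : ℕ) (lab : Fin n → Fin n) (fz : VSet n)
  (G : Graph n) (n≤2^L : n ≤ 2 ^ L) (n²≤2^b : n * n ≤ 2 ^ b)
  (lower : LowerSize ℓ lab fz) (all-unfrozen : 2 ^ suc (suc ℓ) < δ → ∀ l → fz l ≡ false)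
  (δ≤ : ∀ v → δ ≤ Cuts.deg G v) (4096≤Q : 4096 ≤ 2 ^ q) where

  open ContractStep k L q b δ ℓ lab fz G n≤2^L n²≤2^b lower all-unfrozen δ≤ 4096≤Q public
  open Pick {n} k L pairQ using (pickPhase)

  opaque
    unfolding D

    cost-phase′ : ∀ x s β → cost G (phase (x , s , β)) ≡
      cost G (forFin dQ) + (cost G (forFin (wQ x D)) + (cost G (forFin (repQ x s D (W x))) +
      cost G (pickPhase (reps x D (W x) (rep x s)) (Yset x) β)))
    cost-phase′ x s β = trans (cost->>= G (forFin dQ) (phase₁ (x , s , β)))
      (cong (cost G (forFin dQ) +_) (trans (cost->>= G (forFin (wQ x D)) (phase₂ (x , s , β) D))
        (cong (cost G (forFin (wQ x D)) +_) (trans (cost->>= G (forFin (repQ x s D (W x))) (phase₃ (x , s , β) D (W x)))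
          (cong (cost G (forFin (repQ x s D (W x))) +_) (trans
            (cost->>= G (pickPhase (reps x D (W x) (rep x s)) (Yset x) β) (λ p → ret (lowD , merge x D (W x) (rep x s) p)))
            (+-identityʳ _)))))))

  private
    m : ℕ
    m = card small

    goes : Seed xC → VSet n
    goes x = go x D (W x)

    go-small : ∀ x l → goes x l ≡ true → small l ≡ true
    go-small x l g = Fixed.small-l x l g

    cost-dQ : cost G (forFin dQ) ≡ 3 * m
    cost-dQ = trans (cost-forFin G dQ) (trans (∑-cong (λ l → trans (cost-guard G (small l) 0 _)
      (trans (cong (⟦ small l ⟧ *_) (cost-pairQ G _ _)) (*-comm ⟦ small l ⟧ 3)))) (∑-*ˡ 3 (λ l → ⟦ small l ⟧)))

    cost-wQ : ∀ x → cost G (forFin (wQ x D)) ≤ 3 * m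
    cost-wQ x = ≤-trans (≤-reflexive (trans (cost-forFin G (wQ x D)) (∑-cong (λ l → trans (cost-guard G (attD l ∧ inX x l) 0 _)
      (trans (cong (⟦ attD l ∧ inX x l ⟧ *_) (cost-pairQ G _ _)) (*-comm ⟦ attD l ∧ inX x l ⟧ 3))))))
      (≤-trans (≤-reflexive (∑-*ˡ 3 (λ l → ⟦ attD l ∧ inX x l ⟧))) (*-monoʳ-≤ 3 (card-mono {V = small}
        (λ l p → proj₁ (∧-true {small l} (proj₁ (∧-true {attD l} p)))))))

    card-go : ∀ x → card (goes x) ≤ m
    card-go x = card-mono {V = small} (go-small x)

    cost-repQ : ∀ x s → cost G (forFin (repQ x s D (W x))) ≤ m * (3 * suc ℓ)
    cost-repQ x s = ≤-trans (≤-reflexive (cost-forFin G (repQ x s D (W x))))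
      (≤-trans (∑-mono (λ l → ≤-trans (≤-reflexive (cost-guard G (goes x l) l _))
        (*-monoʳ-≤ ⟦ goes x l ⟧ (Locate.cost-locate G (Yset x) l (suc ℓ) _ _))))
        (≤-trans (≤-reflexive (∑-*ʳ (3 * suc ℓ) _)) (*-monoˡ-≤ (3 * suc ℓ) (card-go x))))

    card-reps : ∀ x s → card (reps x D (W x) (rep x s)) ≤ m
    card-reps x s = ≤-trans (≤-reflexive (trans (∑-fibre lab (λ v → ⟦ reps x D (W x) (rep x s) v ⟧)) (∑-cong (λ l → ∑-cong (λ v → pw l v)))))
      (≤-trans (∑-mono (λ l → ≤-trans (∑-mono (λ v → ⟦⟧*≤ (lab v == l) (⟦ v == rep x s l ⟧ * ⟦ goes x l ⟧))) (≤-reflexive (∑-δ (rep x s l) (λ _ → ⟦ goes x l ⟧)))))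
        (card-go x))
      where
      pw : ∀ l v → ⟦ lab v == l ⟧ * ⟦ reps x D (W x) (rep x s) v ⟧ ≡ ⟦ lab v == l ⟧ * (⟦ v == rep x s l ⟧ * ⟦ goes x l ⟧)
      pw l v = ⟦⟧*-cong (lab v == l) (λ e → trans (cong (λ i → ⟦ goes x i ∧ (v == rep x s i) ⟧) (==⇒≡ {i = lab v} e))
                 (trans (⟦∧⟧ (goes x l) _) (*-comm ⟦ goes x l ⟧ _)))

  -- The factor `ℓ + 1` comes from the binary search for a representative in a cluster of fewer than
  -- `2 ^ (ℓ + 1)` vertices. Everything else is constant per small cluster, up to the overhead of
  -- coin weighing.
  cost-phase : L ≤ 8 * (k + 2) → ∀ ω → cost G (phase ω) ≤
    (9 + pickRate) * (suc ℓ * card small) + 3 * (L * (⟦ card small <ᵇ threshold k L ⟧ * card small))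
  cost-phase L≤ (x , s , β) = begin
    cost G (phase (x , s , β))
      ≡⟨ cost-phase′ x s β ⟩
    cost G (forFin dQ) + (cost G (forFin (wQ x D)) + (cost G (forFin (repQ x s D (W x))) + cost G (pickPhase (reps x D (W x) (rep x s)) (Yset x) β)))
      ≤⟨ +-mono-≤ (≤-reflexive cost-dQ) (+-mono-≤ (cost-wQ x) (+-mono-≤ (cost-repQ x s)
           (PickCost.cost-pickPhase k L pairQ G (cost-pairQ G) L≤ (reps x D (W x) (rep x s)) (Yset x) β m (card-reps x s)))) ⟩
    3 * m + (3 * m + (m * (3 * suc ℓ) + (pickRate * m + E)))
      ≡⟨ solve 4 (λ c m l e → con 3 :* m :+ (con 3 :* m :+ (m :* (con 3 :* (con 1 :+ l)) :+ (c :* m :+ e))) :=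
           (con 6 :+ c) :* m :+ con 3 :* ((con 1 :+ l) :* m) :+ e) refl pickRate m ℓ E ⟩
    (6 + pickRate) * m + 3 * (suc ℓ * m) + E
      ≤⟨ +-monoˡ-≤ E (+-monoˡ-≤ (3 * (suc ℓ * m)) (*-monoʳ-≤ (6 + pickRate) (m≤n*m m (suc ℓ)))) ⟩
    (6 + pickRate) * (suc ℓ * m) + 3 * (suc ℓ * m) + E
      ≡⟨ solve 3 (λ c x e → (con 6 :+ c) :* x :+ con 3 :* x :+ e := (con 9 :+ c) :* x :+ e) refl pickRate (suc ℓ * m) E ⟩
    (9 + pickRate) * (suc ℓ * m) + E ∎
    where
    open ≤-Reasoning
    E = 3 * (L * (⟦ m <ᵇ threshold k L ⟧ * m))

  cost-phase-pos : 1 ≤ card small → ∀ ω → 1 ≤ cost G (phase ω)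
  cost-phase-pos p (x , s , β) = ≤-trans p (≤-trans (m≤n*m m 3) (≤-trans (≤-reflexive (sym cost-dQ))
    (≤-trans (m≤m+n _ _) (≤-reflexive (sym (cost-phase′ x s β))))))

  frozenEdgesOf : (Fin n → Fin n) → VSet n → ℕ
  frozenEdgesOf lab fz = ∑ (λ v → nb (adj G) v (λ w → not (lab w == lab v) ∧ (fz (lab v) ∨ fz (lab w))))

  -- A cluster freezes only with `2 D ≤ 32 · 2 ^ ℓ`, hence with at most 32 new edge ends for each of
  -- its vertices. So when everything is frozen, only `32 n` ordered pairs are left to learn.
  frozen-invariant : ∀ ω → frozenEdgesOf lab fz ≤ 32 * ∑ (λ v → ⟦ fz (lab v) ⟧) →
    frozenEdgesOf (At.lab′ ω) (At.fz′ ω) ≤ 32 * ∑ (λ v → ⟦ At.fz′ ω (At.lab′ ω v) ⟧)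
  frozen-invariant ω inv = begin
    frozenEdgesOf (At.lab′ ω) (At.fz′ ω)
      ≤⟨ At.frozenEdges-step ω (adj G) (Graph.sym G) ⟩
    frozenEdgesOf lab fz + 2 * ∑ (λ l → ⟦ At.new ω l ⟧ * degreeOut l)
      ≤⟨ +-mono-≤ inv (≤-trans (≤-reflexive (sym (∑-*ˡ 2 _))) (∑-mono freeze)) ⟩
    32 * ∑ (λ v → ⟦ fz (lab v) ⟧) + ∑ (λ l → 32 * (size l * ⟦ At.new ω l ⟧))
      ≡⟨ cong (32 * ∑ (λ v → ⟦ fz (lab v) ⟧) +_) (trans (∑-*ˡ 32 _) (cong (32 *_) (sym new-sum))) ⟩
    32 * ∑ (λ v → ⟦ fz (lab v) ⟧) + 32 * ∑ (λ v → ⟦ At.new ω (lab v) ⟧)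
      ≡⟨ sym (*-distribˡ-+ 32 (∑ (λ v → ⟦ fz (lab v) ⟧)) _) ⟩
    32 * (∑ (λ v → ⟦ fz (lab v) ⟧) + ∑ (λ v → ⟦ At.new ω (lab v) ⟧))
      ≤⟨ *-monoʳ-≤ 32 (At.frozen-count ω) ⟩
    32 * ∑ (λ v → ⟦ At.fz′ ω (At.lab′ ω v) ⟧) ∎
    where
    open ≤-Reasoning
    new-sum : ∑ (λ v → ⟦ At.new ω (lab v) ⟧) ≡ ∑ (λ l → size l * ⟦ At.new ω l ⟧)
    new-sum = trans (∑-fibre lab (λ v → ⟦ At.new ω (lab v) ⟧)) (∑-cong (λ l → trans (∑-cong (λ v →
      ⟦⟧*-cong (lab v == l) (λ e → cong (λ i → ⟦ At.new ω i ⟧) (==⇒≡ {i = lab v} e)))) (∑-*ʳ ⟦ At.new ω l ⟧ _)))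
    few : ∀ l → lowD l ≡ true → 2 * degreeOut l ≤ 32 * size l
    few l p with 2 ^ suc (suc ℓ) <? δ
    ... | yes q′ = ⊥-elim (true≢false (trans (sym p) (low-impossible q′ l)))
    ... | no ¬q = begin
      2 * degreeOut l  ≡⟨ cong (2 *_) (sym (D-eq l (low-small l p))) ⟩
      2 * D l          ≤⟨ <⇒≤ (≤ᵇ-false {bound} (not-true (proj₂ (∧-true {small l} p)))) ⟩
      bound            ≡⟨ bound-high (≮⇒≥ ¬q) ⟩
      2 ^ ℓ * 32       ≤⟨ *-monoˡ-≤ 32 (small-lower l (low-small l p)) ⟩
      size l * 32      ≡⟨ *-comm (size l) 32 ⟩
      32 * size l ∎
    freeze : ∀ l → 2 * (⟦ At.new ω l ⟧ * degreeOut l) ≤ 32 * (size l * ⟦ At.new ω l ⟧)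
    freeze l = begin
      2 * (⟦ At.new ω l ⟧ * degreeOut l)  ≡⟨ solve 2 (λ a d → con 2 :* (a :* d) := a :* (con 2 :* d)) refl ⟦ At.new ω l ⟧ (degreeOut l) ⟩
      ⟦ At.new ω l ⟧ * (2 * degreeOut l)  ≤⟨ ⟦⟧*-mono (At.new ω l) (λ p → few l (proj₁ (∧-true {lowD l} p))) ⟩
      ⟦ At.new ω l ⟧ * (32 * size l)      ≡⟨ solve 2 (λ a s → a :* (con 32 :* s) := con 32 :* (s :* a)) refl ⟦ At.new ω l ⟧ (size l) ⟩
      32 * (size l * ⟦ At.new ω l ⟧) ∎

  unfrozen′ : ∀ ω → 2 ^ suc (suc ℓ) < δ → ∀ l → At.fz′ ω l ≡ false
  unfrozen′ ω p l = trans (cong (_∨ At.new ω l) (all-unfrozen p l)) (cong (_∧ (sizeOf (At.lab′ ω) l ≡ᵇ sizeOf lab l)) (low-impossible p l))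

-- Learning the edges between different clusters

meets : ∀ {n} → Maybe (Fin n) → Fin n → Bool
meets m w = maybe (_== w) false m

module LearnPhase {n : ℕ} (k L q b : ℕ) (lab : Fin n → Fin n) (d : Fin n → ℕ) (known : Rel₂ n) where

  -- Subtracting what is known makes the query act on the graph of unknown edges, so the sampling
  -- procedure applies without change and never finds an old edge.
  resQ : VSet n → VSet n → DT n ℕ
  resQ I B = pairQ I B >>= λ f → ret (f ∸ form known I B)

  open Pick {n} k L resQ

  xC sC βC Ω : Code
  xC = pow n (bits q)
  sC = pow n (bits b)
  βC = pow n (bits (suc L))
  Ω  = xC ⊗ (sC ⊗ βC)

  unknown : Fin n → ℕ
  unknown v = d v ∸ card (known v)

  active : VSet n
  active v = 0 <ᵇ unknown v

  inX : Seed xC → VSet n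
  inX x l = leading q (lookup x l)

  Uset Yset : Seed xC → VSet n
  Uset x v = active v ∧ inX x (lab v)
  Yset x w = not (inX x (lab w))

  learned : (Fin n → Maybe (Fin n)) → Rel₂ n
  learned p v w = known v w ∨ (meets (p v) w ∨ meets (p w) v)

  -- The query of the empty set makes the phase cost something even if no active vertex belongs to a
  -- caller, as `unfinished-costs` requires.
  learnPhase : Seed Ω → DT n (Rel₂ n)
  learnPhase (x , s , β) = ask (λ _ → false) λ _ → pickPhase (Uset x) (Yset x) β >>= λ p → ret (learned p)

module LearnStep {n : ℕ} (k L q b : ℕ) (lab : Fin n → Fin n) (d : Fin n → ℕ) (known : Rel₂ n)
  (G : Graph n) (n≤2^L : n ≤ 2 ^ L) (4096≤Q : 4096 ≤ 2 ^ q)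
  (d-eq : ∀ v → d v ≡ nb (adj G) v (λ w → not (lab w == lab v)))
  (known-edge : ∀ v w → known v w ≡ true → adj G v w ≡ true × (lab w == lab v) ≡ false)
  (known-sym : ∀ v w → known v w ≡ known w v) where

  open LearnPhase k L q b lab d known public
  open Pick {n} k L resQ using (pickPhase; class; sample; module Correct)

  R : Rel₂ n
  R v w = adj G v w ∧ not (known v w)

  other : Fin n → VSet n
  other v w = not (lab w == lab v)

  private
    adj-split : ∀ v w → ⟦ adj G v w ⟧ ≡ ⟦ R v w ⟧ + ⟦ known v w ⟧
    adj-split v w = table (adj G v w) (known v w) (λ e → proj₁ (known-edge v w e))
      where
      table : ∀ a c → (c ≡ true → a ≡ true) → ⟦ a ⟧ ≡ ⟦ a ∧ not c ⟧ + ⟦ c ⟧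
      table true  true  h = refl
      table true  false h = refl
      table false false h = refl
      table false true  h with h refl
      ... | ()

    nb-split : ∀ v B → nb (adj G) v B ≡ nb R v B + nb known v B
    nb-split v B = trans (∑-cong (λ w → trans (cong (⟦ B w ⟧ *_) (adj-split v w)) (*-distribˡ-+ ⟦ B w ⟧ ⟦ R v w ⟧ _)))
                     (∑-+ (λ w → ⟦ B w ⟧ * ⟦ R v w ⟧) _)

    R-sym : ∀ v w → R v w ≡ R w v
    R-sym v w = cong₂ (λ a c → a ∧ not c) (Graph.sym G v w) (known-sym v w)

  run-resQ : ∀ I B → Disjoint I B → run G (resQ I B) ≡ form R I B
  run-resQ I B dis = trans (run->>= G (pairQ I B) (λ f → ret (f ∸ form known I B)))
    (trans (cong (_∸ form known I B) (trans (run-pairQ G I B dis) split)) (m+n∸n≡m (form R I B) (form known I B)))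
    where
    split : form (adj G) I B ≡ form R I B + form known I B
    split = trans (∑-cong (λ v → trans (cong (⟦ I v ⟧ *_) (nb-split v B)) (*-distribˡ-+ ⟦ I v ⟧ _ _))) (∑-+ (λ v → ⟦ I v ⟧ * nb R v B) _)

  cost-resQ : ∀ I B → cost G (resQ I B) ≡ 3
  cost-resQ I B = trans (cost->>= G (pairQ I B) (λ f → ret (f ∸ form known I B))) (trans (+-identityʳ _) (cost-pairQ G I B))

  unknown-eq : ∀ v → unknown v ≡ nb R v (other v)
  unknown-eq v = trans (cong₂ _∸_ (trans (d-eq v) (nb-split v (other v))) (∑-cong inside)) (m+n∸n≡m (nb R v (other v)) (nb known v (other v)))
    where
    inside : ∀ w → ⟦ known v w ⟧ ≡ ⟦ other v w ⟧ * ⟦ known v w ⟧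
    inside w with bool-cases (known v w)
    ... | inj₁ t = sym (⟦⟧*-1 ⟦ known v w ⟧ (cong not (proj₂ (known-edge v w t))))
    ... | inj₂ f = trans (cong ⟦_⟧ f) (sym (trans (cong (λ c → ⟦ other v w ⟧ * ⟦ c ⟧) f) (*-zeroʳ ⟦ other v w ⟧)))

  total-unknown : ℕ
  total-unknown = ∑ unknown

  -- An unknown edge makes both of its ends active. Few active vertices therefore mean few unknown
  -- edges, and this caps the overhead of coin weighing in `budget`.
  unknown≤ : total-unknown ≤ card active * card active
  unknown≤ = ≤-trans (∑-mono row) (≤-reflexive (∑-*ʳ (card active) _))
    where
    active-intro : ∀ v w → other v w ≡ true → R v w ≡ true → active w ≡ true
    active-intro v w o r = <ᵇ-intro (≤-trans (≤-reflexive (sym (cong₂ (λ a c → ⟦ a ⟧ * ⟦ c ⟧)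
        (trans (cong not (==-sym (lab v) (lab w))) o) (trans (R-sym w v) r))))
      (≤-trans (∑-≥ (λ u → ⟦ other w u ⟧ * ⟦ R w u ⟧) v) (≤-reflexive (sym (unknown-eq w)))))
    row : ∀ v → unknown v ≤ ⟦ active v ⟧ * card active
    row v with zero-or-pos (unknown v)
    ... | inj₁ z = ≤-trans (≤-reflexive z) z≤n
    ... | inj₂ p = ≤-trans (≤-trans (≤-reflexive (unknown-eq v)) (∑-mono cell)) (≤-reflexive (sym (⟦⟧*-1 (card active) (<ᵇ-intro p))))
      where
      cell : ∀ w → ⟦ other v w ⟧ * ⟦ R v w ⟧ ≤ ⟦ active w ⟧
      cell w with bool-cases (other v w) | bool-cases (R v w)
      ... | inj₁ o | inj₁ r = ≤-trans (*-mono-≤ (⟦⟧≤1 (other v w)) (⟦⟧≤1 (R v w))) (≤-reflexive (cong ⟦_⟧ (sym (active-intro v w o r))))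
      ... | inj₂ o | _ = ≤-trans (≤-reflexive (⟦⟧*-0 ⟦ R v w ⟧ o)) z≤n
      ... | inj₁ o | inj₂ r = ≤-trans (≤-reflexive (trans (cong (λ c → ⟦ other v w ⟧ * ⟦ c ⟧) r) (*-zeroʳ ⟦ other v w ⟧))) z≤n

  U#Y : ∀ x → Disjoint (Uset x) (Yset x)
  U#Y x v p r = true≢false (trans (sym (proj₂ (∧-true {active v} p))) (not-true r))

  iso : Seed xC → Fin n → Fin n → Seed βC → Bool
  iso x = PickDist.iso k L resQ n≤2^L R (Yset x)

  opaque

    pk : Seed xC → Seed βC → Fin n → Maybe (Fin n)
    pk x β = run G (pickPhase (Uset x) (Yset x) β)

    run-learnPhase′ : ∀ x s β → run G (learnPhase (x , s , β)) ≡ learned (pk x β)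
    run-learnPhase′ x s β = run->>= G (pickPhase (Uset x) (Yset x) β) (λ p → ret (learned p))

    pk-complete : ∀ x β {v w} → Uset x v ≡ true → iso x v w β ≡ true → pk x β v ≡ just w
    pk-complete x β {v} {w} Uv iw =
      Correct.pick-complete G n≤2^L R run-resQ (Uset x) (Yset x) (U#Y x) β Uv
        (≡ᵇ-true _ 1 (proj₂ (∧-true {T ∧ R v w} iw))) (proj₁ (∧-true {T} Ti)) (proj₂ (∧-true {T} Ti))
      where
      T : Bool
      T = sample (Yset x) β (toℕ (class (nb R v (Yset x)))) w
      Ti : (T ∧ R v w) ≡ true
      Ti = proj₁ (∧-true {T ∧ R v w} iw)

    pk-sound : ∀ x β {v w} → pk x β v ≡ just w → Uset x v ≡ true × Yset x w ≡ true × R v w ≡ true × iso x v w β ≡ true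
    pk-sound x β {v} {w} e with Correct.pick-sound G n≤2^L R run-resQ (Uset x) (Yset x) (U#Y x) β {v} {w} e
    ... | Uv , Tw , Rw , one = Uv , proj₁ (∧-true {Yset x w} Tw) , Rw , ∧-intro (∧-intro Tw Rw) (cong (_≡ᵇ 1) one)

  run-learnPhase : ∀ x s β → run G (learnPhase (x , s , β)) ≡ learned (pk x β)
  run-learnPhase = run-learnPhase′

  cost-learnPhase : L ≤ 8 * (k + 2) → ∀ ω → cost G (learnPhase ω) ≤ 1 + pickCost (threshold k L) L (card active)
  cost-learnPhase L≤ (x , s , β) = s≤s (≤-trans (≤-reflexive (trans
    (cost->>= G (pickPhase (Uset x) (Yset x) β) (λ p → ret (learned p))) (+-identityʳ _)))
    (PickCost.cost-pickPhase k L resQ G cost-resQ L≤ (Uset x) (Yset x) β (card active)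
      (card-mono {V = active} (λ v p → proj₁ (∧-true {active v} p)))))

  module At (ω : Seed Ω) where

    p : Fin n → Maybe (Fin n)
    p = pk (proj₁ ω) (proj₂ (proj₂ ω))

    known′ : Rel₂ n
    known′ = learned p

    private
      meets-elim : ∀ {m : Maybe (Fin n)} {w} → meets m w ≡ true → m ≡ just w
      meets-elim {just u} {w} e = cong just (==⇒≡ {i = u} {w} e)

      ∨-elim : ∀ {a c} → (a ∨ c) ≡ true → a ≡ true ⊎ c ≡ true
      ∨-elim {true}  _ = inj₁ refl
      ∨-elim {false} e = inj₂ e

    pick-edge : ∀ v w → p v ≡ just w → R v w ≡ true × (lab w == lab v) ≡ false
    pick-edge v w e with pk-sound (proj₁ ω) (proj₂ (proj₂ ω)) {v} {w} e
    ... | Uv , Yw , Rw , _ = Rw , ≢⇒== (λ q′ → true≢false (trans (sym (proj₂ (∧-true {active v} Uv)))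
            (trans (cong (inX (proj₁ ω)) (sym q′)) (not-true Yw))))

    known′-sym : ∀ v w → known′ v w ≡ known′ w v
    known′-sym v w = cong₂ _∨_ (known-sym v w) (∨-comm (meets (p v) w) _)

    known′-edge : ∀ v w → known′ v w ≡ true → adj G v w ≡ true × (lab w == lab v) ≡ false
    known′-edge v w e with ∨-elim {known v w} e
    ... | inj₁ t = known-edge v w t
    ... | inj₂ e′ with ∨-elim {meets (p v) w} e′
    ...   | inj₁ t = let r , o = pick-edge v w (meets-elim {p v} t) in proj₁ (∧-true {adj G v w} r) , o
    ...   | inj₂ t = let r , o = pick-edge w v (meets-elim {p w} t) in
                       trans (Graph.sym G v w) (proj₁ (∧-true {adj G w v} r)) , trans (==-sym (lab w) (lab v)) o

    picked : Fin n → ℕ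
    picked v = ⟦ not (isNothing (p v)) ⟧

    unknown′ : Fin n → ℕ
    unknown′ v = d v ∸ card (known′ v)

    private
      picked-sum : ∀ v → picked v ≡ ∑ (λ w → ⟦ meets (p v) w ⟧)
      picked-sum v with p v
      ... | nothing = sym (∑-zero {n} _ (λ _ → refl))
      ... | just u  = sym (trans (∑-cong (λ w → sym (*-identityʳ ⟦ u == w ⟧))) (∑-δ′ u (λ _ → 1)))

    unknown-drop : ∀ v → unknown′ v + picked v ≤ unknown v
    unknown-drop v = ≤-trans (≤-reflexive (+-comm (unknown′ v) (picked v)))
      (m≤o∸n⇒m+n≤o′ (picked v) (d v) (card (known v)) (card (known′ v)) (∑-known v) bounded)
      where
      ∑-known : ∀ v → card (known v) + picked v ≤ card (known′ v)
      ∑-known v = ≤-trans (≤-reflexive (trans (cong (card (known v) +_) (picked-sum v)) (sym (∑-+ (λ w → ⟦ known v w ⟧) _)))) (∑-mono cell)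
        where
        cell : ∀ w → ⟦ known v w ⟧ + ⟦ meets (p v) w ⟧ ≤ ⟦ known′ v w ⟧
        cell w with bool-cases (meets (p v) w)
        ... | inj₂ f = ≤-trans (≤-reflexive (trans (cong (λ c → ⟦ known v w ⟧ + ⟦ c ⟧) f) (+-identityʳ _))) (⟦⟧-mono (λ t → cong (_∨ (meets (p v) w ∨ meets (p w) v)) t))
        ... | inj₁ t = ≤-reflexive (trans (cong₂ (λ a c → ⟦ a ⟧ + ⟦ c ⟧) notKnown t) (cong ⟦_⟧ (sym (trans (cong (λ c → known v w ∨ (c ∨ meets (p w) v)) t) (∨-true (known v w))))))
          where
          ∨-true : ∀ a → (a ∨ true) ≡ true
          ∨-true true  = refl
          ∨-true false = refl
          notKnown : known v w ≡ false
          notKnown = not-true (proj₂ (∧-true {adj G v w} (proj₁ (pick-edge v w (meets-elim {p v} t)))))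
      bounded : card (known′ v) ≤ d v
      bounded = ≤-trans (∑-mono cell) (≤-reflexive (sym (d-eq v)))
        where
        cell : ∀ w → ⟦ known′ v w ⟧ ≤ ⟦ not (lab w == lab v) ⟧ * ⟦ adj G v w ⟧
        cell w with bool-cases (known′ v w)
        ... | inj₂ f = ≤-trans (≤-reflexive (cong ⟦_⟧ f)) z≤n
        ... | inj₁ t = ≤-trans (⟦⟧≤1 (known′ v w)) (≤-reflexive (sym (cong₂ (λ a c → ⟦ not a ⟧ * ⟦ c ⟧) (proj₂ (known′-edge v w t)) (proj₁ (known′-edge v w t)))))
      m≤o∸n⇒m+n≤o′ : ∀ p d c c′ → c + p ≤ c′ → c′ ≤ d → p + (d ∸ c′) ≤ d ∸ c
      m≤o∸n⇒m+n≤o′ p d c c′ h₁ h₂ = +-cancelˡ-≤ c _ _ (≤-trans (≤-reflexive (sym (+-assoc c p (d ∸ c′))))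
        (≤-trans (+-monoˡ-≤ (d ∸ c′) h₁) (≤-reflexive (trans (m+[n∸m]≡n h₂) (sym (m+[n∸m]≡n (≤-trans (≤-trans (m≤m+n c p) h₁) h₂)))))))

  pickedΩ missedΩ : Fin n → Seed Ω → ℕ
  pickedΩ v ω = At.picked ω v
  missedΩ v ω = ⟦ isNothing (At.p ω v) ⟧

  private
    Q vx V : ℕ
    Q = 2 ^ q
    vx = vol xC
    V = vol sC * vol βC

    TX : Fin n → ℕ
    TX l = total xC (λ x → ⟦ inX x l ⟧)

  -- One unknown edge suffices: with probability at least `1 / (2 Q)` the cluster of `v` calls and
  -- the cluster at the other end does not. Then each of the `dY` neighbours of `v` in `Y` is
  -- isolated with probability at least `1 / (8 dY)`. The resulting 16 is weakened to `odds` in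
  -- order to share `Progress`.
  success : ∀ v → active v ≡ true → vol Ω ≤ odds * (Q * total Ω (pickedΩ v))
  success v av with ∑-pos (λ w → ⟦ other v w ⟧ * ⟦ R v w ⟧) (≤-trans (<ᵇ-true av) (≤-reflexive (unknown-eq v)))
  ... | w₀ , edge with bool-cases (other v w₀) | bool-cases (R v w₀)
  ...   | inj₂ o | _ = ⊥-elim (1+n≰n (≤-trans edge (≤-reflexive (⟦⟧*-0 ⟦ R v w₀ ⟧ o))))
  ...   | inj₁ o | inj₂ r = ⊥-elim (1+n≰n (≤-trans edge (≤-reflexive (trans (cong (λ c → ⟦ other v w₀ ⟧ * ⟦ c ⟧) r) (*-zeroʳ ⟦ other v w₀ ⟧)))))
  ...   | inj₁ o | inj₁ r = combine
    where
    T : ℕ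
    T = total xC (λ x → ⟦ inX x (lab v) ⟧ * ⟦ not (inX x (lab w₀)) ⟧)

    ne : lab v ≢ lab w₀
    ne e = true≢false (trans (sym o) (cong not (≡⇒== (sym e))))

    T-eq : T * (Q * Q) + vx ≡ Q * vx
    T-eq = begin
      T * (Q * Q) + vx
        ≡⟨ cong (T * (Q * Q) +_) (sym (leading-marginal₂ q q ≤-refl (lab v) (lab w₀) ne)) ⟩
      T * (Q * Q) + TXX * (Q * Q)
        ≡⟨ trans (sym (*-distribʳ-+ (Q * Q) T TXX)) (cong (_* (Q * Q)) (sym split)) ⟩
      TX (lab v) * (Q * Q)
        ≡⟨ solve 2 (λ t q → t :* (q :* q) := q :* (t :* q)) refl (TX (lab v)) Q ⟩
      Q * (TX (lab v) * Q)
        ≡⟨ cong (Q *_) (leading-marginal q q ≤-refl (lab v)) ⟩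
      Q * vx ∎
      where
      open ≡-Reasoning
      TXX = total xC (λ x → ⟦ inX x (lab v) ⟧ * ⟦ inX x (lab w₀) ⟧)
      split : TX (lab v) ≡ T + TXX
      split = trans (total-cong xC (λ x → pw (inX x (lab v)) (inX x (lab w₀)))) (total-+ xC (λ x → ⟦ inX x (lab v) ⟧ * ⟦ not (inX x (lab w₀)) ⟧) _)
        where
        pw : ∀ a c → ⟦ a ⟧ ≡ ⟦ a ⟧ * ⟦ not c ⟧ + ⟦ a ⟧ * ⟦ c ⟧
        pw true  true  = refl
        pw true  false = refl
        pw false c     = refl

    per-x : ∀ x → ⟦ inX x (lab v) ⟧ * ⟦ not (inX x (lab w₀)) ⟧ * vol βC ≤ 8 * total βC (λ β → ⟦ not (isNothing (pk x β v)) ⟧)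
    per-x x with bool-cases (inX x (lab v)) | bool-cases (inX x (lab w₀))
    ... | inj₂ f | _ = ≤-trans (≤-reflexive (cong (λ c → ⟦ c ⟧ * ⟦ not (inX x (lab w₀)) ⟧ * vol βC) f)) z≤n
    ... | inj₁ t | inj₁ t′ = ≤-trans (≤-reflexive (cong₂ (λ a c → ⟦ a ⟧ * ⟦ not c ⟧ * vol βC) t t′)) z≤n
    ... | inj₁ t | inj₂ f′ = ≤-trans (≤-reflexive (trans (cong₂ (λ a c → ⟦ a ⟧ * ⟦ not c ⟧ * vol βC) t f′) (+-identityʳ (vol βC))))
        (*-cancelˡ-≤ dY {{>-nonZero dY>0}} (begin
      dY * vol βC
        ≡⟨ sym (∑-*ʳ (vol βC) _) ⟩
      ∑ (λ w → ⟦ Yset x w ⟧ * ⟦ R v w ⟧ * vol βC)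
        ≤⟨ ∑-mono (λ w → cell w (bool-cases (Yset x w)) (bool-cases (R v w))) ⟩
      ∑ (λ w → 8 * dY * total βC (λ β → ⟦ iso x v w β ⟧))
        ≡⟨ trans (∑-*ˡ (8 * dY) _) (cong (8 * dY *_) (trans (sym (total-∑ βC (λ w β → ⟦ iso x v w β ⟧))) (total-cong βC (λ β → sym (picked-iso β))))) ⟩
      8 * dY * P
        ≡⟨ solve 2 (λ d p → con 8 :* d :* p := d :* (con 8 :* p)) refl dY P ⟩
      dY * (8 * P) ∎))
      where
      open ≤-Reasoning
      dY = nb R v (Yset x)
      P = total βC (λ β → ⟦ not (isNothing (pk x β v)) ⟧)
      dY>0 : 1 ≤ dY
      dY>0 = ≤-trans (≤-reflexive (sym (cong₂ (λ a c → ⟦ not a ⟧ * ⟦ c ⟧) f′ r))) (∑-≥ (λ w → ⟦ Yset x w ⟧ * ⟦ R v w ⟧) w₀)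
      cell : ∀ w → Yset x w ≡ true ⊎ Yset x w ≡ false → R v w ≡ true ⊎ R v w ≡ false →
             ⟦ Yset x w ⟧ * ⟦ R v w ⟧ * vol βC ≤ 8 * dY * total βC (λ β → ⟦ iso x v w β ⟧)
      cell w (inj₁ y) (inj₁ r′) = ≤-trans (≤-reflexive (trans (cong₂ (λ a c → ⟦ a ⟧ * ⟦ c ⟧ * vol βC) y r′) (+-identityʳ (vol βC))))
        (PickDist.iso-lower k L resQ n≤2^L R (Yset x) v dY>0 w y r′)
      cell w (inj₂ y) _ = ≤-trans (≤-reflexive (cong (λ a → ⟦ a ⟧ * ⟦ R v w ⟧ * vol βC) y)) z≤n
      cell w (inj₁ y) (inj₂ r′) = ≤-trans (≤-reflexive (cong₂ (λ a c → ⟦ a ⟧ * ⟦ c ⟧ * vol βC) y r′)) z≤n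
      picked-iso : ∀ β → ⟦ not (isNothing (pk x β v)) ⟧ ≡ ∑ (λ w → ⟦ iso x v w β ⟧)
      picked-iso β = trans (cong ⟦_⟧ (not-nothing (pk x β v))) (trans (event-sum (pk x β v) (λ _ → true) (λ w → iso x v w β)
          (λ w i → pk-complete x β (∧-intro av t) i) (λ w e → proj₂ (proj₂ (proj₂ (pk-sound x β e)))))
        (∑-cong (λ w → *-identityˡ ⟦ iso x v w β ⟧)))
        where
        not-nothing : (m : Maybe (Fin n)) → not (isNothing m) ≡ maybe (λ _ → true) false m
        not-nothing nothing  = refl
        not-nothing (just _) = refl

    TV : T * V ≤ 8 * total Ω (pickedΩ v)
    TV = begin
      T * V
        ≡⟨ sym (total-*ʳ xC V _) ⟩
      total xC (λ x → ⟦ inX x (lab v) ⟧ * ⟦ not (inX x (lab w₀)) ⟧ * V)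
        ≤⟨ total-mono xC (λ x → ≤-trans (≤-reflexive (solve 3 (λ i s β → i :* (s :* β) := i :* β :* s) refl (⟦ inX x (lab v) ⟧ * ⟦ not (inX x (lab w₀)) ⟧) (vol sC) (vol βC)))
             (*-monoˡ-≤ (vol sC) (per-x x))) ⟩
      total xC (λ x → 8 * P x * vol sC)
        ≡⟨ total-cong xC (λ x → trans (*-assoc 8 (P x) (vol sC)) (cong (8 *_) (sym (total-const sC (P x))))) ⟩
      total xC (λ x → 8 * total sC (λ s → P x))
        ≡⟨ total-*ˡ xC 8 _ ⟩
      8 * total xC (λ x → total sC (λ s → P x))
        ≡⟨ cong (8 *_) (sym (trans (total-⊗ xC (sC ⊗ βC) (pickedΩ v)) (total-cong xC (λ x → total-⊗ sC βC _)))) ⟩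
      8 * total Ω (pickedΩ v) ∎
      where
      open ≤-Reasoning
      P : Seed xC → ℕ
      P x = total βC (λ β → ⟦ not (isNothing (pk x β v)) ⟧)

    vx≤ : vx ≤ 2 * (T * Q)
    vx≤ = *-cancelˡ-≤ Q {{>-nonZero (≤-trans (s≤s z≤n) 4096≤Q)}} (+-cancelʳ-≤ (2 * vx) _ _ (begin
      Q * vx + 2 * vx             ≤⟨ +-monoʳ-≤ (Q * vx) (*-monoˡ-≤ vx (≤-trans (s≤s (s≤s z≤n)) 4096≤Q)) ⟩
      Q * vx + Q * vx             ≡⟨ solve 1 (λ z → z :+ z := con 2 :* z) refl (Q * vx) ⟩
      2 * (Q * vx)                ≡⟨ cong (2 *_) (sym T-eq) ⟩
      2 * (T * (Q * Q) + vx)      ≡⟨ solve 3 (λ t q v → con 2 :* (t :* (q :* q) :+ v) := q :* (con 2 :* (t :* q)) :+ con 2 :* v) refl T Q vx ⟩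
      Q * (2 * (T * Q)) + 2 * vx ∎))
      where open ≤-Reasoning

    combine : vol Ω ≤ odds * (Q * total Ω (pickedΩ v))
    combine = begin
      vol Ω                               ≡⟨ trans (vol-⊗ xC (sC ⊗ βC)) (cong (vx *_) (vol-⊗ sC βC)) ⟩
      vx * V                              ≤⟨ *-monoˡ-≤ V vx≤ ⟩
      2 * (T * Q) * V                     ≡⟨ solve 3 (λ t q v → con 2 :* (t :* q) :* v := con 2 :* (q :* (t :* v))) refl T Q V ⟩
      2 * (Q * (T * V))                   ≤⟨ *-monoʳ-≤ 2 (*-monoʳ-≤ Q TV) ⟩
      2 * (Q * (8 * total Ω (pickedΩ v))) ≡⟨ solve 2 (λ q p → con 2 :* (q :* (con 8 :* p)) := con 16 :* (q :* p)) refl Q (total Ω (pickedΩ v)) ⟩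
      16 * (Q * total Ω (pickedΩ v))      ≤⟨ *-monoˡ-≤ (Q * total Ω (pickedΩ v)) (subst (16 ≤_) (sym odds-def) (m≤m+n 16 48)) ⟩
      odds * (Q * total Ω (pickedΩ v)) ∎
      where open ≤-Reasoning

  -- Every pick removes an unknown edge at its vertex, so the expected decrease is at least
  -- `card active / (odds Q)`; a phase costs a constant per active vertex, and thus a constant per
  -- edge learned.
  progress-learn : odds * (Q * total Ω (λ ω → ∑ (At.unknown′ ω))) + card active * vol Ω ≤ odds * (Q * (total-unknown * vol Ω))
  progress-learn = +-cancelʳ-≤ (odds * (Q * (a * v))) _ _ (begin
    odds * (Q * S) + a * v + odds * (Q * (a * v))
      ≡⟨ solve 5 (λ o q s x y → o :* (q :* s) :+ y :+ o :* (q :* x) := o :* (q :* (s :+ x)) :+ y) refl odds Q S (a * v) (a * v) ⟩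
    odds * (Q * (S + a * v)) + a * v
      ≤⟨ +-monoˡ-≤ (a * v) (*-monoʳ-≤ odds (*-monoʳ-≤ Q pathwise)) ⟩
    odds * (Q * (total-unknown * v + M)) + a * v
      ≡⟨ solve 5 (λ o q u m y → o :* (q :* (u :+ m)) :+ y := o :* (q :* u) :+ (o :* (q :* m) :+ y)) refl odds Q (total-unknown * v) M (a * v) ⟩
    odds * (Q * (total-unknown * v)) + (odds * (Q * M) + a * v)
      ≤⟨ +-monoʳ-≤ (odds * (Q * (total-unknown * v))) (Progress.progress Ω active Q (≤-trans (s≤s z≤n) 4096≤Q) pickedΩ missedΩ success exclusive a ≤-refl) ⟩
    odds * (Q * (total-unknown * v)) + odds * (Q * (a * v)) ∎)
    where
    open ≤-Reasoning
    a = card active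
    v = vol Ω
    S = total Ω (λ ω → ∑ (At.unknown′ ω))
    M = total Ω (λ ω → ∑ (λ u → ⟦ active u ⟧ * missedΩ u ω))
    exclusive : ∀ u ω → pickedΩ u ω + missedΩ u ω ≤ 1
    exclusive u ω with At.p ω u
    ... | nothing = ≤-refl
    ... | just _  = ≤-refl
    pathwise : S + a * v ≤ total-unknown * v + M
    pathwise = ≤-trans (≤-reflexive (trans (cong (S +_) (sym (total-const Ω a))) (sym (total-+ Ω _ _))))
      (≤-trans (total-mono Ω (λ ω → each ω)) (≤-reflexive (trans (total-+ Ω _ _) (cong (_+ M) (total-const Ω total-unknown)))))
      where
      each : ∀ ω → ∑ (At.unknown′ ω) + a ≤ total-unknown + ∑ (λ u → ⟦ active u ⟧ * missedΩ u ω)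
      each ω = ≤-trans (≤-reflexive (sym (∑-+ (At.unknown′ ω) _))) (≤-trans (∑-mono cell) (≤-reflexive (∑-+ unknown _)))
        where
        cell : ∀ u → At.unknown′ ω u + ⟦ active u ⟧ ≤ unknown u + ⟦ active u ⟧ * missedΩ u ω
        cell u = ≤-trans (+-monoʳ-≤ (At.unknown′ ω u) (table (active u) (isNothing (At.p ω u))))
          (≤-trans (≤-reflexive (sym (+-assoc (At.unknown′ ω u) _ _))) (+-monoˡ-≤ (⟦ active u ⟧ * missedΩ u ω) (At.unknown-drop ω u)))
          where
          table : ∀ x m → ⟦ x ⟧ ≤ ⟦ not m ⟧ + ⟦ x ⟧ * ⟦ m ⟧
          table true  true  = ≤-refl
          table true  false = ≤-refl
          table false m     = z≤n

-- The algorithm as a random walk on states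

data State (n : ℕ) : Set where
  contracting : ℕ → (Fin n → Fin n) → VSet n → State n
  learning    : (Fin n → Fin n) → (Fin n → ℕ) → Rel₂ n → State n

clusters : ∀ {n} → State n → Fin n → Fin n
clusters (contracting ℓ lab fz)   = lab
clusters (learning lab d known) = lab

module Walk {n : ℕ} (k L q b δ : ℕ) where

  -- Both kinds of phases draw from the same code, so that a walk consumes a vector of seeds of a
  -- single type.
  Ω : Code
  Ω = pow n (bits q) ⊗ (pow n (bits b) ⊗ pow n (bits (suc L)))

  contracted : ℕ → (Fin n → Fin n) → VSet n → VSet n × (Fin n → Maybe (Fin n)) → State n
  contracted ℓ lab fz (low , t) = contracting ℓ (Merge.lab′ lab fz low t) (Merge.fz′ lab fz low t)

  outDegreeQ : (Fin n → Fin n) → Fin n → DT n ℕ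
  outDegreeQ lab v = pairQ (_== v) (λ w → not (lab w == lab v))

  startLearning : (Fin n → Fin n) → DT n (State n)
  startLearning lab = forFin (outDegreeQ lab) >>= λ d → ret (learning lab d (λ _ _ → false))

  nextLevel : ℕ → (Fin n → Fin n) → VSet n → DT n (State n)
  nextLevel ℓ lab fz = if ℓ <ᵇ L then ret (contracting (suc ℓ) lab fz) else startLearning lab

  -- The query of the empty set makes every step cost something.
  advance : State n → Seed Ω → DT n (State n)
  advance (contracting ℓ lab fz) ω =
    if anyᵇ (smallOf ℓ lab fz)
    then (ContractPhase.phase k L q b δ ℓ lab fz ω >>= λ r → ret (contracted ℓ lab fz r))
    else ask (λ _ → false) (λ _ → nextLevel ℓ lab fz)
  advance (learning lab d known) ω = LearnPhase.learnPhase k L q b lab d known ω >>= λ kn → ret (learning lab d kn)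

  done : State n → Bool
  done (contracting ℓ lab fz)   = false
  done (learning lab d known) = not (anyᵇ (LearnPhase.active k L q b lab d known))

  -- The length of the vector is the number of steps allowed; `nothing` reports that it did not
  -- suffice.
  loop : ∀ {f} → State n → Vec (Seed Ω) f → DT n (Maybe (State n))
  loop st []       = ret (if done st then just st else nothing)
  loop st (ω ∷ ωs) = if done st then ret (just st) else (advance st ω >>= λ st′ → loop st′ ωs)

anyᵇ-card : ∀ {n} (p : Fin n → Bool) → anyᵇ p ≡ true → 1 ≤ card p
anyᵇ-card p e with anyᵇ-elim p e
... | i , t = ≤-trans (≤-reflexive (sym (cong ⟦_⟧ t))) (∑-≥ (λ i → ⟦ p i ⟧) i)

anyᵇ-none : ∀ {n} (p : Fin n → Bool) → anyᵇ p ≡ false → ∀ i → p i ≡ false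
anyᵇ-none p e i with bool-cases (p i)
... | inj₂ f = f
... | inj₁ t = ⊥-elim (true≢false (trans (sym (anyᵇ-intro p i t)) e))

-- An expected decrease by a pays for a cost proportional to a, and below the cap also for the overhead.
budget : ∀ (Ω : Code) K c₁ L X a cap (few : Bool) (cost X′ : Seed Ω → ℕ) →
  K * total Ω X′ + a * vol Ω ≤ K * (X * vol Ω) →
  (few ≡ true → X ≤ cap) → (few ≡ false → ∀ ω → X′ ω ⊓ cap ≤ X ⊓ cap) →
  (∀ ω → cost ω ≤ c₁ * a + 3 * (L * (⟦ few ⟧ * a))) →
  total Ω (λ ω → cost ω + (K * (c₁ * X′ ω) + K * (3 * L) * (X′ ω ⊓ cap))) ≤
  (K * (c₁ * X) + K * (3 * L) * (X ⊓ cap)) * vol Ω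
budget Ω K c₁ L X a cap few cost X′ drop few-cap many cost≤ = begin
  total Ω (λ ω → cost ω + (K * (c₁ * X′ ω) + K * (3 * L) * (X′ ω ⊓ cap)))
    ≤⟨ total-mono Ω (λ ω → +-monoˡ-≤ _ (cost≤ ω)) ⟩
  total Ω (λ ω → c₁ * a + F + (K * (c₁ * X′ ω) + e * (X′ ω ⊓ cap)))
    ≡⟨ total-cong Ω (λ ω → +-interchange (c₁ * a) F (K * (c₁ * X′ ω)) (e * (X′ ω ⊓ cap))) ⟩
  total Ω (λ ω → (c₁ * a + K * (c₁ * X′ ω)) + (F + e * (X′ ω ⊓ cap)))
    ≡⟨ trans (total-+ Ω (λ ω → c₁ * a + K * (c₁ * X′ ω)) _) (cong₂ _+_
         (trans (total-+ Ω _ _) (cong₂ _+_ (total-const Ω (c₁ * a)) (trans (total-*ˡ Ω K _) (cong (K *_) (total-*ˡ Ω c₁ X′)))))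
         (trans (total-+ Ω _ _) (cong₂ _+_ (total-const Ω F) (total-*ˡ Ω e _)))) ⟩
  (c₁ * a * v + K * (c₁ * S)) + (F * v + e * total Ω (λ ω → X′ ω ⊓ cap))
    ≤⟨ +-mono-≤ main (overhead few few-cap many) ⟩
  K * (c₁ * X) * v + e * (X ⊓ cap) * v
    ≡⟨ sym (*-distribʳ-+ v (K * (c₁ * X)) _) ⟩
  (K * (c₁ * X) + e * (X ⊓ cap)) * v ∎
  where
  open ≤-Reasoning
  v = vol Ω
  S = total Ω X′
  e = K * (3 * L)
  F = 3 * (L * (⟦ few ⟧ * a))
  main : c₁ * a * v + K * (c₁ * S) ≤ K * (c₁ * X) * v
  main = begin
    c₁ * a * v + K * (c₁ * S)  ≡⟨ solve 5 (λ c a v k s → c :* a :* v :+ k :* (c :* s) := c :* (k :* s :+ a :* v)) refl c₁ a v K S ⟩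
    c₁ * (K * S + a * v)       ≤⟨ *-monoʳ-≤ c₁ drop ⟩
    c₁ * (K * (X * v))         ≡⟨ solve 4 (λ c k x v → c :* (k :* (x :* v)) := k :* (c :* x) :* v) refl c₁ K X v ⟩
    K * (c₁ * X) * v ∎
  overhead : ∀ few → (few ≡ true → X ≤ cap) → (few ≡ false → ∀ ω → X′ ω ⊓ cap ≤ X ⊓ cap) →
    3 * (L * (⟦ few ⟧ * a)) * v + e * total Ω (λ ω → X′ ω ⊓ cap) ≤ e * (X ⊓ cap) * v
  overhead true h _ = begin
    3 * (L * (1 * a)) * v + e * total Ω (λ ω → X′ ω ⊓ cap)
      ≤⟨ +-monoʳ-≤ (3 * (L * (1 * a)) * v) (*-monoʳ-≤ e (total-mono Ω (λ ω → m⊓n≤m (X′ ω) cap))) ⟩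
    3 * (L * (1 * a)) * v + e * S
      ≡⟨ solve 5 (λ l a v k s → con 3 :* (l :* (con 1 :* a)) :* v :+ k :* (con 3 :* l) :* s := con 3 :* l :* (k :* s :+ a :* v)) refl L a v K S ⟩
    3 * L * (K * S + a * v)
      ≤⟨ *-monoʳ-≤ (3 * L) drop ⟩
    3 * L * (K * (X * v))
      ≡⟨ solve 4 (λ l k x v → con 3 :* l :* (k :* (x :* v)) := k :* (con 3 :* l) :* x :* v) refl L K X v ⟩
    e * X * v
      ≡⟨ cong (λ z → e * z * v) (sym (m≤n⇒m⊓n≡m (h refl))) ⟩
    e * (X ⊓ cap) * v ∎
  overhead false _ h = begin
    3 * (L * 0) * v + e * total Ω (λ ω → X′ ω ⊓ cap)
      ≡⟨ cong (λ z → 3 * z * v + e * total Ω (λ ω → X′ ω ⊓ cap)) (*-zeroʳ L) ⟩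
    e * total Ω (λ ω → X′ ω ⊓ cap)
      ≤⟨ *-monoʳ-≤ e (≤-trans (total-mono Ω (h refl)) (≤-reflexive (total-const Ω (X ⊓ cap)))) ⟩
    e * ((X ⊓ cap) * v)
      ≡⟨ sym (*-assoc e (X ⊓ cap) v) ⟩
    e * (X ⊓ cap) * v ∎

-- Level `j` begins with at most `2 ^ (L − j)` small clusters, each paying for `j + 1` units. The
-- identity `(ℓ + 2) + (ℓ + 4) = 2 (ℓ + 3)` shows that `(ℓ + 3) 2 ^ (L − ℓ)` pays for all levels
-- after `ℓ`, which keeps the total linear.
level-budget : ∀ c k l p x r y →
  1 + (k * (c * suc (suc l) * p) + x + (k * (c * ((3 + suc l) * p)) + r * (x + 1) + y)) ≡
  k * (c * ((3 + l) * (2 * p))) + suc r * (x + 1) + y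
level-budget = solve 7 (λ c k l p x r y → con 1 :+ (k :* (c :* (con 2 :+ l) :* p) :+ x :+ (k :* (c :* ((con 4 :+ l) :* p)) :+ r :* (x :+ con 1) :+ y)) :=
  k :* (c :* ((con 3 :+ l) :* (con 2 :* p))) :+ (con 1 :+ r) :* (x :+ con 1) :+ y) refl

-- Invariants and expected cost of the walk

module WalkAnalysis {n : ℕ} (k L q b δ : ℕ) (G : Graph n) (n≤2^L : n ≤ 2 ^ L) (n²≤2^b : n * n ≤ 2 ^ b)
  (L≤ : L ≤ 8 * (k + 2)) (δ≤ : ∀ v → δ ≤ Cuts.deg G v) (4096≤Q : 4096 ≤ 2 ^ q) where

  open Walk {n} k L q b δ public

  frozenEdges : (Fin n → Fin n) → VSet n → ℕ
  frozenEdges lab fz = ∑ (λ v → nb (adj G) v (λ w → not (lab w == lab v) ∧ (fz (lab v) ∨ fz (lab w))))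

  record ContractInv (ℓ : ℕ) (lab : Fin n → Fin n) (fz : VSet n) : Set where
    field
      ℓ≤L      : ℓ ≤ L
      lower    : LowerSize ℓ lab fz
      unfrozen : 2 ^ suc (suc ℓ) < δ → ∀ l → fz l ≡ false
      frozen   : frozenEdges lab fz ≤ 32 * ∑ (λ v → ⟦ fz (lab v) ⟧)

  record LearnInv (lab : Fin n → Fin n) (d : Fin n → ℕ) (known : Rel₂ n) : Set where
    field
      d-eq       : ∀ v → d v ≡ nb (adj G) v (λ w → not (lab w == lab v))
      known-edge : ∀ v w → known v w ≡ true → adj G v w ≡ true × (lab w == lab v) ≡ false
      known-sym  : ∀ v w → known v w ≡ known w v

  Inv : State n → Set
  Inv (contracting ℓ lab fz)   = ContractInv ℓ lab fz
  Inv (learning lab d known) = LearnInv lab d known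

  module Con {ℓ : ℕ} {lab : Fin n → Fin n} {fz : VSet n} (inv : ContractInv ℓ lab fz) =
    ContractCost k L q b δ ℓ lab fz G n≤2^L n²≤2^b (ContractInv.lower inv) (ContractInv.unfrozen inv) δ≤ 4096≤Q

  module Lrn {lab : Fin n → Fin n} {d : Fin n → ℕ} {known : Rel₂ n} (inv : LearnInv lab d known) =
    LearnStep k L q b lab d known G n≤2^L 4096≤Q (LearnInv.d-eq inv) (LearnInv.known-edge inv) (LearnInv.known-sym inv)

  module _ {ℓ : ℕ} {lab : Fin n → Fin n} {fz : VSet n} (inv : ContractInv ℓ lab fz) where

    private module C = Con inv

    run-contract : anyᵇ (smallOf ℓ lab fz) ≡ true → ∀ ω →
      run G (advance (contracting ℓ lab fz) ω) ≡ contracting ℓ (C.At.lab′ ω) (C.At.fz′ ω)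
    run-contract e ω@(x , s , β) = trans (cong (run G) (if-true e)) (trans (run->>= G (C.phase ω) (λ r → ret (contracted ℓ lab fz r)))
      (cong (contracted ℓ lab fz) (C.run-phase x s β)))

    cost-contract : anyᵇ (smallOf ℓ lab fz) ≡ true → ∀ ω → cost G (advance (contracting ℓ lab fz) ω) ≡ cost G (C.phase ω)
    cost-contract e ω = trans (cong (cost G) (if-true e)) (trans (cost->>= G (C.phase ω) (λ r → ret (contracted ℓ lab fz r))) (+-identityʳ _))

    inv-contract : ∀ ω → ContractInv ℓ (C.At.lab′ ω) (C.At.fz′ ω)
    inv-contract ω = record
      { ℓ≤L      = ContractInv.ℓ≤L inv
      ; lower    = C.At.lower′ ω (ContractInv.lower inv)
      ; unfrozen = C.unfrozen′ ω
      ; frozen   = C.frozen-invariant ω (ContractInv.frozen inv)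
      }

    module _ (none : anyᵇ (smallOf ℓ lab fz) ≡ false) where

      lower-next : LowerSize (suc ℓ) lab fz
      lower-next l f p with bool-cases (sizeOf lab l <ᵇ 2 ^ suc ℓ)
      ... | inj₂ big = <ᵇ-false big
      ... | inj₁ t = ⊥-elim (true≢false (trans (sym (∧-intro (cong not f) (∧-intro (<ᵇ-intro p) t))) (anyᵇ-none (smallOf ℓ lab fz) none l)))

      inv-level : ℓ < L → ContractInv (suc ℓ) lab fz
      inv-level p = record
        { ℓ≤L      = p
        ; lower    = lower-next
        ; unfrozen = λ r → ContractInv.unfrozen inv (<-trans (^-monoʳ-< 2 (s≤s (s≤s z≤n)) (n<1+n (suc (suc ℓ)))) r)
        ; frozen   = ContractInv.frozen inv
        }

      -- A cluster still unfrozen after level `L` would have at least `2 ^ (L + 1)` vertices, which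
      -- is more than `n`.
      all-frozen : L ≤ ℓ → ∀ v → fz (lab v) ≡ true
      all-frozen p v with bool-cases (fz (lab v))
      ... | inj₁ t = t
      ... | inj₂ f = ⊥-elim (<⇒≱ (≤-trans (^-monoʳ-< 2 (s≤s (s≤s z≤n)) (s≤s p)) (lower-next (lab v) f (size-pos lab v)))
                       (≤-trans (≤-trans (∑-mono (λ u → ⟦⟧≤1 (lab u == lab v))) (≤-reflexive (trans (∑-const {n} 1) (*-identityʳ n)))) n≤2^L))

  outDegrees : (Fin n → Fin n) → Fin n → ℕ
  outDegrees lab = run G (forFin (outDegreeQ lab))

  run-startLearning : ∀ lab → run G (startLearning lab) ≡ learning lab (outDegrees lab) (λ _ _ → false)
  run-startLearning lab = run->>= G (forFin (outDegreeQ lab)) (λ d → ret (learning lab d (λ _ _ → false)))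

  cost-startLearning : ∀ lab → cost G (startLearning lab) ≡ 3 * n
  cost-startLearning lab = trans (cost->>= G (forFin (outDegreeQ lab)) (λ d → ret (learning lab d (λ _ _ → false))))
    (trans (+-identityʳ _) (trans (cost-forFin G (outDegreeQ lab)) (trans (∑-cong (λ v → cost-pairQ G _ _)) (trans (∑-const {n} 3) (*-comm n 3)))))

  outDegrees-eq : ∀ lab v → outDegrees lab v ≡ nb (adj G) v (λ w → not (lab w == lab v))
  outDegrees-eq lab v = trans (run-forFin G (outDegreeQ lab) v) (trans (run-pairQ G (_== v) (λ w → not (lab w == lab v))
    (λ u p r → true≢false (trans (sym (≡⇒== (cong lab (==⇒≡ {i = u} p)))) (not-true r)))) (form-single (adj G) v (λ w → not (lab w == lab v))))

  inv-start : ∀ lab → LearnInv lab (outDegrees lab) (λ _ _ → false)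
  inv-start lab = record { d-eq = outDegrees-eq lab ; known-edge = λ v w () ; known-sym = λ v w → refl }

  run-idle : ∀ ℓ lab fz → anyᵇ (smallOf ℓ lab fz) ≡ false → ∀ ω →
    run G (advance (contracting ℓ lab fz) ω) ≡ run G (nextLevel ℓ lab fz)
  run-idle ℓ lab fz e ω = cong (run G) (if-false e)

  run-raise : ∀ ℓ lab fz → (ℓ <ᵇ L) ≡ true → run G (nextLevel ℓ lab fz) ≡ contracting (suc ℓ) lab fz
  run-raise ℓ lab fz p = cong (run G) (if-true p)

  run-last : ∀ ℓ lab fz → (ℓ <ᵇ L) ≡ false → run G (nextLevel ℓ lab fz) ≡ learning lab (outDegrees lab) (λ _ _ → false)
  run-last ℓ lab fz p = trans (cong (run G) (if-false p)) (run-startLearning lab)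

  module _ {lab : Fin n → Fin n} {d : Fin n → ℕ} {known : Rel₂ n} (inv : LearnInv lab d known) where

    private module R = Lrn inv

    run-learn : ∀ ω → run G (advance (learning lab d known) ω) ≡ learning lab d (R.At.known′ ω)
    run-learn ω@(x , s , β) = trans (run->>= G (R.learnPhase ω) (λ kn → ret (learning lab d kn))) (cong (learning lab d) (R.run-learnPhase x s β))

    cost-learn : ∀ ω → cost G (advance (learning lab d known) ω) ≡ cost G (R.learnPhase ω)
    cost-learn ω = trans (cost->>= G (R.learnPhase ω) (λ kn → ret (learning lab d kn))) (+-identityʳ _)

    inv-learn : ∀ ω → LearnInv lab d (R.At.known′ ω)
    inv-learn ω = record { d-eq = LearnInv.d-eq inv ; known-edge = R.At.known′-edge ω ; known-sym = R.At.known′-sym ω }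

  inv-step : ∀ st → Inv st → ∀ ω → Inv (run G (advance st ω))
  inv-step (learning lab d known) inv ω = subst Inv (sym (run-learn inv ω)) (inv-learn inv ω)
  inv-step (contracting ℓ lab fz) inv ω with bool-cases (anyᵇ (smallOf ℓ lab fz))
  ... | inj₁ e = subst Inv (sym (run-contract inv e ω)) (inv-contract inv ω)
  ... | inj₂ e with bool-cases (ℓ <ᵇ L)
  ...   | inj₁ p = subst Inv (sym (trans (run-idle ℓ lab fz e ω) (run-raise ℓ lab fz p))) (inv-level inv e (<ᵇ-true p))
  ...   | inj₂ p = subst Inv (sym (trans (run-idle ℓ lab fz e ω) (run-last ℓ lab fz p))) (inv-start lab)

  advance-costs : ∀ st → Inv st → ∀ ω → 1 ≤ cost G (advance st ω)
  advance-costs (learning lab d known) inv ω = ≤-trans (s≤s z≤n) (≤-reflexive (sym (cost-learn inv ω)))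
  advance-costs (contracting ℓ lab fz) inv ω with bool-cases (anyᵇ (smallOf ℓ lab fz))
  ... | inj₁ e = ≤-trans (Con.cost-phase-pos inv (anyᵇ-card (smallOf ℓ lab fz) e) ω) (≤-reflexive (sym (cost-contract inv e ω)))
  ... | inj₂ e = ≤-trans (s≤s z≤n) (≤-reflexive (sym (cong (cost G) (if-false e))))

  K e b* : ℕ
  K = odds * 2 ^ q
  e = K * (3 * L)
  b* = threshold k L

  learnBudget : ℕ → ℕ
  learnBudget U = K * ((1 + pickRate) * U) + e * (U ⊓ (b* * b*))

  base : ℕ
  base = 1 + (3 * n + learnBudget (32 * n))

  rest : ℕ → ℕ
  rest ℓ = K * ((9 + pickRate) * ((3 + ℓ) * 2 ^ (L ∸ ℓ))) + (L ∸ ℓ) * (e * b* + 1) + base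

  -- A bound for the expected number of queries still to come: the present level, then `rest` for
  -- the later levels and the learning. By `expected-step`, the cost so far plus `Ψ` is a
  -- supermartingale.
  Ψ : State n → ℕ
  Ψ (contracting ℓ lab fz) = K * ((9 + pickRate) * suc ℓ * m) + e * (m ⊓ b*) + rest ℓ
    where m = card (smallOf ℓ lab fz)
  Ψ (learning lab d known) = learnBudget (∑ (LearnPhase.unknown k L q b lab d known))

  learnBudget-mono : ∀ {U U′} → U ≤ U′ → learnBudget U ≤ learnBudget U′
  learnBudget-mono p = +-mono-≤ (*-monoʳ-≤ K (*-monoʳ-≤ (1 + pickRate) p)) (*-monoʳ-≤ e (⊓-monoˡ-≤ (b* * b*) p))

  small-few : ∀ ℓ lab fz → LowerSize ℓ lab fz → ℓ ≤ L → card (smallOf ℓ lab fz) ≤ 2 ^ (L ∸ ℓ)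
  small-few ℓ lab fz lower ℓ≤L = *-cancelʳ-≤ _ _ (2 ^ ℓ) {{m^n≢0 2 ℓ}} (begin
    card (smallOf ℓ lab fz) * 2 ^ ℓ          ≡⟨ sym (∑-*ʳ (2 ^ ℓ) _) ⟩
    ∑ (λ l → ⟦ smallOf ℓ lab fz l ⟧ * 2 ^ ℓ) ≤⟨ ∑-mono (λ l → ≤-trans (⟦⟧*-mono (smallOf ℓ lab fz l) (λ s → lower l (not-true (proj₁ (∧-true {not (fz l)} s)))
                                                   (<ᵇ-true (proj₁ (∧-true {0 <ᵇ sizeOf lab l} (proj₂ (∧-true {not (fz l)} s))))))) (⟦⟧*≤ (smallOf ℓ lab fz l) (sizeOf lab l))) ⟩
    ∑ (λ l → sizeOf lab l)                   ≡⟨ trans (∑-cong (λ l → ∑-cong (λ v → sym (*-identityʳ ⟦ lab v == l ⟧)))) (sym (∑-fibre lab (λ _ → 1))) ⟩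
    ∑ {n} (λ _ → 1)                          ≡⟨ trans (∑-const {n} 1) (*-identityʳ n) ⟩
    n                                        ≤⟨ n≤2^L ⟩
    2 ^ L                                    ≡⟨ cong (2 ^_) (sym (m∸n+n≡m ℓ≤L)) ⟩
    2 ^ (L ∸ ℓ + ℓ)                          ≡⟨ ^-distribˡ-+-* 2 (L ∸ ℓ) ℓ ⟩
    2 ^ (L ∸ ℓ) * 2 ^ ℓ ∎)
    where open ≤-Reasoning

  expected-step : ∀ st → Inv st → done st ≡ false →
    total Ω (λ ω → cost G (advance st ω) + Ψ (run G (advance st ω))) ≤ Ψ st * vol Ω
  expected-step (learning lab d known) inv nd = begin
    total Ω (λ ω → cost G (advance (learning lab d known) ω) + Ψ (run G (advance (learning lab d known) ω)))
      ≡⟨ total-cong Ω (λ ω → cong₂ _+_ (cost-learn inv ω) (cong Ψ (run-learn inv ω))) ⟩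
    total Ω (λ ω → cost G (R.learnPhase ω) + learnBudget (∑ (R.At.unknown′ ω)))
      ≤⟨ budget Ω K (1 + pickRate) L R.total-unknown a (b* * b*) (a <ᵇ b*) (λ ω → cost G (R.learnPhase ω)) (λ ω → ∑ (R.At.unknown′ ω))
           (≤-trans (+-monoˡ-≤ (a * vol Ω) (≤-reflexive (*-assoc odds (2 ^ q) _))) (≤-trans R.progress-learn (≤-reflexive (sym (*-assoc odds (2 ^ q) _)))))
           (λ t → ≤-trans R.unknown≤ (*-mono-≤ {a} {b*} {a} {b*} (<⇒≤ (<ᵇ-true {a} {b*} t)) (<⇒≤ (<ᵇ-true {a} {b*} t))))
           (λ _ ω → ⊓-monoˡ-≤ (b* * b*) (∑-mono (λ v → ≤-trans (m≤m+n _ _) (R.At.unknown-drop ω v))))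
           (λ ω → ≤-trans (R.cost-learnPhase L≤ ω) (≤-trans (+-monoˡ-≤ (pickCost b* L a) a≥1)
             (≤-reflexive (sym (+-assoc a (pickRate * a) (3 * (L * (⟦ a <ᵇ b* ⟧ * a)))))))) ⟩
    learnBudget R.total-unknown * vol Ω ∎
    where
    open ≤-Reasoning
    module R = Lrn inv
    a = card R.active
    not-false : ∀ {c} → not c ≡ false → c ≡ true
    not-false {true} _ = refl
    a≥1 : 1 ≤ a
    a≥1 = anyᵇ-card R.active (not-false nd)
  expected-step (contracting ℓ lab fz) inv _ with bool-cases (anyᵇ (smallOf ℓ lab fz))
  ... | inj₁ some = begin
    total Ω (λ ω → cost G (advance st ω) + Ψ (run G (advance st ω)))
      ≡⟨ total-cong Ω (λ ω → cong₂ _+_ (cost-contract inv some ω) (cong Ψ (run-contract inv some ω))) ⟩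
    total Ω (λ ω → cost G (C.phase ω) + (K * ((9 + pickRate) * suc ℓ * m′ ω) + e * (m′ ω ⊓ b*) + rest ℓ))
      ≡⟨ trans (total-cong Ω (λ ω → sym (+-assoc (cost G (C.phase ω)) (K * ((9 + pickRate) * suc ℓ * m′ ω) + e * (m′ ω ⊓ b*)) (rest ℓ))))
           (trans (total-+ Ω (λ ω → cost G (C.phase ω) + (K * ((9 + pickRate) * suc ℓ * m′ ω) + e * (m′ ω ⊓ b*))) (λ _ → rest ℓ))
             (cong (total Ω (λ ω → cost G (C.phase ω) + (K * ((9 + pickRate) * suc ℓ * m′ ω) + e * (m′ ω ⊓ b*))) +_) (total-const Ω (rest ℓ)))) ⟩
    total Ω (λ ω → cost G (C.phase ω) + (K * ((9 + pickRate) * suc ℓ * m′ ω) + e * (m′ ω ⊓ b*))) + rest ℓ * vol Ω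
      ≤⟨ +-monoˡ-≤ (rest ℓ * vol Ω) (budget Ω K ((9 + pickRate) * suc ℓ) L m m b* (m <ᵇ b*) (λ ω → cost G (C.phase ω)) m′
           (≤-trans (+-monoˡ-≤ (m * vol Ω) (≤-reflexive (*-assoc odds (2 ^ q) _))) (≤-trans C.progress-contract (≤-reflexive (sym (*-assoc odds (2 ^ q) _)))))
           (λ t → <⇒≤ (<ᵇ-true t))
           (λ f ω → ≤-trans (m⊓n≤n (m′ ω) b*) (≤-reflexive (sym (m≥n⇒m⊓n≡n (<ᵇ-false {m} f)))))
           (λ ω → ≤-trans (C.cost-phase L≤ ω) (+-monoˡ-≤ _ (≤-reflexive (sym (*-assoc (9 + pickRate) (suc ℓ) m)))))) ⟩
    (K * ((9 + pickRate) * suc ℓ * m) + e * (m ⊓ b*)) * vol Ω + rest ℓ * vol Ω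
      ≡⟨ sym (*-distribʳ-+ (vol Ω) (K * ((9 + pickRate) * suc ℓ * m) + e * (m ⊓ b*)) (rest ℓ)) ⟩
    Ψ st * vol Ω ∎
    where
    open ≤-Reasoning
    module C = Con inv
    st = contracting ℓ lab fz
    m = card (smallOf ℓ lab fz)
    m′ : Seed Ω → ℕ
    m′ ω = card (smallOf ℓ (C.At.lab′ ω) (C.At.fz′ ω))
  ... | inj₂ none = ≤-trans (total-mono Ω (λ ω → ≤-trans (≤-reflexive (cong (λ t → cost G t + Ψ (run G t)) (if-false none)))
                      (≤-trans next (m≤n+m (rest ℓ) (K * ((9 + pickRate) * suc ℓ * card (smallOf ℓ lab fz)) + e * (card (smallOf ℓ lab fz) ⊓ b*)))))) (≤-reflexive (total-const Ω (Ψ st)))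
    where
    open ≤-Reasoning
    st = contracting ℓ lab fz
    next : suc (cost G (nextLevel ℓ lab fz)) + Ψ (run G (nextLevel ℓ lab fz)) ≤ rest ℓ
    next with bool-cases (ℓ <ᵇ L)
    ... | inj₁ p = begin
      suc (cost G (nextLevel ℓ lab fz)) + Ψ (run G (nextLevel ℓ lab fz))
        ≡⟨ cong (λ t → suc (cost G t) + Ψ (run G t)) (if-true p) ⟩
      1 + (K * ((9 + pickRate) * suc (suc ℓ) * m₁) + e * (m₁ ⊓ b*) + rest (suc ℓ))
        ≤⟨ s≤s (+-monoˡ-≤ (rest (suc ℓ)) (+-mono-≤ (*-monoʳ-≤ K (*-monoʳ-≤ ((9 + pickRate) * suc (suc ℓ))
             (small-few (suc ℓ) lab fz (lower-next inv none) ℓ<L))) (*-monoʳ-≤ e (m⊓n≤n m₁ b*)))) ⟩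
      1 + (K * ((9 + pickRate) * suc (suc ℓ) * p₁) + e * b* + (K * ((9 + pickRate) * ((3 + suc ℓ) * p₁)) + (L ∸ suc ℓ) * (e * b* + 1) + base))
        ≡⟨ level-budget (9 + pickRate) K ℓ p₁ (e * b*) (L ∸ suc ℓ) base ⟩
      K * ((9 + pickRate) * ((3 + ℓ) * 2 ^ suc (L ∸ suc ℓ))) + suc (L ∸ suc ℓ) * (e * b* + 1) + base
        ≡⟨ cong (λ z → K * ((9 + pickRate) * ((3 + ℓ) * 2 ^ z)) + z * (e * b* + 1) + base) (sym (+-∸-assoc 1 ℓ<L)) ⟩
      rest ℓ ∎
      where
      ℓ<L = <ᵇ-true p
      m₁ = card (smallOf (suc ℓ) lab fz)
      p₁ = 2 ^ (L ∸ suc ℓ)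
    ... | inj₂ p = begin
      suc (cost G (nextLevel ℓ lab fz)) + Ψ (run G (nextLevel ℓ lab fz))
        ≡⟨ cong (λ t → suc (cost G t) + Ψ (run G t)) (if-false p) ⟩
      suc (cost G (startLearning lab)) + Ψ (run G (startLearning lab))
        ≡⟨ cong₂ (λ c s → suc c + Ψ s) (cost-startLearning lab) (run-startLearning lab) ⟩
      1 + (3 * n + learnBudget (∑ (LearnPhase.unknown k L q b lab (outDegrees lab) (λ _ _ → false))))
        ≤⟨ +-monoʳ-≤ 1 (+-monoʳ-≤ (3 * n) (learnBudget-mono few)) ⟩
      base
        ≤⟨ m≤n+m base _ ⟩
      rest ℓ ∎
      where
      frozen-v = all-frozen inv none (<ᵇ-false {ℓ} p)
      few : ∑ (LearnPhase.unknown k L q b lab (outDegrees lab) (λ _ _ → false)) ≤ 32 * n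
      few = begin
        ∑ (λ v → outDegrees lab v ∸ card {n} (λ _ → false))
          ≤⟨ ∑-mono (λ v → ≤-trans (m∸n≤m (outDegrees lab v) (card {n} (λ _ → false))) (≤-reflexive (trans (outDegrees-eq lab v)
               (nb-cong (adj G) v (λ w → touch (not (lab w == lab v)) (frozen-v v)))))) ⟩
        frozenEdges lab fz
          ≤⟨ ContractInv.frozen inv ⟩
        32 * ∑ (λ v → ⟦ fz (lab v) ⟧)
          ≤⟨ *-monoʳ-≤ 32 (≤-trans (∑-mono (λ v → ⟦⟧≤1 (fz (lab v)))) (≤-reflexive (trans (∑-const {n} 1) (*-identityʳ n)))) ⟩
        32 * n ∎
        where
        touch : ∀ a {c d} → c ≡ true → a ≡ (a ∧ (c ∨ d))
        touch true  refl = refl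
        touch false refl = refl

  expected-cost : ∀ f st → Inv st → total (pow f Ω) (λ ωs → cost G (loop st ωs)) ≤ Ψ st * vol (pow f Ω)
  expected-cost f st inv with bool-cases (done st)
  ... | inj₁ t = ≤-trans (≤-reflexive (trans (total-cong (pow f Ω) (finished f)) (total-const (pow f Ω) 0))) z≤n
    where
    finished : ∀ f (ωs : Vec (Seed Ω) f) → cost G (loop st ωs) ≡ 0
    finished zero    []       = refl
    finished (suc f) (ω ∷ ωs) = cong (cost G) (if-true t)
  expected-cost zero    st inv | inj₂ nd = ≤-trans (≤-reflexive (total-[] Ω _)) z≤n
  expected-cost (suc f) st inv | inj₂ nd = begin
    total (pow (suc f) Ω) (λ ωs → cost G (loop st ωs))
      ≡⟨ total-∷ f Ω _ ⟩
    total Ω (λ ω → total (pow f Ω) (λ ωs → cost G (loop st (ω ∷ ωs))))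
      ≡⟨ total-cong Ω (λ ω → trans (total-cong (pow f Ω) (λ ωs → trans (cong (cost G) (if-false nd)) (cost->>= G (advance st ω) (λ st′ → loop st′ ωs))))
           (trans (total-+ (pow f Ω) _ _) (cong (_+ total (pow f Ω) (λ ωs → cost G (loop (run G (advance st ω)) ωs))) (total-const (pow f Ω) _)))) ⟩
    total Ω (λ ω → cost G (advance st ω) * vol (pow f Ω) + total (pow f Ω) (λ ωs → cost G (loop (run G (advance st ω)) ωs)))
      ≤⟨ total-mono Ω (λ ω → +-monoʳ-≤ _ (expected-cost f (run G (advance st ω)) (inv-step st inv ω))) ⟩
    total Ω (λ ω → cost G (advance st ω) * vol (pow f Ω) + Ψ (run G (advance st ω)) * vol (pow f Ω))
      ≡⟨ trans (total-cong Ω (λ ω → sym (*-distribʳ-+ (vol (pow f Ω)) (cost G (advance st ω)) _))) (total-*ʳ Ω (vol (pow f Ω)) _) ⟩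
    total Ω (λ ω → cost G (advance st ω) + Ψ (run G (advance st ω))) * vol (pow f Ω)
      ≤⟨ *-monoˡ-≤ (vol (pow f Ω)) (expected-step st inv nd) ⟩
    Ψ st * vol Ω * vol (pow f Ω)
      ≡⟨ trans (*-assoc (Ψ st) _ _) (cong (Ψ st *_) (sym (vol-∷ f Ω))) ⟩
    Ψ st * vol (pow (suc f) Ω) ∎
    where open ≤-Reasoning

  -- Every step costs at least one query, so running out of steps is a special case of being
  -- expensive. One number can then bound both steps and queries, and Markov's inequality covers
  -- both failures.
  unfinished-costs : ∀ f st → Inv st → (ωs : Vec (Seed Ω) f) → run G (loop st ωs) ≡ nothing → f ≤ cost G (loop st ωs)
  unfinished-costs zero    st inv []       _ = z≤n
  unfinished-costs (suc f) st inv (ω ∷ ωs) r with done st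
  unfinished-costs (suc f) st inv (ω ∷ ωs) () | true
  ... | false = ≤-trans (+-mono-≤ (advance-costs st inv ω) (unfinished-costs f (run G (advance st ω)) (inv-step st inv ω) ωs
                  (trans (sym (run->>= G (advance st ω) (λ st′ → loop st′ ωs))) r)))
                  (≤-reflexive (sym (cost->>= G (advance st ω) (λ st′ → loop st′ ωs))))

potential-antitone : ∀ W M H H′ → 1 ≤ W → H′ ≤ H → H ≤ M → potential W M H ≤ potential W M H′
potential-antitone W M H H′ W≥1 p q = *-cancelˡ-≤ W {{>-nonZero W≥1}} (≤-trans
  (≤-reflexive (trans (*-comm W _) (cong (potential W M H *_) (sym (+-identityʳ W)))))
  (potential-step W M H H′ 0 (≤-trans (≤-reflexive (+-identityʳ H′)) p) q))

opaque
  -- The factor 128 in 2048 = 16 · 128, that is, the constant of `P-lower`.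
  gauge : ℕ
  gauge = 128

  2048-gauge : ∀ x → 2048 * x ≡ 16 * gauge * x
  2048-gauge x = cong (_* x) {2048} {16 * 128} refl

-- The weights Φ ℓ bound the sum of Δ j over the levels j ≥ ℓ.
module Weights (L δ c : ℕ) (c<δ : c < δ) where

  early : ℕ → Bool
  early ℓ = 2 ^ suc (suc ℓ) <ᵇ δ

  private
    halves : ∀ ℓ → ℓ ≤ L → 2 ^ (suc L ∸ ℓ) ≡ 2 * 2 ^ (L ∸ ℓ)
    halves ℓ p = cong (2 ^_) (+-∸-assoc 1 p)

    whole : ∀ ℓ → ℓ ≤ L → 2 ^ (L ∸ ℓ) * 2 ^ ℓ ≡ 2 ^ L
    whole ℓ p = trans (sym (^-distribˡ-+-* 2 (L ∸ ℓ) ℓ)) (cong (2 ^_) (m∸n+n≡m p))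

    late : ∀ ℓ → early ℓ ≡ false → δ ≤ 2 ^ suc (suc ℓ)
    late ℓ e = <ᵇ-false {2 ^ suc (suc ℓ)} e

  opaque

    -- In both regimes `Δ ℓ` is exactly `2048 W / bound` for `W = 2 δ 2 ^ L`. `Φ` sums the geometric
    -- series within a regime; the constant term `8 gauge 2 ^ L` reserves the share of the late
    -- levels.
    Δ Φ : ℕ → ℕ
    Δ ℓ = if early ℓ then 32 * gauge * 2 ^ (L ∸ ℓ) else gauge * δ * 2 ^ (L ∸ ℓ)
    Φ ℓ = if early ℓ then 32 * gauge * 2 ^ (suc L ∸ ℓ) + 8 * gauge * 2 ^ L else gauge * δ * 2 ^ (suc L ∸ ℓ)

    Δ-bound : ∀ ℓ → ℓ ≤ L → 16 * gauge * (2 * (δ * 2 ^ L)) ≤ Δ ℓ * (2 ^ ℓ * (if early ℓ then δ else 32))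
    Δ-bound ℓ p with early ℓ
    ... | true  = ≤-reflexive (begin
      16 * gauge * (2 * (δ * 2 ^ L))                ≡⟨ cong (λ z → 16 * gauge * (2 * (δ * z))) (sym (whole ℓ p)) ⟩
      16 * gauge * (2 * (δ * (2 ^ (L ∸ ℓ) * 2 ^ ℓ))) ≡⟨ solve 4 (λ g d x y → con 16 :* g :* (con 2 :* (d :* (x :* y))) := con 32 :* g :* x :* (y :* d)) refl gauge δ (2 ^ (L ∸ ℓ)) (2 ^ ℓ) ⟩
      32 * gauge * 2 ^ (L ∸ ℓ) * (2 ^ ℓ * δ) ∎)
      where open ≡-Reasoning
    ... | false = ≤-reflexive (begin
      16 * gauge * (2 * (δ * 2 ^ L))                ≡⟨ cong (λ z → 16 * gauge * (2 * (δ * z))) (sym (whole ℓ p)) ⟩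
      16 * gauge * (2 * (δ * (2 ^ (L ∸ ℓ) * 2 ^ ℓ))) ≡⟨ solve 4 (λ g d x y → con 16 :* g :* (con 2 :* (d :* (x :* y))) := g :* d :* x :* (y :* con 32)) refl gauge δ (2 ^ (L ∸ ℓ)) (2 ^ ℓ) ⟩
      gauge * δ * 2 ^ (L ∸ ℓ) * (2 ^ ℓ * 32) ∎)
      where open ≡-Reasoning

    Φ-step : ∀ ℓ → ℓ ≤ L → Φ (suc ℓ) + Δ ℓ ≤ Φ ℓ
    Φ-step ℓ p with bool-cases (early ℓ) | bool-cases (early (suc ℓ))
    ... | inj₁ e | inj₁ e′ = subst₂ _≤_ (sym (cong₂ _+_ (if-true e′) (if-true e))) (sym (if-true e)) (≤-reflexive (begin
      32 * gauge * 2 ^ (L ∸ ℓ) + 8 * gauge * 2 ^ L + 32 * gauge * 2 ^ (L ∸ ℓ)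
        ≡⟨ solve 3 (λ k x y → k :* x :+ y :+ k :* x := k :* (con 2 :* x) :+ y) refl (32 * gauge) (2 ^ (L ∸ ℓ)) (8 * gauge * 2 ^ L) ⟩
      32 * gauge * (2 * 2 ^ (L ∸ ℓ)) + 8 * gauge * 2 ^ L
        ≡⟨ cong (λ z → 32 * gauge * z + 8 * gauge * 2 ^ L) (sym (halves ℓ p)) ⟩
      32 * gauge * 2 ^ (suc L ∸ ℓ) + 8 * gauge * 2 ^ L ∎))
      where open ≡-Reasoning
    -- The change of regime: `δ ≤ 2 ^ (ℓ + 3)` bounds the whole late series by the reserved term.
    ... | inj₁ e | inj₂ e′ = subst₂ _≤_ (sym (cong₂ _+_ (if-false e′) (if-true e))) (sym (if-true e)) (begin
      gauge * δ * 2 ^ (L ∸ ℓ) + 32 * gauge * 2 ^ (L ∸ ℓ)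
        ≤⟨ +-monoˡ-≤ (32 * gauge * 2 ^ (L ∸ ℓ)) (*-monoˡ-≤ (2 ^ (L ∸ ℓ)) (*-monoʳ-≤ gauge (late (suc ℓ) e′))) ⟩
      gauge * 2 ^ suc (suc (suc ℓ)) * 2 ^ (L ∸ ℓ) + 32 * gauge * 2 ^ (L ∸ ℓ)
        ≡⟨ solve 3 (λ g x y → g :* (con 2 :* (con 2 :* (con 2 :* y))) :* x :+ con 32 :* g :* x := con 32 :* g :* x :+ con 8 :* g :* (x :* y)) refl gauge (2 ^ (L ∸ ℓ)) (2 ^ ℓ) ⟩
      32 * gauge * 2 ^ (L ∸ ℓ) + 8 * gauge * (2 ^ (L ∸ ℓ) * 2 ^ ℓ)
        ≤⟨ +-mono-≤ (*-monoʳ-≤ (32 * gauge) (≤-trans (m≤n*m (2 ^ (L ∸ ℓ)) 2) (≤-reflexive (sym (halves ℓ p))))) (≤-reflexive (cong (8 * gauge *_) (whole ℓ p))) ⟩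
      32 * gauge * 2 ^ (suc L ∸ ℓ) + 8 * gauge * 2 ^ L ∎)
      where open ≤-Reasoning
    ... | inj₂ e | inj₁ e′ = ⊥-elim (<⇒≱ (<ᵇ-true {2 ^ suc (suc (suc ℓ))} e′) (≤-trans (late ℓ e) (^-monoʳ-≤ 2 (n≤1+n (suc (suc ℓ))))))
    ... | inj₂ e | inj₂ e′ = subst₂ _≤_ (sym (cong₂ _+_ (if-false e′) (if-false e))) (sym (if-false e)) (≤-reflexive (begin
      gauge * δ * 2 ^ (L ∸ ℓ) + gauge * δ * 2 ^ (L ∸ ℓ)
        ≡⟨ solve 2 (λ d x → d :* x :+ d :* x := d :* (con 2 :* x)) refl (gauge * δ) (2 ^ (L ∸ ℓ)) ⟩
      gauge * δ * (2 * 2 ^ (L ∸ ℓ))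
        ≡⟨ cong (gauge * δ *_) (sym (halves ℓ p)) ⟩
      gauge * δ * 2 ^ (suc L ∸ ℓ) ∎))
      where open ≡-Reasoning

    -- At early levels 72 = 64 + 8, from `32 · 2 ^ (L + 1)` and the reserved term; late levels need
    -- only 8. The cut enters through `c < δ` alone.
    Φ-bound : ∀ ℓ → ℓ ≤ L → 2 * c * Φ ℓ ≤ 72 * gauge * (2 * (δ * 2 ^ L))
    Φ-bound ℓ p with bool-cases (early ℓ)
    ... | inj₁ e = subst (λ z → 2 * c * z ≤ 72 * gauge * (2 * (δ * 2 ^ L))) (sym (if-true e)) (begin
      2 * c * (32 * gauge * 2 ^ (suc L ∸ ℓ) + 8 * gauge * 2 ^ L)
        ≤⟨ *-mono-≤ (*-monoʳ-≤ 2 (<⇒≤ c<δ)) (+-monoˡ-≤ (8 * gauge * 2 ^ L) (*-monoʳ-≤ (32 * gauge) (^-monoʳ-≤ 2 (m∸n≤m (suc L) ℓ)))) ⟩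
      2 * δ * (32 * gauge * 2 ^ suc L + 8 * gauge * 2 ^ L)
        ≡⟨ solve 3 (λ g d x → con 2 :* d :* (con 32 :* g :* (con 2 :* x) :+ con 8 :* g :* x) := con 72 :* g :* (con 2 :* (d :* x))) refl gauge δ (2 ^ L) ⟩
      72 * gauge * (2 * (δ * 2 ^ L)) ∎)
      where open ≤-Reasoning
    ... | inj₂ e = subst (λ z → 2 * c * z ≤ 72 * gauge * (2 * (δ * 2 ^ L))) (sym (if-false e)) (begin
      2 * c * (gauge * δ * 2 ^ (suc L ∸ ℓ))
        ≡⟨ cong (λ z → 2 * c * (gauge * δ * z)) (halves ℓ p) ⟩
      2 * c * (gauge * δ * (2 * 2 ^ (L ∸ ℓ)))
        ≤⟨ *-mono-≤ (*-monoʳ-≤ 2 (<⇒≤ c<δ)) (*-monoˡ-≤ (2 * 2 ^ (L ∸ ℓ)) (*-monoʳ-≤ gauge (late ℓ e))) ⟩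
      2 * δ * (gauge * 2 ^ suc (suc ℓ) * (2 * 2 ^ (L ∸ ℓ)))
        ≡⟨ solve 4 (λ g d x y → con 2 :* d :* (g :* (con 2 :* (con 2 :* y)) :* (con 2 :* x)) := con 8 :* g :* (con 2 :* (d :* (x :* y)))) refl gauge δ (2 ^ (L ∸ ℓ)) (2 ^ ℓ) ⟩
      8 * gauge * (2 * (δ * (2 ^ (L ∸ ℓ) * 2 ^ ℓ)))
        ≡⟨ cong (λ z → 8 * gauge * (2 * (δ * z))) (whole ℓ p) ⟩
      8 * gauge * (2 * (δ * 2 ^ L))
        ≤⟨ *-monoˡ-≤ (2 * (δ * 2 ^ L)) (*-monoˡ-≤ gauge (m≤m+n 8 64)) ⟩
      72 * gauge * (2 * (δ * 2 ^ L)) ∎)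
      where open ≤-Reasoning

-- Survival of a minimum cut

module SuccessAnalysis {n : ℕ} (k L q b δ : ℕ) (G : Graph n) (n≤2^L : n ≤ 2 ^ L) (n²≤2^b : n * n ≤ 2 ^ b)
  (L≤ : L ≤ 8 * (k + 2)) (δ≤ : ∀ v → δ ≤ Cuts.deg G v) (4096≤Q : 4096 ≤ 2 ^ q)
  (S : VSet n) (minimal : ∀ T → Proper T → cutSize G S ≤ cutSize G T) (S<δ : cutSize G S < δ)
  (W M : ℕ) (W≡ : W ≡ 2 * (δ * 2 ^ L)) (M≡ : M ≡ 72 * gauge * W) where

  open WalkAnalysis k L q b δ G n≤2^L n²≤2^b L≤ δ≤ 4096≤Q public
  open Cuts G
  open Weights L δ (cutSize G S) S<δ using (Δ; Φ; Δ-bound; Φ-step; Φ-bound)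

  c : ℕ
  c = cutSize G S

  W>0 : 1 ≤ W
  W>0 = ≤-trans (*-mono-≤ {1} {2} (s≤s z≤n) (*-mono-≤ (≤-trans (s≤s z≤n) S<δ) (m^n>0 2 L))) (≤-reflexive (sym W≡))

  exposed : ℕ → (Fin n → Fin n) → VSet n → ℕ
  exposed ℓ lab fz = ∑ (λ v → crossing S v * ⟦ smallOf ℓ lab fz (lab v) ⟧)

  exposed≤ : ∀ ℓ lab fz → exposed ℓ lab fz ≤ 2 * c
  exposed≤ ℓ lab fz = ≤-trans (∑-mono (λ v → ≤-trans (*-monoʳ-≤ (crossing S v) (⟦⟧≤1 (smallOf ℓ lab fz (lab v)))) (≤-reflexive (*-identityʳ _))))
    (≤-reflexive (∑crossing S))

  -- The present exposure at the price of this level, plus full exposure `2 c` at all later levels.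
  -- It is zero during learning, when clusters no longer change.
  danger : State n → ℕ
  danger (contracting ℓ lab fz)   = 2 * c * Φ (suc ℓ) + Δ ℓ * exposed ℓ lab fz
  danger (learning lab d known) = 0

  danger-Φ : ∀ ℓ lab fz → ℓ ≤ L → danger (contracting ℓ lab fz) ≤ 2 * c * Φ ℓ
  danger-Φ ℓ lab fz p = begin
    2 * c * Φ (suc ℓ) + Δ ℓ * exposed ℓ lab fz ≤⟨ +-monoʳ-≤ (2 * c * Φ (suc ℓ)) (*-monoʳ-≤ (Δ ℓ) (exposed≤ ℓ lab fz)) ⟩
    2 * c * Φ (suc ℓ) + Δ ℓ * (2 * c)          ≡⟨ solve 3 (λ c f d → c :* f :+ d :* c := c :* (f :+ d)) refl (2 * c) (Φ (suc ℓ)) (Δ ℓ) ⟩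
    2 * c * (Φ (suc ℓ) + Δ ℓ)                  ≤⟨ *-monoʳ-≤ (2 * c) (Φ-step ℓ p) ⟩
    2 * c * Φ ℓ ∎
    where open ≤-Reasoning

  danger≤M : ∀ st → Inv st → danger st ≤ M
  danger≤M (contracting ℓ lab fz)   inv = ≤-trans (danger-Φ ℓ lab fz (ContractInv.ℓ≤L inv)) (≤-trans (Φ-bound ℓ (ContractInv.ℓ≤L inv)) (≤-reflexive (sym (trans M≡ (cong (72 * gauge *_) W≡)))))
  danger≤M (learning lab d known) inv = z≤n

  VV : State n → ℕ
  VV st = potential W M (danger st)

  VV-zero : potential W M 0 ≡ suc W ^ M
  VV-zero = trans (potential-def W M 0) (*-identityˡ (suc W ^ M))

  VV≤ : ∀ st → Inv st → VV st ≤ suc W ^ M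
  VV≤ st inv = ≤-trans (potential-antitone W M (danger st) 0 W>0 z≤n (danger≤M st inv)) (≤-reflexive VV-zero)

  ok : State n → Bool
  ok st = respects S (clusters st)

  success-step : ∀ st → Inv st → Respecting S (clusters st) →
    vol Ω * VV st ≤ total Ω (λ ω → ⟦ ok (run G (advance st ω)) ⟧ * VV (run G (advance st ω)))
  success-step (learning lab d known) inv res = ≤-trans (≤-reflexive (trans (*-comm (vol Ω) _) (sym (total-const Ω (VV (learning lab d known))))))
    (total-mono Ω (λ ω → ≤-reflexive (sym (trans (cong (λ st → ⟦ ok st ⟧ * VV st) (run-learn inv ω)) (⟦⟧*-1 _ (respects-intro res))))))
  success-step (contracting ℓ lab fz) inv res with bool-cases (anyᵇ (smallOf ℓ lab fz))
  ... | inj₁ some = ≤-trans (C.MinCut.potential-contract S minimal S<δ res (Δ ℓ) W M (2 * c * Φ (suc ℓ)) W>0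
                        (≤-trans (≤-reflexive (trans (2048-gauge W) (cong (16 * gauge *_) W≡))) (Δ-bound ℓ (ContractInv.ℓ≤L inv))) (danger≤M (contracting ℓ lab fz) inv))
      (≤-reflexive (total-cong Ω (λ ω → sym (cong (λ st → ⟦ ok st ⟧ * VV st) (run-contract inv some ω)))))
    where module C = Con inv
  ... | inj₂ none = ≤-trans (≤-reflexive (trans (*-comm (vol Ω) (VV (contracting ℓ lab fz))) (sym (total-const Ω (VV (contracting ℓ lab fz))))))
      (total-mono Ω (λ ω → ≤-trans (next (bool-cases (ℓ <ᵇ L))) (≤-reflexive (cong worth (sym (run-idle ℓ lab fz none ω))))))
    where
    worth : State n → ℕ
    worth st = ⟦ ok st ⟧ * VV st
    next : (ℓ <ᵇ L) ≡ true ⊎ (ℓ <ᵇ L) ≡ false → VV (contracting ℓ lab fz) ≤ worth (run G (nextLevel ℓ lab fz))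
    next (inj₁ p) = ≤-trans (potential-antitone W M (danger (contracting ℓ lab fz)) (danger (contracting (suc ℓ) lab fz)) W>0
            (≤-trans (danger-Φ (suc ℓ) lab fz (<ᵇ-true p)) (m≤m+n (2 * c * Φ (suc ℓ)) (Δ ℓ * exposed ℓ lab fz))) (danger≤M (contracting ℓ lab fz) inv))
          (≤-reflexive (sym (trans (cong worth (run-raise ℓ lab fz p)) (⟦⟧*-1 (VV (contracting (suc ℓ) lab fz)) (respects-intro res)))))
    next (inj₂ p) = ≤-trans (VV≤ (contracting ℓ lab fz) inv)
          (≤-reflexive (sym (trans (cong worth (run-last ℓ lab fz p)) (trans (⟦⟧*-1 (potential W M 0) (respects-intro res)) VV-zero))))

  -- An unfinished walk counts as fine here; it is charged to the cost instead, through
  -- `unfinished-costs`.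
  fine : Maybe (State n) → Bool
  fine r = maybe ok true r

  -- The submartingale is followed for `f` steps, and the potential at the end is at most
  -- `(W + 1) ^ M`. So the probability of survival is at least the initial potential divided by that
  -- number.
  success-count : ∀ f st → Inv st → Respecting S (clusters st) →
    vol (pow f Ω) * VV st ≤ suc W ^ M * total (pow f Ω) (λ ωs → ⟦ fine (run G (loop st ωs)) ⟧)
  success-count f st inv res with bool-cases (done st)
  ... | inj₁ t = ≤-trans (*-monoʳ-≤ (vol (pow f Ω)) (VV≤ st inv)) (≤-reflexive (trans (*-comm (vol (pow f Ω)) _)
        (cong (suc W ^ M *_) (total-cong (pow f Ω) (λ ωs → sym (cong ⟦_⟧ (trans (cong fine (finished f ωs)) (respects-intro res))))))))
    where
    finished : ∀ f (ωs : Vec (Seed Ω) f) → run G (loop st ωs) ≡ just st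
    finished zero    []       = if-true t
    finished (suc f) (ω ∷ ωs) = cong (run G) (if-true t)
  success-count zero st inv res | inj₂ nd = ≤-trans (≤-trans (*-monoʳ-≤ (vol (pow zero Ω)) (VV≤ st inv))
      (≤-reflexive (trans (cong (_* suc W ^ M) (total-[] Ω _)) (*-comm 1 (suc W ^ M)))))
    (≤-reflexive (cong (suc W ^ M *_) (sym (trans (total-[] Ω _) (cong (λ r → ⟦ fine r ⟧) (if-false nd))))))
  success-count (suc f) st inv res | inj₂ nd = begin
    vol (pow (suc f) Ω) * VV st
      ≡⟨ trans (cong (_* VV st) (vol-∷ f Ω)) (solve 3 (λ a v x → a :* v :* x := v :* (a :* x)) refl (vol Ω) vf (VV st)) ⟩
    vf * (vol Ω * VV st)
      ≤⟨ *-monoʳ-≤ vf (success-step st inv res) ⟩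
    vf * total Ω (λ ω → ⟦ ok (st′ ω) ⟧ * VV (st′ ω))
      ≡⟨ trans (sym (total-*ˡ Ω vf _)) (total-cong Ω (λ ω → solve 3 (λ v o x → v :* (o :* x) := o :* (v :* x)) refl vf ⟦ ok (st′ ω) ⟧ (VV (st′ ω)))) ⟩
    total Ω (λ ω → ⟦ ok (st′ ω) ⟧ * (vf * VV (st′ ω)))
      ≤⟨ total-mono Ω (λ ω → ≤-trans (⟦⟧*-mono (ok (st′ ω)) (λ t → success-count f (st′ ω) (inv-step st inv ω) (respects-elim t)))
           (⟦⟧*≤ (ok (st′ ω)) _)) ⟩
    total Ω (λ ω → P * total (pow f Ω) (λ ωs → ⟦ fine (run G (loop (st′ ω) ωs)) ⟧))
      ≡⟨ trans (total-*ˡ Ω P _) (cong (P *_) (trans (total-cong Ω (λ ω → total-cong (pow f Ω) (λ ωs → cong (λ r → ⟦ fine r ⟧)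
           (sym (trans (cong (run G) (if-false nd)) (run->>= G (advance st ω) (λ st′ → loop st′ ωs))))))) (sym (total-∷ f Ω _)))) ⟩
    P * total (pow (suc f) Ω) (λ ωs → ⟦ fine (run G (loop st ωs)) ⟧) ∎
    where
    open ≤-Reasoning
    vf = vol (pow f Ω)
    P = suc W ^ M
    st′ : Seed Ω → State n
    st′ ω = run G (advance st ω)

-- Reading off the answer

allVecs : ∀ n → List (Vec Bool n)
allVecs zero    = [] ∷ []
allVecs (suc n) = mapᴸ (true ∷_) (allVecs n) ++ mapᴸ (false ∷_) (allVecs n)

∈-allVecs : ∀ {n} (v : Vec Bool n) → v ∈ allVecs n
∈-allVecs []          = here refl
∈-allVecs (true ∷ v)  = ∈-++⁺ˡ (∈-map⁺ (true ∷_) (∈-allVecs v))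
∈-allVecs {suc n} (false ∷ v) = ∈-++⁺ʳ (mapᴸ (true ∷_) (allVecs n)) (∈-map⁺ (false ∷_) (∈-allVecs v))

allSets : ∀ n → List (VSet n)
allSets n = mapᴸ lookup (allVecs n)

∈-allSets : ∀ {n} (S : VSet n) → ∃ λ T → T ∈ allSets n × (∀ v → T v ≡ S v)
∈-allSets S = lookup (tabulateⱽ S) , ∈-map⁺ lookup (∈-allVecs (tabulateⱽ S)) , lookup∘tabulate S

proper : ∀ {n} → VSet n → Bool
proper S = anyᵇ S ∧ anyᵇ (not ∘ S)

proper-elim : ∀ {n} {S : VSet n} → proper S ≡ true → Proper S
proper-elim {S = S} e with anyᵇ-elim S (proj₁ (∧-true {anyᵇ S} e)) | anyᵇ-elim (not ∘ S) (proj₂ (∧-true {anyᵇ S} e))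
... | i , p | j , q = (i , p) , (j , not-true q)

proper-intro : ∀ {n} {S : VSet n} → Proper S → proper S ≡ true
proper-intro {S = S} ((i , p) , (j , q)) = ∧-intro (anyᵇ-intro S i p) (anyᵇ-intro (not ∘ S) j (cong not q))

Proper-cong : ∀ {n} {S T : VSet n} → (∀ v → T v ≡ S v) → Proper S → Proper T
Proper-cong h ((i , p) , (j , q)) = (i , trans (h i) p) , (j , trans (h j) q)

-- A minimizer as a list of at most one element, so that an empty list of candidates needs no
-- default.
bestOf : {A : Set} → (A → ℕ) → List A → List A
better : {A : Set} → (A → ℕ) → A → List A → List A
bestOf f []       = []
bestOf f (x ∷ xs) = better f x (bestOf f xs)
better f x []       = x ∷ []
better f x (y ∷ ys) = if f x ≤ᵇ f y then x ∷ [] else (y ∷ ys)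

module _ {A : Set} (f : A → ℕ) where

  bestOf-All : ∀ {P : A → Set} xs → All P xs → All P (bestOf f xs)
  better-All : ∀ {P : A → Set} {x} ys → P x → All P ys → All P (better f x ys)
  bestOf-All []       []       = []
  bestOf-All (x ∷ xs) (p ∷ ps) = better-All (bestOf f xs) p (bestOf-All xs ps)
  better-All []       p ps = p ∷ []
  better-All {x = x} (y ∷ ys) p (q ∷ qs) with f x ≤ᵇ f y
  ... | true  = p ∷ []
  ... | false = q ∷ qs

  bestOf-length : ∀ xs → length (bestOf f xs) ≤ 1
  better-length : ∀ x ys → length ys ≤ 1 → length (better f x ys) ≤ 1
  bestOf-length []       = z≤n
  bestOf-length (x ∷ xs) = better-length x (bestOf f xs) (bestOf-length xs)
  better-length x []       p = ≤-refl
  better-length x (y ∷ ys) p with f x ≤ᵇ f y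
  ... | true  = ≤-refl
  ... | false = p

  bestOf-best : ∀ {x xs} → x ∈ xs → ∃ λ y → y ∈ bestOf f xs × f y ≤ f x
  better-head : ∀ x ys → ∃ λ y → y ∈ better f x ys × f y ≤ f x
  better-tail : ∀ x {y ys} → length ys ≤ 1 → y ∈ ys → ∃ λ z → z ∈ better f x ys × f z ≤ f y
  bestOf-best {xs = x ∷ xs} (here refl) = better-head x (bestOf f xs)
  bestOf-best {xs = x ∷ xs} (there i) with bestOf-best i
  ... | y , j , p with better-tail x (bestOf-length xs) j
  ...   | z , m , q = z , m , ≤-trans q p
  better-head x [] = x , here refl , ≤-refl
  better-head x (y ∷ ys) with f x ≤ᵇ f y in e
  ... | true  = x , here refl , ≤-refl
  ... | false = y , here refl , <⇒≤ (≤ᵇ-false {f x} e)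
  better-tail x {y} {_ ∷ []} le (here refl) with f x ≤ᵇ f y in e
  ... | true  = x , here refl , ≤ᵇ-true e
  ... | false = y , here refl , ≤-refl
  better-tail x {y} {_ ∷ _ ∷ _} (s≤s ()) i

minCuts : ∀ {n} → ℕ → List (VSet n) → DT n ℕ
minCuts d []       = ret d
minCuts d (S ∷ Ss) = ask S λ c → minCuts d Ss >>= λ r → ret (c ⊓ r)

module _ {n : ℕ} (G : Graph n) where

  cost-minCuts : ∀ d Ss → cost G (minCuts d Ss) ≡ length Ss
  cost-minCuts d []       = refl
  cost-minCuts d (S ∷ Ss) = cong suc (trans (cost->>= G (minCuts d Ss) (λ r → ret (cutSize G S ⊓ r))) (trans (+-identityʳ _) (cost-minCuts d Ss)))

  run-minCuts : ∀ d S Ss → run G (minCuts d (S ∷ Ss)) ≡ cutSize G S ⊓ run G (minCuts d Ss)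
  run-minCuts d S Ss = run->>= G (minCuts d Ss) (λ r → ret (cutSize G S ⊓ r))

  minCuts-≥ : ∀ {c d} Ss → c ≤ d → All (λ S → c ≤ cutSize G S) Ss → c ≤ run G (minCuts d Ss)
  minCuts-≥ []       p []       = p
  minCuts-≥ {d = d} (S ∷ Ss) p (q ∷ qs) = ≤-trans (⊓-glb q (minCuts-≥ Ss p qs)) (≤-reflexive (sym (run-minCuts d S Ss)))

  minCuts-≤ : ∀ {d S} Ss → S ∈ Ss → run G (minCuts d Ss) ≤ cutSize G S
  minCuts-≤ {d} (S ∷ Ss) (here refl) = ≤-trans (≤-reflexive (run-minCuts d S Ss)) (m⊓n≤m _ _)
  minCuts-≤ {d} (T ∷ Ss) (there i)   = ≤-trans (≤-reflexive (run-minCuts d T Ss)) (≤-trans (m⊓n≤n (cutSize G T) _) (minCuts-≤ Ss i))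

minF : ∀ {n} → (Fin n → ℕ) → ℕ
minF {zero}        f = 0
minF {suc zero}    f = f zero
minF {suc (suc n)} f = f zero ⊓ minF (λ i → f (suc i))

minF-≤ : ∀ {n} (f : Fin n → ℕ) i → minF f ≤ f i
minF-≤ {suc zero}    f zero    = ≤-refl
minF-≤ {suc (suc n)} f zero    = m⊓n≤m _ _
minF-≤ {suc (suc n)} f (suc i) = ≤-trans (m⊓n≤n (f zero) _) (minF-≤ (λ i → f (suc i)) i)

minF-glb : ∀ {n} (f : Fin n → ℕ) c → 1 ≤ n → (∀ i → c ≤ f i) → c ≤ minF f
minF-glb {suc zero}    f c _ h = h zero
minF-glb {suc (suc n)} f c _ h = ⊓-glb (h zero) (minF-glb (λ i → f (suc i)) c (s≤s z≤n) (λ i → h (suc i)))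

minDegreeQ : ∀ {n} → DT n ℕ
minDegreeQ = forFin (λ v → ask (_== v) ret) >>= λ d → ret (minF d)

bruteForce : ∀ {n} → DT n ℕ
bruteForce {n} = minDegreeQ >>= λ δ → minCuts δ (filter (λ S → proper S ≟ᴮ true) (allSets n))

module MinDegree {n : ℕ} (G : Graph n) where

  minDegree : ℕ
  minDegree = run G minDegreeQ

  private
    d : Fin n → ℕ
    d = run G (forFin (λ v → ask (_== v) ret))

    minDegree-eq : minDegree ≡ minF d
    minDegree-eq = run->>= G (forFin (λ v → ask (_== v) ret)) (λ d → ret (minF d))

    d-eq : ∀ v → d v ≡ cutSize G (_== v)
    d-eq v = run-forFin G (λ v → ask (_== v) ret) v

  cost-minDegreeQ : cost G minDegreeQ ≡ n
  cost-minDegreeQ = trans (cost->>= G (forFin (λ v → ask (_== v) ret)) (λ d → ret (minF d)))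
    (trans (+-identityʳ _) (trans (cost-forFin G (λ v → ask (_== v) ret)) (trans (∑-const {n} 1) (*-identityʳ n))))

  minDegree≤deg : ∀ v → minDegree ≤ Cuts.deg G v
  minDegree≤deg v = ≤-trans (≤-reflexive minDegree-eq) (≤-trans (minF-≤ d v) (≤-trans (≤-reflexive (trans (d-eq v)
    (trans (cutSize-form G (_== v)) (form-single (adj G) v (λ w → not (w == v)))))) (nb-mono (adj G) v {λ w → not (w == v)} {λ _ → true} (λ w _ → refl))))

  singleton-proper : 2 ≤ n → (v : Fin n) → Proper (_== v)
  singleton-proper (s≤s (s≤s _)) zero    = (zero , refl) , (suc zero , refl)
  singleton-proper (s≤s (s≤s _)) (suc v) = (suc v , ==-refl (suc v)) , (zero , refl)

  ≤minDegree : ∀ {c} → 2 ≤ n → (∀ T → Proper T → c ≤ cutSize G T) → c ≤ minDegree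
  ≤minDegree {c} 2≤n h = ≤-trans (minF-glb d c (≤-trans (s≤s z≤n) 2≤n) (λ v → ≤-trans (h (_== v) (singleton-proper 2≤n v)) (≤-reflexive (sym (d-eq v)))))
    (≤-reflexive (sym minDegree-eq))

  bruteForce-correct : ∀ c → 2 ≤ n → (∃ λ S → Proper S × cutSize G S ≡ c) → (∀ T → Proper T → c ≤ cutSize G T) →
                       run G bruteForce ≡ c
  bruteForce-correct c 2≤n (S , pS , S-c) h with ∈-allSets S
  ... | T , i , T≗S = trans (run->>= G minDegreeQ (λ δ → minCuts δ sets)) (≤-antisym
      (≤-trans (minCuts-≤ G {d = minDegree} sets (∈-filter⁺ (λ S → proper S ≟ᴮ true) i (proper-intro (Proper-cong T≗S pS))))
        (≤-reflexive (trans (cutSize-cong G T≗S) S-c)))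
      (minCuts-≥ G {d = minDegree} sets (≤minDegree 2≤n h) (tabulateᴬ (λ j → h _ (proper-elim (proj₂ (∈-filter⁻ (λ S → proper S ≟ᴮ true) {xs = allSets n} j)))))))
    where
    sets = filter (λ S → proper S ≟ᴮ true) (allSets n)

knownCut : ∀ {n} → Rel₂ n → VSet n → ℕ
knownCut known T = form known T (not ∘ T)

-- From the end of a walk to its answer

module Trial {n : ℕ} (k L q b δ : ℕ) where

  open Walk {n} k L q b δ

  candidates : (Fin n → Fin n) → List (VSet n)
  candidates lab = filter (λ T → (proper T ∧ respects T lab) ≟ᴮ true) (allSets n)

  -- The candidate is selected from the learned edges without any query, but its cut is then
  -- queried. So the output is the minimum degree or the size of a true cut, and it is never too
  -- small, however misleading the walk was.
  finish : Maybe (State n) → DT n ℕ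
  finish (just (learning lab d known)) = minCuts δ (bestOf (knownCut known) (candidates lab))
  finish _                             = ret δ

  start : State n
  start = contracting 0 (λ v → v) (λ _ → false)

  trial : ∀ {f} → Vec (Seed Ω) f → DT n ℕ
  trial ωs = loop start ωs >>= finish

  module _ (G : Graph n) where

    private
      candidate-proper : ∀ lab → All (λ T → Proper T) (candidates lab)
      candidate-proper lab = tabulateᴬ (λ {T} j → proper-elim (proj₁ (∧-true {proper T}
        (proj₂ (∈-filter⁻ (λ T → (proper T ∧ respects T lab) ≟ᴮ true) {xs = allSets n} j)))))

    finish-≥ : ∀ {c} r → c ≤ δ → (∀ T → Proper T → c ≤ cutSize G T) → c ≤ run G (finish r)
    finish-≥ nothing                           p h = p
    finish-≥ (just (contracting ℓ lab fz))     p h = p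
    finish-≥ (just (learning lab d known)) p h = minCuts-≥ G {d = δ} (bestOf (knownCut known) (candidates lab)) p
      (mapᴬ (λ {T} pT → h T pT) (bestOf-All (knownCut known) (candidates lab) (candidate-proper lab)))

    cost-finish : ∀ r → cost G (finish r) ≤ 1
    cost-finish nothing                           = z≤n
    cost-finish (just (contracting ℓ lab fz))     = z≤n
    cost-finish (just (learning lab d known)) = ≤-trans (≤-reflexive (cost-minCuts G δ (bestOf (knownCut known) (candidates lab))))
      (bestOf-length (knownCut known) (candidates lab))

    trial-≥ : ∀ {c f} (ωs : Vec (Seed Ω) f) → c ≤ δ → (∀ T → Proper T → c ≤ cutSize G T) → c ≤ run G (trial ωs)
    trial-≥ ωs p h = ≤-trans (finish-≥ (run G (loop start ωs)) p h) (≤-reflexive (sym (run->>= G (loop start ωs) finish)))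

module TrialAnalysis {n : ℕ} (k L q b δ : ℕ) (G : Graph n) (n≤2^L : n ≤ 2 ^ L) (n²≤2^b : n * n ≤ 2 ^ b)
  (L≤ : L ≤ 8 * (k + 2)) (δ≤ : ∀ v → δ ≤ Cuts.deg G v) (4096≤Q : 4096 ≤ 2 ^ q) where

  open WalkAnalysis {n} k L q b δ G n≤2^L n²≤2^b L≤ δ≤ 4096≤Q
  open Trial {n} k L q b δ

  loop-inv : ∀ {f} st → Inv st → (ωs : Vec (Seed Ω) f) → ∀ {st′} → run G (loop st ωs) ≡ just st′ → Inv st′ × done st′ ≡ true
  loop-inv st inv [] r with done st in d
  loop-inv st inv [] refl | true = inv , d
  loop-inv st inv (ω ∷ ωs) r with done st in d
  loop-inv st inv (ω ∷ ωs) refl | true = inv , d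
  ... | false = loop-inv (run G (advance st ω)) (inv-step st inv ω) ωs
                  (trans (sym (run->>= G (advance st ω) (λ st′ → loop st′ ωs))) r)

  -- A union of clusters cuts only edges between clusters, and all of these are known when no vertex
  -- is active.
  known-complete : ∀ {lab d known} → LearnInv lab d known → done (learning lab d known) ≡ true →
    ∀ T → Respecting T lab → knownCut known T ≡ cutSize G T
  known-complete {lab} {d} {known} inv fin T res = trans (∑-cong (λ v → trans (sym (∑-*ˡ ⟦ T v ⟧ _)) (trans (∑-cong (cell v)) (∑-*ˡ ⟦ T v ⟧ _))))
    (sym (cutSize-form G T))
    where
    module R = Lrn inv
    inactive : ∀ v → R.unknown v ≡ 0
    inactive v with zero-or-pos (R.unknown v)
    ... | inj₁ z = z
    ... | inj₂ p = ⊥-elim (true≢false (trans (sym (<ᵇ-intro p)) (anyᵇ-none R.active (not-true fin) v)))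
    cell : ∀ v w → ⟦ T v ⟧ * (⟦ not (T w) ⟧ * ⟦ known v w ⟧) ≡ ⟦ T v ⟧ * (⟦ not (T w) ⟧ * ⟦ adj G v w ⟧)
    cell v w = ⟦⟧*-cong (T v) (λ Tv → ⟦⟧*-cong (not (T w)) (λ Tw → cong ⟦_⟧ (same Tv (not-true Tw) (bool-cases (known v w)) (bool-cases (adj G v w)))))
      where
      same : T v ≡ true → T w ≡ false → known v w ≡ true ⊎ known v w ≡ false → adj G v w ≡ true ⊎ adj G v w ≡ false → known v w ≡ adj G v w
      same Tv Tw (inj₁ p) _ = trans p (sym (proj₁ (LearnInv.known-edge inv v w p)))
      same Tv Tw (inj₂ p) (inj₂ q′) = trans p (sym q′)
      same Tv Tw (inj₂ p) (inj₁ q′) = ⊥-elim (1+n≰n (≤-trans (≤-trans (≤-reflexive (sym (cong₂ (λ a c → ⟦ a ⟧ * ⟦ c ⟧) other-cluster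
          (∧-intro q′ (cong not p))))) (∑-≥ (λ u → ⟦ R.other v u ⟧ * ⟦ R.R v u ⟧) w)) (≤-reflexive (trans (sym (R.unknown-eq v)) (inactive v)))))
        where
        other-cluster : R.other v w ≡ true
        other-cluster = cong not (≢⇒== (λ e → true≢false (trans (sym Tv) (trans (res v w (sym e)) Tw))))

  inv-initial : Inv start
  inv-initial = record
    { ℓ≤L      = z≤n
    ; lower    = λ l _ p → p
    ; unfrozen = λ _ _ → refl
    ; frozen   = ≤-trans (≤-reflexive (∑-zero _ (λ v → ∑-zero _ (λ w → cong (λ c → ⟦ c ⟧ * ⟦ adj G v w ⟧) (∧-false (not (w == v))))))) z≤n
    }
    where
    ∧-false : ∀ a → (a ∧ false) ≡ false
    ∧-false true  = refl
    ∧-false false = refl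

  trial-success : ∀ {f} (ωs : Vec (Seed Ω) f) S {st} → Proper S → (∀ T → Proper T → cutSize G S ≤ cutSize G T) → cutSize G S ≤ δ →
    run G (loop start ωs) ≡ just st → respects S (clusters st) ≡ true → run G (trial ωs) ≡ cutSize G S
  trial-success ωs S {contracting ℓ lab fz} pS h S≤δ r ok with loop-inv start inv-initial ωs r
  ... | _ , ()
  trial-success ωs S {learning lab d known} pS h S≤δ r ok with loop-inv start inv-initial ωs r | ∈-allSets S
  ... | inv , fin | S₀ , i , S₀≗S with bestOf-best (knownCut known) {S₀} {candidates lab}
        (∈-filter⁺ (λ T → (proper T ∧ respects T lab) ≟ᴮ true) i (∧-intro (proper-intro (Proper-cong S₀≗S pS)) (respects-intro resp₀)))
    where
    resp₀ : Respecting S₀ lab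
    resp₀ u v e = trans (S₀≗S u) (trans (respects-elim {S = S} ok u v e) (sym (S₀≗S v)))
  ...   | T , j , T≤S₀ = ≤-antisym
      (≤-trans (≤-reflexive finished) (≤-trans (minCuts-≤ G {d = δ} (bestOf (knownCut known) (candidates lab)) j)
        (≤-trans (≤-reflexive (sym (known-complete inv fin T respT))) (≤-trans T≤S₀
          (≤-reflexive (trans (known-complete inv fin S₀ (λ u v e → trans (S₀≗S u) (trans (respects-elim {S = S} ok u v e) (sym (S₀≗S v)))))
            (cutSize-cong G S₀≗S)))))))
      (trial-≥ G ωs S≤δ h)
    where
    finished : run G (trial ωs) ≡ run G (minCuts δ (bestOf (knownCut known) (candidates lab)))
    finished = trans (run->>= G (loop start ωs) finish) (cong (λ r → run G (finish r)) r)
    respT : Respecting T lab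
    respT = lookupᴬ (bestOf-All (knownCut known) {P = λ T → Respecting T lab} (candidates lab)
      (tabulateᴬ (λ {T} j → respects-elim (proj₂ (∧-true {proper T} (proj₂ (∈-filter⁻ (λ T → (proper T ∧ respects T lab) ≟ᴮ true) {xs = allSets n} j)))))))
      j

-- Trees with random seeds as randomized algorithms

draw : ∀ {n} (c : Code) → (Seed c → Alg n) → Alg n
draw bit             f = coin f
draw (c ⊗ d)         f = draw c (λ a → draw d (λ b → f (a , b)))
draw (pow zero c)    f = f []
draw (pow (suc m) c) f = draw c (λ a → draw (pow m c) (λ as → f (a ∷ as)))

toAlg : ∀ {n} → DT n ℕ → Alg n
toAlg (ret a)   = output a
toAlg (ask S k) = query S (λ c → toAlg (k c))

module _ {n : ℕ} (G : Graph n) where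

  queries-toAlg : ∀ t → queries G (toAlg t) ≡ cost G t
  queries-toAlg (ret a)   = refl
  queries-toAlg (ask S k) = cong suc (queries-toAlg (k (cutSize G S)))

  queries-draw : ∀ c f m → (∀ ω → queries G (f ω) ≤ m) → queries G (draw c f) ≤ m
  queries-draw bit             f m h = ⊔-lub (h true) (h false)
  queries-draw (c ⊗ d)         f m h = queries-draw c _ m (λ a → queries-draw d _ m (λ b → h (a , b)))
  queries-draw (pow zero c)    f m h = h []
  queries-draw (pow (suc k) c) f m h = queries-draw c _ m (λ a → queries-draw (pow k c) _ m (λ as → h (a ∷ as)))

  prob-toAlg : ∀ t {x} → run G t ≡ x → probOutputs G x (toAlg t) ≡ ℚ.1ℚ
  prob-toAlg (ret a) {x} e with a ≟ x
  ... | yes _ = refl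
  ... | no ne = ⊥-elim (ne e)
  prob-toAlg (ask S k) e = prob-toAlg (k (cutSize G S)) e

  prob-toAlg-≥0 : ∀ t x → ℚ.0ℚ ℚ.≤ probOutputs G x (toAlg t)
  prob-toAlg-≥0 (ret a) x with a ≟ x
  ... | yes _ = ℚᵖ.nonNegative⁻¹ ℚ.1ℚ
  ... | no _  = ℚᵖ.≤-refl
  prob-toAlg-≥0 (ask S k) x = prob-toAlg-≥0 (k (cutSize G S)) x

ι : ℕ → ℚ.ℚ
ι zero    = ℚ.0ℚ
ι (suc m) = ℚ.1ℚ ℚ.+ ι m

ι-+ : ∀ a b → ι (a + b) ≡ ι a ℚ.+ ι b
ι-+ zero    b = sym (ℚᵖ.+-identityˡ (ι b))
ι-+ (suc a) b = trans (cong (ℚ.1ℚ ℚ.+_) (ι-+ a b)) (sym (ℚᵖ.+-assoc ℚ.1ℚ (ι a) (ι b)))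

ι-* : ∀ a b → ι (a * b) ≡ ι a ℚ.* ι b
ι-* zero    b = sym (ℚᵖ.*-zeroˡ (ι b))
ι-* (suc a) b = trans (ι-+ b (a * b)) (trans (cong₂ ℚ._+_ (sym (ℚᵖ.*-identityˡ (ι b))) (ι-* a b))
  (sym (ℚᵖ.*-distribʳ-+ (ι b) ℚ.1ℚ (ι a))))

ι-≥0 : ∀ a → ℚ.0ℚ ℚ.≤ ι a
ι-≥0 zero    = ℚᵖ.≤-refl
ι-≥0 (suc a) = ℚᵖ.+-mono-≤ (ℚᵖ.nonNegative⁻¹ ℚ.1ℚ) (ι-≥0 a)

ι-mono : ∀ {a b} → a ≤ b → ι a ℚ.≤ ι b
ι-mono {b = b} z≤n = ι-≥0 b
ι-mono (s≤s {m} {k} p) = ℚᵖ.+-monoʳ-≤ ℚ.1ℚ {ι m} {ι k} (ι-mono p)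

ι-pos : ∀ a → 1 ≤ a → ℚ.Positive (ι a)
ι-pos (suc a) _ = ℚ.positive (ℚᵖ.<-≤-trans (ℚᵖ.positive⁻¹ ℚ.1ℚ) (ι-mono {1} {suc a} (s≤s z≤n)))

module _ {n : ℕ} (G : Graph n) (x : ℕ) where

  private
    P : Alg n → ℚ.ℚ
    P = probOutputs G x

  -- The factor `κ` carries the volume of the inner draws, so that products and powers of codes
  -- follow by nesting.
  draw-prob : ∀ c (f : Seed c → Alg n) (g : Seed c → ℕ) κ → (∀ ω → ι (g ω) ℚ.≤ κ ℚ.* P (f ω)) →
    ι (total c g) ℚ.≤ (ι (vol c) ℚ.* κ) ℚ.* P (draw c f)
  draw-prob bit f g κ h = begin
    ι (total bit g)                           ≡⟨ trans (cong ι (total-bit g)) (ι-+ (g true) (g false)) ⟩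
    ι (g true) ℚ.+ ι (g false)                ≤⟨ ℚᵖ.+-mono-≤ (h true) (h false) ⟩
    κ ℚ.* P (f true) ℚ.+ κ ℚ.* P (f false)    ≡⟨ sym (ℚᵖ.*-distribˡ-+ κ (P (f true)) (P (f false))) ⟩
    κ ℚ.* s                                   ≡⟨ cong (ℚ._* s) (sym (ℚᵖ.*-identityʳ κ)) ⟩
    (κ ℚ.* (ι 2 ℚ.* ℚ.½)) ℚ.* s               ≡⟨ cong (ℚ._* s) (sym (ℚᵖ.*-assoc κ (ι 2) ℚ.½)) ⟩
    ((κ ℚ.* ι 2) ℚ.* ℚ.½) ℚ.* s               ≡⟨ ℚᵖ.*-assoc (κ ℚ.* ι 2) ℚ.½ s ⟩
    (κ ℚ.* ι 2) ℚ.* (ℚ.½ ℚ.* s)               ≡⟨ cong (ℚ._* (ℚ.½ ℚ.* s)) (trans (ℚᵖ.*-comm κ (ι 2)) (cong (λ v → ι v ℚ.* κ) (sym (total-bit (λ _ → 1))))) ⟩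
    (ι (vol bit) ℚ.* κ) ℚ.* (ℚ.½ ℚ.* s) ∎
    where
    open ℚᵖ.≤-Reasoning
    s = P (f true) ℚ.+ P (f false)
  draw-prob (c ⊗ d) f g κ h = subst₂ (λ a b → ι a ℚ.≤ b ℚ.* P (draw (c ⊗ d) f)) (sym (total-⊗ c d g))
    (trans (sym (ℚᵖ.*-assoc (ι (vol c)) (ι (vol d)) κ)) (cong (ℚ._* κ) (sym (trans (cong ι (vol-⊗ c d)) (ι-* (vol c) (vol d))))))
    (draw-prob c _ _ (ι (vol d) ℚ.* κ) (λ a → draw-prob d _ _ κ (λ b → h (a , b))))
  draw-prob (pow zero c) f g κ h = subst₂ (λ a b → ι a ℚ.≤ b ℚ.* P (f [])) (sym (total-[] c g))
    (trans (sym (ℚᵖ.*-identityˡ κ)) (cong (λ v → ι v ℚ.* κ) (sym (total-[] c (λ _ → 1))))) (h [])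
  draw-prob (pow (suc m) c) f g κ h = subst₂ (λ a b → ι a ℚ.≤ b ℚ.* P (draw (pow (suc m) c) f)) (sym (total-∷ m c g))
    (trans (sym (ℚᵖ.*-assoc (ι (vol c)) (ι (vol (pow m c))) κ)) (cong (ℚ._* κ) (sym (trans (cong ι (vol-∷ m c)) (ι-* (vol c) (vol (pow m c)))))))
    (draw-prob c _ _ (ι (vol (pow m c)) ℚ.* κ) (λ a → draw-prob (pow m c) _ _ κ (λ as → h (a ∷ as))))

  draw-toAlg : ∀ c (t : Seed c → DT n ℕ) (good : Seed c → Bool) → (∀ ω → good ω ≡ true → run G (t ω) ≡ x) →
    2 * vol c ≤ 3 * total c (λ ω → ⟦ good ω ⟧) → ι 2 ℚ.≤ ι 3 ℚ.* P (draw c (λ ω → toAlg (t ω)))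
  draw-toAlg c t good correct most = ℚᵖ.*-cancelˡ-≤-pos (ι (vol c)) {{ι-pos (vol c) (vol-pos c)}} (begin
    ι (vol c) ℚ.* ι 2                        ≡⟨ trans (ℚᵖ.*-comm (ι (vol c)) (ι 2)) (sym (ι-* 2 (vol c))) ⟩
    ι (2 * vol c)                            ≤⟨ ι-mono most ⟩
    ι (3 * T)                                ≡⟨ ι-* 3 T ⟩
    ι 3 ℚ.* ι T                              ≤⟨ ℚᵖ.*-monoˡ-≤-nonNeg (ι 3) (draw-prob c f _ ℚ.1ℚ good-prob) ⟩
    ι 3 ℚ.* ((ι (vol c) ℚ.* ℚ.1ℚ) ℚ.* p)     ≡⟨ cong (λ v → ι 3 ℚ.* (v ℚ.* p)) (ℚᵖ.*-identityʳ (ι (vol c))) ⟩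
    ι 3 ℚ.* (ι (vol c) ℚ.* p)                ≡⟨ sym (ℚᵖ.*-assoc (ι 3) (ι (vol c)) p) ⟩
    (ι 3 ℚ.* ι (vol c)) ℚ.* p                ≡⟨ cong (ℚ._* p) (ℚᵖ.*-comm (ι 3) (ι (vol c))) ⟩
    (ι (vol c) ℚ.* ι 3) ℚ.* p                ≡⟨ ℚᵖ.*-assoc (ι (vol c)) (ι 3) p ⟩
    ι (vol c) ℚ.* (ι 3 ℚ.* p) ∎)
    where
    open ℚᵖ.≤-Reasoning
    f : Seed c → Alg n
    f ω = toAlg (t ω)
    T = total c (λ ω → ⟦ good ω ⟧)
    p = P (draw c f)
    good-prob : ∀ ω → ι ⟦ good ω ⟧ ℚ.≤ ℚ.1ℚ ℚ.* P (f ω)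
    good-prob ω with good ω in e
    ... | true  = ℚᵖ.≤-reflexive (trans (sym (prob-toAlg G (t ω) (correct ω e))) (sym (ℚᵖ.*-identityˡ (P (f ω)))))
    ... | false = ℚᵖ.≤-trans (prob-toAlg-≥0 G (t ω) x) (ℚᵖ.≤-reflexive (sym (ℚᵖ.*-identityˡ (P (f ω)))))

-- Repeated trials

-- As no trial falls below the edge connectivity, the minimum is correct as soon as one trial is.
minOver : ∀ {n} {c : Code} → (Seed c → DT n ℕ) → ℕ → ∀ {r} → Vec (Seed c) r → DT n ℕ
minOver t d []      = ret d
minOver t d (ω ∷ ρ) = t ω >>= λ x → minOver t d ρ >>= λ y → ret (x ⊓ y)

module _ {n : ℕ} (G : Graph n) {c : Code} (t : Seed c → DT n ℕ) (d : ℕ) where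

  run-minOver : ∀ {r} ω (ρ : Vec (Seed c) r) → run G (minOver t d (ω ∷ ρ)) ≡ run G (t ω) ⊓ run G (minOver t d ρ)
  run-minOver ω ρ = trans (run->>= G (t ω) (λ x → minOver t d ρ >>= λ y → ret (x ⊓ y)))
    (run->>= G (minOver t d ρ) (λ y → ret (run G (t ω) ⊓ y)))

  cost-minOver : ∀ {r F} (ρ : Vec (Seed c) r) → (∀ ω → cost G (t ω) ≤ F) → cost G (minOver t d ρ) ≤ r * F
  cost-minOver []      h = z≤n
  cost-minOver (ω ∷ ρ) h = ≤-trans (≤-reflexive (cost->>= G (t ω) (λ x → minOver t d ρ >>= λ y → ret (x ⊓ y))))
    (+-mono-≤ (h ω) (≤-trans (≤-reflexive (trans (cost->>= G (minOver t d ρ) (λ y → ret (run G (t ω) ⊓ y))) (+-identityʳ _))) (cost-minOver ρ h)))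

  minOver-≥ : ∀ {r x} (ρ : Vec (Seed c) r) → x ≤ d → (∀ ω → x ≤ run G (t ω)) → x ≤ run G (minOver t d ρ)
  minOver-≥ []      p h = p
  minOver-≥ (ω ∷ ρ) p h = ≤-trans (⊓-glb (h ω) (minOver-≥ ρ p h)) (≤-reflexive (sym (run-minOver ω ρ)))

  minOver-≤ : ∀ {r} (ρ : Vec (Seed c) r) → run G (minOver t d ρ) ≤ d
  minOver-≤ []      = ≤-refl
  minOver-≤ (ω ∷ ρ) = ≤-trans (≤-reflexive (run-minOver ω ρ)) (≤-trans (m⊓n≤n (run G (t ω)) _) (minOver-≤ ρ))

  module _ (x : ℕ) where

    missed : ℕ → ℕ
    missed y = ⟦ not (y ≤ᵇ x) ⟧

    missed-⊓ : ∀ y z → missed (y ⊓ z) ≤ missed y * missed z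
    missed-⊓ y z = cases (bool-cases (y ≤ᵇ x)) (bool-cases (z ≤ᵇ x))
      where
      below : y ⊓ z ≤ x → missed (y ⊓ z) ≤ missed y * missed z
      below p = ≤-trans (≤-reflexive (cong (λ b → ⟦ not b ⟧) (≤ᵇ-intro p))) z≤n
      cases : (y ≤ᵇ x) ≡ true ⊎ (y ≤ᵇ x) ≡ false → (z ≤ᵇ x) ≡ true ⊎ (z ≤ᵇ x) ≡ false → missed (y ⊓ z) ≤ missed y * missed z
      cases (inj₁ p) _        = below (≤-trans (m⊓n≤m y z) (≤ᵇ-true p))
      cases (inj₂ _) (inj₁ p) = below (≤-trans (m⊓n≤n y z) (≤ᵇ-true p))
      cases (inj₂ p) (inj₂ q) = ≤-trans (⟦⟧≤1 (not (y ⊓ z ≤ᵇ x))) (≤-reflexive (sym (cong₂ (λ a b → ⟦ not a ⟧ * ⟦ not b ⟧) p q)))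

    -- The minimum exceeds `x` only if every trial does, and the trials use independent seeds.
    missed-minOver : ∀ r → total (pow r c) (λ ρ → missed (run G (minOver t d ρ))) ≤ total c (λ ω → missed (run G (t ω))) ^ r
    missed-minOver zero    = ≤-trans (≤-reflexive (total-[] c _)) (⟦⟧≤1 _)
    missed-minOver (suc r) = begin
      total (pow (suc r) c) (λ ρ → missed (run G (minOver t d ρ)))
        ≡⟨ total-∷ r c _ ⟩
      total c (λ ω → total (pow r c) (λ ρ → missed (run G (minOver t d (ω ∷ ρ)))))
        ≤⟨ total-mono c (λ ω → total-mono (pow r c) (λ ρ → ≤-trans (≤-reflexive (cong missed (run-minOver ω ρ))) (missed-⊓ (run G (t ω)) _))) ⟩
      total c (λ ω → total (pow r c) (λ ρ → missed (run G (t ω)) * missed (run G (minOver t d ρ))))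
        ≡⟨ trans (total-cong c (λ ω → total-*ˡ (pow r c) (missed (run G (t ω))) _)) (total-*ʳ c _ _) ⟩
      bad * total (pow r c) (λ ρ → missed (run G (minOver t d ρ)))
        ≤⟨ *-monoʳ-≤ bad (missed-minOver r) ⟩
      bad * bad ^ r ∎
      where
      open ≤-Reasoning
      bad = total c (λ ω → missed (run G (t ω)))

vol-pow : ∀ r c → vol (pow r c) ≡ vol c ^ r
vol-pow zero    c = total-[] c _
vol-pow (suc r) c = trans (vol-∷ r c) (cong (vol c *_) (vol-pow r c))

*-^ : ∀ a b r → (a * b) ^ r ≡ a ^ r * b ^ r
*-^ a b zero    = refl
*-^ a b (suc r) = trans (cong (a * b *_) (*-^ a b r)) (solve 4 (λ a b x y → a :* b :* (x :* y) := a :* x :* (b :* y)) refl a b (a ^ r) (b ^ r))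

-- That is `(1 + 1 / Z) ^ (Z + 1) ≥ 2`, by Bernoulli's inequality.
halving : ∀ Z → 2 * Z ^ suc Z ≤ suc Z ^ suc Z
halving zero      = z≤n
halving Z@(suc _) = *-cancelˡ-≤ Z (begin
  Z * (2 * Z ^ suc Z)        ≡⟨ solve 2 (λ z p → z :* (con 2 :* p) := p :* (z :+ z)) refl Z (Z ^ suc Z) ⟩
  Z ^ suc Z * (Z + Z)        ≤⟨ *-monoʳ-≤ (Z ^ suc Z) (+-monoʳ-≤ Z (n≤1+n Z)) ⟩
  Z ^ suc Z * (Z + suc Z)    ≤⟨ bernoulli Z (suc Z) ⟩
  Z * suc Z ^ suc Z ∎)
  where open ≤-Reasoning

-- 2Y repetitions turn a success probability 1/Y into a failure probability at most 1/4.
amplify : ∀ Y bad v → 1 ≤ Y → Y * bad + v ≤ Y * v → 4 * bad ^ (2 * Y) ≤ v ^ (2 * Y)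
amplify Y@(suc Z) bad v _ h = *-cancelˡ-≤ (Y ^ r) {{m^n≢0 Y r}} (begin
  Y ^ r * (4 * bad ^ r)      ≡⟨ solve 2 (λ a b → a :* (con 4 :* b) := con 4 :* (a :* b)) refl (Y ^ r) (bad ^ r) ⟩
  4 * (Y ^ r * bad ^ r)      ≡⟨ cong (4 *_) (sym (*-^ Y bad r)) ⟩
  4 * (Y * bad) ^ r          ≤⟨ *-monoʳ-≤ 4 (^-monoˡ-≤ r Ybad≤) ⟩
  4 * (Z * v) ^ r            ≡⟨ trans (cong (4 *_) (*-^ Z v r)) (sym (*-assoc 4 (Z ^ r) (v ^ r))) ⟩
  4 * Z ^ r * v ^ r          ≤⟨ *-monoˡ-≤ (v ^ r) quarter ⟩
  Y ^ r * v ^ r ∎)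
  where
  open ≤-Reasoning
  r = 2 * Y
  Ybad≤ : Y * bad ≤ Z * v
  Ybad≤ = +-cancelˡ-≤ v _ _ (≤-trans (≤-reflexive (+-comm v (Y * bad))) h)
  square : ∀ a → a ^ r ≡ a ^ Y * a ^ Y
  square a = trans (cong (a ^_) (cong (Y +_) (+-identityʳ Y))) (^-distribˡ-+-* a Y Y)
  quarter : 4 * Z ^ r ≤ Y ^ r
  quarter = begin
    4 * Z ^ r                          ≡⟨ cong (4 *_) (square Z) ⟩
    4 * (Z ^ Y * Z ^ Y)                ≡⟨ solve 1 (λ x → con 4 :* (x :* x) := con 2 :* x :* (con 2 :* x)) refl (Z ^ Y) ⟩
    2 * Z ^ Y * (2 * Z ^ Y)            ≤⟨ *-mono-≤ (halving Z) (halving Z) ⟩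
    Y ^ Y * Y ^ Y                      ≡⟨ sym (square Y) ⟩
    Y ^ r ∎

module _ {n : ℕ} (G : Graph n) {c : Code} (t : Seed c → DT n ℕ) (d x Y : ℕ) (1≤Y : 1 ≤ Y)
  (rare : Y * total c (λ ω → ⟦ not (run G (t ω) ≤ᵇ x) ⟧) + vol c ≤ Y * vol c) where

  -- The failure probability is at most 1/4, and 3/4 exceeds 2/3.
  minOver-mostly : 2 * vol (pow (2 * Y) c) ≤ 3 * total (pow (2 * Y) c) (λ ρ → ⟦ run G (minOver t d ρ) ≤ᵇ x ⟧)
  minOver-mostly = *-cancelˡ-≤ 4 (+-cancelʳ-≤ (3 * v) _ _ (begin
    4 * (2 * v) + 3 * v       ≡⟨ solve 1 (λ v → con 4 :* (con 2 :* v) :+ con 3 :* v := con 8 :* v :+ con 3 :* v) refl v ⟩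
    8 * v + 3 * v             ≤⟨ m≤m+n _ v ⟩
    8 * v + 3 * v + v         ≡⟨ solve 1 (λ v → con 8 :* v :+ con 3 :* v :+ v := con 12 :* v) refl v ⟩
    12 * v                    ≡⟨ cong (12 *_) (sym all) ⟩
    12 * (good + bad)         ≡⟨ solve 2 (λ g b → con 12 :* (g :+ b) := con 4 :* (con 3 :* g) :+ con 3 :* (con 4 :* b)) refl good bad ⟩
    4 * (3 * good) + 3 * (4 * bad) ≤⟨ +-monoʳ-≤ (4 * (3 * good)) (*-monoʳ-≤ 3 bad≤) ⟩
    4 * (3 * good) + 3 * v ∎))
    where
    open ≤-Reasoning
    v = vol (pow (2 * Y) c)
    good = total (pow (2 * Y) c) (λ ρ → ⟦ run G (minOver t d ρ) ≤ᵇ x ⟧)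
    bad  = total (pow (2 * Y) c) (λ ρ → ⟦ not (run G (minOver t d ρ) ≤ᵇ x) ⟧)
    all : good + bad ≡ v
    all = trans (sym (total-+ (pow (2 * Y) c) _ _)) (total-cong (pow (2 * Y) c) (λ ρ → ⟦⟧+⟦not⟧ (run G (minOver t d ρ) ≤ᵇ x)))
    bad≤ : 4 * bad ≤ v
    bad≤ = ≤-trans (*-monoʳ-≤ 4 (missed-minOver G t d x (2 * Y)))
      (≤-trans (amplify Y (total c (λ ω → ⟦ not (run G (t ω) ≤ᵇ x) ⟧)) (vol c) 1≤Y rare) (≤-reflexive (sym (vol-pow (2 * Y) c))))

-- A single trial

-- That is `(1 + 1 / W) ^ j ≤ (W + 1) / (t + 1)`, by a telescoping product: each factor
-- `(W + 1) / W` is at most `(s + 2) / (s + 1)`, where `s` runs from `t` to `W − 1`.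
ratio-step : ∀ j t W → W ≡ j + t → suc W ^ j * suc t ≤ suc W * W ^ j
ratio-step zero    t W e = ≤-trans (≤-reflexive (*-identityˡ (suc t)))
  (≤-trans (s≤s (≤-reflexive (sym e))) (≤-reflexive (sym (*-identityʳ (suc W)))))
ratio-step (suc j) t W e = begin
  suc W * suc W ^ j * suc t        ≡⟨ solve 3 (λ w p t → w :* p :* t := p :* (w :* t)) refl (suc W) (suc W ^ j) (suc t) ⟩
  suc W ^ j * (suc W * suc t)      ≤⟨ *-monoʳ-≤ (suc W ^ j) exchange ⟩
  suc W ^ j * (suc (suc t) * W)    ≡⟨ sym (*-assoc (suc W ^ j) (suc (suc t)) W) ⟩
  suc W ^ j * suc (suc t) * W      ≤⟨ *-monoˡ-≤ W (ratio-step j (suc t) W (trans e (sym (+-suc j t)))) ⟩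
  suc W * W ^ j * W                ≡⟨ solve 3 (λ s p w → s :* p :* w := s :* (w :* p)) refl (suc W) (W ^ j) W ⟩
  suc W * (W * W ^ j) ∎
  where
  open ≤-Reasoning
  exchange : suc W * suc t ≤ suc (suc t) * W
  exchange = begin
    suc W * suc t         ≡⟨ solve 2 (λ w t → (con 1 :+ w) :* (con 1 :+ t) := (w :+ t :* w) :+ (con 1 :+ t)) refl W t ⟩
    W + t * W + suc t     ≤⟨ +-monoʳ-≤ (W + t * W) (≤-trans (s≤s (m≤n+m t j)) (≤-reflexive (sym e))) ⟩
    W + t * W + W         ≡⟨ solve 2 (λ w t → w :+ t :* w :+ w := w :+ (w :+ t :* w)) refl W t ⟩
    suc (suc t) * W ∎

-- The bound `(1 + 1 / W) ^ W ≤ 4` stands in for the limit e: each half of the exponent contributes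
-- at most 2.
ratio-even : ∀ u W → W ≡ 2 * u → suc W ^ W ≤ 4 * W ^ W
ratio-even u W e = begin
  suc W ^ W                        ≡⟨ square (suc W) ⟩
  suc W ^ u * suc W ^ u            ≤⟨ *-mono-≤ half half ⟩
  2 * W ^ u * (2 * W ^ u)          ≡⟨ solve 1 (λ x → con 2 :* x :* (con 2 :* x) := con 4 :* (x :* x)) refl (W ^ u) ⟩
  4 * (W ^ u * W ^ u)              ≡⟨ cong (4 *_) (sym (square W)) ⟩
  4 * W ^ W ∎
  where
  open ≤-Reasoning
  W≡ : W ≡ u + u
  W≡ = trans e (cong (u +_) (+-identityʳ u))
  square : ∀ a → a ^ W ≡ a ^ u * a ^ u
  square a = trans (cong (a ^_) W≡) (^-distribˡ-+-* a u u)
  half : suc W ^ u ≤ 2 * W ^ u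
  half = *-cancelʳ-≤ _ _ (suc u) (begin
    suc W ^ u * suc u       ≤⟨ ratio-step u u W W≡ ⟩
    suc W * W ^ u           ≤⟨ *-monoˡ-≤ (W ^ u) (≤-trans (n≤1+n (suc W)) (≤-reflexive (trans (cong (λ w → suc (suc w)) W≡)
                                 (solve 1 (λ u → con 2 :+ (u :+ u) := con 2 :* (con 1 :+ u)) refl u)))) ⟩
    2 * suc u * W ^ u       ≡⟨ solve 2 (λ s p → con 2 :* s :* p := con 2 :* p :* s) refl (suc u) (W ^ u) ⟩
    2 * W ^ u * suc u ∎)

ratio : ∀ u W h → W ≡ 2 * u → suc W ^ (h * W) ≤ 4 ^ h * W ^ (h * W)
ratio u W h e = begin
  suc W ^ (h * W)           ≡⟨ power (suc W) ⟩
  (suc W ^ W) ^ h           ≤⟨ ^-monoˡ-≤ h (ratio-even u W e) ⟩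
  (4 * W ^ W) ^ h           ≡⟨ *-^ 4 (W ^ W) h ⟩
  4 ^ h * (W ^ W) ^ h       ≡⟨ cong (4 ^ h *_) (sym (power W)) ⟩
  4 ^ h * W ^ (h * W) ∎
  where
  open ≤-Reasoning
  power : ∀ a → a ^ (h * W) ≡ (a ^ W) ^ h
  power a = trans (cong (a ^_) (*-comm h W)) (sym (^-*-assoc a W h))

opaque
  -- The reciprocal of the guaranteed probability of survival. With `M = 72 gauge W` the ratio
  -- `(1 + 1 / W) ^ M` is at most `4 ^ (72 gauge)`, whatever `n` is.
  rarity : ℕ
  rarity = 4 ^ (72 * gauge)

  1≤rarity : 1 ≤ rarity
  1≤rarity = m^n>0 4 (72 * gauge)

  ratio-rarity : ∀ u W M → W ≡ 2 * u → M ≡ 72 * gauge * W → suc W ^ M ≤ rarity * W ^ M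
  ratio-rarity u W M e refl = ratio u W (72 * gauge) e

module SingleTrial {n : ℕ} (k L q b δ : ℕ) (G : Graph n) (n≤2^L : n ≤ 2 ^ L) (n²≤2^b : n * n ≤ 2 ^ b)
  (L≤ : L ≤ 8 * (k + 2)) (δ≤ : ∀ v → δ ≤ Cuts.deg G v) (4096≤Q : 4096 ≤ 2 ^ q)
  (S : VSet n) (pS : Proper S) (minimal : ∀ T → Proper T → cutSize G S ≤ cutSize G T) (S<δ : cutSize G S < δ) where

  open Trial {n} k L q b δ renaming (start to start₀)
  private
    module T = TrialAnalysis {n} k L q b δ G n≤2^L n²≤2^b L≤ δ≤ 4096≤Q

  module _ (W M : ℕ) (W≡ : W ≡ 2 * (δ * 2 ^ L)) (M≡ : M ≡ 72 * gauge * W) where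

    open SuccessAnalysis {n} k L q b δ G n≤2^L n²≤2^b L≤ δ≤ 4096≤Q S minimal S<δ W M W≡ M≡

    fine-count : ∀ f → vol (pow f Ω) ≤ rarity * total (pow f Ω) (λ ωs → ⟦ fine (run G (loop start₀ ωs)) ⟧)
    fine-count f = *-cancelʳ-≤ _ _ (W ^ M) {{>-nonZero (m^n>0 W {{>-nonZero W>0}} M)}} (begin
      vol (pow f Ω) * W ^ M                     ≤⟨ *-monoʳ-≤ (vol (pow f Ω)) VV-start ⟩
      vol (pow f Ω) * VV start₀                  ≤⟨ success-count f start₀ T.inv-initial (λ u v e → cong S e) ⟩
      suc W ^ M * good                          ≤⟨ *-monoˡ-≤ good (ratio-rarity (δ * 2 ^ L) W M W≡ M≡) ⟩
      rarity * W ^ M * good                     ≡⟨ solve 3 (λ r w g → r :* w :* g := r :* g :* w) refl rarity (W ^ M) good ⟩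
      rarity * good * W ^ M ∎)
      where
      open ≤-Reasoning
      good = total (pow f Ω) (λ ωs → ⟦ fine (run G (loop start₀ ωs)) ⟧)
      -- The initial danger is at most `M`, so the walk starts with at least the potential `W ^ M`
      -- of danger `M`.
      VV-start : W ^ M ≤ VV start₀
      VV-start = ≤-trans (≤-reflexive (sym (trans (potential-def W M M)
          (trans (cong (λ z → W ^ M * suc W ^ z) (n∸n≡0 M)) (*-identityʳ (W ^ M))))))
        (potential-antitone W M M (danger start₀) W>0 (danger≤M start₀ T.inv-initial) ≤-refl)

    module _ (F : ℕ) (1≤F : 1 ≤ F) (affordable : 2 * rarity * Ψ start₀ ≤ F) where

      private
        Y = 2 * rarity

        t : Vec (Seed Ω) F → DT n ℕ
        t ωs = limit F δ (trial ωs)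

        looping : Vec (Seed Ω) F → DT n (Maybe (State n))
        looping ωs = loop start₀ ωs

        wrong costly fineᵢ : Vec (Seed Ω) F → ℕ
        wrong ωs  = ⟦ not (run G (t ωs) ≤ᵇ cutSize G S) ⟧
        costly ωs = ⟦ F ≤ᵇ cost G (looping ωs) ⟧
        fineᵢ ωs  = ⟦ fine (run G (looping ωs)) ⟧

        v = vol (pow F Ω)

      successful : ∀ ωs r → run G (looping ωs) ≡ r → fine r ≡ true → cost G (looping ωs) < F → run G (t ωs) ≤ cutSize G S
      successful ωs nothing   e ok cheap = ⊥-elim (<⇒≱ cheap (unfinished-costs F start₀ T.inv-initial ωs e))
      successful ωs (just st) e ok cheap = ≤-reflexive (trans (run-limit G F δ (trial ωs) within)
          (T.trial-success ωs S pS minimal (<⇒≤ S<δ) e ok))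
        where
        within : cost G (trial ωs) ≤ F
        within = ≤-trans (≤-reflexive (cost->>= G (looping ωs) finish))
          (≤-trans (+-monoʳ-≤ (cost G (looping ωs)) (cost-finish G (run G (looping ωs)))) (≤-trans (≤-reflexive (+-comm _ 1)) cheap))

      -- A walk that is fine and not expensive has finished with the cut intact, and its trial,
      -- including the final query, stays within the limit.
      wrong+fine : ∀ ωs → wrong ωs + fineᵢ ωs ≤ 1 + costly ωs
      wrong+fine ωs = cases (bool-cases (F ≤ᵇ cost G (looping ωs))) (bool-cases (fine (run G (looping ωs))))
        where
        cases : (F ≤ᵇ cost G (looping ωs)) ≡ true ⊎ (F ≤ᵇ cost G (looping ωs)) ≡ false →
          fine (run G (looping ωs)) ≡ true ⊎ fine (run G (looping ωs)) ≡ false → wrong ωs + fineᵢ ωs ≤ 1 + costly ωs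
        cases (inj₁ p) _ = ≤-trans (+-mono-≤ (⟦⟧≤1 (not (run G (t ωs) ≤ᵇ cutSize G S))) (⟦⟧≤1 (fine (run G (looping ωs)))))
          (≤-reflexive (sym (cong (λ a → 1 + ⟦ a ⟧) p)))
        cases (inj₂ p) (inj₂ ok) = ≤-trans (+-mono-≤ (⟦⟧≤1 (not (run G (t ωs) ≤ᵇ cutSize G S))) (≤-reflexive (cong ⟦_⟧ ok))) (m≤m+n 1 (costly ωs))
        cases (inj₂ p) (inj₁ ok) = ≤-trans (+-mono-≤ (≤-reflexive (cong (λ a → ⟦ not a ⟧) (≤ᵇ-intro (successful ωs _ refl ok (≤ᵇ-false {F} p)))))
          (⟦⟧≤1 (fine (run G (looping ωs))))) (m≤m+n 1 (costly ωs))

      few-costly : Y * total (pow F Ω) costly ≤ v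
      few-costly = *-cancelˡ-≤ F {{>-nonZero 1≤F}} (begin
        F * (Y * Tc)                 ≡⟨ solve 3 (λ f y c → f :* (y :* c) := y :* (f :* c)) refl F Y Tc ⟩
        Y * (F * Tc)                 ≡⟨ cong (Y *_) (sym (total-*ˡ (pow F Ω) F costly)) ⟩
        Y * total (pow F Ω) (λ ωs → F * costly ωs)
          ≤⟨ *-monoʳ-≤ Y (total-mono (pow F Ω) markov) ⟩
        Y * total (pow F Ω) (λ ωs → cost G (loop start₀ ωs))
          ≤⟨ *-monoʳ-≤ Y (expected-cost F start₀ T.inv-initial) ⟩
        Y * (Ψ start₀ * v)            ≡⟨ sym (*-assoc Y (Ψ start₀) v) ⟩
        Y * Ψ start₀ * v              ≤⟨ *-monoˡ-≤ v affordable ⟩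
        F * v ∎)
        where
        open ≤-Reasoning
        Tc = total (pow F Ω) costly
        markov : ∀ ωs → F * costly ωs ≤ cost G (loop start₀ ωs)
        markov ωs = cases (bool-cases (F ≤ᵇ cost G (looping ωs)))
          where
          cases : (F ≤ᵇ cost G (looping ωs)) ≡ true ⊎ (F ≤ᵇ cost G (looping ωs)) ≡ false → F * costly ωs ≤ cost G (loop start₀ ωs)
          cases (inj₁ p) = ≤-trans (≤-reflexive (trans (cong (λ a → F * ⟦ a ⟧) p) (*-identityʳ F))) (≤ᵇ-true {F} p)
          cases (inj₂ p) = ≤-trans (≤-reflexive (trans (cong (λ a → F * ⟦ a ⟧) p) (*-zeroʳ F))) z≤n

      -- With `Y = 2 rarity`, the walk is fine with probability at least `2 / Y` and expensive with
      -- probability at most `1 / Y`. So a trial is right with probability at least `1 / Y`.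
      rare : Y * total (pow F Ω) wrong + v ≤ Y * v
      rare = +-cancelʳ-≤ v _ _ (begin
        Y * Tw + v + v                    ≡⟨ trans (+-assoc (Y * Tw) v v) (cong (Y * Tw +_) (cong (v +_) (sym (+-identityʳ v)))) ⟩
        Y * Tw + 2 * v                    ≤⟨ +-monoʳ-≤ (Y * Tw) (*-monoʳ-≤ 2 (fine-count F)) ⟩
        Y * Tw + 2 * (rarity * Tf)        ≡⟨ solve 3 (λ r w f → con 2 :* r :* w :+ con 2 :* (r :* f) := con 2 :* r :* (w :+ f)) refl rarity Tw Tf ⟩
        Y * (Tw + Tf)                     ≡⟨ cong (Y *_) (sym (total-+ (pow F Ω) wrong fineᵢ)) ⟩
        Y * total (pow F Ω) (λ ωs → wrong ωs + fineᵢ ωs)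
          ≤⟨ *-monoʳ-≤ Y (total-mono (pow F Ω) wrong+fine) ⟩
        Y * total (pow F Ω) (λ ωs → 1 + costly ωs)
          ≡⟨ cong (Y *_) (total-+ (pow F Ω) (λ _ → 1) costly) ⟩
        Y * (v + Tc)                      ≡⟨ *-distribˡ-+ Y v Tc ⟩
        Y * v + Y * Tc                    ≤⟨ +-monoʳ-≤ (Y * v) few-costly ⟩
        Y * v + v ∎)
        where
        open ≤-Reasoning
        Tw = total (pow F Ω) wrong
        Tf = total (pow F Ω) fineᵢ
        Tc = total (pow F Ω) costly

-- Parameters and the final count of queries

opaque
  -- Chosen for `2 ^ 12 = 4096 = 32 · 128`, the requirement of `P-lower`.
  density : ℕ
  density = 12

  dense : 4096 ≤ 2 ^ density
  dense = ≤-refl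

module Params (n : ℕ) where

  -- With `k` near `L / 8`, a block has about `n ^ (1 / 8)` rows. This is small enough for the
  -- overhead to be sublinear, even with its squared threshold, and large enough for
  -- `L ≤ 8 (k + 2)`. The `2 L` bits in `b` suffice to choose among at most `n * n` edges.
  L k b e b* K : ℕ
  L  = up n
  k  = L div 8
  b  = L + L
  K  = odds * 2 ^ density
  e  = K * (3 * L)
  b* = threshold k L

  -- One cap `b*` for level 0, one for each of the `L` further levels, and `b* * b*` for the
  -- learning.
  overhead : ℕ
  overhead = e * (b* + L * b* + b* * b*)

  n≤2^L : n ≤ 2 ^ L
  n≤2^L = up-≤ n

  n²≤2^b : n * n ≤ 2 ^ b
  n²≤2^b = ≤-trans (*-mono-≤ n≤2^L n≤2^L) (≤-reflexive (sym (^-distribˡ-+-* 2 L L)))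

  8k≤L : 8 * k ≤ L
  8k≤L = ≤-trans (≤-reflexive (*-comm 8 k)) (m/n*n≤m L 8)

  L<8k+8 : L < 8 * suc k
  L<8k+8 = ≤-trans (s≤s (≤-reflexive (m≡m%n+[m/n]*n L 8))) (≤-trans (+-monoˡ-≤ (k * 8) (m%n<n L 8)) (≤-reflexive (*-comm (suc k) 8)))

  L≤8k+16 : L ≤ 8 * (k + 2)
  L≤8k+16 = ≤-trans (<⇒≤ L<8k+8) (*-monoʳ-≤ 8 (≤-trans (≤-reflexive (+-comm 1 k)) (+-monoʳ-≤ k (s≤s z≤n))))

  Ω₀ : Code
  Ω₀ = Walk.Ω {n} k L density b 0

n<2^n : ∀ n → n < 2 ^ n
n<2^n zero    = s≤s z≤n
n<2^n (suc n) = ≤-trans (+-mono-≤ (m^n>0 2 n) (n<2^n n)) (≤-reflexive (cong (2 ^ n +_) (sym (+-identityʳ _))))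

opaque
  rate : ℕ
  rate = (9 + pickRate + (9 + pickRate) * 6 + (1 + pickRate) * 32) * (odds * 2 ^ density) + 6

  rate-def : rate ≡ (9 + pickRate + (9 + pickRate) * 6 + (1 + pickRate) * 32) * (odds * 2 ^ density) + 6
  rate-def = refl

  1≤rate : 1 ≤ rate
  1≤rate = m≤n⇒m≤o+n _ (s≤s z≤n)

initial-budget : ∀ a c d K e b* L n m P → m ≤ n → P ≤ 2 * n → suc L ≤ P →
  e * (b* + L * b* + b* * b*) ≤ n → ∀ U →
  K * (a * 1 * m) + e * (m ⊓ b*) + (K * (a * (3 * P)) + L * (e * b* + 1) + (1 + (3 * n + (K * (c * (d * n)) + e * (U ⊓ (b* * b*))))))
    ≤ ((a + a * 6 + c * d) * K + 6) * n
initial-budget a c d K e b* L n m P m≤n P≤2n L<P small U = begin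
  K * (a * 1 * m) + e * (m ⊓ b*) + (K * (a * (3 * P)) + L * (e * b* + 1) + (1 + (3 * n + (K * (c * (d * n)) + e * (U ⊓ (b* * b*))))))
    ≤⟨ +-mono-≤ (+-mono-≤ (*-monoʳ-≤ K (*-mono-≤ (≤-reflexive (*-identityʳ a)) m≤n)) (*-monoʳ-≤ e (m⊓n≤n m b*)))
         (+-mono-≤ (+-monoˡ-≤ (L * (e * b* + 1)) (*-monoʳ-≤ K (*-monoʳ-≤ a (*-monoʳ-≤ 3 P≤2n))))
           (+-monoʳ-≤ 1 (+-monoʳ-≤ (3 * n) (+-monoʳ-≤ (K * (c * (d * n))) (*-monoʳ-≤ e (m⊓n≤n U (b* * b*))))))) ⟩
  K * (a * n) + e * b* + (K * (a * (3 * (2 * n))) + L * (e * b* + 1) + (1 + (3 * n + (K * (c * (d * n)) + e * (b* * b*)))))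
    ≡⟨ solve 8 (λ a c d K e b* L n →
         K :* (a :* n) :+ e :* b* :+ (K :* (a :* (con 3 :* (con 2 :* n))) :+ L :* (e :* b* :+ con 1) :+ (con 1 :+ (con 3 :* n :+ (K :* (c :* (d :* n)) :+ e :* (b* :* b*)))))
           := (a :+ a :* con 6 :+ c :* d) :* (K :* n) :+ con 3 :* n :+ (con 1 :+ L) :+ e :* (b* :+ L :* b* :+ b* :* b*)) refl a c d K e b* L n ⟩
  (a + a * 6 + c * d) * (K * n) + 3 * n + suc L + e * (b* + L * b* + b* * b*)
    ≤⟨ +-mono-≤ (+-monoʳ-≤ ((a + a * 6 + c * d) * (K * n) + 3 * n) (≤-trans L<P P≤2n)) small ⟩
  -- The final 6 is 3 for the degrees between clusters, 2 for the `L + 1` changes of level, and 1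
  -- for the overhead.
  (a + a * 6 + c * d) * (K * n) + 3 * n + 2 * n + n
    ≡⟨ solve 3 (λ a K n → a :* (K :* n) :+ con 3 :* n :+ con 2 :* n :+ n := (a :* K :+ con 6) :* n) refl (a + a * 6 + c * d) K n ⟩
  ((a + a * 6 + c * d) * K + 6) * n ∎
  where open ≤-Reasoning

square≤2^ : ∀ k → suc k * suc k ≤ 4 * 2 ^ k
square≤2^ zero                = s≤s z≤n
square≤2^ (suc zero)          = s≤s (s≤s (s≤s (s≤s z≤n)))
square≤2^ (suc (suc zero))    = m≤m+n 9 7
square≤2^ (suc (suc (suc k))) = begin
  (4 + k) * (4 + k)                           ≤⟨ m≤m+n ((4 + k) * (4 + k)) (k * k + 4 * k + 2) ⟩
  (4 + k) * (4 + k) + (k * k + 4 * k + 2)     ≡⟨ solve 1 (λ k → (con 4 :+ k) :* (con 4 :+ k) :+ (k :* k :+ con 4 :* k :+ con 2)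
                                                   := con 2 :* ((con 3 :+ k) :* (con 3 :+ k))) refl k ⟩
  2 * ((3 + k) * (3 + k))                     ≤⟨ *-monoʳ-≤ 2 (square≤2^ (suc (suc k))) ⟩
  2 * (4 * 2 ^ suc (suc k))                   ≡⟨ solve 1 (λ p → con 2 :* (con 4 :* p) := con 4 :* (con 2 :* p)) refl (2 ^ suc (suc k)) ⟩
  4 * 2 ^ suc (suc (suc k)) ∎
  where open ≤-Reasoning

-- Logarithms are traded for powers of `P = 2 ^ k`: eight factors `2 + L` form four squares of at
-- most `D P` each, and the two capacities give two more factors `P`. The result is a constant times
-- `P ^ 6`, against the `P ^ 8 ≤ 2 n` available.
overhead-bound : ∀ K L c P D → c ≤ (2 + L) * P → 1 ≤ P → (2 + L) * (2 + L) ≤ D * P → ∀ b* → b* ≡ L * ((2 + L) * c) →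
  K * (3 * L) * (b* + L * b* + b* * b*) ≤ 6 * (K * (D * D * (D * D))) * (P * P * (P * P) * (P * P))
overhead-bound K L c P D c≤ 1≤P s²≤ b* b*≡ = begin
  K * (3 * L) * (b* + L * b* + b* * b*)
    ≡⟨ solve 3 (λ k l b → k :* (con 3 :* l) :* (b :+ l :* b :+ b :* b) := k :* (con 3 :* l) :* (b :* ((con 1 :+ l) :+ b))) refl K L b* ⟩
  K * (3 * L) * (b* * (suc L + b*))
    ≤⟨ *-mono-≤ (*-monoʳ-≤ K (*-monoʳ-≤ 3 (m≤n+m L 2))) (*-mono-≤ b*≤B (+-mono-≤ (≤-trans (n≤1+n (suc L)) s≤B) b*≤B)) ⟩
  K * (3 * s) * (B * (B + B))
    -- The seven factors `s` are completed to eight, so that they can be squared in pairs.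
    ≤⟨ m≤m*n _ s ⟩
  K * (3 * s) * (B * (B + B)) * s
    ≡⟨ solve 3 (λ k s p → k :* (con 3 :* s) :* (s :* (s :* (s :* p)) :* (s :* (s :* (s :* p)) :+ s :* (s :* (s :* p)))) :* s
         := con 6 :* k :* (s :* s :* (s :* s) :* (s :* s :* (s :* s))) :* (p :* p)) refl K s P ⟩
  6 * K * (s * s * (s * s) * (s * s * (s * s))) * (P * P)
    ≤⟨ *-monoˡ-≤ (P * P) (*-monoʳ-≤ (6 * K) (*-mono-≤ (*-mono-≤ s²≤ s²≤) (*-mono-≤ s²≤ s²≤))) ⟩
  6 * K * (D * P * (D * P) * (D * P * (D * P))) * (P * P)
    ≡⟨ solve 3 (λ k d p → con 6 :* k :* (d :* p :* (d :* p) :* (d :* p :* (d :* p))) :* (p :* p)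
         := con 6 :* (k :* (d :* d :* (d :* d))) :* (p :* p :* (p :* p) :* (p :* p))) refl K D P ⟩
  6 * (K * (D * D * (D * D))) * (P * P * (P * P) * (P * P)) ∎
  where
  open ≤-Reasoning
  s = 2 + L
  B = s * (s * (s * P))
  b*≤B : b* ≤ B
  b*≤B = ≤-trans (≤-reflexive b*≡) (*-mono-≤ (m≤n+m L 2) (*-monoʳ-≤ s c≤))
  s≤B : s ≤ B
  s≤B = ≤-trans (≤-reflexive (sym (*-identityʳ s))) (*-monoʳ-≤ s (*-mono-≤ {1} {s} (s≤s z≤n) (*-mono-≤ {1} {s} (s≤s z≤n) 1≤P)))

opaque
  -- From `2 + L ≤ 9 (k + 1)` and `(k + 1) ^ 2 ≤ 4 · 2 ^ k`: the square is at most `81 · 4 · 2 ^ k`.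
  slack : ℕ
  slack = 324

  slack-def : slack ≡ 324
  slack-def = refl

  -- The constant in front of `P ^ 6`. For `n ≥ large` one has `scale ≤ k < P`, so the two spare
  -- factors `P` absorb it.
  scale : ℕ
  scale = 12 * (odds * 2 ^ density * (slack * slack * (slack * slack)))

  scale-def : scale ≡ 12 * (odds * 2 ^ density * (slack * slack * (slack * slack)))
  scale-def = refl

  large : ℕ
  large = 2 ^ (8 * scale)

  large-exponent : ∀ {n} → large ≤ n → 8 * scale ≤ up n
  large-exponent {n} p = ^-cancel (8 * scale) (up n) (≤-trans p (up-≤ n))
    where
    ^-cancel : ∀ a b → 2 ^ a ≤ 2 ^ b → a ≤ b
    ^-cancel a b h = ≮⇒≥ (λ r → <⇒≱ (^-monoʳ-< 2 (s≤s (s≤s z≤n)) r) h)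

module _ (n : ℕ) (n≥ : large ≤ n) (1≤n : 1 ≤ n) where

  open Params n

  private
    P = 2 ^ k

    scale≤k : scale ≤ k
    scale≤k = s≤s⁻¹ (*-cancelˡ-< 8 _ _ (≤-<-trans (large-exponent n≥) L<8k+8))

    P⁸≤2n : P * P * (P * P) * (P * P * (P * P)) ≤ 2 * n
    P⁸≤2n = begin
      P * P * (P * P) * (P * P * (P * P))  ≡⟨ cong₂ _*_ (cong₂ _*_ (add k k) (add k k)) (cong₂ _*_ (add k k) (add k k)) ⟩
      2 ^ (k + k) * 2 ^ (k + k) * (2 ^ (k + k) * 2 ^ (k + k)) ≡⟨ trans (cong₂ _*_ (add (k + k) (k + k)) (add (k + k) (k + k))) (add (k + k + (k + k)) (k + k + (k + k))) ⟩
      2 ^ (k + k + (k + k) + (k + k + (k + k))) ≡⟨ cong (2 ^_) (solve 1 (λ k → k :+ k :+ (k :+ k) :+ (k :+ k :+ (k :+ k)) := con 8 :* k) refl k) ⟩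
      2 ^ (8 * k)                          ≤⟨ ^-monoʳ-≤ 2 8k≤L ⟩
      2 ^ L                                ≤⟨ <⇒≤ (up-< n 1≤n) ⟩
      2 * n ∎
      where
      open ≤-Reasoning
      add : ∀ a b → 2 ^ a * 2 ^ b ≡ 2 ^ (a + b)
      add a b = sym (^-distribˡ-+-* 2 a b)

    s²≤ : (2 + L) * (2 + L) ≤ 324 * P
    s²≤ = begin
      (2 + L) * (2 + L)          ≤⟨ *-mono-≤ s≤ s≤ ⟩
      9 * suc k * (9 * suc k)    ≡⟨ solve 1 (λ u → con 9 :* u :* (con 9 :* u) := con 81 :* (u :* u)) refl (suc k) ⟩
      81 * (suc k * suc k)       ≤⟨ *-monoʳ-≤ 81 (square≤2^ k) ⟩
      81 * (4 * P)               ≡⟨ sym (*-assoc 81 4 P) ⟩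
      324 * P ∎
      where
      open ≤-Reasoning
      s≤ : 2 + L ≤ 9 * suc k
      s≤ = ≤-trans (s≤s L<8k+8) (≤-trans (m≤m+n (suc (8 * suc k)) k) (≤-reflexive
        (solve 1 (λ k → con 1 :+ con 8 :* (con 1 :+ k) :+ k := con 9 :* (con 1 :+ k)) refl k)))

    capacity≤ : capacity k ≤ (2 + L) * P
    capacity≤ = ≤-trans (m≤m+n (capacity k) _) (≤-trans (≤-reflexive (capacity-closed k))
      (*-monoˡ-≤ P (≤-trans (≤-reflexive (+-comm k 2)) (+-monoʳ-≤ 2 (≤-trans (m≤n*m k 8) 8k≤L)))))

  overhead≤n : overhead ≤ n
  overhead≤n = *-cancelˡ-≤ 2 (begin
    2 * overhead               ≤⟨ *-monoʳ-≤ 2 (overhead-bound K L (capacity k) P slack capacity≤ (m^n>0 2 k) (subst (λ d → (2 + L) * (2 + L) ≤ d * P) (sym slack-def) s²≤) b* refl) ⟩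
    2 * (6 * Z * P⁶)           ≡⟨ solve 2 (λ z p → con 2 :* (con 6 :* z :* p) := con 12 :* z :* p) refl Z P⁶ ⟩
    12 * Z * P⁶                ≤⟨ *-monoˡ-≤ P⁶ (≤-trans (≤-reflexive (sym scale-def)) (≤-trans scale≤k (≤-trans (<⇒≤ (n<2^n k)) (m≤m*n P P {{>-nonZero (m^n>0 2 k)}})))) ⟩
    P * P * P⁶                 ≡⟨ solve 1 (λ p → p :* p :* (p :* p :* (p :* p) :* (p :* p)) := p :* p :* (p :* p) :* (p :* p :* (p :* p))) refl P ⟩
    P * P * (P * P) * (P * P * (P * P)) ≤⟨ P⁸≤2n ⟩
    2 * n ∎)
    where
    open ≤-Reasoning
    Z P⁶ : ℕ
    Z = K * (slack * slack * (slack * slack))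
    P⁶ = P * P * (P * P) * (P * P)

-- Turns a large number into a variable known only through an equation, so that the argument does
-- not depend on its numerical form.
naming : {A B : Set} (a : A) → (∀ x → x ≡ a → B) → B
naming a f = f a refl

-- The algorithm

module Algorithm (n : ℕ) where

  open Params n

  -- A trial may spend `2 rarity` times its expected cost, which is what Markov's inequality asks
  -- for. It succeeds with probability at least `1 / (2 rarity)`, and `amplify` wants twice the
  -- reciprocal of that as the number of trials.
  repetitions trialBudget : ℕ
  repetitions = 2 * (2 * rarity)
  trialBudget = 2 * rarity * (rate * n)

  oneTrial : ℕ → Vec (Seed Ω₀) trialBudget → DT n ℕ
  oneTrial δ ωs = limit trialBudget δ (Trial.trial {n} k L density b δ ωs)

  contractionTree : Vec (Vec (Seed Ω₀) trialBudget) repetitions → DT n ℕ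
  contractionTree ρ = minDegreeQ >>= λ δ → minOver {c = pow trialBudget Ω₀} (oneTrial δ) δ ρ

  seeds : Code
  seeds = pow repetitions (pow trialBudget Ω₀)

  algorithm : Alg n
  algorithm = if overhead ≤ᵇ n then draw seeds (λ ρ → toAlg (contractionTree ρ)) else toAlg bruteForce

  module _ (G : Graph n) where

    open MinDegree G

    cost-contractionTree : ∀ ρ → cost G (contractionTree ρ) ≤ (1 + repetitions * (2 * rarity * rate)) * n
    cost-contractionTree ρ = begin
      cost G (contractionTree ρ)
        ≡⟨ cost->>= G minDegreeQ (λ δ → minOver {c = pow trialBudget Ω₀} (oneTrial δ) δ ρ) ⟩
      cost G (minDegreeQ {n}) + cost G (minOver {c = pow trialBudget Ω₀} (oneTrial minDegree) minDegree ρ)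
        ≤⟨ +-mono-≤ (≤-reflexive cost-minDegreeQ) (cost-minOver G {pow trialBudget Ω₀} (oneTrial minDegree) minDegree ρ
             (λ ωs → cost-limit G trialBudget minDegree (Trial.trial {n} k L density b minDegree ωs))) ⟩
      n + repetitions * trialBudget
        ≡⟨ solve 4 (λ n r y c → n :+ r :* (y :* (c :* n)) := (con 1 :+ r :* (y :* c)) :* n) refl n repetitions (2 * rarity) rate ⟩
      (1 + repetitions * (2 * rarity * rate)) * n ∎
      where open ≤-Reasoning

    queries-algorithm : large ≤ n → 1 ≤ n → queries G algorithm ≤ (1 + repetitions * (2 * rarity * rate)) * n
    queries-algorithm n≥ 1≤n = subst (λ A → queries G A ≤ bound) (sym (if-true (≤ᵇ-intro (overhead≤n n n≥ 1≤n))))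
      (queries-draw G seeds (λ ρ → toAlg (contractionTree ρ)) bound (λ ρ → ≤-trans (≤-reflexive (queries-toAlg G (contractionTree ρ))) (cost-contractionTree ρ)))
      where bound = (1 + repetitions * (2 * rarity * rate)) * n

    module _ (2≤n : 2 ≤ n) (S : VSet n) (pS : Proper S) (minimal : ∀ T → Proper T → cutSize G S ≤ cutSize G T) where

      private
        x = cutSize G S

        1≤n : 1 ≤ n
        1≤n = ≤-trans (s≤s z≤n) 2≤n

        x≤δ : x ≤ minDegree
        x≤δ = ≤minDegree 2≤n minimal

        code : Code
        code = pow trialBudget Ω₀

        result : Vec (Vec (Seed Ω₀) trialBudget) repetitions → ℕ
        result ρ = run G (minOver {c = code} (oneTrial minDegree) minDegree ρ)

        run-tree : ∀ ρ → run G (contractionTree ρ) ≡ result ρ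
        run-tree ρ = run->>= G minDegreeQ (λ δ → minOver {c = code} (oneTrial δ) δ ρ)

        x≤trial : ∀ ωs → x ≤ run G (oneTrial minDegree ωs)
        x≤trial ωs with run-limit-either G trialBudget minDegree (Trial.trial {n} k L density b minDegree ωs)
        ... | inj₁ e = ≤-trans (Trial.trial-≥ {n} k L density b minDegree G ωs x≤δ minimal) (≤-reflexive (sym e))
        ... | inj₂ e = ≤-trans x≤δ (≤-reflexive (sym e))

        x≤result : ∀ ρ → x ≤ result ρ
        x≤result ρ = minOver-≥ G {code} (oneTrial minDegree) minDegree ρ x≤δ x≤trial

        1≤budget : 1 ≤ trialBudget
        1≤budget = *-mono-≤ {1} {2 * rarity} (*-mono-≤ {1} {2} (s≤s z≤n) 1≤rarity) (*-mono-≤ {1} {rate} 1≤rate 1≤n)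

      module _ (small : overhead ≤ n) where

        -- At the start every vertex is a cluster of its own, so there are at most `n` small
        -- clusters, and `2 ^ L < 2 n` bounds the later levels.
        Ψ-start : WalkAnalysis.Ψ {n} k L density b minDegree G n≤2^L n²≤2^b L≤8k+16 minDegree≤deg dense
                    (Trial.start {n} k L density b minDegree) ≤ rate * n
        Ψ-start = ≤-trans (initial-budget (9 + pickRate) (1 + pickRate) 32 K e b* L n _ (2 ^ L)
          (≤-trans (∑-mono (λ v → ⟦⟧≤1 _)) (≤-reflexive (trans (∑-const {n} 1) (*-identityʳ n))))
          (<⇒≤ (up-< n 1≤n)) (n<2^n L) small (32 * n)) (*-monoˡ-≤ n (≤-reflexive (sym rate-def)))

        module _ (x<δ : x < minDegree) where

          rare-failure : 2 * rarity * total code (λ ωs → ⟦ not (run G (oneTrial minDegree ωs) ≤ᵇ x) ⟧) + vol code ≤ 2 * rarity * vol code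
          rare-failure = naming (2 * (minDegree * 2 ^ L)) λ W W≡ → naming (72 * gauge * W) λ M M≡ →
            SingleTrial.rare {n} k L density b minDegree G n≤2^L n²≤2^b L≤8k+16 minDegree≤deg dense S pS minimal x<δ
              W M W≡ M≡ trialBudget 1≤budget (*-monoʳ-≤ (2 * rarity) Ψ-start)

        contraction-succeeds : ι 2 ℚ.≤ ι 3 ℚ.* probOutputs G x (draw seeds (λ ρ → toAlg (contractionTree ρ)))
        contraction-succeeds with <-≤-connex x minDegree
        ... | inj₁ x<δ = draw-toAlg G x seeds contractionTree (λ ρ → result ρ ≤ᵇ x)
          (λ ρ ok → trans (run-tree ρ) (≤-antisym (≤ᵇ-true ok) (x≤result ρ)))
          (minOver-mostly G {code} (oneTrial minDegree) minDegree x (2 * rarity) (*-mono-≤ {1} {2} (s≤s z≤n) 1≤rarity) (rare-failure x<δ))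
        -- Here the minimum degree is already the answer, and it is the initial value of the
        -- minimum, so every seed is good.
        ... | inj₂ δ≤x = draw-toAlg G x seeds contractionTree (λ _ → true)
          (λ ρ _ → trans (run-tree ρ) (≤-antisym (≤-trans (minOver-≤ G {code} (oneTrial minDegree) minDegree ρ) δ≤x) (x≤result ρ)))
          (*-monoˡ-≤ (vol seeds) (n≤1+n 2))

      two-thirds : ι 2 ℚ.≤ ι 3 ℚ.* probOutputs G x algorithm
      two-thirds = cases (bool-cases (overhead ≤ᵇ n))
        where
        cases : (overhead ≤ᵇ n) ≡ true ⊎ (overhead ≤ᵇ n) ≡ false → ι 2 ℚ.≤ ι 3 ℚ.* probOutputs G x algorithm
        cases (inj₁ p) = subst (λ A → ι 2 ℚ.≤ ι 3 ℚ.* probOutputs G x A) (sym (if-true p)) (contraction-succeeds (≤ᵇ-true p))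
        cases (inj₂ p) = subst (λ A → ι 2 ℚ.≤ ι 3 ℚ.* probOutputs G x A) (sym (if-false p))
          (ℚᵖ.≤-trans (ι-mono (n≤1+n 2)) (ℚᵖ.≤-reflexive (trans (sym (ℚᵖ.*-identityʳ (ι 3)))
            (cong (ι 3 ℚ.*_) (sym (prob-toAlg G bruteForce (bruteForce-correct x 2≤n (S , pS , refl) minimal)))))))

open import Data.Rational using (_/_)
open import Data.Integer using (+_)

theorem6p4 : Σ ((n : ℕ) → Alg n) λ A →
    (∀ (n : ℕ) (G : Graph n) (k : ℕ) → 2 ≤ n → IsEdgeConnectivity G k →
    (+ 2 / 3) ℚ.≤ probOutputs G k (A n))
    × (∃ λ C → ∃ λ N → ∀ (n : ℕ) → N ≤ n → ∀ (G : Graph n) →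
    queries G (A n) ≤ C * n * ⌊log₂ ⌊log₂ n ⌋ ⌋)
    × (∃ λ C → ∃ λ N → ∀ (n : ℕ) → N ≤ n → ∀ (G : Graph n) →
    (∀ (v : Fin n) → ⌊log₂ n ⌋ ^ 10 < degree G v) →
    queries G (A n) ≤ C * n)
theorem6p4 = Algorithm.algorithm , correct , (C , large + 4 , superlinear) , (C , large + 4 , λ n N≤n G _ → linear n N≤n G)
  where
  C : ℕ
  C = 1 + 2 * (2 * rarity) * (2 * rarity * rate)

  correct : ∀ n (G : Graph n) k → 2 ≤ n → IsEdgeConnectivity G k → (+ 2 / 3) ℚ.≤ probOutputs G k (Algorithm.algorithm n)
  correct n G k 2≤n ((S , i , j , refl) , minimal) = ℚᵖ.*-cancelˡ-≤-pos (ι 3)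
    (Algorithm.two-thirds n G 2≤n S (i , j) (λ T pT → minimal T (proj₁ pT) (proj₂ pT)))

  linear : ∀ n → large + 4 ≤ n → (G : Graph n) → queries G (Algorithm.algorithm n) ≤ C * n
  linear n N≤n G = Algorithm.queries-algorithm n G (≤-trans (m≤m+n large 4) N≤n)
    (≤-trans (s≤s z≤n) (≤-trans (m≤n+m 4 large) N≤n))

  superlinear : ∀ n → large + 4 ≤ n → (G : Graph n) → queries G (Algorithm.algorithm n) ≤ C * n * ⌊log₂ ⌊log₂ n ⌋ ⌋
  -- For `n ≥ 4` the iterated logarithm is at least 1, so the linear bound implies this one with the
  -- same constant.
  superlinear n N≤n G = ≤-trans (linear n N≤n G) (m≤m*n (C * n) ⌊log₂ ⌊log₂ n ⌋ ⌋
    {{>-nonZero (⌊log₂⌋-mono-≤ {2} (⌊log₂⌋-mono-≤ {4} (≤-trans (m≤n+m 4 large) N≤n)))}})
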